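{- Let $k\ge3$, $m\ge3$, $3\le g\le m$ and $0<\alpha<1$. Among all $k$-uniform linear unicyclic hypergraphs with $m$ hyperedges and girth $g$, the first hypergraph in $S_\alpha$-order is $C_g^{(k)}\cdot P_{m-g}^{(k)}$.
   Context: Hypergraphs are finite; $k$-uniform means every hyperedge has exactly $k$ vertices; linear means any two distinct hyperedges share at most one vertex; unicyclic means connected with exactly one cycle; the girth is the minimum length of a cycle. A cored vertex is a vertex of degree one. The hypercycle $C_g^{(k)}$ (resp. hyperpath $P_r^{(k)}$) is obtained from the cycle graph with $g$ edges (resp. path graph with $r$ edges) by inserting $k-2$ new (cored) vertices into each edge. $C_g^{(k)}\cdot P_{m-g}^{(k)}$ is the coalescence of $C_g^{(k)}$ at one of its cored vertices with $P_{m-g}^{(k)}$ at one of its pendant vertices (an end vertex of the path), i.e. these two vertices are identified; for $g=m$ it is $C_m^{(k)}$. For a $k$-uniform hypergraph $\mathcal{H}$ on $[n]$, $\mathcal{A}(\mathcal{H})$ is the $k$-order $n$-dimensional tensor with entry $\frac1{(k-1)!}$ at $(i_1,\dots,i_k)$ if $\{i_1,\dots,i_k\}\in E(\mathcal{H})$ and $0$ otherwise; $\mathcal{D}(\mathcal{H})$ is the diagonal tensor of vertex degrees; $\mathcal{A}_\alpha(\mathcal{H})=\alpha\mathcal{D}(\mathcal{H})+(1-\alpha)\mathcal{A}(\mathcal{H})$. For a tensor $\mathcal{T}$, $\mathrm{Tr}_d(\mathcal{T})$ is the sum of the $d$-th powers of all $n(k-1)^{n-1}$ eigenvalues of $\mathcal{T}$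 (roots of its characteristic polynomial, with multiplicity); in particular $\mathrm{Tr}_0(\mathcal{T})=n(k-1)^{n-1}$, and for $d\ge1$ $$\mathrm{Tr}_{d}(\mathcal{T})=(k-1)^{n-1}\sum_{d_1+\cdots+d_n=d}\ \prod_{i=1}^{n}\frac{1}{(d_i(k-1))!}\Big(\sum_{\gamma\in[n]^{k-1}}(\mathcal{T})_{i\gamma}\frac{\partial}{\partial a_{i\gamma}}\Big)^{d_i}\mathrm{tr}\big(A^{d(k-1)}\big),$$ with $A=(a_{ij})$ an $n\times n$ matrix of indeterminates, $d_i\ge0$ integers, $\frac{\partial}{\partial a_{i\gamma}}=\frac{\partial}{\partial a_{i i_2}}\cdots\frac{\partial}{\partial a_{i i_k}}$ for $\gamma=i_2\cdots i_k$. $S_\alpha$-order: for $k$-uniform hypergraphs $\mathcal{H}_1,\mathcal{H}_2$ with $n$ vertices, $\mathcal{H}_1\prec_\alpha\mathcal{H}_2$ if there is $d\in\{1,\dots,n(k-1)^{n-1}-1\}$ with $\mathrm{Tr}_t(\mathcal{A}_\alpha(\mathcal{H}_1))=\mathrm{Tr}_t(\mathcal{A}_\alpha(\mathcal{H}_2))$ for $t=0,\dots,d-1$ and $\mathrm{Tr}_d(\mathcal{A}_\alpha(\mathcal{H}_1))<\mathrm{Tr}_d(\mathcal{A}_\alpha(\mathcal{H}_2))$. "$X$ is the first hypergraph in a class" means $X$ is in the class and $X\prec_\alpha\mathcal{H}$ for every $\mathcal{H}$ in the class not isomorphic to $X$. -}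

module Defs where

open import Level using (Level; _⊔_) renaming (suc to lsuc)
open import Algebra.Apartness.Structures using (IsHeytingField)
open import Algebra.Bundles using (CommutativeRing)
import Algebra.Properties.Monoid.Mult as Mult
import Data.Bool.Properties as Bool
open import Data.Fin using (Fin; toℕ; fromℕ; inject₁; _↑ˡ_; _↑ʳ_; combine; splitAt; punchOut) renaming (zero to fzero; suc to fsuc)
open import Data.Fin.Properties using (_≟_; any?)
open import Data.Fin.Subset using (Subset; _∈_; _∩_; ∣_∣; ⋃; ⁅_⁆)
open import Data.Fin.Subset.Properties using (_∈?_)
open import Data.List using (List; []; _∷_; map; foldr; filter; length; allFin; upTo; cartesianProductWith)
open import Data.Nat using (ℕ; zero; suc; _∸_; _^_; _!; NonZero; _≤_) renaming (_+_ to _+ℕ_; _*_ to _*ℕ_; _<_ to _<ℕ_)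
open import Data.Nat.DivMod using (_mod_)
open import Data.Nat.GeneralisedArithmetic using (iterate)
import Data.Nat.Properties as ℕ
open import Data.Product using (Σ-syntax; ∃-syntax; _×_; _,_; proj₁; proj₂)
open import Data.Product.Properties as × using ()
open import Data.Sum using (_⊎_; inj₁; inj₂; [_,_]′)
open import Data.Vec using (Vec; []; _∷_; lookup; tabulate; toList) renaming (foldr′ to vfoldr; sum to vsum)
import Data.Vec.Properties as Vec
open import Data.Vec.Relation.Unary.All using (all?)
open import Function using (_∘_; _⇔_; _↔_; Inverse; Injective)
open import Relation.Binary using (Rel; IsStrictPartialOrder)
open import Relation.Binary.Construct.Closure.ReflexiveTransitive using (Star)
open import Relation.Binary.PropositionalEquality using (_≡_; _≢_)
open import Relation.Nullary using (¬_; Dec; yes; no; does; _×-dec_)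

-- The hyperedges are an indexed family of vertex subsets; Simple says that
-- the family has no repetitions, i.e. that it is a set of hyperedges.
record Hypergraph : Set where
  field
    order : ℕ
    size  : ℕ
    edge  : Fin size → Subset order

  Vertex : Set
  Vertex = Fin order

  Edge : Set
  Edge = Fin size

open Hypergraph

Simple : Hypergraph → Set
Simple H = Injective _≡_ _≡_ (edge H)

Uniform : ℕ → Hypergraph → Set
Uniform k H = ∀ e → ∣ edge H e ∣ ≡ k

Linear : Hypergraph → Set
Linear H = ∀ {e f} → e ≢ f → ∣ edge H e ∩ edge H f ∣ ≤ 1

Adjacent : (H : Hypergraph) → Rel (Vertex H) _
Adjacent H u v = ∃[ e ] u ∈ edge H e × v ∈ edge H e

Connected : Hypergraph → Set
Connected H = ∀ u v → Star (Adjacent H) u v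

degree : (H : Hypergraph) → Vertex H → ℕ
degree H v = length (filter (λ e → v ∈? edge H e) (allFin (size H)))

Cored : (H : Hypergraph) → Vertex H → Set
Cored H v = degree H v ≡ 1

next : ∀ {l} → Fin l → Fin l
next {suc l} i = suc (toℕ i) mod suc l

record Cycle (H : Hypergraph) (l : ℕ) : Set where
  field
    2≤length         : 2 ≤ l
    vertex           : Fin l → Vertex H
    hyperedge        : Fin l → Edge H
    vertex-distinct  : Injective _≡_ _≡_ vertex
    edge-distinct    : Injective _≡_ _≡_ hyperedge
    source           : ∀ i → vertex i ∈ edge H (hyperedge i)
    target           : ∀ i → vertex (next i) ∈ edge H (hyperedge i)

Traverses : ∀ {H l} → Cycle H l → Vertex H → Edge H → Set
Traverses C v e = ∃[ i ] hyperedge i ≡ e × (vertex i ≡ v ⊎ vertex (next i) ≡ v)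
  where open Cycle C

-- Cycles are identified when they differ only in starting point and
-- direction, i.e. when they use the same vertex-hyperedge incidences.
SameCycle : ∀ {H l l′} → Cycle H l → Cycle H l′ → Set
SameCycle C D = ∀ v e → Traverses C v e ⇔ Traverses D v e

Unicyclic : Hypergraph → Set
Unicyclic H =
  Connected H × (∃[ l ] Σ[ C ∈ Cycle H l ] ∀ {l′} (D : Cycle H l′) → SameCycle C D)

Girth : Hypergraph → ℕ → Set
Girth H g = Cycle H g × (∀ {l} → Cycle H l → g ≤ l)

record LinearUnicyclic (k m g : ℕ) (H : Hypergraph) : Set where
  field
    simple    : Simple H
    uniform   : Uniform k H
    linear    : Linear H
    unicyclic : Unicyclic H
    size-m    : size H ≡ m
    girth     : Girth H g

record _≅_ (G H : Hypergraph) : Set where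
  field
    onVertices : Vertex G ↔ Vertex H
    onEdges    : Edge G ↔ Edge H
    incidence  : ∀ v e →
      v ∈ edge G e ⇔ Inverse.to onVertices v ∈ edge H (Inverse.to onEdges e)

setOf : ∀ {n} → List (Fin n) → Subset n
setOf xs = ⋃ (map ⁅_⁆ xs)

image : ∀ {a b} → (Fin a → Fin b) → Subset a → Subset b
image f S = tabulate λ y → does (any? λ x → (x ∈? S) ×-dec (f x ≟ y))

record Graph : Set where
  field
    #vertices : ℕ
    #edges    : ℕ
    ends      : Fin #edges → Fin #vertices × Fin #vertices

cycleGraph : ℕ → Graph
cycleGraph g = record { #vertices = g ; #edges = g ; ends = λ i → i , next i }

pathGraph : ℕ → Graph
pathGraph r = record
  { #vertices = suc r ; #edges = r ; ends = λ i → inject₁ i , fsuc i }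

-- Insert k − 2 new vertices into each edge: the old vertices come first,
-- followed by q blocks of k − 2 new ones, one block for each edge.
power : ℕ → Graph → Hypergraph
power k G = record
  { order = p +ℕ q *ℕ (k ∸ 2)
  ; size  = q
  ; edge  = λ e → setOf ((proj₁ (ends e) ↑ˡ _) ∷ (proj₂ (ends e) ↑ˡ _) ∷
                         map (λ j → p ↑ʳ combine e j) (allFin (k ∸ 2)))
  }
  where open Graph G renaming (#vertices to p; #edges to q)

oldVertex : ∀ k G → Fin (Graph.#vertices G) → Vertex (power k G)
oldVertex k G v = v ↑ˡ (Graph.#edges G *ℕ (k ∸ 2))

hypercycle : ℕ → ℕ → Hypergraph
hypercycle k g = power k (cycleGraph g)

hyperpath : ℕ → ℕ → Hypergraph
hyperpath k r = power k (pathGraph r)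

-- For r = 0 the hyperpath is a single vertex without hyperedges, and both
-- ends are that vertex.
PathEnd : ∀ k r → Vertex (hyperpath k r) → Set
PathEnd k r w = w ≡ oldVertex k (pathGraph r) fzero ⊎ w ≡ oldVertex k (pathGraph r) (fromℕ r)

-- The inclusion of the second summand when w is identified with u.
glue : ∀ {a b} → Fin a → Fin b → Fin b → Fin (a +ℕ (b ∸ 1))
glue {a} {suc b} u w x with w ≟ x
... | yes _  = u ↑ˡ b
... | no w≢x = a ↑ʳ punchOut w≢x

coalescence : (G : Hypergraph) → Vertex G → (H : Hypergraph) → Vertex H → Hypergraph
coalescence G u H w = record
  { order = order G +ℕ (order H ∸ 1)
  ; size  = size G +ℕ size H
  ; edge  = [ image (_↑ˡ (order H ∸ 1)) ∘ edge G , image (glue u w) ∘ edge H ]′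
            ∘ splitAt (size G)
  }

-- The real numbers enter only through this structure.  Neither trichotomy
-- nor completeness is assumed, so ℝ is an instance both classically and
-- constructively, and so is ℚ.
record OrderedField c ℓ₁ ℓ₂ : Set (lsuc (c ⊔ ℓ₁ ⊔ ℓ₂)) where
  infix  8 -_
  infixl 7 _*_
  infixl 6 _+_
  infix  4 _≈_ _<_ _#_
  field
    Carrier : Set c
    _≈_     : Rel Carrier ℓ₁
    _<_     : Rel Carrier ℓ₂
    _+_ _*_ : Carrier → Carrier → Carrier
    -_      : Carrier → Carrier
    0# 1#   : Carrier

  _#_ : Rel Carrier ℓ₂
  x # y = x < y ⊎ y < x

  field
    isHeytingField       : IsHeytingField _≈_ _#_ _+_ _*_ -_ 0# 1#
    isStrictPartialOrder : IsStrictPartialOrder _≈_ _<_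
    0<1                  : 0# < 1#
    +-monoˡ-<            : ∀ z {x y} → x < y → x + z < y + z
    *-pos                : ∀ {x y} → 0# < x → 0# < y → 0# < x * y

  open IsHeytingField isHeytingField public
    using (isCommutativeRing; #⇒invertible; _-_)
  open IsStrictPartialOrder isStrictPartialOrder public
    using (<-resp-≈) renaming (trans to <-trans)

  commutativeRing : CommutativeRing c ℓ₁
  commutativeRing = record { isCommutativeRing = isCommutativeRing }

  open CommutativeRing commutativeRing using (sym; +-monoid; +-identityˡ; +-identityʳ)
  open Mult +-monoid using () renaming (_×_ to _·_)

  fromℕ# : ℕ → Carrier
  fromℕ# n = n · 1#

  fromℕ#-pos : ∀ n .{{_ : NonZero n}} → 0# < fromℕ# n
  fromℕ#-pos (suc zero)    = proj₁ <-resp-≈ (sym (+-identityʳ 1#)) 0<1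
  fromℕ#-pos (suc (suc n)) =
    <-trans (fromℕ#-pos (suc n))
            (proj₂ <-resp-≈ (+-identityˡ _) (+-monoˡ-< (fromℕ# (suc n)) 0<1))

  1/! : ℕ → Carrier
  1/! n = proj₁ (#⇒invertible (inj₂ (fromℕ#-pos (n !) {{n ℕ.!≢0}})))

words : ∀ {a} {A : Set a} → List A → ∀ p → List (Vec A p)
words xs zero    = [] ∷ []
words xs (suc p) = cartesianProductWith _∷_ xs (words xs p)

module Tensors {c ℓ₁ ℓ₂} (F : OrderedField c ℓ₁ ℓ₂) where
  open OrderedField F

  -- k-order n-dimensional tensors, with the first index i separated from
  -- the multi-index γ ∈ [n]^(k-1).
  Tensor : ℕ → ℕ → Set c
  Tensor k n = Fin n → Vec (Fin n) (k ∸ 1) → Carrier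

  module _ (k : ℕ) (H : Hypergraph) where

    isEdge? : (S : Subset (order H)) → Dec (∃[ e ] edge H e ≡ S)
    isEdge? S = any? λ e → Vec.≡-dec Bool._≟_ (edge H e) S

    adjacencyTensor : Tensor k (order H)
    adjacencyTensor i γ with isEdge? (setOf (i ∷ toList γ))
    ... | yes _ = 1/! (k ∸ 1)
    ... | no  _ = 0#

    degreeTensor : Tensor k (order H)
    degreeTensor i γ with all? (i ≟_) γ
    ... | yes _ = fromℕ# (degree H i)
    ... | no  _ = 0#

    A[_] : Carrier → Tensor k (order H)
    A[ α ] i γ = α * degreeTensor i γ + (1# - α) * adjacencyTensor i γ

  -- Polynomials in the indeterminates a i j, as formal expressions.
  infixl 7 _⊗_
  infixl 6 _⊕_
  data Poly (n : ℕ) : Set c where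
    con     : Carrier → Poly n
    a       : Fin n → Fin n → Poly n
    _⊕_ _⊗_ : Poly n → Poly n → Poly n

  module _ {n : ℕ} where

    ∂ : Fin n → Fin n → Poly n → Poly n
    ∂ i j (con _) = con 0#
    ∂ i j (a r s) with ×.≡-dec _≟_ _≟_ (i , j) (r , s)
    ... | yes _ = con 1#
    ... | no  _ = con 0#
    ∂ i j (p ⊕ q) = ∂ i j p ⊕ ∂ i j q
    ∂ i j (p ⊗ q) = (∂ i j p ⊗ q) ⊕ (p ⊗ ∂ i j q)

    constantTerm : Poly n → Carrier
    constantTerm (con x) = x
    constantTerm (a _ _) = 0#
    constantTerm (p ⊕ q) = constantTerm p + constantTerm q
    constantTerm (p ⊗ q) = constantTerm p * constantTerm q

    ∑ : ∀ {x} {X : Set x} → List X → (X → Poly n) → Poly n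
    ∑ xs f = foldr (λ x p → f x ⊕ p) (con 0#) xs

    matrixPower : ℕ → Fin n → Fin n → Poly n
    matrixPower zero i j with i ≟ j
    ... | yes _ = con 1#
    ... | no  _ = con 0#
    matrixPower (suc l) i j = ∑ (allFin n) λ s → a i s ⊗ matrixPower l s j

    tracePower : ℕ → Poly n
    tracePower l = ∑ (allFin n) λ i → matrixPower l i i

  module _ {k n : ℕ} (T : Tensor k n) where

    -- Σ_γ T_{iγ} ∂/∂a_{iγ}
    operator : Fin n → Poly n → Poly n
    operator i p = ∑ (words (allFin n) (k ∸ 1)) λ γ →
      con (T i γ) ⊗ vfoldr (∂ i) p γ

    -- The operators for different i commute, so the order in which the
    -- product composes them is immaterial.
    applyOperators : Vec ℕ n → Poly n → Poly n
    applyOperators d p = foldr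
      (λ i q → con (1/! (lookup d i *ℕ (k ∸ 1))) ⊗ iterate (operator i) q (lookup d i))
      p (allFin n)

    exponents : ℕ → List (Vec ℕ n)
    exponents d = filter (λ v → vsum v ℕ.≟ d) (words (upTo (suc d)) n)

    -- The d-th order trace, by the Morozov–Shakirov formula for d ≥ 1.  The
    -- polynomial tr(A^(d(k-1))) is homogeneous of degree d(k-1), the total
    -- order of the differential operator, so the result is a constant.
    Tr : ℕ → Carrier
    Tr zero      = fromℕ# (n *ℕ (k ∸ 1) ^ (n ∸ 1))
    Tr d@(suc _) = fromℕ# ((k ∸ 1) ^ (n ∸ 1)) *
      constantTerm (∑ (exponents d) λ v → applyOperators v (tracePower (d *ℕ (k ∸ 1))))

  TrA : ℕ → Carrier → Hypergraph → ℕ → Carrier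
  TrA k α H = Tr {k} (A[_] k H α)

  Precedes : ℕ → Carrier → Hypergraph → Hypergraph → Set (ℓ₁ ⊔ ℓ₂)
  Precedes k α G H = order G ≡ order H × (∃[ d ]
    1 ≤ d × d ≤ order G *ℕ (k ∸ 1) ^ (order G ∸ 1) ∸ 1 ×
    (∀ t → t <ℕ d → TrA k α G t ≈ TrA k α H t) ×
    TrA k α G d < TrA k α H d)

  IsFirst : ∀ {p} → ℕ → Carrier → (Hypergraph → Set p) → Hypergraph → Set _
  IsFirst k α Class X =
    Class X × (∀ H → Class H → ¬ (H ≅ X) → Precedes k α X H)

{-# OPTIONS --safe #-}
-- A choice of tensor entries contributes to the Morozov–Shakirov formula for Tr_d only if its
-- arcs can be ordered into a closed walk.  The arcs are then balanced, so k divides the number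
-- of chosen hyperedge entries through each vertex, and for d ≤ k + 2 linearity leaves two kinds
-- of choices: loops at a single vertex, or one hyperedge e, chosen once at each of its vertices,
-- together with d − k loops at vertices of e.  Hence Tr_d is a combination of Σ_v (deg v)^d and
-- of the sums over e and over multisets of d − k vertices of e of products of degrees, whose
-- coefficients depend only on the shape of the multiset.  So Tr_2 compares Σ_v (deg v)², and if
-- all degrees are at most 2, then the first trace that can differ is Tr_(k+2), which compares
-- Σ_e (Σ_{v∈e} deg v)²: the coefficient of deg u · deg v is positive because the complete
-- digraph with loops is Eulerian.
--
-- Growing a linear unicyclic hypergraph from its cycle gives each hyperedge e a distinguished
-- vertex ext e, owned by a hyperedge parent e, such that every vertex is owned exactly once.
-- Up to constants the two sums count the pairs of hyperedges on which ext, respectively parent,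
-- takes equal values.  If ext is injective, then parent determines the hypergraph, and it has
-- the fewest coincidences exactly when the hyperedges off the cycle form a single path.
module Submission where

open import Defs
open import Data.Nat using (ℕ; _≤_; _∸_)

-- The polynomials in the trace formula are formal expressions. Each is studied through the
-- functional that sends a list of arcs to the constant term left after differentiating along these
-- arcs; for powers of the matrix this functional counts walks, and what follows is combinatorics of
-- arc lists. The bound k + 2 works because k + 2 < 2k for k at least 3: a vertex of a chosen
-- hyperedge then lies on exactly k of the chosen ones. The coefficients in the traces are never
-- evaluated. They are shown to be the same for both hypergraphs, and only the one that decides the
-- comparison is shown to be positive. Below order k + 2 the traces see only the numbers of vertices
-- and hyperedges and power sums of degrees, and degrees 1 and 2 leave no freedom in these; two
-- extra loops are the fewest that see a product of degrees at distinct vertices of a hyperedge.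
-- Isomorphisms come from counting: once the hyperedges are identified, every vertex is labelled by
-- its owner and by the hyperedge whose distinguished vertex it is, and hypergraphs with equally
-- many vertices of each label are matched.

-- Permutations of lists, and sums and products over lists.

module BigOperators where

  open import Algebra.Bundles using (CommutativeMonoid; CommutativeSemiring)
  open import Data.Bool using (if_then_else_)
  open import Data.Empty using (⊥-elim)
  open import Data.List using (List; []; _∷_; _++_; map; foldr; filter; length; cartesianProductWith; concatMap)
  open import Data.List.Properties using (length-++; ++-identityʳ)
  open import Data.List.Membership.Propositional using (_∈_; _∉_)
  open import Data.List.Membership.Propositional.Properties using (∈-∃++; ∈-++⁺ʳ)
  open import Data.List.Relation.Binary.Permutation.Propositional
    as ↭ using (_↭_; ↭-sym; ↭-trans; ↭-reflexive)
  open import Data.List.Relation.Binary.Permutation.Propositional.Properties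
    using (∈-resp-↭; shift; ↭-length)
  open import Data.List.Relation.Unary.All as All using (All; []; _∷_)
  open import Data.List.Relation.Unary.Any using (here; there)
  open import Data.List.Relation.Unary.AllPairs using ([]; _∷_)
  open import Data.List.Relation.Unary.Unique.Propositional using (Unique)
  open import Data.List.Relation.Unary.Unique.Propositional.Properties as Unique using (Unique[x∷xs]⇒x∉xs)
  open import Data.Nat as ℕ using (ℕ; _≤_)
  import Data.Nat.Properties as ℕ
  open import Data.Product using (∃-syntax; _,_)
  open import Function using (_∘_)
  open import Relation.Binary.PropositionalEquality as ≡ using (_≡_; _≢_; cong; subst)
  open import Relation.Nullary using (¬_; Dec; yes; no; does)
  open import Relation.Unary using (Pred; Decidable)

  ∈⇒↭ : ∀ {a} {A : Set a} {x : A} {xs} → x ∈ xs → ∃[ ys ] xs ↭ x ∷ ys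
  ∈⇒↭ {x = x} x∈xs with ∈-∃++ x∈xs
  ... | ys , zs , ≡.refl = ys ++ zs , shift x ys zs

  -- Members of `ys` are peeled off `xs` one at a time; since `ys` has no repetition, the copy
  -- removed is never one that a later member still needs.
  ⊆⇒↭++ : ∀ {a} {A : Set a} {ys xs : List A} → Unique ys → (∀ {y} → y ∈ ys → y ∈ xs) →
          ∃[ zs ] xs ↭ ys ++ zs
  ⊆⇒↭++ {ys = []}     {xs} _ _ = xs , ↭.refl
  ⊆⇒↭++ {ys = y ∷ ys} {xs} uy@(_ ∷ u) sub with ∈⇒↭ (sub (here ≡.refl))
  ... | xs′ , p = let zs , q = ⊆⇒↭++ u sub′ in zs , ↭-trans p (↭.prep y q)
    where
    sub′ : ∀ {z} → z ∈ ys → z ∈ xs′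
    sub′ z∈ys with ∈-resp-↭ p (sub (there z∈ys))
    ... | here ≡.refl = ⊥-elim (Unique[x∷xs]⇒x∉xs uy z∈ys)
    ... | there z∈xs′ = z∈xs′

  Unique-⊆⇒length≤ : ∀ {a} {A : Set a} {ys xs : List A} → Unique ys → (∀ {y} → y ∈ ys → y ∈ xs) →
                     length ys ≤ length xs
  Unique-⊆⇒length≤ {ys = ys} u sub with ⊆⇒↭++ u sub
  ... | zs , p = ℕ.≤-trans (ℕ.m≤m+n _ _) (ℕ.≤-reflexive (≡.sym (≡.trans (↭-length p) (length-++ ys))))

  -- Anything left of `xs` once the members of `ys` are taken out would make `xs` too long. This
  -- turns two enumerations of the same finite set into permutations of each other.
  ⊆∧length≤⇒↭ : ∀ {a} {A : Set a} {ys xs : List A} → Unique ys → (∀ {y} → y ∈ ys → y ∈ xs) →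
                length xs ≤ length ys → xs ↭ ys
  ⊆∧length≤⇒↭ {ys = ys} u sub le with ⊆⇒↭++ u sub
  ... | []     , p = ↭-trans p (↭-reflexive (++-identityʳ ys))
  ... | z ∷ zs , p = ⊥-elim (ℕ.<-irrefl ≡.refl (ℕ.<-≤-trans lt le))
    where
    lt : length ys ℕ.< _
    lt = subst (length ys ℕ.<_) (≡.sym (≡.trans (↭-length p) (length-++ ys))) (ℕ.m<m+n _ ℕ.z<s)

  Unique-resp-↭ : ∀ {a} {A : Set a} {xs ys : List A} → xs ↭ ys → Unique xs → Unique ys
  Unique-resp-↭ ↭.refl u = u
  Unique-resp-↭ (↭.prep x p) (x∉ ∷ u) =
    All.tabulate (λ y∈ → All.lookup x∉ (∈-resp-↭ (↭-sym p) y∈)) ∷ Unique-resp-↭ p u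
  Unique-resp-↭ (↭.swap x y p) ((x≢y ∷ x∉) ∷ y∉ ∷ u) =
    ((x≢y ∘ ≡.sym) ∷ All.tabulate (λ z∈ → All.lookup y∉ (∈-resp-↭ (↭-sym p) z∈)))
    ∷ All.tabulate (λ z∈ → All.lookup x∉ (∈-resp-↭ (↭-sym p) z∈)) ∷ Unique-resp-↭ p u
  Unique-resp-↭ (↭.trans p q) u = Unique-resp-↭ q (Unique-resp-↭ p u)

  module BigOp {c ℓ} (M : CommutativeMonoid c ℓ) where
    open CommutativeMonoid M renaming (trans to ≈-trans; refl to ≈-refl)
    open import Relation.Binary.Reasoning.Setoid setoid
    open import Algebra.Properties.CommutativeSemigroup commutativeSemigroup using (interchange; x∙yz≈y∙xz)

    big : ∀ {a} {A : Set a} → List A → (A → Carrier) → Carrier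
    big xs f = foldr (λ x s → f x ∙ s) ε xs

    big-cong∈ : ∀ {a} {A : Set a} {f g : A → Carrier} (xs : List A) →
                (∀ x → x ∈ xs → f x ≈ g x) → big xs f ≈ big xs g
    big-cong∈ [] e = ≈-refl
    big-cong∈ (x ∷ xs) e = ∙-cong (e x (here ≡.refl)) (big-cong∈ xs (λ y y∈ → e y (there y∈)))

    big-cong : ∀ {a} {A : Set a} {f g : A → Carrier} (xs : List A) →
               (∀ x → f x ≈ g x) → big xs f ≈ big xs g
    big-cong xs e = big-cong∈ xs (λ x _ → e x)

    big-ε : ∀ {a} {A : Set a} {f : A → Carrier} (xs : List A) →
            (∀ x → x ∈ xs → f x ≈ ε) → big xs f ≈ ε
    big-ε [] e = ≈-refl
    big-ε (x ∷ xs) e = ≈-trans (∙-cong (e x (here ≡.refl)) (big-ε xs (λ y y∈ → e y (there y∈)))) (identityˡ ε)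

    big-∙ : ∀ {a} {A : Set a} (f g : A → Carrier) (xs : List A) →
            big xs (λ x → f x ∙ g x) ≈ big xs f ∙ big xs g
    big-∙ f g [] = sym (identityˡ ε)
    big-∙ f g (x ∷ xs) = ≈-trans (∙-congˡ (big-∙ f g xs)) (interchange _ _ _ _)

    big-swap : ∀ {a b} {A : Set a} {B : Set b} (f : A → B → Carrier) (xs : List A) (ys : List B) →
               big xs (λ x → big ys (f x)) ≈ big ys (λ y → big xs (λ x → f x y))
    big-swap f [] ys = sym (big-ε ys (λ _ _ → ≈-refl))
    big-swap f (x ∷ xs) ys = ≈-trans (∙-congˡ (big-swap f xs ys)) (sym (big-∙ _ _ ys))

    big-++ : ∀ {a} {A : Set a} (f : A → Carrier) (xs ys : List A) →
             big (xs ++ ys) f ≈ big xs f ∙ big ys f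
    big-++ f [] ys = sym (identityˡ _)
    big-++ f (x ∷ xs) ys = ≈-trans (∙-congˡ (big-++ f xs ys)) (sym (assoc _ _ _))

    big-map : ∀ {a b} {A : Set a} {B : Set b} (f : B → Carrier) (h : A → B) (xs : List A) →
              big (map h xs) f ≡ big xs (f ∘ h)
    big-map f h [] = ≡.refl
    big-map f h (x ∷ xs) = cong (f (h x) ∙_) (big-map f h xs)

    big-concatMap : ∀ {a b} {A : Set a} {B : Set b} (f : B → Carrier) (h : A → List B) (xs : List A) →
                    big (concatMap h xs) f ≈ big xs (λ x → big (h x) f)
    big-concatMap f h [] = ≈-refl
    big-concatMap f h (x ∷ xs) = ≈-trans (big-++ f (h x) _) (∙-congˡ (big-concatMap f h xs))

    big-cartesian : ∀ {a b d} {A : Set a} {B : Set b} {D : Set d} (f : D → Carrier) (h : A → B → D)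
                    (xs : List A) (ys : List B) →
                    big (cartesianProductWith h xs ys) f ≈ big xs (λ x → big ys (λ y → f (h x y)))
    big-cartesian f h [] ys = ≈-refl
    big-cartesian f h (x ∷ xs) ys = ≈-trans (big-++ f (map (h x) ys) _)
      (∙-cong (reflexive (big-map f (h x) ys)) (big-cartesian f h xs ys))

    big-↭ : ∀ {a} {A : Set a} (f : A → Carrier) {xs ys : List A} → xs ↭ ys → big xs f ≈ big ys f
    big-↭ f ↭.refl = ≈-refl
    big-↭ f (↭.prep x p) = ∙-congˡ (big-↭ f p)
    big-↭ f (↭.swap x y p) = ≈-trans (x∙yz≈y∙xz _ _ _) (∙-congˡ (∙-congˡ (big-↭ f p)))
    big-↭ f (↭.trans p q) = ≈-trans (big-↭ f p) (big-↭ f q)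

    -- This is how a sum is cut down to its support: `xs` is rearranged into `ys` followed by the
    -- rest, and the rest, disjoint from `ys` because `xs` has no repetition, contributes only
    -- units.
    big-reindex : ∀ {a} {A : Set a} (f : A → Carrier) {xs ys : List A} → Unique xs → Unique ys →
                  (∀ {y} → y ∈ ys → y ∈ xs) → (∀ {x} → x ∈ xs → x ∉ ys → f x ≈ ε) →
                  big xs f ≈ big ys f
    big-reindex f {xs} {ys} ux uy sub off with ⊆⇒↭++ uy sub
    ... | zs , p = begin
      big xs f             ≈⟨ big-↭ f p ⟩
      big (ys ++ zs) f     ≈⟨ big-++ f ys zs ⟩
      big ys f ∙ big zs f  ≈⟨ ∙-congˡ (big-ε zs off′) ⟩
      big ys f ∙ ε         ≈⟨ identityʳ _ ⟩
      big ys f             ∎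
      where
      disjoint : ∀ {z} (ys : List _) → Unique (ys ++ zs) → z ∈ zs → z ∉ ys
      disjoint (y ∷ ys) (y∉ ∷ u) z∈zs (here ≡.refl) = All.lookup y∉ (∈-++⁺ʳ ys z∈zs) ≡.refl
      disjoint (y ∷ ys) (_ ∷ u) z∈zs (there z∈ys) = disjoint ys u z∈zs z∈ys
      off′ : ∀ z → z ∈ zs → f z ≈ ε
      off′ z z∈zs = off (∈-resp-↭ (↭-sym p) (∈-++⁺ʳ ys z∈zs)) (disjoint ys (Unique-resp-↭ p ux) z∈zs)

  module Sums {c ℓ} (R : CommutativeSemiring c ℓ) where
    open CommutativeSemiring R
    open import Relation.Binary.Reasoning.Setoid setoid

    open BigOp +-commutativeMonoid public renaming
      ( big to ⅀; big-cong∈ to ⅀-cong∈; big-cong to ⅀-cong; big-ε to ⅀-0; big-∙ to ⅀-+; big-swap to ⅀-swap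
      ; big-++ to ⅀-++; big-map to ⅀-map; big-concatMap to ⅀-concatMap; big-cartesian to ⅀-cartesian
      ; big-↭ to ⅀-↭; big-reindex to ⅀-reindex )
    open BigOp *-commutativeMonoid public renaming
      ( big to ∏; big-cong∈ to ∏-cong∈; big-cong to ∏-cong; big-ε to ∏-1; big-∙ to ∏-*; big-swap to ∏-swap
      ; big-++ to ∏-++; big-map to ∏-map; big-concatMap to ∏-concatMap; big-cartesian to ∏-cartesian
      ; big-↭ to ∏-↭; big-reindex to ∏-reindex )

    *-⅀ : ∀ {a} {A : Set a} (x : Carrier) (f : A → Carrier) (xs : List A) →
          x * ⅀ xs f ≈ ⅀ xs (λ y → x * f y)
    *-⅀ x f [] = zeroʳ x
    *-⅀ x f (y ∷ ys) = trans (distribˡ x _ _) (+-congˡ (*-⅀ x f ys))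

    ⅀-* : ∀ {a} {A : Set a} (x : Carrier) (f : A → Carrier) (xs : List A) →
          ⅀ xs f * x ≈ ⅀ xs (λ y → f y * x)
    ⅀-* x f [] = zeroˡ x
    ⅀-* x f (y ∷ ys) = trans (distribʳ x _ _) (+-congˡ (⅀-* x f ys))

    𝟙 : ∀ {p} {P : Set p} → Dec P → Carrier
    𝟙 d = if does d then 1# else 0#

    𝟙-yes : ∀ {p} {P : Set p} (d : Dec P) → P → 𝟙 d ≈ 1#
    𝟙-yes (yes _) _ = refl
    𝟙-yes (no ¬p) p = ⊥-elim (¬p p)

    𝟙-no : ∀ {p} {P : Set p} (d : Dec P) → ¬ P → 𝟙 d ≈ 0#
    𝟙-no (yes p) ¬p = ⊥-elim (¬p p)
    𝟙-no (no _) _ = refl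

    𝟙-⇔ : ∀ {p q} {P : Set p} {Q : Set q} (d : Dec P) (e : Dec Q) → (P → Q) → (Q → P) → 𝟙 d ≈ 𝟙 e
    𝟙-⇔ (yes p) e f g = sym (𝟙-yes e (f p))
    𝟙-⇔ (no ¬p) e f g = sym (𝟙-no e (¬p ∘ g))

    ⅀-filter : ∀ {a p} {A : Set a} {P : Pred A p} (P? : Decidable P) (f : A → Carrier) (xs : List A) →
               ⅀ (filter P? xs) f ≈ ⅀ xs (λ x → 𝟙 (P? x) * f x)
    ⅀-filter P? f [] = refl
    ⅀-filter P? f (x ∷ xs) with P? x
    ... | yes _ = +-cong (sym (*-identityˡ _)) (⅀-filter P? f xs)
    ... | no _ = trans (⅀-filter P? f xs) (sym (trans (+-congʳ (zeroˡ _)) (+-identityˡ _)))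

    ⅀-single : ∀ {a} {A : Set a} (f : A → Carrier) {xs : List A} {y : A} → Unique xs → y ∈ xs →
               (∀ {x} → x ∈ xs → x ≢ y → f x ≈ 0#) → ⅀ xs f ≈ f y
    ⅀-single f {xs} {y} u y∈ off = trans
      (⅀-reindex f u ([] ∷ []) (λ { (here ≡.refl) → y∈ }) (λ x∈ x∉ → off x∈ (x∉ ∘ here)))
      (+-identityʳ _)

-- Orderings of labelled arcs into closed walks.

module ClosedWalks where

  open BigOperators
  open import Algebra.Bundles using (CommutativeSemiring)
  open import Data.Empty using (⊥-elim)
  open import Data.List using (List; []; _∷_; _++_; map; length)
  open import Data.List.Membership.Propositional using (_∈_)
  open import Data.List.Membership.Propositional.Properties using (∈-map⁻)
  open import Data.List.Relation.Binary.Permutation.Propositional as ↭ using (_↭_; ↭-sym)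
  open import Data.List.Relation.Binary.Permutation.Propositional.Properties using (∈-resp-↭; ↭-length)
  open import Data.List.Relation.Unary.Any using (here; there)
  open import Data.Nat as ℕ using (ℕ; zero; suc; _+_; _*_; _≤_; _<_; z≤n; s≤s)
  import Data.Nat.Properties as ℕ
  open import Data.Nat.Tactic.RingSolver using (solve-∀)
  open import Data.Product as × using (∃-syntax; _×_; _,_; proj₁; proj₂)
  open import Function using (_∘_)
  open import Relation.Binary.Definitions using (DecidableEquality)
  open import Relation.Binary.PropositionalEquality as ≡ using (_≡_; _≢_; refl; sym; trans; cong; cong₂)
  open import Relation.Nullary using (yes; no)
  open ≡.≡-Reasoning

  module ℕΣ = Sums ℕ.+-*-commutativeSemiring
  open ℕΣ

  ⅀≢0 : ∀ {a} {A : Set a} (f : A → ℕ) (xs : List A) → ⅀ xs f ≢ 0 → ∃[ x ] x ∈ xs × f x ≢ 0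
  ⅀≢0 f [] ne = ⊥-elim (ne refl)
  ⅀≢0 f (x ∷ xs) ne with f x in eq
  ... | suc _ = x , here refl , λ fx≡0 → ℕ.1+n≢0 (trans (sym eq) fx≡0)
  ... | zero = let y , y∈ , p = ⅀≢0 f xs ne in y , there y∈ , p

  ⅀-≤∈ : ∀ {a} {A : Set a} {f g : A → ℕ} (xs : List A) → (∀ x → x ∈ xs → f x ≤ g x) → ⅀ xs f ≤ ⅀ xs g
  ⅀-≤∈ [] h = z≤n
  ⅀-≤∈ (x ∷ xs) h = ℕ.+-mono-≤ (h x (here refl)) (⅀-≤∈ xs (λ y y∈ → h y (there y∈)))

  ⅀-≤ : ∀ {a} {A : Set a} {f g : A → ℕ} (xs : List A) → (∀ x → f x ≤ g x) → ⅀ xs f ≤ ⅀ xs g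
  ⅀-≤ xs h = ⅀-≤∈ xs (λ x _ → h x)

  ⅀-const : ∀ {a} {A : Set a} (c : ℕ) (xs : List A) → ⅀ xs (λ _ → c) ≡ length xs * c
  ⅀-const c [] = refl
  ⅀-const c (x ∷ xs) = cong (c +_) (⅀-const c xs)

  ⅀-1 : ∀ {a} {A : Set a} (xs : List A) → ⅀ xs (λ _ → 1) ≡ length xs
  ⅀-1 xs = trans (⅀-const 1 xs) (ℕ.*-identityʳ _)

  ∈⇒≤⅀ : ∀ {a} {A : Set a} (f : A → ℕ) {x} {xs : List A} → x ∈ xs → f x ≤ ⅀ xs f
  ∈⇒≤⅀ f (here refl) = ℕ.m≤m+n _ _
  ∈⇒≤⅀ f (there x∈) = ℕ.≤-trans (∈⇒≤⅀ f x∈) (ℕ.m≤n+m _ _)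

  -- There is one item for each position, not for each value, so equal arcs count separately. This
  -- matches the product rule, where each of several equal derivatives may be the one that hits a
  -- factor.
  picks : ∀ {a} {A : Set a} → List A → List (A × List A)
  picks [] = []
  picks (x ∷ xs) = (x , xs) ∷ map (×.map₂ (x ∷_)) (picks xs)

  ∈-picks : ∀ {a} {A : Set a} {x : A} {r} (xs : List A) → (x , r) ∈ picks xs → xs ↭ x ∷ r
  ∈-picks (x ∷ xs) (here refl) = ↭.refl
  ∈-picks (x ∷ xs) (there p) with ∈-map⁻ _ p
  ... | (y , r) , q , refl = ↭.trans (↭.prep x (∈-picks xs q)) (↭.swap x y ↭.refl)

  module PickSums {c ℓ} (R : CommutativeSemiring c ℓ) where
    open CommutativeSemiring R hiding (_+_; _*_; refl; sym; trans)
    private module R = CommutativeSemiring R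
    private module S = Sums R

    picks-∷ : ∀ {a} {A : Set a} (f : A × List A → Carrier) x (xs : List A) →
              S.⅀ (picks (x ∷ xs)) f ≡ f (x , xs) R.+ S.⅀ (picks xs) (f ∘ ×.map₂ (x ∷_))
    picks-∷ f x xs = cong (f (x , xs) R.+_) (S.⅀-map f (×.map₂ (x ∷_)) (picks xs))

    -- The hypothesis on `f` concerns the remainders: after a permutation the same entry is singled
    -- out, but what is left over appears in another order.
    ⅀-picks-↭ : ∀ {a} {A : Set a} {f : A × List A → Carrier} {xs ys : List A} →
                (∀ x {r r′} → r ↭ r′ → f (x , r) ≈ f (x , r′)) → xs ↭ ys →
                S.⅀ (picks xs) f ≈ S.⅀ (picks ys) f
    ⅀-picks-↭ resp ↭.refl = R.refl
    ⅀-picks-↭ {f = f} resp (↭.prep {xs} {ys} x p) = R.trans (R.reflexive (picks-∷ f x xs))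
      (R.trans (R.+-cong (resp x p) (⅀-picks-↭ (λ y q → resp y (↭.prep x q)) p))
        (R.sym (R.reflexive (picks-∷ f x ys))))
    ⅀-picks-↭ {f = f} resp (↭.swap {xs} {ys} x y p) = R.trans (R.reflexive (expand x y xs))
      (R.trans (x∙yz≈y∙xz _ _ _) (R.trans (R.+-cong (resp y (↭.prep x p)) (R.+-cong (resp x (↭.prep y p))
        (R.trans (S.⅀-cong (picks xs) (λ (z , r) → resp z (↭.swap x y ↭.refl)))
          (⅀-picks-↭ (λ z q → resp z (↭.prep y (↭.prep x q))) p))))
        (R.sym (R.reflexive (expand y x ys)))))
      where
      open import Algebra.Properties.CommutativeSemigroup R.+-commutativeSemigroup using (x∙yz≈y∙xz)
      expand : ∀ x y xs → S.⅀ (picks (x ∷ y ∷ xs)) f ≡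
               f (x , y ∷ xs) R.+ (f (y , x ∷ xs) R.+ S.⅀ (picks xs) (f ∘ ×.map₂ (x ∷_) ∘ ×.map₂ (y ∷_)))
      expand x y xs = trans (picks-∷ f x (y ∷ xs)) (cong (f (x , y ∷ xs) R.+_) (picks-∷ _ y xs))
    ⅀-picks-↭ resp (↭.trans p q) = R.trans (⅀-picks-↭ resp p) (⅀-picks-↭ resp q)

  open PickSums ℕ.+-*-commutativeSemiring using (⅀-picks-↭; picks-∷)

  picks-map : ∀ {a b} {A : Set a} {B : Set b} (h : A → B) (xs : List A) →
              picks (map h xs) ≡ map (×.map h (map h)) (picks xs)
  picks-map h [] = refl
  picks-map h (x ∷ xs) = cong ((h x , map h xs) ∷_) (begin
    map (×.map₂ (h x ∷_)) (picks (map h xs))                ≡⟨ cong (map _) (picks-map h xs) ⟩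
    map (×.map₂ (h x ∷_)) (map (×.map h (map h)) (picks xs)) ≡⟨ map-∘ (picks xs) ⟨
    map (λ (y , r) → h y , h x ∷ map h r) (picks xs)         ≡⟨ map-∘ (picks xs) ⟩
    map (×.map h (map h)) (map (×.map₂ (x ∷_)) (picks xs))   ∎)
    where open import Data.List.Properties using (map-∘)

  data IsWalk {v} {V : Set v} : V → V → List (V × V) → Set v where
    []  : ∀ {i} → IsWalk i i []
    _∷_ : ∀ i {s j r} → IsWalk s j r → IsWalk i j ((i , s) ∷ r)

  _++ʷ_ : ∀ {v} {V : Set v} {i j l : V} {r s} → IsWalk i j r → IsWalk j l s → IsWalk i l (r ++ s)
  [] ++ʷ q = q
  (i ∷ p) ++ʷ q = i ∷ (p ++ʷ q)

  -- An arc set closed under both directions of the relation "P holds at the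
  -- ends" is traversed entirely inside P or entirely outside it.
  module _ {v p} {V : Set v} (P : V → Set p) where

    walk-forward : ∀ {i j L} → IsWalk i j L → (∀ {u w} → (u , w) ∈ L → P u → P w) → P i →
                   ∀ {u w} → (u , w) ∈ L → P u
    walk-forward (i ∷ walk) closed pi (here refl) = pi
    walk-forward (i ∷ walk) closed pi (there x) =
      walk-forward walk (closed ∘ there) (closed (here refl) pi) x

    walk-backward : ∀ {i j L} → IsWalk i j L → (∀ {u w} → (u , w) ∈ L → P w → P u) →
                    ∀ {u w} → (u , w) ∈ L → P u → P i
    walk-backward (i ∷ walk) closed (here refl) pu = pu
    walk-backward (i ∷ walk) closed (there x) pu =
      closed (here refl) (walk-backward walk (closed ∘ there) x pu)

  module Walks {v} {V : Set v} (_≟_ : DecidableEquality V) where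

    Arc : Set v
    Arc = V × V

    -- Orderings of the labelled arcs into a walk from `i` to `j`. The length is a separate argument
    -- because the remainders produced by `picks` are not structurally smaller; with a length other
    -- than that of the list the count is zero.
    walks : ℕ → V → V → List Arc → ℕ
    walks zero    i j []      = 𝟙 (i ≟ j)
    walks zero    i j (_ ∷ _) = 0
    walks (suc l) i j L       = ⅀ (picks L) λ (e , r) → 𝟙 (proj₁ e ≟ i) * walks l (proj₂ e) j r

    -- The number of orderings of the (labelled) arcs L into a closed walk.
    circuits : List Arc → ℕ
    circuits L = ⅀ (picks L) λ (e , r) → walks (length r) (proj₂ e) (proj₁ e) r

    walks-↭ : ∀ l {i j L L′} → L ↭ L′ → walks l i j L ≡ walks l i j L′
    walks-↭ zero {L = []} {[]} p = refl
    walks-↭ zero {L = []} {_ ∷ _} p = case ↭-length p of λ ()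
      where open import Function using (case_of_)
    walks-↭ zero {L = _ ∷ _} {[]} p = case ↭-length p of λ ()
      where open import Function using (case_of_)
    walks-↭ zero {L = _ ∷ _} {_ ∷ _} p = refl
    walks-↭ (suc l) {i} p = ⅀-picks-↭ (λ e q → cong (𝟙 (proj₁ e ≟ i) *_) (walks-↭ l q)) p

    circuits-↭ : ∀ {L L′} → L ↭ L′ → circuits L ≡ circuits L′
    circuits-↭ = ⅀-picks-↭ λ (u , w) {r} {r′} q →
      trans (cong (λ l → walks l w u r) (↭-length q)) (walks-↭ (length r′) q)

    walks≢0 : ∀ l {i j} L → walks l i j L ≢ 0 → ∃[ L′ ] L ↭ L′ × IsWalk i j L′
    walks≢0 zero {i} {j} [] ne with i ≟ j
    ... | yes refl = [] , ↭.refl , []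
    ... | no _ = ⊥-elim (ne refl)
    walks≢0 zero (_ ∷ _) ne = ⊥-elim (ne refl)
    walks≢0 (suc l) {i} L ne with ⅀≢0 _ (picks L) ne
    ... | ((u , w) , r) , e∈ , ne′ with u ≟ i
    ... | no _ = ⊥-elim (ne′ refl)
    ... | yes refl with walks≢0 l r (ne′ ∘ trans (ℕ.*-identityˡ _))
    ... | L′ , p , walk = _ , ↭.trans (∈-picks L e∈) (↭.prep _ p) , u ∷ walk

    circuits≢0 : ∀ L → circuits L ≢ 0 → ∃[ i ] ∃[ L′ ] L ↭ L′ × IsWalk i i L′
    circuits≢0 L ne with ⅀≢0 _ (picks L) ne
    ... | ((u , w) , r) , e∈ , ne′ with walks≢0 (length r) r ne′
    ... | L′ , p , walk = u , _ , ↭.trans (∈-picks L e∈) (↭.prep _ p) , u ∷ walk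

    walks>0 : ∀ {i j L} → IsWalk i j L → 0 < walks (length L) i j L
    walks>0 {i} [] with i ≟ i
    ... | yes _ = s≤s z≤n
    ... | no ne = ⊥-elim (ne refl)
    walks>0 (i ∷ walk) with i ≟ i
    ... | yes _ = ℕ.<-≤-trans (walks>0 walk)
                    (ℕ.≤-trans (ℕ.≤-reflexive (sym (ℕ.*-identityˡ _))) (ℕ.m≤m+n _ _))
    ... | no ne = ⊥-elim (ne refl)

    circuits>0 : ∀ {i e L} → IsWalk i i (e ∷ L) → 0 < circuits (e ∷ L)
    circuits>0 (i ∷ walk) = ℕ.<-≤-trans (walks>0 walk) (ℕ.m≤m+n _ _)

    -- Entering and leaving cancel at inner vertices; the two extra terms account for the ends of an
    -- open walk, through which the induction has to pass.
    walk-balanced : ∀ {i j L} x → IsWalk i j L →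
      ⅀ L (λ e → 𝟙 (proj₁ e ≟ x)) + 𝟙 (j ≟ x) ≡ ⅀ L (λ e → 𝟙 (proj₂ e ≟ x)) + 𝟙 (i ≟ x)
    walk-balanced x [] = refl
    walk-balanced {j = j} x (_∷_ i {s} {r = r} walk) =
      trans (ℕ.+-assoc (𝟙 (i ≟ x)) _ _) (trans (cong (𝟙 (i ≟ x) +_) (walk-balanced x walk))
        (lemma (𝟙 (i ≟ x)) (⅀ r (λ e → 𝟙 (proj₂ e ≟ x))) (𝟙 (s ≟ x))))
      where
      lemma : ∀ a b c → a + (b + c) ≡ (c + b) + a
      lemma = solve-∀

    circuits-balanced : ∀ L → circuits L ≢ 0 → ∀ x →
      ⅀ L (λ e → 𝟙 (proj₁ e ≟ x)) ≡ ⅀ L (λ e → 𝟙 (proj₂ e ≟ x))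
    circuits-balanced L ne x with circuits≢0 L ne
    ... | i , L′ , p , walk = begin
      ⅀ L (λ e → 𝟙 (proj₁ e ≟ x))   ≡⟨ ⅀-↭ _ p ⟩
      ⅀ L′ (λ e → 𝟙 (proj₁ e ≟ x))  ≡⟨ ℕ.+-cancelʳ-≡ _ _ _ (walk-balanced x walk) ⟩
      ⅀ L′ (λ e → 𝟙 (proj₂ e ≟ x))  ≡⟨ ⅀-↭ _ p ⟨
      ⅀ L (λ e → 𝟙 (proj₂ e ≟ x))   ∎

    -- A closed ordering runs through all arcs in a row: going back from the first given arc to the
    -- start, and from there forward to the second one, carries `P` along.
    circuits-connected : ∀ {p} (P : V → Set p) L → circuits L ≢ 0 →
      (∀ {u w} → (u , w) ∈ L → P u → P w) → (∀ {u w} → (u , w) ∈ L → P w → P u) →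
      ∀ {u w u′ w′} → (u , w) ∈ L → P u → (u′ , w′) ∈ L → P u′
    circuits-connected P L ne fwd bwd e∈ pu e′∈ with circuits≢0 L ne
    ... | i , L′ , p , walk =
      walk-forward P walk (fwd ∘ ∈-resp-↭ (↭-sym p))
        (walk-backward P walk (bwd ∘ ∈-resp-↭ (↭-sym p)) (∈-resp-↭ p e∈) pu)
        (∈-resp-↭ p e′∈)

  module _ {v w} {V : Set v} {W : Set w} (_≟ⱽ_ : DecidableEquality V) (_≟ᵂ_ : DecidableEquality W)
           (f : V → W) (f-inj : ∀ {x y} → f x ≡ f y → x ≡ y) where
    private
      module V = Walks _≟ⱽ_
      module W = Walks _≟ᵂ_

    walks-map : ∀ l i j L → W.walks l (f i) (f j) (map (×.map f f) L) ≡ V.walks l i j L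
    walks-map zero i j [] = 𝟙-⇔ (f i ≟ᵂ f j) (i ≟ⱽ j) f-inj (cong f)
    walks-map zero i j (_ ∷ _) = refl
    walks-map (suc l) i j L = begin
      ⅀ (picks (map (×.map f f) L)) _  ≡⟨ cong (λ ps → ⅀ ps _) (picks-map (×.map f f) L) ⟩
      ⅀ (map _ (picks L)) _            ≡⟨ ⅀-map _ _ (picks L) ⟩
      ⅀ (picks L) _                    ≡⟨ ⅀-cong (picks L) (λ ((u , s) , r) → cong₂ _*_
                                            (𝟙-⇔ (f u ≟ᵂ f i) (u ≟ⱽ i) f-inj (cong f)) (walks-map l s j r)) ⟩
      ⅀ (picks L) _                    ∎

    circuits-map : ∀ L → W.circuits (map (×.map f f) L) ≡ V.circuits L
    circuits-map L = begin
      ⅀ (picks (map (×.map f f) L)) _  ≡⟨ cong (λ ps → ⅀ ps _) (picks-map (×.map f f) L) ⟩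
      ⅀ (map _ (picks L)) _            ≡⟨ ⅀-map _ _ (picks L) ⟩
      ⅀ (picks L) _                    ≡⟨ ⅀-cong (picks L) (λ ((u , s) , r) →
                                            trans (cong (λ l → W.walks l (f s) (f u) (map _ r)) (length-map _ r))
                                              (walks-map (length r) s u r)) ⟩
      ⅀ (picks L) _                    ∎
      where open import Data.List.Properties using (length-map)

-- Derivatives of matrix powers as walk counts.

module TraceFunctionals where

  open BigOperators
  open ClosedWalks
  open import Algebra.Bundles using (CommutativeRing)
  import Algebra.Properties.Semiring.Mult as Mult
  open import Data.Empty using (⊥-elim)
  open import Data.Fin using (Fin)
  open import Data.Fin.Properties using (_≟_)
  open import Data.List using (List; []; _∷_; _++_; map; foldr; length; allFin)
  open import Data.List.Membership.Propositional.Properties using (∈-allFin)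
  open import Data.List.Relation.Binary.Permutation.Propositional as ↭ using (_↭_; ↭-trans)
  open import Data.List.Relation.Binary.Permutation.Propositional.Properties using (↭-length; shift; ++⁺ˡ)
  open import Data.List.Relation.Unary.Unique.Propositional.Properties using (allFin⁺)
  open import Data.Nat as ℕ using (ℕ; zero; suc; _∸_; _!)
  import Data.Nat.Properties as ℕ
  open import Data.Nat.GeneralisedArithmetic using (iterate)
  open import Data.Product as × using (_,_; proj₁; proj₂)
  import Data.Product.Properties as ×ₚ
  open import Data.Sum using (inj₂)
  open import Data.Vec as Vec using (Vec; []; _∷_; toList; lookup)
  open import Function using (_∘_)
  open import Relation.Binary.PropositionalEquality as ≡ using (_≡_; _≢_; cong)
  open import Relation.Nullary using (Dec; yes; no)

  module Derivatives {c ℓ₁ ℓ₂} (F : OrderedField c ℓ₁ ℓ₂) where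
    open OrderedField F
    open Tensors F using (Tensor; Poly; con; a; _⊕_; _⊗_; ∂; constantTerm; ∑; matrixPower; tracePower; operator; applyOperators)
    private module R = CommutativeRing commutativeRing
    open R using (commutativeSemiring; setoid; refl; sym; trans; reflexive; +-cong; +-congˡ; +-congʳ; *-cong; *-congˡ; *-congʳ; zeroˡ; +-identityˡ; +-identityʳ)
    open import Relation.Binary.Reasoning.Setoid setoid
    open Sums commutativeSemiring
    open PickSums commutativeSemiring
    module ℕS = Sums ℕ.+-*-commutativeSemiring

    ι : ℕ → Carrier
    ι = fromℕ#

    ι-+ : ∀ x y → ι (x ℕ.+ y) ≈ ι x + ι y
    ι-+ x y = Mult.×-homo-+ R.semiring 1# x y

    ι-* : ∀ x y → ι (x ℕ.* y) ≈ ι x * ι y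
    ι-* = Mult.×1-homo-* R.semiring

    ι-1 : ι 1 ≈ 1#
    ι-1 = +-identityʳ 1#

    1/!-inverse : ∀ p → 1/! p * ι (p !) ≈ 1#
    1/!-inverse p = trans (*-congˡ (sym (trans (+-congˡ -0#≈0#) (+-identityʳ _))))
                      (proj₁ (proj₂ (#⇒invertible (inj₂ (fromℕ#-pos (p !) {{p ℕ.!≢0}})))))
      where open import Algebra.Properties.Ring R.ring using (-0#≈0#)

    ι-⅀ : ∀ {x} {X : Set x} (f : X → ℕ) xs → ι (ℕS.⅀ xs f) ≈ ⅀ xs (ι ∘ f)
    ι-⅀ f [] = refl
    ι-⅀ f (x ∷ xs) = trans (ι-+ (f x) _) (+-congˡ (ι-⅀ f xs))

    ι-𝟙 : ∀ {p} {P : Set p} (d : Dec P) → ι (ℕS.𝟙 d) ≈ 𝟙 d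
    ι-𝟙 (yes _) = ι-1
    ι-𝟙 (no _) = refl

    module _ {n : ℕ} where
      open Walks (_≟_ {n})

      infix 5 _≟ᵃ_
      _≟ᵃ_ : (e f : Arc) → Dec (e ≡ f)
      _≟ᵃ_ = ×ₚ.≡-dec _≟_ _≟_

      D : List Arc → Poly n → Poly n
      D []            p = p
      D ((i , j) ∷ L) p = D L (∂ i j p)

      -- A formal polynomial is examined only through these numbers, one for each list of
      -- derivatives; identities between polynomials are stated as identities between them.
      ev : List Arc → Poly n → Carrier
      ev L p = constantTerm (D L p)

      ev-⊕ : ∀ L p q → ev L (p ⊕ q) ≈ ev L p + ev L q
      ev-⊕ [] p q = refl
      ev-⊕ ((i , j) ∷ L) p q = ev-⊕ L _ _

      ev-0 : ∀ L → ev L (con 0#) ≈ 0#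
      ev-0 [] = refl
      ev-0 (_ ∷ L) = ev-0 L

      ev-con⊗ : ∀ L x p → ev L (con x ⊗ p) ≈ x * ev L p
      ev-con⊗ [] x p = refl
      ev-con⊗ ((i , j) ∷ L) x p = begin
        ev L ((con 0# ⊗ p) ⊕ (con x ⊗ ∂ i j p))      ≈⟨ ev-⊕ L _ _ ⟩
        ev L (con 0# ⊗ p) + ev L (con x ⊗ ∂ i j p)   ≈⟨ +-cong (ev-con⊗ L 0# p) (ev-con⊗ L x (∂ i j p)) ⟩
        0# * ev L p + x * ev L (∂ i j p)             ≈⟨ +-congʳ (zeroˡ _) ⟩
        0# + x * ev L (∂ i j p)                      ≈⟨ +-identityˡ _ ⟩
        x * ev L (∂ i j p)                           ∎

      ev-∑ : ∀ {x} {X : Set x} L (xs : List X) (f : X → Poly n) → ev L (∑ xs f) ≈ ⅀ xs (ev L ∘ f)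
      ev-∑ L [] f = ev-0 L
      ev-∑ L (x ∷ xs) f = trans (ev-⊕ L _ _) (+-congˡ (ev-∑ L xs f))

      ev-∂a⊗ : ∀ L i j r s p → ev L (∂ i j (a r s) ⊗ p) ≈ 𝟙 ((i , j) ≟ᵃ (r , s)) * ev L p
      ev-∂a⊗ L i j r s p with (i , j) ≟ᵃ (r , s)
      ... | yes _ = ev-con⊗ L 1# p
      ... | no _  = ev-con⊗ L 0# p

      -- Exactly one derivative must be spent on the variable: with none the constant term is zero,
      -- and a second one would find a constant. The product rule tries each of them in turn.
      ev-a⊗ : ∀ L r s p → ev L (a r s ⊗ p) ≈ ⅀ (picks L) λ (e , L′) → 𝟙 (e ≟ᵃ (r , s)) * ev L′ p
      ev-a⊗ [] r s p = zeroˡ _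
      ev-a⊗ ((i , j) ∷ L) r s p = begin
        ev L ((∂ i j (a r s) ⊗ p) ⊕ (a r s ⊗ ∂ i j p))
          ≈⟨ ev-⊕ L _ _ ⟩
        ev L (∂ i j (a r s) ⊗ p) + ev L (a r s ⊗ ∂ i j p)
          ≈⟨ +-cong (ev-∂a⊗ L i j r s p) (ev-a⊗ L r s (∂ i j p)) ⟩
        𝟙 ((i , j) ≟ᵃ (r , s)) * ev L p + ⅀ (picks L) (λ (e , L′) → 𝟙 (e ≟ᵃ (r , s)) * ev ((i , j) ∷ L′) p)
          ≈⟨ reflexive (picks-∷ _ (i , j) L) ⟨
        ⅀ (picks ((i , j) ∷ L)) (λ (e , L′) → 𝟙 (e ≟ᵃ (r , s)) * ev L′ p)
          ∎

      -- The factors of a monomial in an entry of the power form a walk from `i` to `j`, so the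
      -- derivatives that do not annihilate it are orderings of its arcs.
      ev-matrixPower : ∀ l i j L → ev L (matrixPower l i j) ≈ ι (walks l i j L)
      ev-matrixPower zero i j [] with i ≟ j
      ... | yes _ = sym ι-1
      ... | no _ = refl
      ev-matrixPower zero i j (_ ∷ L) with i ≟ j
      ... | yes _ = ev-0 L
      ... | no _ = ev-0 L
      ev-matrixPower (suc l) i j L = begin
        ev L (∑ (allFin n) (λ s → a i s ⊗ matrixPower l s j))
          ≈⟨ ev-∑ L (allFin n) _ ⟩
        ⅀ (allFin n) (λ s → ev L (a i s ⊗ matrixPower l s j))
          ≈⟨ ⅀-cong (allFin n) (λ s → ev-a⊗ L i s _) ⟩
        ⅀ (allFin n) (λ s → ⅀ (picks L) λ (e , r) → 𝟙 (e ≟ᵃ (i , s)) * ev r (matrixPower l s j))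
          ≈⟨ ⅀-swap _ (allFin n) (picks L) ⟩
        ⅀ (picks L) (λ (e , r) → ⅀ (allFin n) λ s → 𝟙 (e ≟ᵃ (i , s)) * ev r (matrixPower l s j))
          ≈⟨ ⅀-cong (picks L) (λ (e , r) → step e r) ⟩
        ⅀ (picks L) (λ (e , r) → ι (ℕS.𝟙 (proj₁ e ≟ i) ℕ.* walks l (proj₂ e) j r))
          ≈⟨ ι-⅀ _ (picks L) ⟨
        ι (walks (suc l) i j L) ∎
        where
        step : ∀ e r → ⅀ (allFin n) (λ s → 𝟙 (e ≟ᵃ (i , s)) * ev r (matrixPower l s j))
                       ≈ ι (ℕS.𝟙 (proj₁ e ≟ i) ℕ.* walks l (proj₂ e) j r)
        step (u , w) r = begin
          ⅀ (allFin n) (λ s → 𝟙 ((u , w) ≟ᵃ (i , s)) * ev r (matrixPower l s j))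
            ≈⟨ ⅀-single _ (allFin⁺ n) (∈-allFin w) (λ {s} _ s≢w →
                 trans (*-congʳ (𝟙-no ((u , w) ≟ᵃ (i , s)) (λ { ≡.refl → s≢w ≡.refl }))) (zeroˡ _)) ⟩
          𝟙 ((u , w) ≟ᵃ (i , w)) * ev r (matrixPower l w j)
            ≈⟨ *-cong (trans (𝟙-⇔ ((u , w) ≟ᵃ (i , w)) (u ≟ i) (cong proj₁) (cong (_, w))) (sym (ι-𝟙 (u ≟ i))))
                      (ev-matrixPower l w j r) ⟩
          ι (ℕS.𝟙 (u ≟ i)) * ι (walks l w j r)
            ≈⟨ ι-* (ℕS.𝟙 (u ≟ i)) (walks l w j r) ⟨
          ι (ℕS.𝟙 (u ≟ i) ℕ.* walks l w j r) ∎

      traceWalks : ℕ → List Arc → ℕ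
      traceWalks N L = ℕS.⅀ (allFin n) λ i → walks N i i L

      traceWalks-↭ : ∀ N {L L′} → L ↭ L′ → traceWalks N L ≡ traceWalks N L′
      traceWalks-↭ N p = ℕS.⅀-cong (allFin n) (λ i → walks-↭ N p)

      -- The trace sums over the starting vertex, whereas `circuits` reads it off the first arc.
      -- Length zero is excluded because the empty walk closes up at every vertex, while `circuits`
      -- of the empty list is zero.
      traceWalks-circuits : ∀ N L → length L ≡ N → N ≢ 0 → traceWalks N L ≡ circuits L
      traceWalks-circuits zero L _ ne = ⊥-elim (ne ≡.refl)
      traceWalks-circuits (suc N) L len ne = ≡.trans (ℕS.⅀-swap _ (allFin n) (picks L))
        (ℕS.⅀-cong∈ (picks L) λ ((u , w) , r) p∈ → ≡.trans
          (ℕS.⅀-single _ (allFin⁺ n) (∈-allFin u) (λ {i} _ i≢u →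
            cong (ℕ._* walks N w i r) (ℕS.𝟙-no (u ≟ i) (i≢u ∘ ≡.sym))))
          (≡.trans (cong (ℕ._* walks N w u r) (ℕS.𝟙-yes (u ≟ u) ≡.refl)) (≡.trans (ℕ.*-identityˡ _)
            (cong (λ l → walks l w u r) (ℕ.suc-injective (≡.trans (≡.sym len) (↭-length (∈-picks L p∈))))))))

      ev-tracePower : ∀ N L → ev L (tracePower N) ≈ ι (traceWalks N L)
      ev-tracePower N L = trans (ev-∑ L (allFin n) _)
        (trans (⅀-cong (allFin n) (λ i → ev-matrixPower N i i L)) (sym (ι-⅀ _ (allFin n))))

      Functional : Set c
      Functional = List Arc → Carrier

      -- The commutation of derivatives enters in this form: walk counts ignore the order of the
      -- arcs, and every operator preserves this.
      Symmetric : Functional → Set _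
      Symmetric G = ∀ {L L′} → L ↭ L′ → G L ≈ G L′

      -- An operator Σ_l wt l ∂^(arcs l), as it acts on the functionals ev _ p.
      Op : ∀ {x} {Λ : Set x} → List Λ → (Λ → Carrier) → (Λ → List Arc) → Functional → Functional
      Op ls wt arcs G L = ⅀ ls λ l → wt l * G (arcs l ++ L)

      Op-symmetric : ∀ {x} {Λ : Set x} (ls : List Λ) wt arcs {G} → Symmetric G → Symmetric (Op ls wt arcs G)
      Op-symmetric ls wt arcs sG p = ⅀-cong ls (λ l → *-congˡ (sG (++⁺ˡ (arcs l) p)))

      star : Fin n → List (Fin n) → List Arc
      star i = map (i ,_)

      module _ {k : ℕ} (T : Tensor k n) where

        tensorOp : Fin n → Functional → Functional
        tensorOp i = Op (words (allFin n) (k ∸ 1)) (T i) (star i ∘ toList)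

        -- The arcs in the order in which the nested derivatives reach the list, which is the
        -- reverse of `γ`; `accum-↭` compares it with the star of `i`.
        accum : ∀ {p} → Fin n → Vec (Fin n) p → List Arc → List Arc
        accum i []      L = L
        accum i (g ∷ γ) L = accum i γ ((i , g) ∷ L)

        accum-↭ : ∀ {p} i (γ : Vec (Fin n) p) L → accum i γ L ↭ star i (toList γ) ++ L
        accum-↭ i [] L = ↭.refl
        accum-↭ i (g ∷ γ) L = ↭-trans (accum-↭ i γ _) (shift (i , g) (star i (toList γ)) L)

        ev-∂s : ∀ {p} i (γ : Vec (Fin n) p) L q → ev L (Vec.foldr′ (∂ i) q γ) ≡ ev (accum i γ L) q
        ev-∂s i [] L q = ≡.refl
        ev-∂s i (g ∷ γ) L q = ev-∂s i γ _ q

        Represents : Functional → Poly n → Set _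
        Represents G p = ∀ L → ev L p ≈ G L

        operator-represents : ∀ {G p} i → Symmetric G → Represents G p → Represents (tensorOp i G) (operator {k} T i p)
        operator-represents {G} {p} i sG rep L = trans (ev-∑ L (words (allFin n) (k ∸ 1)) _)
          (⅀-cong (words (allFin n) (k ∸ 1)) λ γ → trans (ev-con⊗ L (T i γ) _) (*-congˡ
            (trans (reflexive (ev-∂s i γ L p)) (trans (rep _) (sG (accum-↭ i γ L))))))

        iterate-symmetric : ∀ {G} i r → Symmetric G → Symmetric (iterate (tensorOp i) G r)
        iterate-symmetric i zero sG = sG
        iterate-symmetric i (suc r) sG =
          iterate-symmetric i r (Op-symmetric (words (allFin n) (k ∸ 1)) (T i) (star i ∘ toList) sG)

        iterate-represents : ∀ {G p} i r → Symmetric G → Represents G p →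
          Represents (iterate (tensorOp i) G r) (iterate (operator {k} T i) p r)
        iterate-represents i zero sG rep = rep
        iterate-represents i (suc r) sG rep =
          iterate-represents i r (Op-symmetric (words (allFin n) (k ∸ 1)) (T i) (star i ∘ toList) sG)
            (operator-represents i sG rep)

        -- The action of `applyOperators` on functionals, for an arbitrary list of vertices so that
        -- induction on the list is possible.
        applyF : Vec ℕ n → List (Fin n) → Functional → Functional
        applyF d is G = foldr (λ i H L → 1/! (lookup d i ℕ.* (k ∸ 1)) * iterate (tensorOp i) H (lookup d i) L) G is

        applyF-symmetric : ∀ {G} d is → Symmetric G → Symmetric (applyF d is G)
        applyF-symmetric d [] sG = sG
        applyF-symmetric d (i ∷ is) sG p = *-congˡ (iterate-symmetric i (lookup d i) (applyF-symmetric d is sG) p)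

        apply-represents : ∀ {G p} d is → Symmetric G → Represents G p →
          Represents (applyF d is G)
            (foldr (λ i q → con (1/! (lookup d i ℕ.* (k ∸ 1))) ⊗ iterate (operator {k} T i) q (lookup d i)) p is)
        apply-represents d [] sG rep = rep
        apply-represents d (i ∷ is) sG rep L = trans (ev-con⊗ L _ _)
          (*-congˡ (iterate-represents i (lookup d i) (applyF-symmetric d is sG) (apply-represents d is sG rep) L))

        constantTerm-applyOperators : ∀ d N →
          constantTerm (applyOperators {k} T d (tracePower N)) ≈ applyF d (allFin n) (ι ∘ traceWalks N) []
        constantTerm-applyOperators d N =
          apply-represents {p = tracePower N} d (allFin n)
            (λ p → reflexive (cong ι (traceWalks-↭ N p))) (ev-tracePower N) []

-- Expansion of the trace over choices of tensor entries.

module TraceExpansion where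

  open BigOperators
  open TraceFunctionals
  open import Algebra.Bundles using (CommutativeRing)
  import Algebra.Properties.CommutativeSemigroup as CSG
  open import Data.Fin using (Fin)
  open import Data.List using (List; []; _∷_; _++_; allFin; concatMap; cartesianProductWith)
  open import Data.List.Properties using (++-assoc; ++-identityʳ; concatMap-++)
  open import Data.List.Relation.Binary.Permutation.Propositional as ↭ using (_↭_; ↭-trans; ↭-reflexive)
  open import Data.List.Relation.Binary.Permutation.Propositional.Properties using (shifts)
  open import Data.Nat as ℕ using (ℕ; zero; suc; _∸_)
  open import Data.Nat.GeneralisedArithmetic using (iterate)
  open import Data.Product as × using (_×_; _,_)
  open import Data.Vec using (Vec; lookup; toList)
  open import Function using (_∘_)
  open import Relation.Binary.PropositionalEquality as ≡ using (_≡_; cong)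

  module _ {n : ℕ} {x} {Λ : Set x} where

    arcsOf : (Fin n → Λ → List (Fin n × Fin n)) → List (Fin n × Λ) → List (Fin n × Fin n)
    arcsOf arcs = concatMap λ (i , l) → arcs i l

    spell : List Λ → Fin n → ℕ → List (List (Fin n × Λ))
    spell ls i zero    = [] ∷ []
    spell ls i (suc r) = cartesianProductWith (λ l s → (i , l) ∷ s) ls (spell ls i r)

    -- A choice takes an ordered word of `d i` letters at each vertex `i`. The letters stay abstract
    -- so that tensor entries with the same effect can be merged into one letter.
    choices : List Λ → (Fin n → ℕ) → List (Fin n) → List (List (Fin n × Λ))
    choices ls d []       = [] ∷ []
    choices ls d (i ∷ is) = cartesianProductWith _++_ (spell ls i (d i)) (choices ls d is)

  module Expansion {c ℓ₁ ℓ₂} (F : OrderedField c ℓ₁ ℓ₂) where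
    open OrderedField F
    open Tensors F using (Tensor; Tr; exponents)
    open Derivatives F
    private module R = CommutativeRing commutativeRing
    open R using (commutativeSemiring; setoid; sym; trans; reflexive; *-cong; *-congˡ; *-identityˡ; *-assoc)
    open import Relation.Binary.Reasoning.Setoid setoid
    open Sums commutativeSemiring
    open CSG R.*-commutativeSemigroup using (x∙yz≈y∙xz)

    module _ {n : ℕ} {k : ℕ} (T : Tensor k n) {x} {Λ : Set x} (ls : List Λ)
             (wt : Fin n → Λ → Carrier) (arcs : Fin n → Λ → List (Fin n × Fin n)) where

      weight : List (Fin n × Λ) → Carrier
      weight s = ∏ s λ (i , l) → wt i l

      weight-++ : ∀ s t → weight (s ++ t) ≈ weight s * weight t
      weight-++ = ∏-++ _

      -- Only symmetric functionals are tested, so entries of a row that differ merely in the order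
      -- of their arcs may share a letter.
      module _ (agree : ∀ i {G} → Symmetric G → ∀ L → tensorOp {k = k} T i G L ≈ Op ls (wt i) (arcs i) G L) where

        iterate-spell : ∀ {G} i r → Symmetric G → ∀ L →
          iterate (tensorOp {k = k} T i) G r L ≈ ⅀ (spell ls i r) λ s → weight s * G (arcsOf arcs s ++ L)
        iterate-spell {G} i zero sG L = sym (trans (R.+-identityʳ _) (*-identityˡ _))
        iterate-spell {G} i (suc r) sG L = begin
          iterate (tensorOp {k = k} T i) (tensorOp {k = k} T i G) r L
            ≈⟨ iterate-spell i r (Op-symmetric (words (allFin n) (k ∸ 1)) (T i) (star i ∘ toList) sG) L ⟩
          ⅀ (spell ls i r) (λ s → weight s * tensorOp {k = k} T i G (arcsOf arcs s ++ L))
            ≈⟨ ⅀-cong (spell ls i r) (λ s → *-congˡ (agree i sG _)) ⟩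
          ⅀ (spell ls i r) (λ s → weight s * ⅀ ls (λ l → wt i l * G (arcs i l ++ (arcsOf arcs s ++ L))))
            ≈⟨ ⅀-cong (spell ls i r) (λ s → *-⅀ (weight s) _ ls) ⟩
          ⅀ (spell ls i r) (λ s → ⅀ ls (λ l → weight s * (wt i l * G (arcs i l ++ (arcsOf arcs s ++ L)))))
            ≈⟨ ⅀-swap _ (spell ls i r) ls ⟩
          ⅀ ls (λ l → ⅀ (spell ls i r) (λ s → weight s * (wt i l * G (arcs i l ++ (arcsOf arcs s ++ L)))))
            ≈⟨ ⅀-cong ls (λ l → ⅀-cong (spell ls i r) λ s →
                 trans (x∙yz≈y∙xz _ _ _) (trans (sym (*-assoc _ _ _))
                   (*-congˡ (reflexive (cong G (≡.sym (++-assoc (arcs i l) (arcsOf arcs s) L))))))) ⟩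
          ⅀ ls (λ l → ⅀ (spell ls i r) (λ s → weight ((i , l) ∷ s) * G (arcsOf arcs ((i , l) ∷ s) ++ L)))
            ≈⟨ ⅀-cartesian _ _ ls (spell ls i r) ⟨
          ⅀ (spell ls i (suc r)) (λ s → weight s * G (arcsOf arcs s ++ L)) ∎

        private
          ω : (Fin n → ℕ) → Fin n → Carrier
          ω d i = 1/! (d i ℕ.* (k ∸ 1))

        apply-choices : ∀ {G} (v : Vec ℕ n) is → Symmetric G → ∀ L →
          applyF {k = k} T v is G L ≈
          ∏ is (ω (lookup v)) * ⅀ (choices ls (lookup v) is) λ s → weight s * G (arcsOf arcs s ++ L)
        apply-choices v [] sG L = sym (trans (*-identityˡ _) (trans (R.+-identityʳ _) (*-identityˡ _)))
        apply-choices {G} v (i ∷ is) sG L = begin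
          ω d i * iterate (tensorOp {k = k} T i) H (d i) L
            ≈⟨ *-congˡ (iterate-spell i (d i) (applyF-symmetric {k = k} T v is sG) L) ⟩
          ω d i * ⅀ (spell ls i (d i)) (λ s → weight s * H (arcsOf arcs s ++ L))
            ≈⟨ *-congˡ (⅀-cong (spell ls i (d i)) λ s → trans (*-congˡ (apply-choices v is sG _))
                 (trans (x∙yz≈y∙xz _ _ _) (*-congˡ (*-⅀ (weight s) _ (choices ls d is))))) ⟩
          ω d i * ⅀ (spell ls i (d i)) (λ s → ∏ is (ω d) *
            ⅀ (choices ls d is) λ t → weight s * (weight t * G (arcsOf arcs t ++ (arcsOf arcs s ++ L))))
            ≈⟨ *-congˡ (*-⅀ (∏ is (ω d)) _ (spell ls i (d i))) ⟨
          ω d i * (∏ is (ω d) * ⅀ (spell ls i (d i)) (λ s →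
            ⅀ (choices ls d is) λ t → weight s * (weight t * G (arcsOf arcs t ++ (arcsOf arcs s ++ L)))))
            ≈⟨ *-assoc _ _ _ ⟨
          ∏ (i ∷ is) (ω d) * ⅀ (spell ls i (d i)) (λ s →
            ⅀ (choices ls d is) λ t → weight s * (weight t * G (arcsOf arcs t ++ (arcsOf arcs s ++ L))))
            ≈⟨ *-congˡ (⅀-cong (spell ls i (d i)) λ s → ⅀-cong (choices ls d is) λ t →
                 trans (sym (*-assoc _ _ _)) (*-cong (sym (weight-++ s t)) (sG (arcs-↭ s t)))) ⟩
          ∏ (i ∷ is) (ω d) * ⅀ (spell ls i (d i)) (λ s →
            ⅀ (choices ls d is) λ t → weight (s ++ t) * G (arcsOf arcs (s ++ t) ++ L))
            ≈⟨ *-congˡ (⅀-cartesian _ _++_ (spell ls i (d i)) (choices ls d is)) ⟨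
          ∏ (i ∷ is) (ω d) * ⅀ (choices ls d (i ∷ is)) (λ s → weight s * G (arcsOf arcs s ++ L)) ∎
          where
          d = lookup v
          H = applyF {k = k} T v is G
          -- The outer operator puts its arcs on the list before the inner ones do, so they end up
          -- behind the arcs of `t`.
          arcs-↭ : ∀ s t → arcsOf arcs t ++ (arcsOf arcs s ++ L) ↭ arcsOf arcs (s ++ t) ++ L
          arcs-↭ s t = ↭-trans (shifts (arcsOf arcs t) (arcsOf arcs s)) (↭-reflexive (≡.trans
            (≡.sym (++-assoc (arcsOf arcs s) (arcsOf arcs t) L)) (cong (_++ L) (≡.sym (concatMap-++ _ s t)))))

        Tr-choices : ∀ d → Tr {k} T (suc d) ≈ ι ((k ∸ 1) ℕ.^ (n ∸ 1)) *
          ⅀ (exponents {k} T (suc d)) λ v → ∏ (allFin n) (ω (lookup v)) *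
            ⅀ (choices ls (lookup v) (allFin n)) λ s → weight s * ι (traceWalks (suc d ℕ.* (k ∸ 1)) (arcsOf arcs s))
        Tr-choices d = *-congˡ (trans (ev-∑ [] (exponents {k} T (suc d)) _) (⅀-cong (exponents {k} T (suc d)) λ v →
          trans (constantTerm-applyOperators {k = k} T v N) (trans (apply-choices v (allFin n) sG [])
            (*-congˡ (⅀-cong (choices ls (lookup v) (allFin n)) λ s →
              *-congˡ (reflexive (cong (ι ∘ traceWalks N) (++-identityʳ (arcsOf arcs s)))))))))
          where
          N = suc d ℕ.* (k ∸ 1)
          sG : Symmetric (ι ∘ traceWalks N)
          sG p = reflexive (cong ι (traceWalks-↭ N p))

-- Subsets as lists, and tensor entries grouped into letters.

module SubsetLists where

  open BigOperators
  open TraceFunctionals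
  open import Algebra.Bundles using (CommutativeRing)
  open import Data.Bool using (true; false)
  import Data.Bool.Properties as Bool
  open import Data.Empty using (⊥-elim)
  open import Data.Fin as Fin using (Fin)
  open import Data.Fin.Properties using (_≟_)
  open import Data.Fin.Subset using (Subset; _∈_; ∣_∣; ⁅_⁆)
  open import Data.Fin.Subset.Properties using (_∈?_; x∈p∪q⁻; x∈p∪q⁺; x∈⁅x⁆; x∈⁅y⁆⇒x≡y; ∉⊥; ⊆-antisym; drop-there)
  open import Data.List using (List; []; _∷_; _++_; map; length; allFin; filter; tabulate; replicate)
  open import Data.List.Properties using (filter-≐; length-map; map-tabulate; length-tabulate)
  import Data.List.Membership.Propositional as L
  open import Data.List.Membership.Propositional.Properties using (∈-allFin; ∈-filter⁺; ∈-filter⁻; ∈-cartesianProductWith⁺)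
  open import Data.List.Relation.Binary.Permutation.Propositional as ↭ using (_↭_; ↭-sym; ↭-trans)
  open import Data.List.Relation.Binary.Permutation.Propositional.Properties using (∈-resp-↭; ↭-length; drop-∷; map⁺; ++⁺ʳ)
  open import Data.List.Relation.Unary.All as All using (All; []; _∷_)
  open import Data.List.Relation.Unary.AllPairs using ([]; _∷_)
  open import Data.List.Relation.Unary.Any using (here; there)
  open import Data.List.Relation.Unary.Unique.Propositional using (Unique)
  import Data.List.Relation.Unary.Unique.Propositional.Properties as Unique
  open import Data.Maybe using (Maybe; just; nothing)
  open import Data.Nat as ℕ using (ℕ; zero; suc; _∸_; _!)
  import Data.Nat.Properties as ℕ
  open import Data.Product as × using (_×_; _,_; proj₁; proj₂)
  open import Data.Sum using (inj₁; inj₂)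
  open import Data.Vec as Vec using (Vec; []; _∷_; toList)
  import Data.Vec.Properties as Vecₚ
  open import Data.Vec.Relation.Unary.All as VAll using ([]; _∷_)
  open import Function using (_∘_)
  open import Relation.Binary.PropositionalEquality as ≡ using (_≡_; _≢_; refl; cong; subst)
  open import Relation.Nullary using (¬_; yes; no; ¬?)
  open import Relation.Unary using (Pred; Decidable)

  length-allFin : ∀ n → length (allFin n) ≡ n
  length-allFin n = length-tabulate {n = n} (λ i → i)

  els : ∀ {n} → Subset n → List (Fin n)
  els S = filter (_∈? S) (allFin _)

  els-unique : ∀ {n} (S : Subset n) → Unique (els S)
  els-unique S = Unique.filter⁺ (_∈? S) (Unique.allFin⁺ _)

  ∈-els⁺ : ∀ {n} {S : Subset n} {v} → v ∈ S → v L.∈ els S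
  ∈-els⁺ {S = S} v∈ = ∈-filter⁺ (_∈? S) (∈-allFin _) v∈

  ∈-els⁻ : ∀ {n} {S : Subset n} {v} → v L.∈ els S → v ∈ S
  ∈-els⁻ {S = S} v∈ = proj₂ (∈-filter⁻ (_∈? S) {xs = allFin _} v∈)

  filter-map : ∀ {a b p} {A : Set a} {B : Set b} {P : Pred B p} (P? : Decidable P) (f : A → B) xs →
               filter P? (map f xs) ≡ map f (filter (P? ∘ f) xs)
  filter-map P? f [] = refl
  filter-map P? f (x ∷ xs) with P? (f x)
  ... | yes _ = cong (f x ∷_) (filter-map P? f xs)
  ... | no _  = filter-map P? f xs

  els-∷ : ∀ {n} s (S : Subset n) → length (filter (_∈? (s ∷ S)) (tabulate Fin.suc)) ≡ length (els S)
  els-∷ {n} s S = ≡.trans (cong (length ∘ filter (_∈? (s ∷ S))) (≡.sym (map-tabulate (λ x → x) Fin.suc)))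
    (≡.trans (cong length (filter-map (_∈? (s ∷ S)) Fin.suc (allFin n))) (≡.trans (length-map Fin.suc (filter ((_∈? (s ∷ S)) ∘ Fin.suc) (allFin n)))
      (cong length (filter-≐ ((_∈? (s ∷ S)) ∘ Fin.suc) (_∈? S) (drop-there , Vec.there) (allFin n)))))

  length-els : ∀ {n} (S : Subset n) → length (els S) ≡ ∣ S ∣
  length-els [] = refl
  length-els (true ∷ S) = cong suc (≡.trans (els-∷ true S) (length-els S))
  length-els (false ∷ S) = ≡.trans (els-∷ false S) (length-els S)

  ∈-setOf⁺ : ∀ {n} {xs : List (Fin n)} {v} → v L.∈ xs → v ∈ setOf xs
  ∈-setOf⁺ (here refl) = x∈p∪q⁺ (inj₁ (x∈⁅x⁆ _))
  ∈-setOf⁺ {xs = x ∷ xs} (there v∈) = x∈p∪q⁺ {p = ⁅ x ⁆} (inj₂ (∈-setOf⁺ v∈))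

  ∈-setOf⁻ : ∀ {n} {xs : List (Fin n)} {v} → v ∈ setOf xs → v L.∈ xs
  ∈-setOf⁻ {xs = []} v∈ = ⊥-elim (∉⊥ v∈)
  ∈-setOf⁻ {xs = x ∷ xs} v∈ with x∈p∪q⁻ ⁅ x ⁆ _ v∈
  ... | inj₁ p = here (x∈⁅y⁆⇒x≡y x p)
  ... | inj₂ p = there (∈-setOf⁻ p)

  ↭-els : ∀ {n} {S : Subset n} {ys} → Unique ys → (∀ {v} → v L.∈ ys → v ∈ S) → (∀ {v} → v ∈ S → v L.∈ ys) →
          els S ↭ ys
  ↭-els {S = S} u f g =
    ⊆∧length≤⇒↭ u (∈-els⁺ ∘ f) (Unique-⊆⇒length≤ (els-unique S) (g ∘ ∈-els⁻))

  ∣∣-list : ∀ {n} {S : Subset n} {ys} → Unique ys → (∀ {v} → v L.∈ ys → v ∈ S) → (∀ {v} → v ∈ S → v L.∈ ys) →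
            ∣ S ∣ ≡ length ys
  ∣∣-list {S = S} u f g = ≡.trans (≡.sym (length-els S)) (↭-length (↭-els u f g))

  others : ∀ {n} → Fin n → Subset n → List (Fin n)
  others i S = filter (¬? ∘ (i ≟_)) (els S)

  others-↭ : ∀ {n} {i : Fin n} {S} → i ∈ S → els S ↭ i ∷ others i S
  others-↭ {i = i} {S} i∈ = ↭-els
    (All.tabulate (λ v∈ → proj₂ (∈-filter⁻ (¬? ∘ (i ≟_)) {xs = els S} v∈)) ∷ Unique.filter⁺ _ (els-unique S))
    (λ { (here refl) → i∈ ; (there v∈) → ∈-els⁻ (proj₁ (∈-filter⁻ (¬? ∘ (i ≟_)) v∈)) })
    (λ {v} v∈ → case i ≟ v of λ { (yes refl) → here refl ; (no i≢v) → there (∈-filter⁺ (¬? ∘ (i ≟_)) (∈-els⁺ v∈) i≢v) })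
    where open import Function using (case_of_)

  setOf-≡ : ∀ {n} {S : Subset n} {xs} → length xs ≡ ∣ S ∣ → S ≡ setOf xs → els S ↭ xs
  setOf-≡ {S = S} {xs} len refl = ↭-sym (⊆∧length≤⇒↭ (els-unique S) (∈-setOf⁻ ∘ ∈-els⁻)
    (ℕ.≤-reflexive (≡.trans len (≡.sym (length-els S)))))

  ↭⇒setOf-≡ : ∀ {n} {S : Subset n} {xs} → els S ↭ xs → S ≡ setOf xs
  ↭⇒setOf-≡ p = ⊆-antisym (∈-setOf⁺ ∘ ∈-resp-↭ p ∘ ∈-els⁺) (∈-els⁻ ∘ ∈-resp-↭ (↭-sym p) ∘ ∈-setOf⁻)

  length-toList : ∀ {a} {A : Set a} {p} (γ : Vec A p) → length (toList γ) ≡ p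
  length-toList = Vecₚ.length-toList

  ∈-words : ∀ {a} {A : Set a} {xs : List A} {p} (γ : Vec A p) → (∀ {x} → x L.∈ toList γ → x L.∈ xs) → γ L.∈ words xs p
  ∈-words [] h = here refl
  ∈-words (x ∷ γ) h = ∈-cartesianProductWith⁺ Vec._∷_ (h (here refl)) (∈-words γ (h ∘ there))

  words-unique : ∀ {a} {A : Set a} {xs : List A} → Unique xs → ∀ p → Unique (words xs p)
  words-unique u zero = [] ∷ []
  words-unique u (suc p) = Unique.cartesianProductWith⁺ Vec._∷_ Vecₚ.∷-injective u (words-unique u p)

  module _ (k : ℕ) (H : Hypergraph) where
    open Hypergraph H

    -- nothing stands for the diagonal entry, just e for the entries of the hyperedge e.
    Letter : Set
    Letter = Maybe Edge

    letters : List Letter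
    letters = nothing ∷ map just (allFin size)

    letterArcs : Vertex → Letter → List (Vertex × Vertex)
    letterArcs i nothing  = replicate (k ∸ 1) (i , i)
    letterArcs i (just e) = map (i ,_) (others i (edge e))

  module Grouping {c ℓ₁ ℓ₂} (F : OrderedField c ℓ₁ ℓ₂) where
    open OrderedField F
    open Tensors F using (A[_]; adjacencyTensor; degreeTensor; isEdge?)
    open Derivatives F
    private module R = CommutativeRing commutativeRing
    open R using (commutativeSemiring; setoid; sym; trans; reflexive; +-cong; +-congˡ; *-cong; *-congˡ; *-congʳ; zeroˡ; zeroʳ; *-identityˡ; *-identityʳ; +-identityʳ; *-assoc; distribʳ)
      renaming ()
    open import Relation.Binary.Reasoning.Setoid setoid
    open Sums commutativeSemiring

    -- Every arrangement of the distinct letters ys is one of the words.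
    ⅀-arrangements : ∀ {n} p (ys : List (Fin n)) → Unique ys → length ys ≡ p → (f : Vec (Fin n) p → Carrier) (x : Carrier) →
      (∀ γ → toList γ ↭ ys → f γ ≈ x) → (∀ γ → ¬ (toList γ ↭ ys) → f γ ≈ 0#) →
      ⅀ (words (allFin n) p) f ≈ ι (p !) * x
    ⅀-arrangements zero [] u len f x on off =
      trans (+-identityʳ _) (trans (on [] ↭.refl) (sym (trans (*-congʳ ι-1) (*-identityˡ x))))
    ⅀-arrangements {n} (suc p) ys u len f x on off = begin
      ⅀ (words (allFin n) (suc p)) f
        ≈⟨ ⅀-cartesian f Vec._∷_ (allFin n) (words (allFin n) p) ⟩
      ⅀ (allFin n) (λ g → ⅀ (words (allFin n) p) (λ γ → f (g ∷ γ)))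
        ≈⟨ ⅀-reindex _ (Unique.allFin⁺ n) u (λ _ → ∈-allFin _) (λ {g} _ g∉ → ⅀-0 (words (allFin n) p)
             (λ γ _ → off (g ∷ γ) (λ q → g∉ (∈-resp-↭ q (here refl))))) ⟩
      ⅀ ys (λ g → ⅀ (words (allFin n) p) (λ γ → f (g ∷ γ)))
        ≈⟨ ⅀-cong∈ ys (λ g g∈ → step g g∈) ⟩
      ⅀ ys (λ g → ι (p !) * x)
        ≈⟨ const ys ⟩
      ι (length ys) * (ι (p !) * x)
        ≈⟨ *-assoc _ _ _ ⟨
      ι (length ys) * ι (p !) * x
        ≈⟨ *-congʳ (trans (*-congʳ (reflexive (cong ι len))) (sym (ι-* (suc p) (p !)))) ⟩
      ι (suc p !) * x ∎
      where
      const : ∀ {y} (ys : List (Fin n)) → ⅀ ys (λ _ → y) ≈ ι (length ys) * y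
      const [] = sym (zeroˡ _)
      const (_ ∷ ys) = sym (trans (distribʳ _ _ _) (+-cong (*-identityˡ _) (sym (const ys))))
      step : ∀ g → g L.∈ ys → ⅀ (words (allFin n) p) (λ γ → f (g ∷ γ)) ≈ ι (p !) * x
      step g g∈ with ∈⇒↭ g∈
      ... | ys′ , q with Unique-resp-↭ q u
      ... | _ ∷ u′ = ⅀-arrangements p ys′ u′ (ℕ.suc-injective (≡.trans (≡.sym (↭-length q)) len)) _ x
        (λ γ r → on (g ∷ γ) (↭-trans (↭.prep g r) (↭-sym q)))
        (λ γ ¬r → off (g ∷ γ) (λ r → ¬r (drop-∷ (↭-trans r q))))

    ⅀-words-constant : ∀ {n} p (i : Fin n) (f : Vec (Fin n) p → Carrier) →
      (∀ γ → ¬ VAll.All (i ≡_) γ → f γ ≈ 0#) → ⅀ (words (allFin n) p) f ≈ f (Vec.replicate p i)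
    ⅀-words-constant {n} p i f off = ⅀-single f (words-unique (Unique.allFin⁺ n) p) (∈-words _ (λ _ → ∈-allFin _))
      (λ {γ} _ ne → off γ (ne ∘ constant γ))
      where
      constant : ∀ {p} (γ : Vec (Fin n) p) → VAll.All (i ≡_) γ → γ ≡ Vec.replicate p i
      constant [] [] = refl
      constant (_ ∷ γ) (refl ∷ a) = cong (i ∷_) (constant γ a)

    module _ (k : ℕ) (k≢0 : k ≢ 0) (H : Hypergraph) (simple : Simple H) (uniform : Uniform k H) (α : Carrier) where
      open Hypergraph H

      private
        n = order
        m = size

      letterWeight : Vertex → Letter k H → Carrier
      letterWeight i nothing  = α * ι (degree H i)
      letterWeight i (just e) = (1# - α) * 𝟙 (i ∈? edge e)

      -- Simplicity leaves at most one nonzero summand. Writing the existence of a hyperedge as a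
      -- sum allows an interchange with the sum over words.
      adjacency-indicator : ∀ i γ → adjacencyTensor k H i γ ≈
        1/! (k ∸ 1) * ⅀ (allFin m) λ e → 𝟙 (Vecₚ.≡-dec Bool._≟_ (edge e) (setOf (i ∷ toList γ)))
      adjacency-indicator i γ with isEdge? k H (setOf (i ∷ toList γ))
      ... | yes (e , eq) = sym (trans (*-congˡ (trans (⅀-single _ (Unique.allFin⁺ m) (∈-allFin e)
              (λ {f} _ f≢e → 𝟙-no (Vecₚ.≡-dec Bool._≟_ (edge f) _) (λ eq′ → f≢e (simple (≡.trans eq′ (≡.sym eq))))))
              (𝟙-yes (Vecₚ.≡-dec Bool._≟_ (edge e) _) eq))) (*-identityʳ _))
      ... | no none = sym (trans (*-congˡ (⅀-0 (allFin m) (λ e _ →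
              𝟙-no (Vecₚ.≡-dec Bool._≟_ (edge e) _) (λ eq → none (e , eq))))) (zeroʳ _))

      degree-indicator : ∀ i γ → degreeTensor k H i γ ≈ 𝟙 (VAll.all? (i ≟_) γ) * ι (degree H i)
      degree-indicator i γ with VAll.all? (i ≟_) γ
      ... | yes _ = sym (*-identityˡ _)
      ... | no _ = sym (zeroˡ _)

      private
        p = k ∸ 1
        k≡1+p : k ≡ suc p
        k≡1+p = ≡.sym (ℕ.m+[n∸m]≡n (ℕ.n≢0⇒n>0 k≢0))

      -- The words that complete `i` to `e` are the orderings of the other vertices of `e`, and a
      -- symmetric `h` does not distinguish them. Their number (k - 1)! will cancel the denominator
      -- in the adjacency tensor.
      edge-sum : ∀ i e {h : List (Vertex) → Carrier} → (∀ {xs ys} → xs ↭ ys → h xs ≈ h ys) →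
        ⅀ (words (allFin n) p) (λ γ → 𝟙 (Vecₚ.≡-dec Bool._≟_ (edge e) (setOf (i ∷ toList γ))) * h (toList γ))
        ≈ ι (p !) * (𝟙 (i ∈? edge e) * h (others i (edge e)))
      edge-sum i e {h} sh with i ∈? edge e
      ... | no i∉ = trans (⅀-0 (words (allFin n) p) (λ γ _ → trans (*-congʳ (𝟙-no (Vecₚ.≡-dec Bool._≟_ (edge e) _)
                      (λ eq → i∉ (subst (i ∈_) (≡.sym eq) (∈-setOf⁺ {xs = i ∷ toList γ} (here refl)))))) (zeroˡ _)))
                      (sym (trans (*-congˡ (zeroˡ _)) (zeroʳ _)))
      ... | yes i∈ = ⅀-arrangements p (others i (edge e)) (Unique.filter⁺ _ (els-unique (edge e)))
        (ℕ.suc-injective (≡.trans (≡.sym (↭-length (others-↭ i∈))) (≡.trans (length-els (edge e)) (≡.trans (uniform e) k≡1+p))))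
        _ _
        (λ γ q → *-cong (𝟙-yes (Vecₚ.≡-dec Bool._≟_ (edge e) _)
            (↭⇒setOf-≡ (↭-trans (others-↭ i∈) (↭.prep i (↭-sym q))))) (sh q))
        (λ γ ¬q → trans (*-congʳ (𝟙-no (Vecₚ.≡-dec Bool._≟_ (edge e) _) (λ eq → ¬q (drop-∷ (↭-trans
            (↭-sym (setOf-≡ {xs = i ∷ toList γ} (≡.trans (cong suc (length-toList γ)) (≡.trans (≡.sym k≡1+p) (≡.sym (uniform e)))) eq))
            (others-↭ i∈)))))) (zeroˡ _))

      star-replicate : ∀ p (i : Vertex) → star i (toList (Vec.replicate p i)) ≡ replicate p (i , i)
      star-replicate zero i = refl
      star-replicate (suc p) i = cong ((i , i) ∷_) (star-replicate p i)

      -- In the diagonal part only the constant word survives, and the (k - 1)! entries of a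
      -- hyperedge through `i` merge into one letter whose weight is free of factorials.
      tensorOp-letters : ∀ i {G} → Symmetric G → ∀ L →
        tensorOp {k = k} (A[_] k H α) i G L ≈ Op (letters k H) (letterWeight i) (letterArcs k H i) G L
      tensorOp-letters i {G} sG L = begin
        ⅀ W (λ γ → (α * degreeTensor k H i γ + (1# - α) * adjacencyTensor k H i γ) * g γ)
          ≈⟨ ⅀-cong W (λ γ → trans (distribʳ _ _ _) (+-cong (*-congʳ (*-congˡ (degree-indicator i γ)))
               (*-congʳ (*-congˡ (adjacency-indicator i γ))))) ⟩
        ⅀ W (λ γ → (α * (𝟙 (VAll.all? (i ≟_) γ) * ι (degree H i))) * g γ + ((1# - α) * (1/! p * ⅀ (allFin m) (ind γ))) * g γ)
          ≈⟨ ⅀-+ _ _ W ⟩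
        ⅀ W (λ γ → (α * (𝟙 (VAll.all? (i ≟_) γ) * ι (degree H i))) * g γ) + ⅀ W (λ γ → ((1# - α) * (1/! p * ⅀ (allFin m) (ind γ))) * g γ)
          ≈⟨ +-cong diagonal edges ⟩
        letterWeight i nothing * G (letterArcs k H i nothing ++ L) + ⅀ (allFin m) (λ e → letterWeight i (just e) * G (letterArcs k H i (just e) ++ L))
          ≈⟨ +-congˡ (reflexive (⅀-map _ just (allFin m))) ⟨
        Op (letters k H) (letterWeight i) (letterArcs k H i) G L ∎
        where
        W = words (allFin n) p
        g : Vec Vertex p → Carrier
        g γ = G (star i (toList γ) ++ L)
        ind : Vec Vertex p → Edge → Carrier
        ind γ e = 𝟙 (Vecₚ.≡-dec Bool._≟_ (edge e) (setOf (i ∷ toList γ)))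
        diagonal : ⅀ W (λ γ → (α * (𝟙 (VAll.all? (i ≟_) γ) * ι (degree H i))) * g γ) ≈ (α * ι (degree H i)) * G (letterArcs k H i nothing ++ L)
        diagonal = trans (⅀-words-constant p i _ (λ γ ¬a → trans (*-congʳ (trans (*-congˡ
            (trans (*-congʳ (𝟙-no (VAll.all? (i ≟_) γ) ¬a)) (zeroˡ _))) (zeroʳ _))) (zeroˡ _)))
          (*-cong (*-congˡ (trans (*-congʳ (𝟙-yes (VAll.all? (i ≟_) (Vec.replicate p i)) (same p))) (*-identityˡ _)))
            (reflexive (cong (λ L′ → G (L′ ++ L)) (star-replicate p i))))
          where
          same : ∀ p → VAll.All (i ≡_) (Vec.replicate p i)
          same zero = []
          same (suc p) = refl ∷ same p
        edges : ⅀ W (λ γ → ((1# - α) * (1/! p * ⅀ (allFin m) (ind γ))) * g γ) ≈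
                ⅀ (allFin m) (λ e → letterWeight i (just e) * G (letterArcs k H i (just e) ++ L))
        edges = begin
          ⅀ W (λ γ → ((1# - α) * (1/! p * ⅀ (allFin m) (ind γ))) * g γ)
            ≈⟨ ⅀-cong W (λ γ → trans (*-congʳ (sym (*-assoc _ _ _))) (trans (*-assoc _ _ _) (*-congˡ (⅀-* (g γ) (ind γ) (allFin m))))) ⟩
          ⅀ W (λ γ → ((1# - α) * 1/! p) * ⅀ (allFin m) (λ e → ind γ e * g γ))
            ≈⟨ *-⅀ _ _ W ⟨
          ((1# - α) * 1/! p) * ⅀ W (λ γ → ⅀ (allFin m) (λ e → ind γ e * g γ))
            ≈⟨ *-congˡ (⅀-swap _ W (allFin m)) ⟩
          ((1# - α) * 1/! p) * ⅀ (allFin m) (λ e → ⅀ W (λ γ → ind γ e * g γ))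
            ≈⟨ *-congˡ (⅀-cong (allFin m) (λ e → edge-sum i e (λ q → sG (++⁺ʳ L (map⁺ (i ,_) q))))) ⟩
          ((1# - α) * 1/! p) * ⅀ (allFin m) (λ e → ι (p !) * (𝟙 (i ∈? edge e) * G (star i (others i (edge e)) ++ L)))
            ≈⟨ *-⅀ _ _ (allFin m) ⟩
          ⅀ (allFin m) (λ e → ((1# - α) * 1/! p) * (ι (p !) * (𝟙 (i ∈? edge e) * G (star i (others i (edge e)) ++ L))))
            ≈⟨ ⅀-cong (allFin m) (λ e → trans (*-assoc _ _ _) (trans (*-congˡ (trans (sym (*-assoc _ _ _))
                 (trans (*-congʳ (1/!-inverse p)) (*-identityˡ _)))) (sym (*-assoc _ _ _)))) ⟩
          ⅀ (allFin m) (λ e → letterWeight i (just e) * G (letterArcs k H i (just e) ++ L)) ∎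

-- The choices of entries that admit a closed walk.

module ContributingPicks where

  open BigOperators
  open ClosedWalks
  open TraceExpansion
  open SubsetLists
  open import Data.Empty using (⊥; ⊥-elim)
  open import Data.Fin.Properties using (_≟_)
  open import Data.Fin.Subset using (Subset; _∈_; _∉_; _∩_; ∣_∣)
  open import Data.Fin.Subset.Properties using (_∈?_; x∈p∩q⁺)
  open import Data.List using (List; []; _∷_; _++_; map; length; replicate)
  import Data.List.Membership.Propositional as L
  open import Data.List.Membership.Propositional.Properties using (∈-++⁺ˡ; ∈-++⁺ʳ; ∈-++⁻; ∈-map⁻; ∈-filter⁻)
  open import Data.List.Relation.Binary.Permutation.Propositional.Properties using (↭-length)
  open import Data.List.Relation.Unary.All as All using ([]; _∷_)
  open import Data.List.Relation.Unary.AllPairs using ([]; _∷_)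
  open import Data.List.Relation.Unary.Any using (here; there)
  open import Data.Maybe using (just; nothing)
  open import Data.Nat as ℕ using (ℕ; zero; suc; _∸_; _+_; _*_; _≤_; _<_; z≤n; s≤s)
  import Data.Nat.Properties as ℕ
  open import Data.Nat.Tactic.RingSolver using (solve-∀)
  open import Data.Product as × using (∃-syntax; _×_; _,_; proj₁; proj₂)
  open import Data.Sum using (_⊎_; inj₁; inj₂)
  open import Function using (_∘_)
  open import Relation.Binary.PropositionalEquality as ≡ using (_≡_; _≢_; refl; sym; trans; cong; cong₂; subst)
  open import Relation.Nullary using (¬_; Dec; yes; no; ¬?)
  open ℕΣ
  open Walks

  𝟙≤1 : ∀ {p} {P : Set p} (d : Dec P) → 𝟙 d ≤ 1
  𝟙≤1 (yes _) = s≤s z≤n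
  𝟙≤1 (no _) = z≤n

  count-els : ∀ {n} x (S : Subset n) → ⅀ (els S) (λ y → 𝟙 (y ≟ x)) ≡ 𝟙 (x ∈? S)
  count-els x S with x ∈? S
  ... | yes x∈ = trans (⅀-single _ (els-unique S) (∈-els⁺ x∈) (λ {y} _ ne → 𝟙-no (y ≟ x) ne)) (𝟙-yes (x ≟ x) refl)
  ... | no x∉ = ⅀-0 (els S) (λ y y∈ → 𝟙-no (y ≟ x) (λ { refl → x∉ (∈-els⁻ y∈) }))

  linear-≡ : ∀ {H} → Linear H → ∀ {v w e f} → v ≢ w →
             v ∈ Hypergraph.edge H e → w ∈ Hypergraph.edge H e → v ∈ Hypergraph.edge H f → w ∈ Hypergraph.edge H f → e ≡ f
  linear-≡ {H} linear {v} {w} {e} {f} v≢w v∈e w∈e v∈f w∈f with e ≟ f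
  ... | yes e≡f = e≡f
  ... | no e≢f = ⊥-elim (ℕ.<-irrefl refl (ℕ.≤-trans two (linear e≢f)))
    where
    open Hypergraph H
    two : 2 ≤ ∣ edge e ∩ edge f ∣
    two = subst (2 ≤_) (length-els (edge e ∩ edge f)) (Unique-⊆⇒length≤ {ys = v ∷ w ∷ []} ((v≢w ∷ []) ∷ [] ∷ [])
      λ { (here refl) → ∈-els⁺ (x∈p∩q⁺ (v∈e , v∈f)) ; (there (here refl)) → ∈-els⁺ (x∈p∩q⁺ (w∈e , w∈f)) })

  three : ∀ {n} (S : Subset n) → 3 ≤ ∣ S ∣ → ∃[ x ] ∃[ y ] ∃[ z ] x ∈ S × y ∈ S × z ∈ S × x ≢ y × x ≢ z × y ≢ z
  three S 3≤ with els S | els-unique S | length-els S | ∈-els⁻ {S = S}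
  ... | []              | _ | eq | _ = ⊥-elim (ℕ.n≮0 (subst (3 ≤_) (sym eq) 3≤))
  ... | x ∷ []          | _ | eq | _ = ⊥-elim (ℕ.n≮0 (ℕ.s≤s⁻¹ (subst (3 ≤_) (sym eq) 3≤)))
  ... | x ∷ y ∷ []      | _ | eq | _ = ⊥-elim (ℕ.n≮0 (ℕ.s≤s⁻¹ (ℕ.s≤s⁻¹ (subst (3 ≤_) (sym eq) 3≤))))
  ... | x ∷ y ∷ z ∷ _ | (x≢y ∷ x≢z ∷ _) ∷ (y≢z ∷ _) ∷ _ | _ | mem =
    x , y , z , mem (here refl) , mem (there (here refl)) , mem (there (there (here refl))) , x≢y , x≢z , y≢z

  module Vanishing (k : ℕ) (3≤k : 3 ≤ k) (H : Hypergraph)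
                   (uniform : Uniform k H) (linear : Linear H) where
    open Hypergraph H

    private
      -- This is what ties the order of the trace to k ≥ 3: among at most k + 2 choices there is no
      -- room for the second positive multiple of `k`.
      k+2<2k : ∀ {l} → l ≤ k + 2 → l < k * 2
      k+2<2k {l} l≤ = ℕ.≤-<-trans l≤ (subst (k + 2 <_) (sym (trans (ℕ.*-comm k 2) (cong (k +_) (ℕ.+-identityʳ k)))) (ℕ.+-monoʳ-< k 3≤k))

      outside : ∀ {e f} → e ≢ f → ∃[ i ] i ∈ edge e × i ∉ edge f
      outside {e} {f} e≢f with three (edge e) (subst (3 ≤_) (sym (uniform e)) 3≤k)
      ... | x , y , _ , x∈ , y∈ , _ , x≢y , _ with x ∈? edge f | y ∈? edge f
      ... | no x∉ | _ = x , x∈ , x∉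
      ... | yes _ | no y∉ = y , y∈ , y∉
      ... | yes x∈f | yes y∈f = ⊥-elim (e≢f (linear-≡ {H} linear x≢y x∈ y∈ x∈f y∈f))

    -- `es` will be the hyperedges of a choice, with repetition, and `f x` the number of hyperedge
    -- entries picked at `x`; the divisibility will come from the balance of a closed walk.
    module _ (es : List Edge) (short : length es ≤ k + 2) (f : Vertex → ℕ)
             (divisible : ∀ x → ⅀ es (λ e → 𝟙 (x ∈? edge e)) ≡ k * f x) where

      private
        mult : Edge → ℕ
        mult e = ⅀ es (λ g → 𝟙 (e ≟ g))

        bounded : ∀ {h : Edge → ℕ} → (∀ e → h e ≤ 1) → ⅀ es h ≤ length es
        bounded h≤1 = ℕ.≤-trans (⅀-≤ es h≤1) (ℕ.≤-reflexive (⅀-1 es))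

        -- The count is a positive multiple of `k` and at most k + 2, hence below 2k.
        through : ∀ {e x} → e L.∈ es → x ∈ edge e → ⅀ es (λ e → 𝟙 (x ∈? edge e)) ≡ k
        through {e} {x} e∈ x∈ with f x | divisible x
        ... | 0 | eq = ⊥-elim (ℕ.<-irrefl (sym (trans eq (ℕ.*-zeroʳ k)))
                (ℕ.<-≤-trans (ℕ.≤-reflexive (sym (𝟙-yes (x ∈? edge e) x∈))) (∈⇒≤⅀ (λ e → 𝟙 (x ∈? edge e)) e∈)))
        ... | 1 | eq = trans eq (ℕ.*-identityʳ k)
        ... | suc (suc n) | eq = ⊥-elim (ℕ.<-irrefl refl (ℕ.<-≤-trans (k+2<2k short)
                (ℕ.≤-trans (ℕ.*-monoʳ-≤ k (s≤s (s≤s z≤n))) (ℕ.≤-trans (ℕ.≤-reflexive (sym eq)) (bounded λ e → 𝟙≤1 (x ∈? edge e))))))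

        -- Three vertices of e are jointly met at most once by any other hyperedge.
        frequent : ∀ {e} → e L.∈ es → k ≤ suc (mult e)
        frequent {e} e∈ with three (edge e) (subst (3 ≤_) (sym (uniform e)) 3≤k)
        ... | x , y , z , x∈ , y∈ , z∈ , x≢y , x≢z , y≢z =
          ℕ.*-cancelˡ-≤ 2 (ℕ.+-cancelˡ-≤ k (2 * k) (2 * suc (mult e)) (begin
            k + 2 * k                      ≡⟨ three-k k ⟩
            k + (k + k)                    ≡⟨ cong₂ _+_ (through e∈ x∈) (cong₂ _+_ (through e∈ y∈) (through e∈ z∈)) ⟨
            ⅀ es χx + (⅀ es χy + ⅀ es χz)  ≡⟨ cong (⅀ es χx +_) (⅀-+ χy χz es) ⟨
            ⅀ es χx + ⅀ es (λ g → χy g + χz g) ≡⟨ ⅀-+ χx _ es ⟨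
            ⅀ es (λ g → χx g + (χy g + χz g))  ≤⟨ ⅀-≤ es pointwise ⟩
            ⅀ es (λ g → 1 + 2 * 𝟙 (e ≟ g))  ≡⟨ trans (⅀-+ (λ _ → 1) _ es) (cong₂ _+_ (⅀-1 es) (sym (*-⅀ 2 _ es))) ⟩
            length es + 2 * mult e         ≤⟨ ℕ.+-monoˡ-≤ (2 * mult e) short ⟩
            k + 2 + 2 * mult e             ≡⟨ rearrange k (mult e) ⟩
            k + 2 * suc (mult e)           ∎))
          where
          open ℕ.≤-Reasoning
          three-k : ∀ k → k + 2 * k ≡ k + (k + k)
          three-k = solve-∀
          rearrange : ∀ k x → k + 2 + 2 * x ≡ k + 2 * suc x
          rearrange = solve-∀
          χx χy χz : Edge → ℕ
          χx g = 𝟙 (x ∈? edge g)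
          χy g = 𝟙 (y ∈? edge g)
          χz g = 𝟙 (z ∈? edge g)
          pointwise : ∀ g → χx g + (χy g + χz g) ≤ 1 + 2 * 𝟙 (e ≟ g)
          pointwise g with e ≟ g
          ... | yes _ = ℕ.+-mono-≤ (𝟙≤1 (x ∈? edge g)) (ℕ.+-mono-≤ (𝟙≤1 (y ∈? edge g)) (𝟙≤1 (z ∈? edge g)))
          ... | no e≢g with x ∈? edge g | y ∈? edge g | z ∈? edge g
          ... | yes p | yes q | _ = ⊥-elim (e≢g (linear-≡ {H} linear x≢y x∈ y∈ p q))
          ... | yes p | no _ | yes q = ⊥-elim (e≢g (linear-≡ {H} linear x≢z x∈ z∈ p q))
          ... | no _ | yes p | yes q = ⊥-elim (e≢g (linear-≡ {H} linear y≢z y∈ z∈ p q))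
          ... | yes _ | no _ | no _ = ℕ.≤-refl
          ... | no _ | yes _ | no _ = ℕ.≤-refl
          ... | no _ | no _ | yes _ = ℕ.≤-refl
          ... | no _ | no _ | no _ = z≤n

        -- Each of `e` and `g` occurs at least k - 1 times, and all these occurrences pass through
        -- `j`, which lies on exactly `k` of the choices; but 2(k - 1) > k.
        apart : ∀ {e g j} → e ≢ g → e L.∈ es → g L.∈ es → j ∈ edge e → j ∈ edge g → ⊥
        apart {e} {g} {j} e≢g e∈ g∈ j∈e j∈g = ℕ.<-irrefl refl (begin-strict
          k + 2             <⟨ k+2<2k ℕ.≤-refl ⟩
          k * 2             ≡⟨ ℕ.*-comm k 2 ⟩
          k + (k + 0)       ≡⟨ cong (k +_) (ℕ.+-identityʳ k) ⟩
          k + k             ≤⟨ ℕ.+-mono-≤ (frequent e∈) (frequent g∈) ⟩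
          suc (mult e) + suc (mult g) ≡⟨ rearrange (mult e) (mult g) ⟩
          mult e + mult g + 2 ≤⟨ ℕ.+-monoˡ-≤ 2 (ℕ.≤-trans (ℕ.≤-reflexive (sym (⅀-+ _ _ es))) (⅀-≤ es pointwise)) ⟩
          ⅀ es (λ h → 𝟙 (j ∈? edge h)) + 2 ≡⟨ cong (_+ 2) (through e∈ j∈e) ⟩
          k + 2             ∎)
          where
          open ℕ.≤-Reasoning
          rearrange : ∀ x y → suc x + suc y ≡ x + y + 2
          rearrange = solve-∀
          pointwise : ∀ h → 𝟙 (e ≟ h) + 𝟙 (g ≟ h) ≤ 𝟙 (j ∈? edge h)
          pointwise h with e ≟ h | g ≟ h
          ... | yes refl | yes refl = ⊥-elim (e≢g refl)
          ... | yes refl | no _ = ℕ.≤-reflexive (sym (𝟙-yes (j ∈? edge h) j∈e))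
          ... | no _ | yes refl = ℕ.≤-reflexive (sym (𝟙-yes (j ∈? edge h) j∈g))
          ... | no _ | no _ = z≤n

      -- Otherwise there are `i` in `e` outside `g` and `j` in `g` outside `e`. By `apart` no chosen
      -- hyperedge contains both, so the `k` choices through `i` and the `k` through `j` are
      -- disjoint, which is more than k + 2.
      edges-equal : ∀ {e g} → e L.∈ es → g L.∈ es → e ≡ g
      edges-equal {e} {g} e∈ g∈ with e ≟ g
      ... | yes e≡g = e≡g
      ... | no e≢g with outside e≢g | outside (e≢g ∘ sym)
      ... | i , i∈e , i∉g | j , j∈g , j∉e = ⊥-elim (ℕ.<-irrefl refl (ℕ.<-≤-trans (k+2<2k short) (begin
          k * 2                                         ≡⟨ trans (ℕ.*-comm k 2) (cong (k +_) (ℕ.+-identityʳ k)) ⟩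
          k + k                                         ≡⟨ cong₂ _+_ (through e∈ i∈e) (through g∈ j∈g) ⟨
          ⅀ es (λ h → 𝟙 (i ∈? edge h)) + ⅀ es (λ h → 𝟙 (j ∈? edge h)) ≡⟨ ⅀-+ _ _ es ⟨
          ⅀ es (λ h → 𝟙 (i ∈? edge h) + 𝟙 (j ∈? edge h)) ≤⟨ ⅀-≤∈ es pointwise ⟩
          ⅀ es (λ _ → 1)                                ≡⟨ ⅀-1 es ⟩
          length es                                     ∎)))
        where
        open ℕ.≤-Reasoning
        pointwise : ∀ h → h L.∈ es → 𝟙 (i ∈? edge h) + 𝟙 (j ∈? edge h) ≤ 1
        pointwise h h∈ with i ∈? edge h | j ∈? edge h
        ... | no _ | j? = 𝟙≤1 j?
        ... | yes _ | no _ = ℕ.≤-refl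
        ... | yes i∈h | yes j∈h = ⊥-elim (apart (λ { refl → j∉e j∈h }) e∈ h∈ i∈e i∈h)

      vertex-once : ∀ {e} → e L.∈ es → ∀ x → f x ≡ 𝟙 (x ∈? edge e)
      vertex-once {e} e∈ x with x ∈? edge e
      ... | yes x∈ = ℕ.*-cancelˡ-≡ (f x) 1 k {{ℕ.>-nonZero (ℕ.<-≤-trans ℕ.z<s 3≤k)}} (trans (sym (divisible x)) (trans (through e∈ x∈) (sym (ℕ.*-identityʳ k))))
      ... | no x∉ = ℕ.*-cancelˡ-≡ (f x) 0 k {{ℕ.>-nonZero (ℕ.<-≤-trans ℕ.z<s 3≤k)}} (trans (sym (divisible x)) (trans
            (⅀-0 es (λ g g∈ → 𝟙-no (x ∈? edge g) (λ x∈g → x∉ (subst (λ h → x ∈ edge h) (edges-equal g∈ e∈) x∈g)))) (sym (ℕ.*-zeroʳ k))))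

    Picks : Set
    Picks = List (Vertex × Letter k H)

    edgesOf : Picks → List Edge
    edgesOf []                 = []
    edgesOf ((_ , nothing) ∷ s) = edgesOf s
    edgesOf ((_ , just e) ∷ s)  = e ∷ edgesOf s

    edgePick : Vertex → Vertex × Letter k H → ℕ
    edgePick x (i , nothing) = 0
    edgePick x (i , just _)  = 𝟙 (i ≟ x)

    Valid : Picks → Set
    Valid s = ∀ {i e} → (i , just e) L.∈ s → i ∈ edge e

    length-edgesOf : ∀ s → length (edgesOf s) ≤ length s
    length-edgesOf [] = z≤n
    length-edgesOf ((_ , nothing) ∷ s) = ℕ.m≤n⇒m≤1+n (length-edgesOf s)
    length-edgesOf ((_ , just _) ∷ s) = s≤s (length-edgesOf s)

    ∈-edgesOf⁺ : ∀ {i e} s → (i , just e) L.∈ s → e L.∈ edgesOf s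
    ∈-edgesOf⁺ ((_ , just _) ∷ s) (here refl) = here refl
    ∈-edgesOf⁺ ((_ , just _) ∷ s) (there p) = there (∈-edgesOf⁺ s p)
    ∈-edgesOf⁺ ((_ , nothing) ∷ s) (there p) = ∈-edgesOf⁺ s p

    ∈-edgesOf⁻ : ∀ {e} s → e L.∈ edgesOf s → ∃[ i ] (i , just e) L.∈ s
    ∈-edgesOf⁻ ((i , just _) ∷ s) (here refl) = i , here refl
    ∈-edgesOf⁻ ((_ , just _) ∷ s) (there p) = ×.map₂ there (∈-edgesOf⁻ s p)
    ∈-edgesOf⁻ ((_ , nothing) ∷ s) p = ×.map₂ there (∈-edgesOf⁻ s p)

    arcs : Picks → List (Vertex × Vertex)
    arcs = arcsOf (letterArcs k H)

    private
      out inn : Vertex → List (Vertex × Vertex) → ℕ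
      out x L = ⅀ L (λ e → 𝟙 (proj₁ e ≟ x))
      inn x L = ⅀ L (λ e → 𝟙 (proj₂ e ≟ x))

      loops-balanced : ∀ x i p → out x (replicate p (i , i)) ≡ inn x (replicate p (i , i))
      loops-balanced x i zero = refl
      loops-balanced x i (suc p) = cong (𝟙 (i ≟ x) +_) (loops-balanced x i p)

      star-out : ∀ x i ys → out x (map (i ,_) ys) ≡ length ys * 𝟙 (i ≟ x)
      star-out x i ys = trans (⅀-map _ (i ,_) ys) (⅀-const (𝟙 (i ≟ x)) ys)

      star-in : ∀ x {i e} → i ∈ edge e → 𝟙 (i ≟ x) + inn x (map (i ,_) (others i (edge e))) ≡ 𝟙 (x ∈? edge e)
      star-in x {i} {e} i∈ = trans (cong (𝟙 (i ≟ x) +_) (⅀-map _ (i ,_) (others i (edge e))))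
        (trans (sym (⅀-↭ _ (others-↭ i∈))) (count-els x (edge e)))

      length-others : ∀ {i e} → i ∈ edge e → suc (length (others i (edge e))) ≡ k
      length-others {i} {e} i∈ = trans (sym (↭-length (others-↭ i∈))) (trans (length-els (edge e)) (uniform e))

      -- An entry of the hyperedge `e` at `i` leaves `i` k - 1 times and enters every other vertex
      -- of `e` once; one more loop at `i` would give `k` exits there and one entrance at each
      -- vertex of `e`. Diagonal entries are balanced by themselves. For balanced arcs this becomes
      -- the divisibility by `k`.
      edge-count : ∀ x s → Valid s → inn x (arcs s) + k * ⅀ s (edgePick x) ≡ out x (arcs s) + ⅀ (edgesOf s) (λ e → 𝟙 (x ∈? edge e))
      edge-count x [] _ = ℕ.*-zeroʳ k
      edge-count x ((i , nothing) ∷ s) valid = trans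
        (cong (_+ k * ⅀ s (edgePick x)) (⅀-++ _ (replicate (k ∸ 1) (i , i)) (arcs s)))
        (trans (ℕ.+-assoc (inn x (replicate (k ∸ 1) (i , i))) _ _)
        (trans (cong₂ _+_ (sym (loops-balanced x i (k ∸ 1))) (edge-count x s (valid ∘ there)))
        (trans (sym (ℕ.+-assoc (out x (replicate (k ∸ 1) (i , i))) _ _))
        (cong (_+ ⅀ (edgesOf s) (λ e → 𝟙 (x ∈? edge e))) (sym (⅀-++ _ (replicate (k ∸ 1) (i , i)) (arcs s)))))))
      edge-count x ((i , just e) ∷ s) valid = begin
        inn x (A ++ arcs s) + k * (a + P)       ≡⟨ cong₂ _+_ (⅀-++ _ A (arcs s)) (ℕ.*-distribˡ-+ k a P) ⟩
        (inn x A + inn x (arcs s)) + (k * a + k * P) ≡⟨ cong (λ z → (inn x A + inn x (arcs s)) + (z * a + k * P)) (length-others i∈) ⟨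
        (inn x A + inn x (arcs s)) + ((a + l * a) + k * P) ≡⟨ cong (λ z → (inn x A + inn x (arcs s)) + ((a + z) + k * P)) (star-out x i (others i (edge e))) ⟨
        (inn x A + inn x (arcs s)) + ((a + out x A) + k * P) ≡⟨ shuffle (inn x A) (inn x (arcs s)) a (out x A) (k * P) ⟩
        (out x A + (a + inn x A)) + (inn x (arcs s) + k * P) ≡⟨ cong₂ _+_ (cong (out x A +_) (star-in x i∈)) (edge-count x s (valid ∘ there)) ⟩
        (out x A + E) + (out x (arcs s) + ⅀ (edgesOf s) (λ e → 𝟙 (x ∈? edge e))) ≡⟨ shuffle₂ (out x A) E (out x (arcs s)) _ ⟩
        (out x A + out x (arcs s)) + (E + ⅀ (edgesOf s) (λ e → 𝟙 (x ∈? edge e))) ≡⟨ cong (_+ (E + ⅀ (edgesOf s) (λ e → 𝟙 (x ∈? edge e)))) (⅀-++ _ A (arcs s)) ⟨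
        out x (A ++ arcs s) + (E + ⅀ (edgesOf s) (λ e → 𝟙 (x ∈? edge e))) ∎
        where
        open ≡.≡-Reasoning
        i∈ = valid (here refl)
        A = map (i ,_) (others i (edge e))
        a = 𝟙 (i ≟ x)
        l = length (others i (edge e))
        E = 𝟙 (x ∈? edge e)
        P = ⅀ s (edgePick x)
        shuffle : ∀ a b c d e → (a + b) + ((c + d) + e) ≡ (d + (c + a)) + (b + e)
        shuffle = solve-∀
        shuffle₂ : ∀ a b c d → (a + b) + (c + d) ≡ (a + c) + (b + d)
        shuffle₂ = solve-∀

    arc-∈ : ∀ {i l u w} s → (i , l) L.∈ s → (u , w) L.∈ letterArcs k H i l → (u , w) L.∈ arcs s
    arc-∈ ((i , l) ∷ s) (here refl) q = ∈-++⁺ˡ q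
    arc-∈ ((i , l) ∷ s) (there p) q = ∈-++⁺ʳ (letterArcs k H i l) (arc-∈ s p q)

    arc-∈⁻ : ∀ {u w} s → (u , w) L.∈ arcs s → ∃[ i ] ∃[ l ] (i , l) L.∈ s × (u , w) L.∈ letterArcs k H i l
    arc-∈⁻ ((i , l) ∷ s) p with ∈-++⁻ (letterArcs k H i l) p
    ... | inj₁ q = i , l , here refl , q
    ... | inj₂ q = let j , l′ , r , t = arc-∈⁻ s q in j , l′ , there r , t

    private
      ∈-loops : ∀ {u w i : Vertex} p → (u , w) L.∈ replicate p (i , i) → u ≡ i × w ≡ i
      ∈-loops (suc p) (here refl) = refl , refl
      ∈-loops (suc p) (there q) = ∈-loops p q

      loop-∈ : ∀ i → (i , i) L.∈ letterArcs k H i nothing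
      loop-∈ i = first (k ∸ 1) (ℕ.∸-monoˡ-≤ 1 3≤k)
        where
        first : ∀ p → 2 ≤ p → (i , i) L.∈ replicate p (i , i)
        first (suc p) _ = here refl

      star-∈ : ∀ {i e} → i ∈ edge e → ∃[ w ] (i , w) L.∈ letterArcs k H i (just e)
      star-∈ {i} {e} i∈ with others i (edge e) | length-others i∈
      ... | [] | eq = ⊥-elim (ℕ.<-irrefl eq (ℕ.<-≤-trans (s≤s (s≤s z≤n)) 3≤k))
      ... | w ∷ _ | _ = w , here refl

    data Shape (s : Picks) : Set where
      loops : ∀ i → (∀ {p} → p L.∈ s → p ≡ (i , nothing)) → Shape s
      edged : ∀ e → (∀ {i f} → (i , just f) L.∈ s → f ≡ e) → (∀ x → ⅀ s (edgePick x) ≡ 𝟙 (x ∈? edge e)) →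
              (∀ {i} → (i , nothing) L.∈ s → i ∈ edge e) → Shape s

    -- If no hyperedge is chosen, all arcs are loops and connectedness leaves a single vertex.
    -- Otherwise the vertices of the only chosen hyperedge `e` are closed under the arcs in both
    -- directions, so connectedness confines the diagonal entries to `e`.
    shape : ∀ s → s ≢ [] → Valid s → length s ≤ k + 2 → circuits _≟_ (arcs s) ≢ 0 → Shape s
    shape [] ne _ _ _ = ⊥-elim (ne refl)
    shape s@((i₀ , l₀) ∷ s′) _ valid short circ = go (edgesOf s) refl
      where
      divisible : ∀ x → ⅀ (edgesOf s) (λ e → 𝟙 (x ∈? edge e)) ≡ k * ⅀ s (edgePick x)
      divisible x = sym (ℕ.+-cancelˡ-≡ (inn x (arcs s)) _ _ (trans (edge-count x s valid)
        (cong (_+ ⅀ (edgesOf s) (λ e → 𝟙 (x ∈? edge e))) (circuits-balanced _≟_ (arcs s) circ x))))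
      short′ = ℕ.≤-trans (length-edgesOf s) short
      go : ∀ es → edgesOf s ≡ es → Shape s
      go [] eq = loops i₀ all
        where
        none : ∀ {i e} → ¬ (i , just e) L.∈ s
        none {e = e} p with subst (e L.∈_) eq (∈-edgesOf⁺ s p)
        ... | ()
        closed : ∀ {u w} → (u , w) L.∈ arcs s → u ≡ w
        closed p with arc-∈⁻ s p
        ... | i , nothing , _ , q = trans (proj₁ (∈-loops (k ∸ 1) q)) (sym (proj₂ (∈-loops (k ∸ 1) q)))
        ... | i , just e , q , _ = ⊥-elim (none q)
        first : (i₀ , i₀) L.∈ arcs s
        first = head l₀ refl
          where
          head : ∀ l → l ≡ l₀ → (i₀ , i₀) L.∈ arcs s
          head nothing refl = ∈-++⁺ˡ (loop-∈ i₀)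
          head (just e) refl = ⊥-elim (none (here refl))
        all : ∀ {p} → p L.∈ s → p ≡ (i₀ , nothing)
        all {i , just e} p = ⊥-elim (none p)
        all {i , nothing} p = cong (_, nothing) (circuits-connected _≟_ (_≡ i₀) (arcs s) circ
          (λ q u≡ → trans (sym (closed q)) u≡) (λ q w≡ → trans (closed q) w≡) first refl (arc-∈ s p (loop-∈ i)))
      go (e ∷ es) eq = edged e same (vertex-once (edgesOf s) short′ _ divisible e∈) inside
        where
        e∈ : e L.∈ edgesOf s
        e∈ = subst (e L.∈_) (sym eq) (here refl)
        same : ∀ {i f} → (i , just f) L.∈ s → f ≡ e
        same p = edges-equal (edgesOf s) short′ _ divisible (∈-edgesOf⁺ s p) e∈
        both : ∀ {u w} → (u , w) L.∈ arcs s → u ≡ w ⊎ (u ∈ edge e × w ∈ edge e)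
        both p with arc-∈⁻ s p
        ... | i , nothing , _ , q = inj₁ (trans (proj₁ (∈-loops (k ∸ 1) q)) (sym (proj₂ (∈-loops (k ∸ 1) q))))
        ... | i , just f , q , r with same q | ∈-map⁻ (i ,_) r
        ... | refl | y , y∈ , refl = inj₂ (valid q , ∈-els⁻ (proj₁ (∈-filter⁻ (¬? ∘ (i ≟_)) y∈)))
        inside : ∀ {i} → (i , nothing) L.∈ s → i ∈ edge e
        inside {i} p with ∈-edgesOf⁻ s e∈
        ... | j , q with star-∈ (valid q)
        ... | w , r = circuits-connected _≟_ (_∈ edge e) (arcs s) circ
          (λ t u∈ → case both t of λ { (inj₁ refl) → u∈ ; (inj₂ (_ , w∈)) → w∈ })
          (λ t w∈ → case both t of λ { (inj₁ refl) → w∈ ; (inj₂ (u∈ , _)) → u∈ })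
          (arc-∈ s q r) (valid q) (arc-∈ s p (loop-∈ i))
          where open import Function using (case_of_)

-- Counting the arrangements of a choice, and multisets.

module PickCounting where

  open BigOperators
  open ClosedWalks
  open TraceExpansion
  open import Algebra.Bundles using (CommutativeSemiring)
  open import Data.Empty using (⊥-elim)
  open import Data.Fin using (Fin)
  open import Data.Fin.Properties using (_≟_)
  open import Data.List using (List; []; _∷_; _++_; map; length; replicate; allFin; concatMap; filter)
  open import Data.List.Properties using (length-++; ∷-injectiveʳ)
  open import Data.List.Membership.Propositional using (_∈_; _∉_)
  open import Data.List.Membership.Propositional.Properties using (∈-++⁺ˡ; ∈-++⁺ʳ; ∈-++⁻; ∈-map⁺; ∈-map⁻; ∈-allFin; ∈-cartesianProductWith⁻)
  open import Data.List.Relation.Binary.Permutation.Propositional as ↭ using (_↭_; ↭-sym; ↭-trans; ↭-reflexive)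
  open import Data.List.Relation.Binary.Permutation.Propositional.Properties using (∈-resp-↭; drop-∷; ++⁺; filter-↭; ↭-length)
  open import Data.List.Relation.Unary.All as All using (All; []; _∷_)
  import Data.List.Relation.Unary.All.Properties as All
  open import Data.List.Relation.Unary.AllPairs using ([]; _∷_)
  open import Data.List.Relation.Unary.Any using (here; there)
  open import Data.List.Relation.Unary.Unique.Propositional using (Unique)
  import Data.List.Relation.Unary.Unique.Propositional.Properties as Unique
  open import Data.Maybe using (Maybe; just; nothing)
  open import Data.Nat as ℕ using (ℕ; zero; suc; _+_; _*_)
  import Data.Nat.Properties as ℕ
  open import Data.Product as × using (∃-syntax; _×_; _,_; proj₁; proj₂)
  open import Data.Sum using (inj₁; inj₂)
  open import Function using (_∘_; case_of_)
  open import Relation.Binary.Definitions using (DecidableEquality)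
  open import Relation.Binary.PropositionalEquality as ≡ using (_≡_; _≢_; refl; sym; trans; cong; cong₂)
  open import Relation.Nullary using (¬_; yes; no; ¬?)
  open ℕΣ

  module Counts {a} {A : Set a} (_≟_ : DecidableEquality A) where

    count : A → List A → ℕ
    count x xs = ⅀ xs λ y → 𝟙 (y ≟ x)

    count≢0 : ∀ {x} xs → count x xs ≢ 0 → x ∈ xs
    count≢0 {x} xs ne with ⅀≢0 _ xs ne
    ... | y , y∈ , ne′ with y ≟ x
    ... | yes refl = y∈
    ... | no _ = ⊥-elim (ne′ refl)

    ∈⇒count≢0 : ∀ {x xs} → x ∈ xs → count x xs ≢ 0
    ∈⇒count≢0 {x} {xs} x∈ eq = ℕ.1+n≰n (ℕ.≤-trans
      (ℕ.≤-reflexive (sym (𝟙-yes (x ≟ x) refl))) (ℕ.≤-trans (∈⇒≤⅀ (λ y → 𝟙 (y ≟ x)) x∈) (ℕ.≤-reflexive eq)))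

    ∉⇒count≡0 : ∀ {x xs} → x ∉ xs → count x xs ≡ 0
    ∉⇒count≡0 {x} {xs} x∉ = ⅀-0 xs λ y y∈ → 𝟙-no (y ≟ x) λ { refl → x∉ y∈ }

    count-↭ : ∀ {x xs ys} → xs ↭ ys → count x xs ≡ count x ys
    count-↭ = ⅀-↭ _

    -- Permutations of concatenated lists are obtained from this criterion, since multiplicities add
    -- up and can be computed piece by piece.
    count⇒↭ : ∀ xs ys → (∀ x → count x xs ≡ count x ys) → xs ↭ ys
    count⇒↭ [] [] h = ↭.refl
    count⇒↭ [] (y ∷ ys) h = ⊥-elim (∈⇒count≢0 {y} {y ∷ ys} (here refl) (sym (h y)))
    count⇒↭ (x ∷ xs) ys h with ∈⇒↭ (count≢0 ys (λ eq → ∈⇒count≢0 {x} {x ∷ xs} (here refl) (trans (h x) eq)))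
    ... | ys′ , p = ↭-trans (↭.prep x (count⇒↭ xs ys′ λ y →
            ℕ.+-cancelˡ-≡ (𝟙 (x ≟ y)) _ _ (trans (h y) (count-↭ p)))) (↭-sym p)

  module _ (n : ℕ) {x} {Λ : Set x} (ls : List Λ) where

    spell-at : ∀ (i : Fin n) r {s} → s ∈ spell ls i r → All ((_≡ i) ∘ proj₁) s
    spell-at i zero (here refl) = []
    spell-at i (suc r) s∈ with ∈-cartesianProductWith⁻ (λ l s → (i , l) ∷ s) ls (spell ls i r) s∈
    ... | l , s , _ , s∈′ , refl = refl ∷ spell-at i r s∈′

    length-spell : ∀ (i : Fin n) r {s} → s ∈ spell ls i r → length s ≡ r
    length-spell i zero (here refl) = refl
    length-spell i (suc r) s∈ with ∈-cartesianProductWith⁻ (λ l s → (i , l) ∷ s) ls (spell ls i r) s∈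
    ... | l , s , _ , s∈′ , refl = cong suc (length-spell i r s∈′)

    choices-at : ∀ (d : Fin n → ℕ) is {s} → s ∈ choices ls d is → All ((_∈ is) ∘ proj₁) s
    choices-at d [] (here refl) = []
    choices-at d (i ∷ is) s∈ with ∈-cartesianProductWith⁻ _++_ (spell ls i (d i)) (choices ls d is) s∈
    ... | w , t , w∈ , t∈ , refl = All.++⁺ (All.map here (spell-at i (d i) w∈)) (All.map there (choices-at d is t∈))

    count-spell : ∀ (i : Fin n) r {s} j → s ∈ spell ls i r → ⅀ s (λ p → 𝟙 (proj₁ p ≟ j)) ≡ 𝟙 (i ≟ j) * r
    count-spell i r {s} j s∈ = trans
      (⅀-cong∈ s (λ p p∈ → cong (λ y → 𝟙 (y ≟ j)) (All.lookup (spell-at i r s∈) p∈)))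
      (trans (⅀-const (𝟙 (i ≟ j)) s) (trans (cong (_* 𝟙 (i ≟ j)) (length-spell i r s∈)) (ℕ.*-comm r _)))

    count-choices′ : ∀ (d : Fin n → ℕ) is {s} j → s ∈ choices ls d is →
                     ⅀ s (λ p → 𝟙 (proj₁ p ≟ j)) ≡ ⅀ is (λ i → 𝟙 (i ≟ j) * d i)
    count-choices′ d [] j (here refl) = refl
    count-choices′ d (i ∷ is) j s∈ with ∈-cartesianProductWith⁻ _++_ (spell ls i (d i)) (choices ls d is) s∈
    ... | w , t , w∈ , t∈ , refl = trans (⅀-++ _ w t) (cong₂ _+_ (count-spell i (d i) j w∈) (count-choices′ d is j t∈))

    count-choices : ∀ (d : Fin n → ℕ) {s} j → s ∈ choices ls d (allFin n) → ⅀ s (λ p → 𝟙 (proj₁ p ≟ j)) ≡ d j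
    count-choices d j s∈ = trans (count-choices′ d (allFin n) j s∈)
      (trans (⅀-single _ (Unique.allFin⁺ n) (∈-allFin j) (λ {i} _ i≢j → cong (_* d i) (𝟙-no (i ≟ j) i≢j)))
        (trans (cong (_* d j) (𝟙-yes (j ≟ j) refl)) (ℕ.*-identityˡ (d j))))

    length-choices : ∀ (d : Fin n → ℕ) is {s} → s ∈ choices ls d is → length s ≡ ⅀ is d
    length-choices d [] (here refl) = refl
    length-choices d (i ∷ is) s∈ with ∈-cartesianProductWith⁻ _++_ (spell ls i (d i)) (choices ls d is) s∈
    ... | w , t , w∈ , t∈ , refl = trans (length-++ w) (cong₂ _+_ (length-spell i (d i) w∈) (length-choices d is t∈))

    split-↭ : ∀ i {w w′ t t′ : List (Fin n × Λ)} → All ((_≡ i) ∘ proj₁) w → All ((_≡ i) ∘ proj₁) w′ →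
              All ((_≢ i) ∘ proj₁) t → All ((_≢ i) ∘ proj₁) t′ → w ++ t ↭ w′ ++ t′ → w ↭ w′ × t ↭ t′
    split-↭ i {w} {w′} {t} {t′} aw aw′ at at′ p =
        ↭-trans (↭-reflexive (sym (keep at? aw at))) (↭-trans (filter-↭ at? p) (↭-reflexive (keep at? aw′ at′)))
      , ↭-trans (↭-reflexive (sym (drop′ (¬? ∘ at?) aw at))) (↭-trans (filter-↭ (¬? ∘ at?) p) (↭-reflexive (drop′ (¬? ∘ at?) aw′ at′)))
      where
      open import Data.List.Properties using (filter-++; filter-all; filter-none; ++-identityʳ)
      open import Relation.Unary using (Decidable)
      at? : Decidable {A = Fin n × Λ} ((_≡ i) ∘ proj₁)
      at? q = proj₁ q ≟ i
      keep : ∀ {w t : List (Fin n × Λ)} (P? : Decidable ((_≡ i) ∘ proj₁)) → All ((_≡ i) ∘ proj₁) w → All ((_≢ i) ∘ proj₁) t → filter P? (w ++ t) ≡ w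
      keep {w} {t} P? aw at = trans (filter-++ P? w t) (trans (cong₂ _++_ (filter-all P? aw) (filter-none P? at)) (++-identityʳ w))
      drop′ : ∀ {w t : List (Fin n × Λ)} (P? : Decidable ((_≢ i) ∘ proj₁)) → All ((_≡ i) ∘ proj₁) w → All ((_≢ i) ∘ proj₁) t → filter P? (w ++ t) ≡ t
      drop′ {w} {t} P? aw at = trans (filter-++ P? w t) (cong₂ _++_ (filter-none P? (All.map (λ eq ne → ne eq) aw)) (filter-all P? at))

    module Arrangements {c ℓ} (R : CommutativeSemiring c ℓ) where
      open CommutativeSemiring R using (Carrier; _≈_; 0#) renaming (_*_ to _*ᴿ_)
      private module R = CommutativeSemiring R
      private module S = Sums R

      -- The form of the summands to come: weight and circuit count see a choice only up to
      -- permutation, and for given exponents at most one multiset of entries contributes.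
      Concentrated : List (List (Fin n × Λ)) → List (Fin n × Λ) → (List (Fin n × Λ) → Carrier) → Carrier → Set _
      Concentrated ss s* f x = (∀ {s} → s ∈ ss → s ↭ s* → f s ≈ x) × (∀ {s} → s ∈ ss → ¬ (s ↭ s*) → f s ≈ 0#)

      -- To rearrange a choice is to rearrange the word at each vertex separately, so the number of
      -- admissible arrangements is the product of the numbers `N i`.
      ⅀-choices : ∀ (d : Fin n → ℕ) (w* : Fin n → List (Fin n × Λ)) (N : Fin n → Carrier) is → Unique is →
        (∀ i → All ((_≡ i) ∘ proj₁) (w* i)) →
        (∀ i f x → Concentrated (spell ls i (d i)) (w* i) f x → S.⅀ (spell ls i (d i)) f ≈ N i *ᴿ x) →
        ∀ f x → Concentrated (choices ls d is) (concatMap w* is) f x →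
        S.⅀ (choices ls d is) f ≈ S.∏ is N *ᴿ x
      ⅀-choices d w* N [] u at total f x (on , off) =
        R.trans (R.+-identityʳ _) (R.trans (on (here refl) ↭.refl) (R.sym (R.*-identityˡ x)))
      ⅀-choices d w* N (i ∷ is) (i∉ ∷ u) at total f x (on , off) =
        R.trans (S.⅀-cartesian f _++_ (spell ls i (d i)) (choices ls d is))
          (R.trans (total i _ (S.∏ is N *ᴿ x)
            ( (λ {w} w∈ w↭ → ⅀-choices d w* N is u at total _ x
                ( (λ t∈ t↭ → on (mem w∈ t∈) (++⁺ w↭ t↭))
                , (λ t∈ ¬t↭ → off (mem w∈ t∈) (λ p → ¬t↭ (proj₂ (split w∈ t∈ p))))))
            , (λ {w} w∈ ¬w↭ → S.⅀-0 (choices ls d is) λ t t∈ → off (mem w∈ t∈) (λ p → ¬w↭ (proj₁ (split w∈ t∈ p))))))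
          (R.sym (R.*-assoc _ _ _)))
        where
        open import Data.List.Membership.Propositional.Properties using (∈-cartesianProductWith⁺)
        mem : ∀ {w t} → w ∈ spell ls i (d i) → t ∈ choices ls d is → w ++ t ∈ choices ls d (i ∷ is)
        mem = ∈-cartesianProductWith⁺ _++_
        away : ∀ {j} → j ∈ is → j ≢ i
        away j∈ refl = All.lookup i∉ j∈ refl
        rest : ∀ is → (∀ {j} → j ∈ is → j ≢ i) → All ((_≢ i) ∘ proj₁) (concatMap w* is)
        rest [] _ = []
        rest (j ∷ is) ne = All.++⁺ (All.map (λ { refl → ne (here refl) }) (at j)) (rest is (ne ∘ there))
        split : ∀ {w t} → w ∈ spell ls i (d i) → t ∈ choices ls d is →
                w ++ t ↭ w* i ++ concatMap w* is → w ↭ w* i × t ↭ concatMap w* is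
        split w∈ t∈ = split-↭ i (spell-at i (d i) w∈) (at i) (All.map away (choices-at d is t∈)) (rest is away)

  module SpellCounts {c ℓ} (R : CommutativeSemiring c ℓ) {n : ℕ} {y} {E : Set y} (es : List E) (unique : Unique es) where
    open CommutativeSemiring R using (Carrier; _≈_; 0#; 1#) renaming (_*_ to _*ᴿ_; _+_ to _+ᴿ_)
    private module R = CommutativeSemiring R
    private module S = Sums R
    private
      ls : List (Maybe E)
      ls = nothing ∷ map just es
    open Arrangements n ls R

    private
      expand : ∀ (i : Fin n) r f → S.⅀ (spell ls i (suc r)) f ≈
        S.⅀ (spell ls i r) (λ w → f ((i , nothing) ∷ w)) +ᴿ S.⅀ es (λ e → S.⅀ (spell ls i r) (λ w → f ((i , just e) ∷ w)))
      expand i r f = R.trans (S.⅀-cartesian f _ ls (spell ls i r)) (R.+-congˡ (R.reflexive (S.⅀-map _ just es)))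
      cons∈ : ∀ {i : Fin n} {r l w} → l ∈ ls → w ∈ spell ls i r → (i , l) ∷ w ∈ spell ls i (suc r)
      cons∈ = ∈-cartesianProductWith⁺ _
        where open import Data.List.Membership.Propositional.Properties using (∈-cartesianProductWith⁺)
      no-just : ∀ {i : Fin n} {e : E} {r} → (i , just e) ∉ replicate r (i , nothing)
      no-just {r = suc r} (there p) = no-just {r = r} p

    ⅀-spell-loops : ∀ i r f x → Concentrated (spell ls i r) (replicate r (i , nothing)) f x →
                    S.⅀ (spell ls i r) f ≈ x
    ⅀-spell-loops i zero f x (on , off) = R.trans (R.+-identityʳ _) (on (here refl) ↭.refl)
    ⅀-spell-loops i (suc r) f x (on , off) = R.trans (expand i r f) (R.trans (R.+-cong
      (⅀-spell-loops i r _ x ((λ w∈ p → on (cons∈ {r = r} (here refl) w∈) (↭.prep _ p)) , (λ w∈ ¬p → off (cons∈ {r = r} (here refl) w∈) (¬p ∘ drop-∷))))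
      (S.⅀-0 es (λ e e∈ → S.⅀-0 (spell ls i r) (λ w w∈ → off (cons∈ {r = r} (there (∈-map⁺ just e∈)) w∈)
        (λ p → no-just {r = suc r} (∈-resp-↭ p (here refl))))))) (R.+-identityʳ x))

    -- The hyperedge letter may stand at any of r + 1 places among the `r` loops. This factor is
    -- written as a sum of ones because the semiring is arbitrary.
    ⅀-spell-edge : ∀ i {e} → e ∈ es → ∀ r f x → Concentrated (spell ls i (suc r)) ((i , just e) ∷ replicate r (i , nothing)) f x →
                   S.⅀ (spell ls i (suc r)) f ≈ S.⅀ (replicate (suc r) 1#) (λ y → y) *ᴿ x
    ⅀-spell-edge i {e} e∈ r f x (on , off) = R.trans (expand i r f) (R.trans (R.+-comm _ _) (R.trans
      (R.+-cong (R.trans (S.⅀-single _ unique e∈ (λ {g} g∈ g≢e → S.⅀-0 (spell ls i r) λ w w∈ →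
          off (cons∈ {r = r} (there (∈-map⁺ just g∈)) w∈) (λ p → case ∈-resp-↭ p (here refl) of λ
            { (here refl) → g≢e refl ; (there q) → no-just {r = r} q })))
        (⅀-spell-loops i r _ x ((λ w∈ p → on (cons∈ {r = r} (there (∈-map⁺ just e∈)) w∈) (↭.prep _ p)) , (λ w∈ ¬p → off (cons∈ {r = r} (there (∈-map⁺ just e∈)) w∈) (¬p ∘ drop-∷)))))
        (tail r on off)) (R.sym (R.trans (R.distribʳ x _ _) (R.+-congʳ (R.*-identityˡ x))))))
      where
      tail : ∀ r → (∀ {s} → s ∈ spell ls i (suc r) → s ↭ (i , just e) ∷ replicate r (i , nothing) → f s ≈ x) →
             (∀ {s} → s ∈ spell ls i (suc r) → ¬ (s ↭ (i , just e) ∷ replicate r (i , nothing)) → f s ≈ 0#) →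
             S.⅀ (spell ls i r) (λ w → f ((i , nothing) ∷ w)) ≈ S.⅀ (replicate r 1#) (λ y → y) *ᴿ x
      tail zero on off = R.trans (S.⅀-0 (spell ls i 0) (λ w w∈ → off (cons∈ {r = 0} (here refl) w∈) (λ p → case ∈-resp-↭ p (here refl) of λ { (here ()) ; (there ()) })))
        (R.sym (R.zeroˡ x))
      tail (suc r) on off = ⅀-spell-edge i e∈ r _ x
        ( (λ w∈ p → on (cons∈ {r = suc r} (here refl) w∈) (↭-trans (↭.prep _ p) (↭.swap _ _ ↭.refl)))
        , (λ w∈ ¬p → off (cons∈ {r = suc r} (here refl) w∈) (λ p → ¬p (drop-∷ (↭-trans p (↭.swap _ _ ↭.refl))))))

  -- Every multiset has one representative, with its members in the order of `ys`: the first part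
  -- uses `y` once more, the second has done with `y`.
  msets : ∀ {a} {A : Set a} → ℕ → List A → List (List A)
  msets zero    ys       = [] ∷ []
  msets (suc j) []       = []
  msets (suc j) (y ∷ ys) = map (y ∷_) (msets j (y ∷ ys)) ++ msets (suc j) ys

  module _ {a} {A : Set a} where

    length-msets : ∀ j (ys : List A) {ls} → ls ∈ msets j ys → length ls ≡ j
    length-msets zero ys (here refl) = refl
    length-msets (suc j) (y ∷ ys) p with ∈-++⁻ (map (y ∷_) (msets j (y ∷ ys))) p
    ... | inj₂ q = length-msets (suc j) ys q
    ... | inj₁ q with ∈-map⁻ (y ∷_) q
    ... | ls , r , refl = cong suc (length-msets j (y ∷ ys) r)

    msets-⊆ : ∀ j (ys : List A) {ls x} → ls ∈ msets j ys → x ∈ ls → x ∈ ys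
    msets-⊆ zero ys (here refl) ()
    msets-⊆ (suc j) (y ∷ ys) p x∈ with ∈-++⁻ (map (y ∷_) (msets j (y ∷ ys))) p
    ... | inj₂ q = there (msets-⊆ (suc j) ys q x∈)
    ... | inj₁ q with ∈-map⁻ (y ∷_) q | x∈
    ... | ls , r , refl | here refl = here refl
    ... | ls , r , refl | there x∈′ = msets-⊆ j (y ∷ ys) r x∈′

    -- The two branches of `msets` call for an outer induction on `ys` and an inner one on the size.
    msets-complete : DecidableEquality A → ∀ (ys ls : List A) → (∀ {x} → x ∈ ls → x ∈ ys) →
                     ∃[ ls′ ] ls′ ∈ msets (length ls) ys × ls′ ↭ ls
    msets-complete _≟_ ys ls sub = go ys (length ls) ls refl sub
      where
      open import Data.List.Membership.DecPropositional _≟_ using (_∈?_)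
      Completes : List A → Set _
      Completes ys = ∀ j ls → length ls ≡ j → (∀ {x} → x ∈ ls → x ∈ ys) → ∃[ ls′ ] ls′ ∈ msets j ys × ls′ ↭ ls
      cons : ∀ y ys → Completes ys → Completes (y ∷ ys)
      cons y ys ih zero [] _ sub = [] , here refl , ↭.refl
      cons y ys ih (suc j) ls len sub with y ∈? ls
      ... | yes y∈ = let ls₁ , p = ∈⇒↭ y∈
                         ls₂ , q , r = cons y ys ih j ls₁ (ℕ.suc-injective (trans (sym (↭-length p)) len)) (sub ∘ ∈-resp-↭ (↭-sym p) ∘ there)
                     in y ∷ ls₂ , ∈-++⁺ˡ (∈-map⁺ (y ∷_) q) , ↭-trans (↭.prep y r) (↭-sym p)
      ... | no y∉ = let ls₂ , q , r = ih (suc j) ls len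
                          (λ {x} x∈ → case sub x∈ of λ { (here refl) → ⊥-elim (y∉ x∈) ; (there x∈′) → x∈′ })
                    in ls₂ , ∈-++⁺ʳ (map (y ∷_) (msets j (y ∷ ys))) q , r
      go : ∀ ys → Completes ys
      go [] zero [] _ sub = [] , here refl , ↭.refl
      go [] (suc j) (l ∷ ls) _ sub = case sub (here refl) of λ ()
      go (y ∷ ys) = cons y ys (go ys)

    msets-injective : ∀ j {ys ls ls′ : List A} → Unique ys → ls ∈ msets j ys → ls′ ∈ msets j ys → ls ↭ ls′ → ls ≡ ls′
    msets-injective zero u (here refl) (here refl) p = refl
    msets-injective (suc j) {y ∷ ys} uy@(y∉ ∷ u) p q r
      with ∈-++⁻ (map (y ∷_) (msets j (y ∷ ys))) p | ∈-++⁻ (map (y ∷_) (msets j (y ∷ ys))) q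
    ... | inj₂ p′ | inj₂ q′ = msets-injective (suc j) u p′ q′ r
    ... | inj₁ p′ | inj₂ q′ with ∈-map⁻ (y ∷_) p′
    ... | _ , _ , refl = ⊥-elim (All.lookup y∉ (msets-⊆ (suc j) ys q′ (∈-resp-↭ r (here refl))) refl)
    msets-injective (suc j) {y ∷ ys} uy@(y∉ ∷ u) p q r | inj₂ p′ | inj₁ q′ with ∈-map⁻ (y ∷_) q′
    ... | _ , _ , refl = ⊥-elim (All.lookup y∉ (msets-⊆ (suc j) ys p′ (∈-resp-↭ (↭-sym r) (here refl))) refl)
    msets-injective (suc j) {y ∷ ys} uy@(y∉ ∷ u) p q r | inj₁ p′ | inj₁ q′ with ∈-map⁻ (y ∷_) p′ | ∈-map⁻ (y ∷_) q′
    ... | _ , p″ , refl | _ , q″ , refl = cong (y ∷_) (msets-injective j uy p″ q″ (drop-∷ r))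

    msets-unique : ∀ j {ys : List A} → Unique ys → Unique (msets j ys)
    msets-unique zero u = [] ∷ []
    msets-unique (suc j) {[]} u = []
    msets-unique (suc j) {y ∷ ys} uy@(y∉ ∷ u) = Unique.++⁺ (Unique.map⁺ ∷-injectiveʳ (msets-unique j uy)) (msets-unique (suc j) u) disjoint
      where
      disjoint : ∀ {ls} → ¬ (ls ∈ map (y ∷_) (msets j (y ∷ ys)) × ls ∈ msets (suc j) ys)
      disjoint (p , q) with ∈-map⁻ (y ∷_) p
      ... | _ , _ , refl = All.lookup y∉ (msets-⊆ (suc j) ys q (here refl)) refl

  Unique-map∈ : ∀ {a b} {A : Set a} {B : Set b} (f : A → B) {xs} → Unique xs →
                (∀ {x y} → x ∈ xs → y ∈ xs → f x ≡ f y → x ≡ y) → Unique (map f xs)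
  Unique-map∈ f {[]} u inj = []
  Unique-map∈ f {x ∷ xs} (x∉ ∷ u) inj =
    All.tabulate (λ fy∈ eq → case ∈-map⁻ f fy∈ of λ { (y , y∈ , refl) → All.lookup x∉ y∈ (inj (here refl) (there y∈) eq) })
    ∷ Unique-map∈ f u (λ p q → inj (there p) (there q))

-- Euler tours and the coefficients attached to a hyperedge.

module EdgeConstants where

  open BigOperators
  open ClosedWalks
  open TraceFunctionals
  open SubsetLists
  open PickCounting
  open import Algebra.Bundles using (CommutativeRing)
  open import Data.Empty using (⊥-elim)
  open import Data.Fin as Fin using (Fin)
  open import Data.Fin.Properties using (_≟_)
  open import Data.List using (List; []; _∷_; _++_; map; length; replicate; allFin; concatMap; filter; lookup; tabulate)
  open import Data.List.Properties using (concatMap-map; filter-≐; filter-all; filter-accept; filter-reject; map-tabulate; tabulate-lookup; map-++; map-replicate; map-∘)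
  open import Data.List.Membership.Propositional using (_∈_)
  open import Data.List.Relation.Binary.Permutation.Propositional as ↭ using (_↭_; ↭-sym; ↭-trans; ↭-reflexive)
  open import Data.List.Relation.Binary.Permutation.Propositional.Properties using (∈-resp-↭; ++⁺; ++⁺ʳ; ++⁺ˡ; filter-↭; ↭-length; ++-comm; shift; shifts)
  open import Data.List.Relation.Unary.All as All using (All; []; _∷_)
  open import Data.List.Relation.Unary.AllPairs using ([]; _∷_)
  open import Data.List.Relation.Unary.Any using (here; there)
  open import Data.List.Relation.Unary.Unique.Propositional using (Unique)
  import Data.List.Relation.Unary.Unique.Propositional.Properties as Unique
  open import Data.Nat as ℕ using (ℕ; zero; suc; _∸_; _!)
  import Data.Nat.Properties as ℕ
  open import Data.Product as × using (∃-syntax; _×_; _,_; proj₁; proj₂)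
  import Data.Product.Properties as ×ₚ
  open import Data.Sum using (inj₁; inj₂)
  open import Function using (_∘_)
  open import Relation.Binary.PropositionalEquality as ≡ using (_≡_; _≢_; refl; sym; trans; cong; cong₂; subst)
  open import Relation.Nullary using (¬?)

  module _ {n : ℕ} where
    open ℕΣ
    private
      module CA = Counts {A = Fin n × Fin n} (×ₚ.≡-dec _≟_ _≟_)

    -- The complete digraph on `ys`, as a union of stars: these are the arcs when a hyperedge is
    -- chosen once at each of its vertices.
    starsOf : List (Fin n) → List (Fin n × Fin n)
    starsOf ys = concatMap (λ y → map (y ,_) (filter (¬? ∘ (y ≟_)) ys)) ys

    loopsOf : ℕ → List (Fin n) → List (Fin n × Fin n)
    loopsOf k ls = concatMap (λ l → replicate (k ∸ 1) (l , l)) ls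

    kArcs : ℕ → List (Fin n) → List (Fin n) → List (Fin n × Fin n)
    kArcs k ys ls = starsOf ys ++ loopsOf k ls

    concatMap-↭ : ∀ {a} {A : Set a} {f g : A → List (Fin n × Fin n)} {xs ys} → (∀ x → f x ↭ g x) → xs ↭ ys →
                  concatMap f xs ↭ concatMap g ys
    concatMap-↭ {f = f} {g} {xs} {ys} e p = CA.count⇒↭ _ _ λ z →
      trans (⅀-concatMap _ f xs) (trans (⅀-↭ _ p) (trans (⅀-cong ys (λ x → CA.count-↭ (e x))) (sym (⅀-concatMap _ g ys))))

    kArcs-↭ : ∀ k {ys ys′ ls ls′} → ys ↭ ys′ → ls ↭ ls′ → kArcs k ys ls ↭ kArcs k ys′ ls′
    kArcs-↭ k p q = ++⁺ (concatMap-↭ (λ y → map⁺ (y ,_) (filter-↭ (¬? ∘ (y ≟_)) p)) p) (concatMap-↭ (λ _ → ↭.refl) q)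
      where open import Data.List.Relation.Binary.Permutation.Propositional.Properties using (map⁺)

    Eulerian : Fin n → List (Fin n × Fin n) → Set
    Eulerian v L = ∃[ L′ ] L ↭ L′ × IsWalk v v L′

    Eulerian-↭ : ∀ {v L L′} → L ↭ L′ → Eulerian v L′ → Eulerian v L
    Eulerian-↭ p (L″ , q , w) = L″ , ↭-trans p q , w

    Eulerian-++ : ∀ {v L M} → Eulerian v L → Eulerian v M → Eulerian v (L ++ M)
    Eulerian-++ (L′ , p , w) (M′ , q , x) = L′ ++ M′ , ++⁺ p q , w ++ʷ x

    -- The tour at `u` is inserted between the arc that goes there and the arc that comes back.
    Eulerian-detour : ∀ {v u L} → Eulerian u L → Eulerian v ((v , u) ∷ (u , v) ∷ L)
    Eulerian-detour {v} {u} {L} (L′ , p , w) = (v , u) ∷ L′ ++ (u , v) ∷ [] ,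
      ↭.prep _ (↭-trans (↭.prep _ p) (↭-sym (↭-trans (shift (u , v) L′ []) (↭-reflexive (cong ((u , v) ∷_) (++-identityʳ L′)))))) ,
      v ∷ (w ++ʷ (u ∷ []))
      where open import Data.List.Properties using (++-identityʳ)

    Eulerian-loops : ∀ v p → Eulerian v (replicate p (v , v))
    Eulerian-loops v p = _ , ↭.refl , go p
      where
      go : ∀ p → IsWalk v v (replicate p (v , v))
      go zero = []
      go (suc p) = v ∷ go p

    Eulerian-both : ∀ v ws → Eulerian v (map (v ,_) ws ++ map (_, v) ws)
    Eulerian-both v [] = [] , ↭.refl , []
    Eulerian-both v (w ∷ ws) = Eulerian-↭ (↭.prep _ (shift (w , v) (map (v ,_) ws) (map (_, v) ws)))
      (Eulerian-++ {L = (v , w) ∷ (w , v) ∷ []} (Eulerian-detour ([] , ↭.refl , [])) (Eulerian-both v ws))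

    starsOf-∷ : ∀ {y ys} → Unique (y ∷ ys) → starsOf (y ∷ ys) ↭ (map (y ,_) ys ++ map (_, y) ys) ++ starsOf ys
    starsOf-∷ {y} {ys} (y∉ ∷ u) = ↭-trans (++⁺ (↭-reflexive (cong (map (y ,_)) first)) rest)
      (↭-reflexive (sym (++-assoc (map (y ,_) ys) _ _)))
      where
      open import Data.List.Properties using (++-assoc)
      first : filter (¬? ∘ (y ≟_)) (y ∷ ys) ≡ ys
      first = trans (filter-reject (¬? ∘ (y ≟_)) (λ ne → ne refl)) (filter-all (¬? ∘ (y ≟_)) y∉)
      others′ : Fin n → List (Fin n × Fin n)
      others′ w = map (w ,_) (filter (¬? ∘ (w ≟_)) ys)
      step : ∀ w → w ∈ ys → map (w ,_) (filter (¬? ∘ (w ≟_)) (y ∷ ys)) ≡ (w , y) ∷ others′ w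
      step w w∈ = cong (map (w ,_)) (filter-accept (¬? ∘ (w ≟_)) (λ { refl → All.lookup y∉ w∈ refl }))
      rest : concatMap (λ w → map (w ,_) (filter (¬? ∘ (w ≟_)) (y ∷ ys))) ys ↭ map (_, y) ys ++ starsOf ys
      rest = CA.count⇒↭ _ _ λ z → trans (⅀-concatMap _ _ ys) (trans
        (⅀-cong∈ ys (λ w w∈ → cong (CA.count z) (step w w∈)))
        (trans (⅀-+ (λ w → 𝟙 (×ₚ.≡-dec _≟_ _≟_ (w , y) z)) (CA.count z ∘ others′) ys)
          (sym (trans (⅀-++ _ (map (_, y) ys) (starsOf ys))
            (cong₂ ℕ._+_ (⅀-map _ (_, y) ys) (⅀-concatMap _ others′ ys))))))

    -- From `y` go to `w`, tour the complete digraph on the remaining vertices from there, return,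
    -- and visit each other vertex by going there and straight back.
    Eulerian-starsOf : ∀ {y ys} → Unique (y ∷ ys) → Eulerian y (starsOf (y ∷ ys))
    Eulerian-starsOf {y} {[]} u = Eulerian-↭ (starsOf-∷ u) ([] , ↭.refl , [])
    Eulerian-starsOf {y} {w ∷ ws} (y∉ ∷ u) = Eulerian-↭
      (↭-trans (starsOf-∷ (y∉ ∷ u)) (↭-trans (++⁺ʳ (starsOf (w ∷ ws)) (↭.prep _ (shift (w , y) (map (y ,_) ws) (map (_, y) ws))))
        (↭.prep _ (↭.prep _ (++-comm (map (y ,_) ws ++ map (_, y) ws) (starsOf (w ∷ ws)))))))
      (Eulerian-++ {L = (y , w) ∷ (w , y) ∷ starsOf (w ∷ ws)} (Eulerian-detour (Eulerian-starsOf u)) (Eulerian-both y ws))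

    -- The tour of the complete digraph again, with the loops at `y` run through at the start and
    -- those at `w` during the stay there.
    Eulerian-kArcs : ∀ k {y w ws} → Unique (y ∷ w ∷ ws) → Eulerian y (kArcs k (y ∷ w ∷ ws) (y ∷ w ∷ []))
    Eulerian-kArcs k {y} {w} {ws} (y∉ ∷ u) = Eulerian-↭ perm
      (Eulerian-++ (Eulerian-loops y (k ∸ 1)) (Eulerian-++ {L = (y , w) ∷ (w , y) ∷ starsOf (w ∷ ws) ++ replicate (k ∸ 1) (w , w)}
        (Eulerian-detour (Eulerian-++ (Eulerian-starsOf u) (Eulerian-loops w (k ∸ 1)))) (Eulerian-both y ws)))
      where
      B = map (y ,_) ws ++ map (_, y) ws
      S = starsOf (w ∷ ws)
      Ly = replicate (k ∸ 1) (y , y)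
      Lw = replicate (k ∸ 1) (w , w)
      open import Data.List.Properties using (++-assoc; ++-identityʳ)
      perm : starsOf (y ∷ w ∷ ws) ++ (Ly ++ (Lw ++ [])) ↭ Ly ++ ((y , w) ∷ (w , y) ∷ S ++ Lw) ++ B
      perm = ↭-trans (shifts (starsOf (y ∷ w ∷ ws)) Ly) (++⁺ˡ Ly (↭-trans
        (++⁺ (↭-trans (starsOf-∷ (y∉ ∷ u)) (++⁺ʳ S (↭.prep (y , w) (shift (w , y) (map (y ,_) ws) (map (_, y) ws))))) (↭-reflexive (++-identityʳ Lw)))
        (↭.prep _ (↭.prep _ (↭-trans (↭-reflexive (++-assoc B S Lw)) (++-comm B (S ++ Lw)))))))

    circ : ℕ → List (Fin n) → List (Fin n) → ℕ
    circ k ys ls = Walks.circuits _≟_ (kArcs k ys ls)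

  module _ {n n′ : ℕ} (f : Fin n → Fin n′) (f-inj : ∀ {x y} → f x ≡ f y → x ≡ y) where
    open ℕΣ

    private
      concatMap-arcs : ∀ {a} {A : Set a} {g : A → List (Fin n′ × Fin n′)} {h : A → List (Fin n × Fin n)} →
        ∀ xs → (∀ x → g x ≡ map (×.map f f) (h x)) → concatMap g xs ≡ map (×.map f f) (concatMap h xs)
      concatMap-arcs [] e = refl
      concatMap-arcs {h = h} (x ∷ xs) e = trans (cong₂ _++_ (e x) (concatMap-arcs xs e)) (sym (map-++ _ (h x) _))

    kArcs-map : ∀ k ys ls → kArcs k (map f ys) (map f ls) ≡ map (×.map f f) (kArcs k ys ls)
    kArcs-map k ys ls = trans (cong₂ _++_
      (trans (concatMap-map _ f ys) (concatMap-arcs ys star-map))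
      (trans (concatMap-map _ f ls) (concatMap-arcs ls (λ l → sym (map-replicate (×.map f f) (k ∸ 1) (l , l))))))
      (sym (map-++ _ (starsOf ys) _))
      where
      star-map : ∀ y → map (f y ,_) (filter (¬? ∘ (f y ≟_)) (map f ys)) ≡ map (×.map f f) (map (y ,_) (filter (¬? ∘ (y ≟_)) ys))
      star-map y = trans (cong (map (f y ,_)) (trans (filter-map (¬? ∘ (f y ≟_)) f ys) (cong (map f)
        (filter-≐ (¬? ∘ (f y ≟_) ∘ f) (¬? ∘ (y ≟_)) ((λ ne eq → ne (cong f eq)) , (λ ne eq → ne (f-inj eq))) ys))))
        (trans (sym (map-∘ (filter (¬? ∘ (y ≟_)) ys))) (map-∘ (filter (¬? ∘ (y ≟_)) ys)))

    circ-map : ∀ k ys ls → circ k (map f ys) (map f ls) ≡ circ k ys ls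
    circ-map k ys ls = trans (cong (Walks.circuits _≟_) (kArcs-map k ys ls))
      (circuits-map _≟_ _≟_ f f-inj (kArcs k ys ls))

    count-map : ∀ y ls → Counts.count _≟_ (f y) (map f ls) ≡ Counts.count _≟_ y ls
    count-map y ls = trans (⅀-map _ f ls) (⅀-cong ls (λ l → 𝟙-⇔ (f l ≟ f y) (l ≟ y) f-inj (cong f)))

  module Positivity {c ℓ₁ ℓ₂} (F : OrderedField c ℓ₁ ℓ₂) where
    open OrderedField F
    private module R = CommutativeRing commutativeRing
    open import Algebra.Apartness.Structures using (IsHeytingField)
    open IsHeytingField isHeytingField using (invertible⇒#)
    open import Relation.Binary using (IsStrictPartialOrder)
    open IsStrictPartialOrder isStrictPartialOrder using (irrefl)
    open import Algebra.Properties.Ring R.ring using (-0#≈0#; -‿distribʳ-*)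

    <-respʳ : ∀ {x y z} → y ≈ z → x < y → x < z
    <-respʳ = proj₁ <-resp-≈

    <-respˡ : ∀ {x y z} → y ≈ z → y < x → z < x
    <-respˡ = proj₂ <-resp-≈

    -- An inverse of a positive element is apart from 0, and cannot be negative.
    inverse-pos : ∀ {x y} → 0# < x → y * x ≈ 1# → 0# < y
    inverse-pos {x} {y} 0<x yx≈1 with invertible⇒# {y} {0#} (x , left , R.trans (R.*-comm _ _) left)
      where
      left : x * (y - 0#) ≈ 1#
      left = R.trans (R.*-congˡ (R.trans (R.+-congˡ -0#≈0#) (R.+-identityʳ y))) (R.trans (R.*-comm x y) yx≈1)
    ... | inj₂ 0<y = 0<y
    ... | inj₁ y<0 = ⊥-elim (irrefl R.refl (<-trans 0<1 1<0))
      where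
      0<-y : 0# < - y
      0<-y = <-respˡ (R.-‿inverseʳ y) (<-respʳ (R.+-identityˡ (- y)) (+-monoˡ-< (- y) y<0))
      0<-1 : 0# < - 1#
      0<-1 = <-respʳ (R.trans (R.sym (-‿distribʳ-* x y)) (R.-‿cong (R.trans (R.*-comm x y) yx≈1))) (*-pos 0<x 0<-y)
      1<0 : 1# < 0#
      1<0 = <-respˡ (R.+-identityˡ 1#) (<-respʳ (R.-‿inverseˡ 1#) (+-monoˡ-< 1# 0<-1))

    open Sums R.commutativeSemiring using (∏)

    ∏-pos : ∀ {a} {A : Set a} (f : A → Carrier) xs → (∀ x → 0# < f x) → 0# < ∏ xs f
    ∏-pos f [] h = 0<1
    ∏-pos f (x ∷ xs) h = *-pos (h x) (∏-pos f xs h)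

    *-fromℕ-mono-< : ∀ {x a b} → 0# < x → a ℕ.< b → x * fromℕ# a < x * fromℕ# b
    *-fromℕ-mono-< {x} {a} {b} 0<x a<b = <-respˡ (R.+-identityˡ _) (<-respʳ eq (+-monoˡ-< (x * fromℕ# a) (*-pos 0<x (fromℕ#-pos (b ∸ a) {{ℕ.>-nonZero (ℕ.m<n⇒0<n∸m a<b)}}))))
      where
      open Derivatives F using (ι-+)
      eq : x * fromℕ# (b ∸ a) + x * fromℕ# a ≈ x * fromℕ# b
      eq = R.trans (R.sym (R.distribˡ x _ _)) (R.*-congˡ (R.trans (R.sym (ι-+ (b ∸ a) a)) (R.reflexive (cong fromℕ# (ℕ.m∸n+n≡m (ℕ.<⇒≤ a<b))))))

  module Constants {c ℓ₁ ℓ₂} (F : OrderedField c ℓ₁ ℓ₂) (k : ℕ) where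
    open OrderedField F
    open Derivatives F
    open Positivity F
    private module R = CommutativeRing commutativeRing
    open Sums R.commutativeSemiring

    1/!-pos : ∀ p → 0# < 1/! p
    1/!-pos p = inverse-pos (fromℕ#-pos (p !) {{p ℕ.!≢0}}) (1/!-inverse p)

    -- The factor of a vertex of the hyperedge that is visited by r loops.
    ψ : ℕ → Carrier
    ψ r = 1/! (suc r ℕ.* (k ∸ 1)) * ι (suc r)

    ψ-pos : ∀ r → 0# < ψ r
    ψ-pos r = *-pos (1/!-pos (suc r ℕ.* (k ∸ 1))) (fromℕ#-pos (suc r))

    -- The coefficient of a hyperedge with vertices `ys` that carries diagonal entries at `ls`,
    -- apart from the factors made of α, 1 - α and degrees.
    κ : ∀ {n} → List (Fin n) → List (Fin n) → Carrier
    κ ys ls = ∏ ys (λ y → ψ (Counts.count _≟_ y ls)) * ι (circ k ys ls)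

    κ-↭ : ∀ {n} {ys ys′ : List (Fin n)} ls → ys ↭ ys′ → κ ys ls ≈ κ ys′ ls
    κ-↭ ls p = R.*-cong (∏-↭ _ p) (R.reflexive (cong ι (Walks.circuits-↭ _≟_ (kArcs-↭ k {ls = ls} p ↭.refl))))

    κ-map : ∀ {n n′} (f : Fin n → Fin n′) → (∀ {x y} → f x ≡ f y → x ≡ y) → ∀ ys ls → κ (map f ys) (map f ls) ≈ κ ys ls
    κ-map f f-inj ys ls = R.*-cong
      (R.trans (R.reflexive (∏-map _ f ys)) (∏-cong ys (λ y → R.reflexive (cong ψ (count-map f f-inj y ls)))))
      (R.reflexive (cong ι (circ-map f f-inj k ys ls)))

    -- Naming the vertices by their places in the list moves the coefficient to a standard vertex
    -- set. It therefore depends only on the number of vertices and the pattern of the loops, and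
    -- not on the hypergraph.
    κ-lookup : ∀ {n} {zs : List (Fin n)} → Unique zs → ∀ is → κ zs (map (lookup zs) is) ≈ κ (allFin (length zs)) is
    κ-lookup {zs = zs} u is = R.trans (R.reflexive (cong (λ ws → κ ws (map (lookup zs) is))
      (sym (trans (map-tabulate (λ i → i) (lookup zs)) (tabulate-lookup zs)))))
      (κ-map (lookup zs) (lookup-injective u) (allFin (length zs)) is)
      where
      open import Data.List.Relation.Unary.Unique.Propositional.Properties using (Unique[x∷xs]⇒x∉xs)
      open import Data.List.Membership.Propositional.Properties using (∈-lookup)
      lookup-injective : ∀ {n} {zs : List (Fin n)} → Unique zs → ∀ {i j} → lookup zs i ≡ lookup zs j → i ≡ j
      lookup-injective (_ ∷ u) {Fin.zero} {Fin.zero} eq = refl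
      lookup-injective uz@(_ ∷ u) {Fin.zero} {Fin.suc j} refl = ⊥-elim (Unique[x∷xs]⇒x∉xs uz (∈-lookup j))
      lookup-injective uz@(_ ∷ u) {Fin.suc i} {Fin.zero} refl = ⊥-elim (Unique[x∷xs]⇒x∉xs uz (∈-lookup i))
      lookup-injective (_ ∷ u) {Fin.suc i} {Fin.suc j} eq = cong Fin.suc (lookup-injective u eq)

    κ₀ : ℕ → Carrier
    κ₀ p = κ (allFin p) []

    -- The patterns are one diagonal entry, two at the same vertex, and two at distinct vertices.
    -- The argument counts the vertices that carry none.
    κ₁ κ₂ κ₁₁ : ℕ → Carrier
    κ₁ p  = κ (allFin (suc p)) (Fin.zero ∷ [])
    κ₂ p  = κ (allFin (suc p)) (Fin.zero ∷ Fin.zero ∷ [])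
    κ₁₁ p = κ (allFin (suc (suc p))) (Fin.zero ∷ Fin.suc Fin.zero ∷ [])

    module _ {n} {ys : List (Fin n)} (u : Unique ys) where

      κ-none : κ ys [] ≈ κ₀ (length ys)
      κ-none = κ-lookup u []

      κ-single : ∀ {p a} → length ys ≡ suc p → a ∈ ys → κ ys (a ∷ []) ≈ κ₁ p
      κ-single {p} len a∈ with ∈⇒↭ a∈
      ... | zs , q with ℕ.suc-injective (trans (sym len) (↭-length q))
      ... | refl = R.trans (κ-↭ (_ ∷ []) q) (κ-lookup (Unique-resp-↭ q u) (Fin.zero ∷ []))

      κ-double : ∀ {p a} → length ys ≡ suc p → a ∈ ys → κ ys (a ∷ a ∷ []) ≈ κ₂ p
      κ-double {p} len a∈ with ∈⇒↭ a∈
      ... | zs , q with ℕ.suc-injective (trans (sym len) (↭-length q))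
      ... | refl = R.trans (κ-↭ (_ ∷ _ ∷ []) q) (κ-lookup (Unique-resp-↭ q u) (Fin.zero ∷ Fin.zero ∷ []))

      κ-pair : ∀ {p a b} → length ys ≡ suc (suc p) → a ∈ ys → b ∈ ys → a ≢ b → κ ys (a ∷ b ∷ []) ≈ κ₁₁ p
      κ-pair {p} len a∈ b∈ a≢b with ∈⇒↭ a∈
      ... | zs , q with ∈-resp-↭ q b∈
      ... | here refl = ⊥-elim (a≢b refl)
      ... | there b∈′ with ∈⇒↭ b∈′
      ... | ws , r with ↭-trans q (↭.prep _ r)
      ... | s with ℕ.suc-injective (ℕ.suc-injective (trans (sym len) (↭-length s)))
      ... | refl = R.trans (κ-↭ (_ ∷ _ ∷ []) s) (κ-lookup (Unique-resp-↭ s u) (Fin.zero ∷ Fin.suc Fin.zero ∷ []))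

    κ₁₁-pos : ∀ p → 2 ℕ.≤ k → 0# < κ₁₁ p
    κ₁₁-pos p 2≤k = *-pos (∏-pos _ (allFin (suc (suc p))) (λ i → ψ-pos (Counts.count _≟_ i (Fin.zero ∷ Fin.suc Fin.zero ∷ [])))) (positive circ>0)
      where
      positive : ∀ {m} → 0 ℕ.< m → 0# < ι m
      positive {suc m} _ = fromℕ#-pos (suc m)
      circ>0 : 0 ℕ.< circ k (allFin (suc (suc p))) (Fin.zero ∷ Fin.suc Fin.zero ∷ [])
      circ>0 with Eulerian-kArcs k {Fin.zero} {Fin.suc Fin.zero} {tabulate (Fin.suc ∘ Fin.suc)} (Unique.allFin⁺ (suc (suc p)))
      ... | [] , q , w = ⊥-elim (nonempty (↭-length q))
        where
        nonempty : length (kArcs k (allFin (suc (suc p))) (Fin.zero ∷ Fin.suc Fin.zero ∷ [])) ≢ 0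
        nonempty ()
      ... | e ∷ L , q , w = subst (0 ℕ.<_) (sym (Walks.circuits-↭ _≟_ q)) (Walks.circuits>0 _≟_ w)

-- Traces of order at most k + 2.

module LowOrderTraces where

  open BigOperators
  open ClosedWalks
  open TraceFunctionals
  open TraceExpansion
  open SubsetLists
  open ContributingPicks
  open PickCounting
  open EdgeConstants
  open import Algebra.Bundles using (CommutativeRing)
  open import Data.Empty using (⊥-elim)
  open import Data.Fin as Fin using (Fin)
  open import Data.Fin.Properties using (_≟_)
  open import Data.Fin.Subset using (_∈_; _∉_)
  open import Data.Fin.Subset.Properties using (_∈?_; ⊆-antisym)
  open import Data.List using (List; []; _∷_; _++_; map; length; replicate; allFin; concatMap; filter; upTo)
  open import Data.List.Properties using (concatMap-map; length-++; length-map; length-replicate; concatMap-++)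
  import Data.List.Membership.Propositional as L
  open import Data.List.Membership.Propositional.Properties using (∈-++⁺ˡ; ∈-++⁺ʳ; ∈-++⁻; ∈-map⁺; ∈-map⁻; ∈-allFin; ∈-filter⁺; ∈-filter⁻; ∈-concatMap⁺; ∈-concatMap⁻; ∈-upTo⁺)
  open import Data.List.Relation.Binary.Permutation.Propositional as ↭ using (_↭_; ↭-sym; ↭-trans; ↭-reflexive)
  open import Data.List.Relation.Binary.Permutation.Propositional.Properties using (++⁺; ++⁺ˡ; map⁺; ↭-length; shift)
  open import Data.List.Relation.Unary.All as All using (All; []; _∷_)
  import Data.List.Relation.Unary.All.Properties as All
  open import Data.List.Relation.Unary.AllPairs using ([]; _∷_)
  open import Data.List.Relation.Unary.Any using (here; there)
  open import Data.List.Relation.Unary.Unique.Propositional using (Unique)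
  import Data.List.Relation.Unary.Unique.Propositional.Properties as Unique
  open import Data.Maybe using (Maybe; just; nothing)
  import Data.Maybe.Properties as Maybe
  open import Data.Nat as ℕ using (ℕ; zero; suc; _∸_; _≤_; s≤s; _≤?_)
  import Data.Nat.Properties as ℕ
  open import Data.Product as × using (∃-syntax; _×_; _,_; proj₁; proj₂)
  import Data.Product.Properties as ×ₚ
  open import Data.Sum using (_⊎_; inj₁; inj₂)
  open import Data.Sum.Properties using (inj₁-injective; inj₂-injective)
  open import Data.Vec as Vec using (Vec; lookup; tabulate)
  import Data.Vec.Properties as Vec
  open import Function using (_∘_; case_of_)
  open import Relation.Binary.PropositionalEquality as ≡ using (_≡_; _≢_; refl; sym; trans; cong; cong₂; subst)
  open import Relation.Nullary using (¬_; Dec; yes; no)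

  Unique-concatMap : ∀ {a b} {A : Set a} {B : Set b} (h : A → List B) {xs} → Unique xs → (∀ x → Unique (h x)) →
                     (∀ {x y z} → z L.∈ h x → z L.∈ h y → x ≡ y) → Unique (concatMap h xs)
  Unique-concatMap h {[]} u uh dis = []
  Unique-concatMap h {x ∷ xs} (x∉ ∷ u) uh dis = Unique.++⁺ (uh x) (Unique-concatMap h u uh dis)
    λ { (p , q) → let y , y∈ , r = find (∈-concatMap⁻ h q) in All.lookup x∉ y∈ (dis p r) }
    where open import Data.List.Membership.Propositional using (find)

  vsum-tabulate : ∀ {n} (f : Fin n → ℕ) → Vec.sum (tabulate f) ≡ ℕΣ.⅀ (allFin n) f
  vsum-tabulate {zero} f = refl
  vsum-tabulate {suc n} f = cong (f Fin.zero ℕ.+_) (trans (vsum-tabulate (f ∘ Fin.suc))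
    (trans (sym (ℕΣ.⅀-map f Fin.suc (allFin n))) (cong (λ xs → ℕΣ.⅀ xs f) (map-tabulate (λ i → i) Fin.suc))))
    where open import Data.List.Properties using (map-tabulate)

  ∈-exponents : ∀ {n} (d : ℕ) {v : Vec ℕ n} → Vec.sum v ≡ d → v L.∈ filter (λ v → Vec.sum v ℕ.≟ d) (words (upTo (suc d)) n)
  ∈-exponents d {v} eq = ∈-filter⁺ _ (∈-words v (λ x∈ → ∈-upTo⁺ (s≤s (ℕ.≤-trans (bound v x∈) (ℕ.≤-reflexive eq))))) eq
    where
    bound : ∀ {n x} (v : Vec ℕ n) → x L.∈ Vec.toList v → x ≤ Vec.sum v
    bound (x Vec.∷ v) (here refl) = ℕ.m≤m+n _ _
    bound (x Vec.∷ v) (there p) = ℕ.≤-trans (bound v p) (ℕ.m≤n+m _ _)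

  module _ {n : ℕ} {a} {Λ : Set a} (_≟ˡ_ : (l l′ : Λ) → Dec (l ≡ l′)) where
    open ℕΣ
    private
      _≟ᵖ_ : (p q : Fin n × Λ) → Dec (p ≡ q)
      _≟ᵖ_ = ×ₚ.≡-dec _≟_ _≟ˡ_
      module CP = Counts _≟ᵖ_
      module CV = Counts (_≟_ {n})

    count-pairs : ∀ x l l′ ys → CP.count (x , l) (map (_, l′) ys) ≡ 𝟙 (l′ ≟ˡ l) ℕ.* CV.count x ys
    count-pairs x l l′ ys = trans (⅀-map _ (_, l′) ys) (trans (⅀-cong ys pointwise) (sym (*-⅀ (𝟙 (l′ ≟ˡ l)) _ ys)))
      where
      pointwise : ∀ y → 𝟙 ((y , l′) ≟ᵖ (x , l)) ≡ 𝟙 (l′ ≟ˡ l) ℕ.* 𝟙 (y ≟ x)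
      pointwise y = go (l′ ≟ˡ l) (y ≟ x) ((y , l′) ≟ᵖ (x , l))
        where
        go : (b : Dec (l′ ≡ l)) (c : Dec (y ≡ x)) (d : Dec ((y , l′) ≡ (x , l))) → 𝟙 d ≡ 𝟙 b ℕ.* 𝟙 c
        go (yes refl) (yes refl) d = 𝟙-yes d refl
        go (yes refl) (no ne) d = 𝟙-no d (ne ∘ cong proj₁)
        go (no ne) _ d = 𝟙-no d (ne ∘ cong proj₂)

    count-concatMap-at : ∀ (w : Fin n → List (Fin n × Λ)) → (∀ i → All ((_≡ i) ∘ proj₁) (w i)) → ∀ x l →
                         CP.count (x , l) (concatMap w (allFin n)) ≡ CP.count (x , l) (w x)
    count-concatMap-at w at x l = trans (⅀-concatMap _ w (allFin n))
      (⅀-single _ (Unique.allFin⁺ n) (∈-allFin x) (λ {i} _ i≢x → CP.∉⇒count≡0 (λ p → i≢x (sym (All.lookup (at i) p)))))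

  module TraceFormula {c ℓ₁ ℓ₂} (F : OrderedField c ℓ₁ ℓ₂) (k : ℕ) (3≤k : 3 ≤ k)
                      (H : Hypergraph)
                      (simple : Simple H) (uniform : Uniform k H) (linear : Linear H)
                      (α : OrderedField.Carrier F) where
    open Hypergraph H
    open OrderedField F
    open Tensors F using (A[_]; TrA; exponents)
    open Derivatives F
    open Constants F k
    private module R = CommutativeRing commutativeRing
    open R using (+-cong; *-cong; *-congˡ; *-congʳ; *-identityˡ; zeroˡ; zeroʳ)
    open Sums R.commutativeSemiring
    open Vanishing k 3≤k H uniform linear using (Valid; Shape; loops; edged; shape; edgePick)
    private
      k≢0 : k ≢ 0
      k≢0 refl = case 3≤k of λ ()
      n = order
      m = size
      T = A[_] k H α
      ltrs = letters k H

      wt : Vertex → Letter k H → Carrier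
      wt = Grouping.letterWeight F k k≢0 H simple uniform α
      arcs : List (Vertex × Letter k H) → List (Vertex × Vertex)
      arcs = arcsOf (letterArcs k H)

      weight : List (Vertex × Letter k H) → Carrier
      weight = Expansion.weight F {n} {k} T ltrs wt (letterArcs k H)

      _≟ˡ_ : (l l′ : Letter k H) → Dec (l ≡ l′)
      _≟ˡ_ = Maybe.≡-dec _≟_
      module CP = Counts (×ₚ.≡-dec (_≟_ {n}) _≟ˡ_)
      module CV = Counts (_≟_ {n})

    x : Vertex → Carrier
    x i = α * ι (degree H i)

    β : Carrier
    β = 1# - α

    private
      -- The summand with `circuits` in place of `traceWalks`, which makes it independent of the
      -- order `d`; `trace-term` shows that nothing changes.
      term : List (Vertex × Letter k H) → Carrier
      term s = weight s * ι (Walks.circuits _≟_ (arcs s))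

      arcs-↭ : ∀ {s s′} → s ↭ s′ → arcs s ↭ arcs s′
      arcs-↭ = concatMap-↭ (λ _ → ↭.refl)

      term-↭ : ∀ {s s′} → s ↭ s′ → term s ≈ term s′
      term-↭ p = *-cong (∏-↭ _ p) (R.reflexive (cong ι (Walks.circuits-↭ _≟_ (arcs-↭ p))))

      length-others : ∀ {i e} → i ∈ edge e → length (others i (edge e)) ≡ k ∸ 1
      length-others {i} {e} i∈ = cong (_∸ 1) (trans (sym (↭-length (others-↭ i∈))) (trans (length-els (edge e)) (uniform e)))

      length-arcs : ∀ s → Valid s → length (arcs s) ≡ length s ℕ.* (k ∸ 1)
      length-arcs [] _ = refl
      length-arcs ((i , nothing) ∷ s) valid = trans (length-++ (replicate (k ∸ 1) (i , i)))
        (cong₂ ℕ._+_ (length-replicate (k ∸ 1)) (length-arcs s (valid ∘ there)))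
      length-arcs ((i , just e) ∷ s) valid = trans (length-++ (map (i ,_) (others i (edge e))))
        (cong₂ ℕ._+_ (trans (length-map _ (others i (edge e))) (length-others (valid (here refl)))) (length-arcs s (valid ∘ there)))

      valid? : ∀ s → Valid s ⊎ weight s ≈ 0#
      valid? [] = inj₁ λ ()
      valid? ((i , l) ∷ s) with valid? s
      ... | inj₂ w≈0 = inj₂ (R.trans (*-congˡ w≈0) (zeroʳ _))
      valid? ((i , nothing) ∷ s) | inj₁ v = inj₁ λ { (there p) → v p }
      valid? ((i , just e) ∷ s) | inj₁ v with i ∈? edge e
      ... | yes i∈ = inj₁ λ { (here refl) → i∈ ; (there p) → v p }
      ... | no _ = inj₂ (R.trans (*-congʳ (zeroʳ _)) (zeroˡ _))

    module _ (d : ℕ) (d≢0 : d ≢ 0) (d≤ : d ≤ k ℕ.+ 2) where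

      -- The test guards against truncated subtraction: for d < k no hyperedge contributes, but
      -- `msets 0` would supply the empty multiset.
      msetsFor : List Vertex → List (List Vertex)
      msetsFor ys with k ≤? d
      ... | yes _ = msets (d ∸ k) ys
      ... | no _ = []

      -- Names for the multisets of entries that can contribute: `inj₁ i` has `d` diagonal entries
      -- at `i`, and `inj₂ (e , ls)` has one entry of `e` at each of its vertices and diagonal
      -- entries at `ls`.
      Index : Set
      Index = Vertex ⊎ (Edge × List Vertex)

      idx : List Index
      idx = map inj₁ (allFin n) ++ concatMap (λ e → map (λ ls → inj₂ (e , ls)) (msetsFor (els (edge e)))) (allFin m)

      exps : Index → Vertex → ℕ
      exps (inj₁ i) j        = d ℕ.* ℕΣ.𝟙 (i ≟ j)
      exps (inj₂ (e , ls)) j = ℕΣ.𝟙 (j ∈? edge e) ℕ.+ CV.count j ls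

      value : Index → Carrier
      value (inj₁ i)        = 1/! (d ℕ.* (k ∸ 1)) * (∏ (replicate d i) x * ι (Walks.circuits _≟_ (loopsOf k (replicate d i))))
      value (inj₂ (e , ls)) = κ (els (edge e)) ls * (∏ (els (edge e)) (λ _ → β) * ∏ ls x)

      private
        canonical : Index → List (Vertex × Letter k H)
        canonical (inj₁ i)        = map (_, nothing) (replicate d i)
        canonical (inj₂ (e , ls)) = map (_, just e) (els (edge e)) ++ map (_, nothing) ls

        msetsFor-∈ : ∀ {ys ls} → ls L.∈ msetsFor ys → k ℕ.+ length ls ≡ d × ls L.∈ msets (d ∸ k) ys
        msetsFor-∈ {ys} p with k ≤? d
        ... | yes k≤d = trans (cong (k ℕ.+_) (length-msets (d ∸ k) ys p)) (ℕ.m+[n∸m]≡n k≤d) , p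

        ∈-msetsFor : ∀ ys ls → (∀ {y} → y L.∈ ls → y L.∈ ys) → k ℕ.+ length ls ≡ d → ∃[ ls′ ] ls′ L.∈ msetsFor ys × ls′ ↭ ls
        ∈-msetsFor ys ls sub eq with k ≤? d
        ... | no ¬k≤d = ⊥-elim (¬k≤d (subst (k ≤_) eq (ℕ.m≤m+n k _)))
        ... | yes k≤d = subst (λ j → ∃[ ls′ ] ls′ L.∈ msets j ys × ls′ ↭ ls)
              (sym (trans (cong (_∸ k) (sym eq)) (ℕ.m+n∸m≡n k (length ls)))) (msets-complete _≟_ ys ls sub)

        msetsFor-unique : ∀ {ys} → Unique ys → Unique (msetsFor ys)
        msetsFor-unique u with k ≤? d
        ... | yes _ = msets-unique (d ∸ k) u
        ... | no _ = []

        idx₂ : ∀ {e ls} → inj₂ (e , ls) L.∈ idx → ls L.∈ msetsFor (els (edge e))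
        idx₂ p with ∈-++⁻ (map inj₁ (allFin n)) p
        ... | inj₁ q = case ∈-map⁻ inj₁ q of λ ()
        ... | inj₂ q with find (∈-concatMap⁻ (λ e → map (λ ls → inj₂ (e , ls)) (msetsFor (els (edge e)))) {xs = allFin m} q)
          where open import Data.List.Membership.Propositional using (find)
        ... | _ , _ , r with ∈-map⁻ _ r
        ... | _ , ls∈ , refl = ls∈

        ∈-idx₂ : ∀ {e ls} → ls L.∈ msetsFor (els (edge e)) → inj₂ (e , ls) L.∈ idx
        ∈-idx₂ {e} p = ∈-++⁺ʳ (map inj₁ (allFin n)) (∈-concatMap⁺ (λ e → map (λ ls → inj₂ (e , ls)) (msetsFor (els (edge e))))
          (lose (∈-allFin e) (∈-map⁺ (λ ls → inj₂ (e , ls)) p)))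
          where open import Data.List.Membership.Propositional using (lose)

        idx-⊆ : ∀ {e ls y} → inj₂ (e , ls) L.∈ idx → y L.∈ ls → y ∈ edge e
        idx-⊆ {e} p y∈ = ∈-els⁻ (msets-⊆ (d ∸ k) (els (edge e)) (proj₂ (msetsFor-∈ (idx₂ p))) y∈)

        idx-unique : Unique idx
        idx-unique = Unique.++⁺ (Unique.map⁺ inj₁-injective (Unique.allFin⁺ n))
          (Unique-concatMap _ (Unique.allFin⁺ m)
            (λ e → Unique.map⁺ (cong proj₂ ∘ inj₂-injective) (msetsFor-unique (els-unique (edge e))))
            (λ p q → let _ , _ , r = ∈-map⁻ _ p ; _ , _ , s = ∈-map⁻ _ q in cong proj₁ (inj₂-injective (trans (sym r) s))))
          λ { (p , q) → let _ , _ , r = ∈-map⁻ inj₁ p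
                            _ , _ , s = find (∈-concatMap⁻ (λ e → map (λ ls → inj₂ (e , ls)) (msetsFor (els (edge e)))) {xs = allFin m} q)
                            _ , _ , t = ∈-map⁻ _ s in case trans (sym r) t of λ () }
          where open import Data.List.Membership.Propositional using (find)

        exps₂-≢0 : ∀ {e ls j} → j ∈ edge e → exps (inj₂ (e , ls)) j ≢ 0
        exps₂-≢0 {e} {ls} {j} j∈ eq = case trans (sym (ℕΣ.𝟙-yes (j ∈? edge e) j∈)) (ℕ.m+n≡0⇒m≡0 _ eq) of λ ()

        ≢0⇒∈ : ∀ {e ls j} → inj₂ (e , ls) L.∈ idx → exps (inj₂ (e , ls)) j ≢ 0 → j ∈ edge e
        ≢0⇒∈ {e} {ls} {j} p ne with j ∈? edge e
        ... | yes j∈ = j∈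
        ... | no _ = idx-⊆ p (CV.count≢0 ls ne)

        -- One exponent vector is supported at a single vertex, the other at all vertices of `e`, of
        -- which there are several.
        off-vertex : ∀ i {e ls} → ¬ (∀ j → exps (inj₁ i) j ≡ exps (inj₂ (e , ls)) j)
        off-vertex i {e} {ls} h with three (edge e) (subst (3 ≤_) (sym (uniform e)) 3≤k)
        ... | y , z , _ , y∈ , z∈ , _ , y≢z , _ with i ≟ y
        ... | no i≢y = exps₂-≢0 {e} {ls} y∈ (trans (sym (h y)) (trans (cong (d ℕ.*_) (ℕΣ.𝟙-no (i ≟ y) i≢y)) (ℕ.*-zeroʳ d)))
        ... | yes refl = exps₂-≢0 {e} {ls} z∈ (trans (sym (h z)) (trans (cong (d ℕ.*_) (ℕΣ.𝟙-no (i ≟ z) y≢z)) (ℕ.*-zeroʳ d)))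

        -- The hyperedge is recovered from the support of the exponents, by simplicity, and the
        -- loops from the excess over one. So indices and contributing exponent vectors correspond
        -- without double counting.
        exps-injective : ∀ {t t′} → t L.∈ idx → t′ L.∈ idx → (∀ j → exps t j ≡ exps t′ j) → t ≡ t′
        exps-injective {inj₁ i} {inj₁ i′} p q h with i ≟ i′
        ... | yes refl = refl
        ... | no i≢i′ = ⊥-elim (d≢0 (trans (sym (trans (cong (d ℕ.*_) (ℕΣ.𝟙-yes (i ≟ i) refl)) (ℕ.*-identityʳ d)))
                (trans (h i) (trans (cong (d ℕ.*_) (ℕΣ.𝟙-no (i′ ≟ i) (i≢i′ ∘ sym))) (ℕ.*-zeroʳ d)))))
        exps-injective {inj₁ i} {inj₂ (e , ls)} p q h = ⊥-elim (off-vertex i {e} {ls} h)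
        exps-injective {inj₂ (e , ls)} {inj₁ i} p q h = ⊥-elim (off-vertex i {e} {ls} (sym ∘ h))
        exps-injective {inj₂ (e , ls)} {inj₂ (e′ , ls′)} p q h
          with simple {e} {e′} (⊆-antisym
                 (λ {j} j∈ → ≢0⇒∈ {e′} {ls′} q (λ eq → exps₂-≢0 {e} {ls} j∈ (trans (h j) eq)))
                 (λ {j} j∈ → ≢0⇒∈ {e} {ls} p (λ eq → exps₂-≢0 {e′} {ls′} j∈ (trans (sym (h j)) eq))))
        ... | refl = cong (λ ms → inj₂ (e , ms)) (msets-injective (d ∸ k) (els-unique (edge e))
                (proj₂ (msetsFor-∈ (idx₂ p))) (proj₂ (msetsFor-∈ (idx₂ q)))
                (CV.count⇒↭ ls ls′ (λ j → ℕ.+-cancelˡ-≡ (ℕΣ.𝟙 (j ∈? edge e)) _ _ (h j))))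

        sum-exps : ∀ {t} → t L.∈ idx → ℕΣ.⅀ (allFin n) (exps t) ≡ d
        sum-exps {inj₁ i} p = trans (sym (ℕΣ.*-⅀ d _ (allFin n))) (trans (cong (d ℕ.*_)
          (trans (ℕΣ.⅀-single _ (Unique.allFin⁺ n) (∈-allFin i) (λ {j} _ j≢i → ℕΣ.𝟙-no (i ≟ j) (j≢i ∘ sym))) (ℕΣ.𝟙-yes (i ≟ i) refl))) (ℕ.*-identityʳ d))
        sum-exps {inj₂ (e , ls)} p = trans (ℕΣ.⅀-+ _ (λ j → CV.count j ls) (allFin n)) (trans (cong₂ ℕ._+_
          (trans (sym (trans (ℕΣ.⅀-filter (_∈? edge e) (λ _ → 1) (allFin n)) (ℕΣ.⅀-cong (allFin n) (λ j → ℕ.*-identityʳ _))))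
            (trans (⅀-1 (els (edge e))) (trans (length-els (edge e)) (uniform e))))
          (trans (ℕΣ.⅀-swap _ (allFin n) ls) (trans (ℕΣ.⅀-cong ls (λ l → trans (ℕΣ.⅀-single _ (Unique.allFin⁺ n) (∈-allFin l)
            (λ {j} _ j≢l → ℕΣ.𝟙-no (l ≟ j) (j≢l ∘ sym))) (ℕΣ.𝟙-yes (l ≟ l) refl))) (⅀-1 ls))))
          (proj₁ (msetsFor-∈ (idx₂ p))))

        count-canonical : ∀ t j → ℕΣ.⅀ (canonical t) (λ p → ℕΣ.𝟙 (proj₁ p ≟ j)) ≡ exps t j
        count-canonical (inj₁ i) j = trans (ℕΣ.⅀-map _ _ (replicate d i)) (go d)
          where
          go : ∀ d → ℕΣ.⅀ (replicate d i) (λ y → ℕΣ.𝟙 (y ≟ j)) ≡ d ℕ.* ℕΣ.𝟙 (i ≟ j)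
          go zero = refl
          go (suc d) = cong (ℕΣ.𝟙 (i ≟ j) ℕ.+_) (go d)
        count-canonical (inj₂ (e , ls)) j = trans (ℕΣ.⅀-++ _ (map (_, just e) (els (edge e))) _)
          (cong₂ ℕ._+_ (trans (ℕΣ.⅀-map _ _ (els (edge e))) (count-els j (edge e))) (ℕΣ.⅀-map _ _ ls))

        edgeVertices loopVertices : List (Vertex × Letter k H) → List Vertex
        edgeVertices [] = []
        edgeVertices ((i , nothing) ∷ s) = edgeVertices s
        edgeVertices ((i , just _) ∷ s) = i ∷ edgeVertices s
        loopVertices [] = []
        loopVertices ((i , nothing) ∷ s) = i ∷ loopVertices s
        loopVertices ((i , just _) ∷ s) = loopVertices s

        sorted : ∀ e s → (∀ {i f} → (i , just f) L.∈ s → f ≡ e) →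
                 s ↭ map (_, just e) (edgeVertices s) ++ map (_, nothing) (loopVertices s)
        sorted e [] h = ↭.refl
        sorted e ((i , nothing) ∷ s) h = ↭-trans (↭.prep _ (sorted e s (h ∘ there)))
          (↭-sym (shift (i , nothing) (map (_, just e) (edgeVertices s)) _))
        sorted e ((i , just f) ∷ s) h with h (here refl)
        ... | refl = ↭.prep _ (sorted e s (h ∘ there))

        count-edgeVertices : ∀ y s → CV.count y (edgeVertices s) ≡ ℕΣ.⅀ s (edgePick y)
        count-edgeVertices y [] = refl
        count-edgeVertices y ((i , nothing) ∷ s) = count-edgeVertices y s
        count-edgeVertices y ((i , just _) ∷ s) = cong (ℕΣ.𝟙 (i ≟ y) ℕ.+_) (count-edgeVertices y s)

        ∈-loopVertices : ∀ {y} s → y L.∈ loopVertices s → (y , nothing) L.∈ s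
        ∈-loopVertices ((i , nothing) ∷ s) (here refl) = here refl
        ∈-loopVertices ((i , nothing) ∷ s) (there p) = there (∈-loopVertices s p)
        ∈-loopVertices ((i , just _) ∷ s) p = there (∈-loopVertices s p)

        shape-canonical : ∀ s → length s ≡ d → Shape s → ∃[ t ] t L.∈ idx × s ↭ canonical t
        shape-canonical s len (loops i all) = inj₁ i , ∈-++⁺ˡ (∈-map⁺ inj₁ (∈-allFin i)) ,
          ↭-reflexive (trans (constant s all) (cong (λ d → map (_, nothing) (replicate d i)) len))
          where
          constant : ∀ s → (∀ {p} → p L.∈ s → p ≡ (i , nothing)) → s ≡ map (_, nothing) (replicate (length s) i)
          constant [] _ = refl
          constant (p ∷ s) all = cong₂ _∷_ (all (here refl)) (constant s (all ∘ there))
        shape-canonical s len (edged e same once inside) =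
          let perm = ↭-trans (sorted e s same) (++⁺ (map⁺ (_, just e) (CV.count⇒↭ (edgeVertices s) (els (edge e))
                       (λ y → trans (count-edgeVertices y s) (trans (once y) (sym (count-els y (edge e))))))) ↭.refl)
              ls , ls∈ , p = ∈-msetsFor (els (edge e)) (loopVertices s) (∈-els⁺ ∘ inside ∘ ∈-loopVertices s)
                (trans (sym (trans (↭-length perm) (trans (length-++ (map (_, just e) (els (edge e))))
                  (cong₂ ℕ._+_ (trans (length-map _ (els (edge e))) (trans (length-els (edge e)) (uniform e))) (length-map _ (loopVertices s)))))) len)
          in inj₂ (e , ls) , ∈-idx₂ ls∈ , ↭-trans perm (++⁺ˡ _ (map⁺ (_, nothing) (↭-sym p)))

        choices-length : ∀ {v : Vec ℕ n} {s} → v L.∈ exponents {k} T d → s L.∈ choices ltrs (lookup v) (allFin n) → length s ≡ d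
        choices-length {v} v∈ s∈ = trans (length-choices n ltrs (lookup v) (allFin n) s∈)
          (trans (sym (vsum-tabulate (lookup v))) (trans (cong Vec.sum (Vec.tabulate∘lookup v)) (proj₂ (∈-filter⁻ _ {xs = words (upTo (suc d)) n} v∈))))

        -- Valid choices have the number of arcs that the comparison with `circuits` requires; for
        -- the others both sides vanish with the weight.
        trace-term : ∀ s → length s ≡ d → weight s * ι (traceWalks (d ℕ.* (k ∸ 1)) (arcs s)) ≈ term s
        trace-term s len with valid? s
        ... | inj₂ w≈0 = R.trans (*-congʳ w≈0) (R.trans (zeroˡ _) (R.sym (R.trans (*-congʳ w≈0) (zeroˡ _))))
        ... | inj₁ valid = *-congˡ (R.reflexive (cong ι (traceWalks-circuits (d ℕ.* (k ∸ 1)) (arcs s)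
                (trans (length-arcs s valid) (cong (ℕ._* (k ∸ 1)) len))
                (λ eq → case ℕ.m*n≡0⇒m≡0∨n≡0 d eq of λ { (inj₁ d≡0) → d≢0 d≡0
                  ; (inj₂ p≡0) → ℕ.<-irrefl (sym p≡0) (ℕ.<-≤-trans ℕ.z<s (ℕ.∸-monoˡ-≤ 1 3≤k)) }))))

        contributes : ∀ s → length s ≡ d → (∃[ t ] t L.∈ idx × s ↭ canonical t) ⊎ term s ≈ 0#
        contributes s len with valid? s
        ... | inj₂ w≈0 = inj₂ (R.trans (*-congʳ w≈0) (zeroˡ _))
        ... | inj₁ valid with Walks.circuits _≟_ (arcs s) ℕ.≟ 0
        ... | yes c≡0 = inj₂ (R.trans (*-congˡ (R.reflexive (cong ι c≡0))) (zeroʳ _))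
        ... | no c≢0 = inj₁ (shape-canonical s len (shape s (λ { refl → d≢0 (sym len) }) valid (subst (_≤ k ℕ.+ 2) (sym len) d≤) c≢0))

        contribution : Vec ℕ n → Carrier
        contribution v = ∏ (allFin n) (λ i → 1/! (lookup v i ℕ.* (k ∸ 1))) *
          ⅀ (choices ltrs (lookup v) (allFin n)) (λ s → weight s * ι (traceWalks (d ℕ.* (k ∸ 1)) (arcs s)))

        ∈-exps : ∀ {t} → t L.∈ idx → tabulate (exps t) L.∈ exponents {k} T d
        ∈-exps {t} t∈ = ∈-exponents d (trans (vsum-tabulate (exps t)) (sum-exps t∈))

        exps-of : ∀ {v : Vec ℕ n} {s t} → s L.∈ choices ltrs (lookup v) (allFin n) → s ↭ canonical t → ∀ j → lookup v j ≡ exps t j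
        exps-of {v} {s} {t} s∈ p j = trans (sym (count-choices n ltrs (lookup v) j s∈)) (trans (ℕΣ.⅀-↭ _ p) (count-canonical t j))

        contribution-0 : ∀ {v} → v L.∈ exponents {k} T d → v L.∉ map (tabulate ∘ exps) idx → contribution v ≈ 0#
        contribution-0 {v} v∈ v∉ = R.trans (*-congˡ (⅀-0 _ λ s s∈ → R.trans (trace-term s (choices-length v∈ s∈)) (vanish s s∈))) (zeroʳ _)
          where
          vanish : ∀ s → s L.∈ choices ltrs (lookup v) (allFin n) → term s ≈ 0#
          vanish s s∈ with contributes s (choices-length v∈ s∈)
          ... | inj₂ z = z
          ... | inj₁ (t , t∈ , p) = ⊥-elim (v∉ (subst (L._∈ map (tabulate ∘ exps) idx)
                  (trans (Vec.tabulate-cong (sym ∘ exps-of {v} {t = t} s∈ p)) (Vec.tabulate∘lookup v)) (∈-map⁺ (tabulate ∘ exps) t∈)))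

        open Arrangements n ltrs R.commutativeSemiring
        open SpellCounts R.commutativeSemiring {n} (allFin m) (Unique.allFin⁺ m)

        -- The canonical choice cut into its words at the single vertices, the form that `⅀-choices`
        -- asks for.
        pieces : Index → Vertex → List (Vertex × Letter k H)
        pieces (inj₁ i) j = replicate (d ℕ.* ℕΣ.𝟙 (i ≟ j)) (j , nothing)
        pieces (inj₂ (e , ls)) j with j ∈? edge e
        ... | yes _ = (j , just e) ∷ replicate (CV.count j ls) (j , nothing)
        ... | no _ = replicate (CV.count j ls) (j , nothing)

        pieces-at : ∀ t j → All ((_≡ j) ∘ proj₁) (pieces t j)
        pieces-at (inj₁ i) j = All.replicate⁺ _ refl
        pieces-at (inj₂ (e , ls)) j with j ∈? edge e
        ... | yes _ = refl ∷ All.replicate⁺ _ refl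
        ... | no _ = All.replicate⁺ _ refl

        -- The number of arrangements of the word at `j`: a hyperedge letter can be placed anywhere
        -- among the loops, while loops alone make one word.
        multiplicity : Index → Vertex → Carrier
        multiplicity (inj₁ i) j = 1#
        multiplicity (inj₂ (e , ls)) j with j ∈? edge e
        ... | yes _ = ι (suc (CV.count j ls))
        ... | no _ = 1#

        pieces-total : ∀ t j f y → Concentrated (spell ltrs j (exps t j)) (pieces t j) f y →
                       ⅀ (spell ltrs j (exps t j)) f ≈ multiplicity t j * y
        pieces-total (inj₁ i) j f y con = R.trans (⅀-spell-loops j (d ℕ.* ℕΣ.𝟙 (i ≟ j)) f y con) (R.sym (*-identityˡ y))
        pieces-total (inj₂ (e , ls)) j f y con with j ∈? edge e
        ... | yes _ = R.trans (⅀-spell-edge j (∈-allFin e) (CV.count j ls) f y con) (*-congʳ (R.reflexive (ones (suc (CV.count j ls)))))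
          where
          ones : ∀ r → ⅀ (replicate r 1#) (λ z → z) ≡ ι r
          ones zero = refl
          ones (suc r) = cong (1# +_) (ones r)
        ... | no _ = R.trans (⅀-spell-loops j (CV.count j ls) f y con) (R.sym (*-identityˡ y))

        count-replicate : ∀ j l r → CP.count (j , l) (replicate r (j , nothing)) ≡ ℕΣ.𝟙 (nothing ≟ˡ l) ℕ.* r
        count-replicate j l zero = sym (ℕ.*-zeroʳ (ℕΣ.𝟙 (nothing ≟ˡ l)))
        count-replicate j l (suc r) = trans (cong₂ ℕ._+_ (ℕΣ.𝟙-⇔ (×ₚ.≡-dec _≟_ _≟ˡ_ (j , nothing) (j , l)) (nothing ≟ˡ l) (cong proj₂) (cong (j ,_)))
          (count-replicate j l r)) (sym (ℕ.*-suc (ℕΣ.𝟙 (nothing ≟ˡ l)) r))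

        pieces-canonical : ∀ t → concatMap (pieces t) (allFin n) ↭ canonical t
        pieces-canonical t = CP.count⇒↭ _ _ λ (y , l) →
          trans (count-concatMap-at _≟ˡ_ (pieces t) (pieces-at t) y l) (sym (eq t y l))
          where
          eq : ∀ t y l → CP.count (y , l) (canonical t) ≡ CP.count (y , l) (pieces t y)
          eq (inj₁ i) y l = trans (count-pairs _≟ˡ_ y l nothing (replicate d i)) (trans
            (cong (ℕΣ.𝟙 (nothing ≟ˡ l) ℕ.*_) (trans (sym (ℕΣ.⅀-map _ (_, nothing) (replicate d i))) (count-canonical (inj₁ i) y)))
            (sym (count-replicate y l (d ℕ.* ℕΣ.𝟙 (i ≟ y)))))
          eq (inj₂ (e , ls)) y l with trans (ℕΣ.⅀-++ _ (map (_, just e) (els (edge e))) (map (_, nothing) ls))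
            (cong₂ ℕ._+_ (trans (count-pairs _≟ˡ_ y l (just e) (els (edge e))) (cong (ℕΣ.𝟙 (just e ≟ˡ l) ℕ.*_) (count-els y (edge e))))
              (trans (count-pairs _≟ˡ_ y l nothing ls) (sym (count-replicate y l (CV.count y ls)))))
          ... | h with y ∈? edge e
          ... | yes _ = trans h (cong (ℕ._+ CP.count (y , l) (replicate (CV.count y ls) (y , nothing)))
                  (trans (ℕ.*-identityʳ _) (ℕΣ.𝟙-⇔ (just e ≟ˡ l) (×ₚ.≡-dec _≟_ _≟ˡ_ (y , just e) (y , l)) (cong (y ,_)) (cong proj₂))))
          ... | no _ = trans h (cong (ℕ._+ CP.count (y , l) (replicate (CV.count y ls) (y , nothing))) (ℕ.*-zeroʳ (ℕΣ.𝟙 (just e ≟ˡ l))))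

        choices-cong : ∀ {d d′ : Vertex → ℕ} is → (∀ i → d i ≡ d′ i) → choices ltrs d is ≡ choices ltrs d′ is
        choices-cong [] h = refl
        choices-cong (i ∷ is) h = cong₂ (λ r cs → cartesianProductWith _++_ (spell ltrs i r) cs) (h i) (choices-cong is h)
          where open import Data.List using (cartesianProductWith)

        -- Since `exps` is injective, no other canonical choice has these exponents, so a choice
        -- that does not rearrange this one has weight or circuit count zero.
        contribution-exps : ∀ {t} → t L.∈ idx → contribution (tabulate (exps t)) ≈
          ∏ (allFin n) (λ i → 1/! (exps t i ℕ.* (k ∸ 1)) * multiplicity t i) * term (canonical t)
        contribution-exps {t} t∈ = R.trans (*-cong
          (∏-cong (allFin n) (λ i → R.reflexive (cong (λ r → 1/! (r ℕ.* (k ∸ 1))) (Vec.lookup∘tabulate (exps t) i))))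
          (R.trans (⅀-cong∈ _ (λ s s∈ → trace-term s (choices-length (∈-exps t∈) s∈)))
            (R.trans (R.reflexive (cong (λ cs → ⅀ cs term) same))
              (⅀-choices (exps t) (pieces t) (multiplicity t) (allFin n) (Unique.allFin⁺ n) (pieces-at t) (pieces-total t) term (term (canonical t))
                ((λ _ p → term-↭ (↭-trans p (pieces-canonical t))) , off)))))
          (R.trans (R.sym (R.*-assoc _ _ _)) (*-congʳ (R.sym (∏-* _ _ (allFin n)))))
          where
          same : choices ltrs (lookup (tabulate (exps t))) (allFin n) ≡ choices ltrs (exps t) (allFin n)
          same = choices-cong (allFin n) (Vec.lookup∘tabulate (exps t))
          off : ∀ {s} → s L.∈ choices ltrs (exps t) (allFin n) → ¬ (s ↭ concatMap (pieces t) (allFin n)) → term s ≈ 0#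
          off {s} s∈ ¬p with subst (s L.∈_) (sym same) s∈
          ... | s∈′ with contributes s (choices-length (∈-exps t∈) s∈′)
          ... | inj₂ z = z
          ... | inj₁ (t′ , t′∈ , q) with exps-injective t∈ t′∈ (λ j → trans (sym (Vec.lookup∘tabulate (exps t) j)) (exps-of {tabulate (exps t)} {t = t′} s∈′ q j))
          ... | refl = ⊥-elim (¬p (↭-trans q (↭-sym (pieces-canonical t))))

        1/!0 : 1/! 0 ≈ 1#
        1/!0 = R.trans (R.sym (R.trans (*-congˡ ι-1) (R.*-identityʳ _))) (1/!-inverse 0)

        -- Vertices that do not occur in the index contribute 1/0! and multiplicity 1, which reduces
        -- the product to the vertices involved.
        contribution-value : ∀ {t} → t L.∈ idx → contribution (tabulate (exps t)) ≈ value t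
        contribution-value {inj₁ i} t∈ = R.trans (contribution-exps t∈) (*-cong
          (R.trans (∏-reindex _ (Unique.allFin⁺ n) ([] ∷ []) (λ _ → ∈-allFin _)
              (λ {j} _ j∉ → R.trans (R.*-identityʳ _) (R.trans (R.reflexive (cong (λ r → 1/! (r ℕ.* (k ∸ 1)))
                (trans (cong (d ℕ.*_) (ℕΣ.𝟙-no (i ≟ j) (λ eq → j∉ (here (sym eq))))) (ℕ.*-zeroʳ d)))) 1/!0)))
            (R.trans (R.*-identityʳ _) (R.trans (R.*-identityʳ _) (R.reflexive (cong (λ r → 1/! (r ℕ.* (k ∸ 1)))
              (trans (cong (d ℕ.*_) (ℕΣ.𝟙-yes (i ≟ i) refl)) (ℕ.*-identityʳ d)))))))
          (*-cong (R.reflexive (∏-map _ (_, nothing) (replicate d i))) (R.reflexive (cong (ι ∘ Walks.circuits _≟_) (concatMap-map _ (_, nothing) (replicate d i))))))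
        contribution-value {inj₂ (e , ls)} t∈ = R.trans (contribution-exps t∈) (R.trans (*-cong
          (R.trans (∏-reindex _ (Unique.allFin⁺ n) (els-unique (edge e)) (λ _ → ∈-allFin _) (λ {j} _ j∉ → trivial j (j∉ ∘ ∈-els⁺)))
            (∏-cong∈ (els (edge e)) (λ y y∈ → factor y (∈-els⁻ y∈))))
          (*-cong weights (R.reflexive (cong (ι ∘ Walks.circuits _≟_)
            (trans (concatMap-++ _ (map (_, just e) (els (edge e))) _) (cong₂ _++_ (concatMap-map _ (_, just e) (els (edge e))) (concatMap-map _ (_, nothing) ls)))))))
          (R.trans (*-congˡ (R.*-comm _ _)) (R.sym (R.*-assoc _ _ _))))
          where
          trivial : ∀ j → j ∉ edge e → 1/! (exps (inj₂ (e , ls)) j ℕ.* (k ∸ 1)) * multiplicity (inj₂ (e , ls)) j ≈ 1#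
          trivial j j∉ with j ∈? edge e
          ... | yes j∈ = ⊥-elim (j∉ j∈)
          ... | no _ = R.trans (R.*-identityʳ _) (R.trans (R.reflexive (cong (λ r → 1/! (r ℕ.* (k ∸ 1)))
                  (CV.∉⇒count≡0 (j∉ ∘ idx-⊆ t∈)))) 1/!0)
          factor : ∀ y → y ∈ edge e → 1/! (exps (inj₂ (e , ls)) y ℕ.* (k ∸ 1)) * multiplicity (inj₂ (e , ls)) y ≈ ψ (CV.count y ls)
          factor y y∈ with y ∈? edge e
          ... | yes _ = R.refl
          ... | no y∉ = ⊥-elim (y∉ y∈)
          weights : weight (canonical (inj₂ (e , ls))) ≈ ∏ (els (edge e)) (λ _ → β) * ∏ ls x
          weights = R.trans (∏-++ _ (map (_, just e) (els (edge e))) _) (*-cong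
            (R.trans (R.reflexive (∏-map _ (_, just e) (els (edge e)))) (∏-cong∈ (els (edge e)) (λ y y∈ →
              R.trans (*-congˡ (𝟙-yes (y ∈? edge e) (∈-els⁻ y∈))) (R.*-identityʳ β))))
            (R.reflexive (∏-map _ (_, nothing) ls)))

      private
        contributions : ⅀ (exponents {k} T d) contribution ≈ ⅀ idx value
        contributions = R.trans (⅀-reindex contribution
          (Unique.filter⁺ _ (words-unique (Unique.upTo⁺ (suc d)) n))
          (Unique-map∈ (tabulate ∘ exps) idx-unique (λ p q eq → exps-injective p q (λ j →
            trans (sym (Vec.lookup∘tabulate _ j)) (trans (cong (λ v → lookup v j) eq) (Vec.lookup∘tabulate _ j)))))
          (λ p → let t , t∈ , eq = ∈-map⁻ _ p in subst (L._∈ exponents {k} T d) (sym eq) (∈-exps t∈))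
          contribution-0)
          (R.trans (R.reflexive (⅀-map contribution (tabulate ∘ exps) idx)) (⅀-cong∈ idx (λ t t∈ → contribution-value t∈)))

      contributions-split : ⅀ (exponents {k} T d) contribution ≈
        ⅀ (allFin n) (value ∘ inj₁) + ⅀ (allFin m) (λ e → ⅀ (msetsFor (els (edge e))) (λ ls → value (inj₂ (e , ls))))
      contributions-split = R.trans contributions (R.trans (⅀-++ value (map inj₁ (allFin n)) _) (+-cong
        (R.reflexive (⅀-map value inj₁ (allFin n)))
        (R.trans (⅀-concatMap value _ (allFin m)) (⅀-cong (allFin m) (λ e → R.reflexive (⅀-map value _ (msetsFor (els (edge e)))))))))

    Tr-formula : ∀ d (d≤ : suc d ≤ k ℕ.+ 2) → TrA k α H (suc d) ≈ ι ((k ∸ 1) ℕ.^ (n ∸ 1)) *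
      (⅀ (allFin n) (value (suc d) (λ ()) d≤ ∘ inj₁) +
       ⅀ (allFin m) (λ e → ⅀ (msetsFor (suc d) (λ ()) d≤ (els (edge e))) (λ ls → value (suc d) (λ ()) d≤ (inj₂ (e , ls)))))
    Tr-formula d d≤ = R.trans (Expansion.Tr-choices F {n} {k} T ltrs wt (letterArcs k H) (λ i sG L → Grouping.tensorOp-letters F k k≢0 H simple uniform α i sG L) d)
      (*-congˡ (contributions-split (suc d) (λ ()) d≤))

-- Comparison of traces by degree statistics.

module TraceComparison where

  open BigOperators
  open ClosedWalks
  open TraceFunctionals
  open SubsetLists
  open PickCounting
  open EdgeConstants
  open LowOrderTraces
  open import Algebra.Bundles using (CommutativeRing)
  import Algebra.Properties.CommutativeSemigroup as CSG
  open import Data.Empty using (⊥-elim)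
  open import Data.Fin as Fin using (Fin)
  open import Data.Fin.Properties using (_≟_)
  open import Data.Fin.Subset.Properties using (_∈?_)
  open import Data.List using (List; []; _∷_; _++_; map; length; replicate; allFin; filter)
  open import Data.List.Properties using (map-replicate)
  import Data.List.Membership.Propositional as L
  open import Data.List.Relation.Unary.All as All using (All; []; _∷_)
  open import Data.List.Relation.Unary.AllPairs using ([]; _∷_)
  open import Data.List.Relation.Unary.Any using (here; there)
  open import Data.List.Relation.Unary.Unique.Propositional using (Unique)
  open import Data.Nat as ℕ using (ℕ; zero; suc; _∸_; _≤_; z≤n; s≤s; _≤?_)
  import Data.Nat.Properties as ℕ
  open import Data.Nat.Tactic.RingSolver using (solve-∀)
  open import Data.Product as × using (_,_)
  open import Data.Sum using (_⊎_; inj₁; inj₂)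
  open import Function using (_∘_)
  open import Relation.Binary.PropositionalEquality as ≡ using (_≡_; _≢_; refl; sym; trans; cong; cong₂; subst)
  open import Relation.Nullary using (yes; no)
  open import Relation.Binary.Definitions using (tri<; tri≈; tri>)

  -- The second elementary symmetric polynomial of the values of `f`.
  pairSum : ∀ {a} {A : Set a} → (A → ℕ) → List A → ℕ
  pairSum f []       = 0
  pairSum f (y ∷ ys) = f y ℕ.* ℕΣ.⅀ ys f ℕ.+ pairSum f ys

  square-⅀ : ∀ {a} {A : Set a} (f : A → ℕ) ys →
             ℕΣ.⅀ ys f ℕ.* ℕΣ.⅀ ys f ≡ ℕΣ.⅀ ys (λ y → f y ℕ.* f y) ℕ.+ 2 ℕ.* pairSum f ys
  square-⅀ f [] = refl
  square-⅀ f (y ∷ ys) = trans (lemma (f y) (ℕΣ.⅀ ys f)) (trans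
    (cong (λ s → f y ℕ.* f y ℕ.+ (2 ℕ.* (f y ℕ.* ℕΣ.⅀ ys f) ℕ.+ s)) (square-⅀ f ys))
    (lemma₂ (f y ℕ.* f y) (f y ℕ.* ℕΣ.⅀ ys f) (ℕΣ.⅀ ys (λ y → f y ℕ.* f y)) (pairSum f ys)))
    where
    lemma : ∀ a s → (a ℕ.+ s) ℕ.* (a ℕ.+ s) ≡ a ℕ.* a ℕ.+ (2 ℕ.* (a ℕ.* s) ℕ.+ s ℕ.* s)
    lemma = solve-∀
    lemma₂ : ∀ a b c d → a ℕ.+ (2 ℕ.* b ℕ.+ (c ℕ.+ 2 ℕ.* d)) ≡ (a ℕ.+ c) ℕ.+ 2 ℕ.* (b ℕ.+ d)
    lemma₂ = solve-∀

  module _ (H : Hypergraph) where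
    open Hypergraph H

    powerSum : ℕ → ℕ
    powerSum d = ℕΣ.⅀ (allFin order) λ v → degree H v ℕ.^ d

    edgeDegree : Edge → ℕ
    edgeDegree e = ℕΣ.⅀ (els (edge e)) (degree H)

    spread : ℕ
    spread = ℕΣ.⅀ (allFin size) λ e → edgeDegree e ℕ.* edgeDegree e

    degree-⅀ : ∀ v → degree H v ≡ ℕΣ.⅀ (allFin size) (λ e → ℕΣ.𝟙 (v ∈? edge e))
    degree-⅀ v = trans (sym (⅀-1 (filter (λ e → v ∈? edge e) (allFin size)))) (trans
      (ℕΣ.⅀-filter (λ e → v ∈? edge e) (λ _ → 1) (allFin size)) (ℕΣ.⅀-cong (allFin size) (λ e → ℕ.*-identityʳ _)))

    -- Double counting of incidences: a vertex is met once in each hyperedge through it.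
    ⅀-incidences : ∀ (f : Vertex → ℕ) → ℕΣ.⅀ (allFin size) (λ e → ℕΣ.⅀ (els (edge e)) f) ≡
                   ℕΣ.⅀ (allFin order) (λ v → degree H v ℕ.* f v)
    ⅀-incidences f = trans (ℕΣ.⅀-cong (allFin size) (λ e → ℕΣ.⅀-filter (_∈? edge e) f (allFin order)))
      (trans (ℕΣ.⅀-swap _ (allFin size) (allFin order)) (ℕΣ.⅀-cong (allFin order) λ v →
        trans (sym (ℕΣ.⅀-* (f v) _ (allFin size))) (cong (ℕ._* f v) (sym (degree-⅀ v)))))

    pairTotal : ℕ
    pairTotal = ℕΣ.⅀ (allFin size) (λ e → pairSum (degree H) (els (edge e)))

    ⅀-degree : ∀ {k} → Uniform k H → ℕΣ.⅀ (allFin order) (degree H) ≡ size ℕ.* k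
    ⅀-degree {k} uniform = trans (sym (trans (⅀-incidences (λ _ → 1)) (ℕΣ.⅀-cong (allFin order) (λ v → ℕ.*-identityʳ _))))
      (trans (ℕΣ.⅀-cong (allFin size) (λ e → trans (⅀-1 (els (edge e))) (trans (length-els (edge e)) (uniform e))))
        (trans (⅀-const k (allFin size)) (cong (ℕ._* k) (length-allFin size))))

    ⅀-edgeDegree : ℕΣ.⅀ (allFin size) edgeDegree ≡ powerSum 2
    ⅀-edgeDegree = trans (⅀-incidences (degree H)) (ℕΣ.⅀-cong (allFin order) (λ v → cong (degree H v ℕ.*_) (sym (ℕ.*-identityʳ _))))

    spread-split : spread ≡ powerSum 3 ℕ.+ 2 ℕ.* pairTotal
    spread-split = trans (ℕΣ.⅀-cong (allFin size) (λ e → square-⅀ (degree H) (els (edge e))))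
      (trans (ℕΣ.⅀-+ _ _ (allFin size)) (cong₂ ℕ._+_
        (trans (⅀-incidences (λ v → degree H v ℕ.* degree H v)) (ℕΣ.⅀-cong (allFin order) (λ v → cong (λ z → degree H v ℕ.* (degree H v ℕ.* z)) (sym (ℕ.*-identityʳ _)))))
        (sym (ℕΣ.*-⅀ 2 _ (allFin size)))))

    Degrees12 : Set
    Degrees12 = ∀ v → degree H v ≡ 1 ⊎ degree H v ≡ 2

    -- The number of vertices of degree 2 is the excess of the degree sum over the order, so these
    -- two numbers determine every power sum.
    powerSum-12 : Degrees12 → ∀ d → powerSum d ≡ order ℕ.+ (ℕΣ.⅀ (allFin order) (degree H) ∸ order) ℕ.* (2 ℕ.^ d ∸ 1)
    powerSum-12 deg12 d = trans (ℕΣ.⅀-cong (allFin order) pointwise) (trans (ℕΣ.⅀-+ _ _ (allFin order)) (cong₂ ℕ._+_ ones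
      (trans (sym (ℕΣ.⅀-* (2 ℕ.^ d ∸ 1) (λ v → degree H v ∸ 1) (allFin order))) (cong (ℕ._* (2 ℕ.^ d ∸ 1)) excess))))
      where
      ones : ℕΣ.⅀ (allFin order) (λ _ → 1) ≡ order
      ones = trans (⅀-1 (allFin order)) (length-allFin order)
      suc-pred : ∀ v → 1 ℕ.+ (degree H v ∸ 1) ≡ degree H v
      suc-pred v with degree H v | deg12 v
      ... | .1 | inj₁ refl = refl
      ... | .2 | inj₂ refl = refl
      excess : ℕΣ.⅀ (allFin order) (λ v → degree H v ∸ 1) ≡ ℕΣ.⅀ (allFin order) (degree H) ∸ order
      excess = trans (sym (ℕ.m+n∸m≡n order (ℕΣ.⅀ (allFin order) (λ v → degree H v ∸ 1)))) (cong (_∸ order)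
        (trans (cong (ℕ._+ ℕΣ.⅀ (allFin order) (λ v → degree H v ∸ 1)) (sym ones))
          (trans (sym (ℕΣ.⅀-+ (λ _ → 1) (λ v → degree H v ∸ 1) (allFin order))) (ℕΣ.⅀-cong (allFin order) suc-pred))))
      pointwise : ∀ v → degree H v ℕ.^ d ≡ 1 ℕ.+ (degree H v ∸ 1) ℕ.* (2 ℕ.^ d ∸ 1)
      pointwise v with degree H v | deg12 v
      ... | .1 | inj₁ refl = ℕ.^-zeroˡ d
      ... | .2 | inj₂ refl = trans (sym (ℕ.m+[n∸m]≡n (ℕ.>-nonZero⁻¹ (2 ℕ.^ d) {{ℕ.m^n≢0 2 d}}))) (cong suc (sym (ℕ.*-identityˡ _)))

  module Comparison {c ℓ₁ ℓ₂} (F : OrderedField c ℓ₁ ℓ₂) (k : ℕ) (3≤k : 3 ≤ k) (α : OrderedField.Carrier F) where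
    open OrderedField F
    open Tensors F using (TrA; Precedes)
    open Derivatives F
    open Constants F k
    open Positivity F
    private module R = CommutativeRing commutativeRing
    open R using (+-cong; +-congˡ; +-congʳ; *-cong; *-congˡ; *-congʳ; *-identityʳ; +-identityˡ; +-identityʳ; zeroʳ; *-assoc; distribˡ)
    open Sums R.commutativeSemiring
    open CSG R.*-commutativeSemigroup using (interchange)
    open CSG R.+-commutativeSemigroup using () renaming (interchange to +-interchange)
    open import Relation.Binary.Reasoning.Setoid R.setoid

    private
      p = k ∸ 1

      pow : Carrier → ℕ → Carrier
      pow y d = ∏ (replicate d y) (λ z → z)

      pow-pos : ∀ {y} d → 0# < y → 0# < pow y d
      pow-pos zero 0<y = 0<1
      pow-pos (suc d) 0<y = *-pos 0<y (pow-pos d 0<y)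

      β : Carrier
      β = 1# - α

      loopCircuits : ℕ → ℕ
      loopCircuits d = circ {1} k [] (replicate d Fin.zero)

      -- The coefficient of the power sum of degrees in the trace of order `d`, up to the common
      -- factor. The walks on loops at one vertex are counted on a set with one element, so that the
      -- constant does not refer to a hypergraph.
      Λ : ℕ → Carrier
      Λ d = 1/! (d ℕ.* p) * (pow α d * ι (loopCircuits d))

      ι-*-⅀ : ∀ {a} {A : Set a} y (f : A → ℕ) xs → ⅀ xs (λ z → y * ι (f z)) ≈ y * ι (ℕΣ.⅀ xs f)
      ι-*-⅀ y f xs = R.trans (R.sym (*-⅀ y (ι ∘ f) xs)) (*-congˡ (R.sym (ι-⅀ f xs)))

    ⅀-msets₁ : ∀ {a} {A : Set a} (g : List A → Carrier) ys → ⅀ (msets 1 ys) g ≈ ⅀ ys (λ y → g (y ∷ []))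
    ⅀-msets₁ g [] = R.refl
    ⅀-msets₁ g (y ∷ ys) = +-congˡ (⅀-msets₁ g ys)

    -- A multiset of two vertices is a doubled vertex or a pair of distinct ones. The shapes have
    -- separate coefficients because only the pairs will distinguish the hypergraphs.
    ⅀-msets₂ : ∀ {a} {A : Set a} (g : List A → Carrier) (f : A → ℕ) (C₂ C₁₁ : Carrier) ys → Unique ys →
      (∀ y → y L.∈ ys → g (y ∷ y ∷ []) ≈ C₂ * ι (f y ℕ.* f y)) →
      (∀ y z → y L.∈ ys → z L.∈ ys → y ≢ z → g (y ∷ z ∷ []) ≈ C₁₁ * ι (f y ℕ.* f z)) →
      ⅀ (msets 2 ys) g ≈ C₂ * ι (ℕΣ.⅀ ys (λ y → f y ℕ.* f y)) + C₁₁ * ι (pairSum f ys)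
    ⅀-msets₂ g f C₂ C₁₁ [] u h₂ h₁₁ = R.sym (R.trans (+-cong (zeroʳ _) (zeroʳ _)) (+-identityˡ _))
    ⅀-msets₂ g f C₂ C₁₁ (y ∷ ys) (y∉ ∷ u) h₂ h₁₁ = begin
      ⅀ (map (y ∷_) (msets 1 (y ∷ ys)) ++ msets 2 ys) g
        ≈⟨ ⅀-++ g (map (y ∷_) (msets 1 (y ∷ ys))) (msets 2 ys) ⟩
      ⅀ (map (y ∷_) (msets 1 (y ∷ ys))) g + ⅀ (msets 2 ys) g
        ≈⟨ +-cong (R.trans (R.reflexive (⅀-map g (y ∷_) (msets 1 (y ∷ ys)))) (⅀-msets₁ (g ∘ (y ∷_)) (y ∷ ys)))
             (⅀-msets₂ g f C₂ C₁₁ ys u (λ z z∈ → h₂ z (there z∈)) (λ z w z∈ w∈ → h₁₁ z w (there z∈) (there w∈))) ⟩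
      (g (y ∷ y ∷ []) + ⅀ ys (λ z → g (y ∷ z ∷ []))) + (C₂ * ι S₂ + C₁₁ * ι P)
        ≈⟨ +-congʳ (+-cong (h₂ y (here refl)) (R.trans
             (⅀-cong∈ ys (λ z z∈ → h₁₁ y z (here refl) (there z∈) (All.lookup y∉ z∈)))
             (R.trans (ι-*-⅀ C₁₁ (λ z → f y ℕ.* f z) ys) (*-congˡ (R.reflexive (cong ι (sym (ℕΣ.*-⅀ (f y) f ys)))))))) ⟩
      (C₂ * ι (f y ℕ.* f y) + C₁₁ * ι (f y ℕ.* ℕΣ.⅀ ys f)) + (C₂ * ι S₂ + C₁₁ * ι P)
        ≈⟨ +-interchange _ _ _ _ ⟩
      (C₂ * ι (f y ℕ.* f y) + C₂ * ι S₂) + (C₁₁ * ι (f y ℕ.* ℕΣ.⅀ ys f) + C₁₁ * ι P)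
        ≈⟨ +-cong (R.trans (*-congˡ (ι-+ (f y ℕ.* f y) S₂)) (distribˡ _ _ _)) (R.trans (*-congˡ (ι-+ (f y ℕ.* ℕΣ.⅀ ys f) P)) (distribˡ _ _ _)) ⟨
      C₂ * ι (f y ℕ.* f y ℕ.+ S₂) + C₁₁ * ι (f y ℕ.* ℕΣ.⅀ ys f ℕ.+ P) ∎
      where
      S₂ = ℕΣ.⅀ ys (λ y → f y ℕ.* f y)
      P = pairSum f ys

    module Statistics (H : Hypergraph) (simple : Simple H) (uniform : Uniform k H) (linear : Linear H) where
      open Hypergraph H
      open TraceFormula F k 3≤k H simple uniform linear α hiding (β)

      private
        n = order
        m = size
        cₙ = ι (p ℕ.^ (n ∸ 1))

        length-edge : ∀ e → length (els (edge e)) ≡ k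
        length-edge e = trans (length-els (edge e)) (uniform e)

        power-x : ∀ d i → ∏ (replicate d i) x ≈ pow α d * ι (degree H i ℕ.^ d)
        power-x zero i = R.sym (R.trans (*-congˡ ι-1) (*-identityʳ _))
        power-x (suc d) i = R.trans (*-congˡ (power-x d i)) (R.trans (interchange _ _ _ _) (*-congˡ (R.sym (ι-* (degree H i) _))))

        loopCircuits-eq : ∀ d i → Walks.circuits _≟_ (loopsOf {n} k (replicate d i)) ≡ loopCircuits d
        loopCircuits-eq d i = trans (cong (λ ls → circ k [] ls) (sym (map-replicate (λ _ → i) d Fin.zero)))
          (circ-map {1} {n} (λ _ → i) (λ { {Fin.zero} {Fin.zero} _ → refl }) k [] (replicate d Fin.zero))

        edge-powers : ∀ e → ∏ (els (edge e)) (λ _ → β) ≈ pow β k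
        edge-powers e = R.reflexive (trans (go (els (edge e))) (cong (pow β) (length-edge e)))
          where
          go : ∀ ys → ∏ ys (λ _ → β) ≡ pow β (length ys)
          go [] = refl
          go (y ∷ ys) = cong (β *_) (go ys)

      module _ (d : ℕ) (d≤ : suc d ≤ k ℕ.+ 2) where

        vertexPart : ⅀ (allFin n) (value (suc d) (λ ()) d≤ ∘ inj₁) ≈ Λ (suc d) * ι (powerSum H (suc d))
        vertexPart = R.trans (⅀-cong (allFin n) (λ i → R.trans
          (*-congˡ (R.trans (*-cong (power-x (suc d) i) (R.reflexive (cong ι (loopCircuits-eq (suc d) i))))
            (R.trans (*-assoc _ _ _) (R.trans (*-congˡ (R.*-comm _ _)) (R.sym (*-assoc _ _ _))))))
          (R.sym (*-assoc _ _ _)))) (ι-*-⅀ _ _ (allFin n))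

        edgePart : Carrier
        edgePart = ⅀ (allFin m) (λ e → ⅀ (msetsFor (suc d) (λ ()) d≤ (els (edge e))) (λ ls → value (suc d) (λ ()) d≤ (inj₂ (e , ls))))

        Tr-statistics : ∀ {y} → edgePart ≈ y → TrA k α H (suc d) ≈ cₙ * (Λ (suc d) * ι (powerSum H (suc d)) + y)
        Tr-statistics eq = R.trans (Tr-formula d d≤) (*-congˡ (+-cong vertexPart eq))

        msetsFor-≡ : ∀ j → suc d ≡ k ℕ.+ j → ∀ ys → msetsFor (suc d) (λ ()) d≤ ys ≡ msets j ys
        msetsFor-≡ j eq ys with k ≤? suc d
        ... | yes _ = cong (λ j → msets j ys) (trans (cong (_∸ k) eq) (ℕ.m+n∸m≡n k j))
        ... | no ¬k≤ = ⊥-elim (¬k≤ (subst (k ≤_) (sym eq) (ℕ.m≤m+n k j)))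

        edgePart-< : suc d ℕ.< k → edgePart ≈ 0#
        edgePart-< d<k = ⅀-0 (allFin m) (λ e _ → R.reflexive (cong (λ ms → ⅀ ms _) (none (els (edge e)))))
          where
          none : ∀ ys → msetsFor (suc d) (λ ()) d≤ ys ≡ []
          none ys with k ≤? suc d
          ... | yes k≤ = ⊥-elim (ℕ.<-irrefl refl (ℕ.<-≤-trans d<k k≤))
          ... | no _ = refl

        edgePart-0 : suc d ≡ k ℕ.+ 0 → edgePart ≈ (κ₀ k * pow β k) * ι m
        edgePart-0 eq = R.trans (⅀-cong (allFin m) (λ e → R.trans (R.reflexive (cong (λ ms → ⅀ ms _) (msetsFor-≡ 0 eq (els (edge e)))))
          (R.trans (+-identityʳ _) (R.trans (*-cong (R.trans (κ-none (els-unique (edge e))) (R.reflexive (cong κ₀ (length-edge e))))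
            (R.trans (*-identityʳ _) (edge-powers e))) (R.sym (R.trans (*-congˡ ι-1) (*-identityʳ _)))))))
          (R.trans (ι-*-⅀ _ (λ _ → 1) (allFin m)) (*-congˡ (R.reflexive (cong ι (trans (⅀-1 (allFin m)) (length-allFin m))))))

        edgePart-1 : suc d ≡ k ℕ.+ 1 → edgePart ≈ (κ₁ p * (pow β k * α)) * ι (powerSum H 2)
        edgePart-1 eq = R.trans (⅀-cong (allFin m) (λ e → R.trans (R.reflexive (cong (λ ms → ⅀ ms _) (msetsFor-≡ 1 eq (els (edge e)))))
          (R.trans (⅀-msets₁ _ (els (edge e))) (R.trans (⅀-cong∈ (els (edge e)) (λ a a∈ → R.trans
            (*-cong (κ-single (els-unique (edge e)) (trans (length-edge e) k≡) a∈) (*-cong (edge-powers e) (*-identityʳ _)))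
            (R.trans (*-congˡ (R.sym (*-assoc _ _ _))) (R.sym (*-assoc _ _ _))))) (ι-*-⅀ _ (degree H) (els (edge e)))))))
          (R.trans (ι-*-⅀ _ (edgeDegree H) (allFin m)) (*-congˡ (R.reflexive (cong ι (⅀-edgeDegree H)))))
          where
          k≡ : k ≡ suc p
          k≡ = sym (ℕ.m+[n∸m]≡n (ℕ.≤-trans (s≤s z≤n) 3≤k))

        edgePart-2 : suc d ≡ k ℕ.+ 2 → edgePart ≈
          (κ₂ p * (pow β k * (α * α))) * ι (powerSum H 3) + (κ₁₁ (p ∸ 1) * (pow β k * (α * α))) * ι (pairTotal H)
        edgePart-2 eq = R.trans (⅀-cong (allFin m) (λ e → R.trans (R.reflexive (cong (λ ms → ⅀ ms _) (msetsFor-≡ 2 eq (els (edge e)))))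
          (⅀-msets₂ _ (degree H) _ _ (els (edge e)) (els-unique (edge e))
            (λ y y∈ → R.trans (*-cong (κ-double (els-unique (edge e)) (trans (length-edge e) k≡) y∈) (*-cong (edge-powers e) (xx y y))) regroup)
            (λ y z y∈ z∈ y≢z → R.trans (*-cong (κ-pair (els-unique (edge e)) (trans (length-edge e) k≡₂) y∈ z∈ y≢z) (*-cong (edge-powers e) (xx y z))) regroup))))
          (R.trans (⅀-+ _ _ (allFin m)) (+-cong
            (R.trans (ι-*-⅀ _ (λ e → ℕΣ.⅀ (els (edge e)) (λ y → degree H y ℕ.* degree H y)) (allFin m))
              (*-congˡ (R.reflexive (cong ι (trans (⅀-incidences H (λ v → degree H v ℕ.* degree H v))
                (ℕΣ.⅀-cong (allFin n) (λ v → cong (λ z → degree H v ℕ.* (degree H v ℕ.* z)) (sym (ℕ.*-identityʳ _)))))))))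
            (ι-*-⅀ _ (λ e → pairSum (degree H) (els (edge e))) (allFin m))))
          where
          k≡ : k ≡ suc p
          k≡ = sym (ℕ.m+[n∸m]≡n (ℕ.≤-trans (s≤s z≤n) 3≤k))
          k≡₂ : k ≡ suc (suc (p ∸ 1))
          k≡₂ = trans k≡ (cong suc (sym (ℕ.m+[n∸m]≡n (ℕ.∸-monoˡ-≤ 1 (ℕ.≤-trans (s≤s (s≤s z≤n)) 3≤k)))))
          xx : ∀ y z → x y * (x z * 1#) ≈ (α * α) * ι (degree H y ℕ.* degree H z)
          xx y z = R.trans (*-congˡ (*-identityʳ _)) (R.trans (interchange _ _ _ _) (*-congˡ (R.sym (ι-* (degree H y) _))))
          regroup : ∀ {a b c d} → a * (b * (c * d)) ≈ (a * (b * c)) * d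
          regroup = R.trans (*-congˡ (R.sym (*-assoc _ _ _))) (R.sym (*-assoc _ _ _))

    module _ (G H : Hypergraph)
             (simpleG : Simple G) (uniformG : Uniform k G) (linearG : Linear G)
             (simpleH : Simple H) (uniformH : Uniform k H) (linearH : Linear H)
             (same-order : Hypergraph.order G ≡ Hypergraph.order H) (same-size : Hypergraph.size G ≡ Hypergraph.size H)
             (large : k ℕ.+ 3 ≤ Hypergraph.order G ℕ.* p ℕ.^ (Hypergraph.order G ∸ 1))
             (0<α : 0# < α) (α<1 : α < 1#) where
      private
        module SG = Statistics G simpleG uniformG linearG
        module SH = Statistics H simpleH uniformH linearH
        nG = Hypergraph.order G
        nH = Hypergraph.order H
        instance
          p-nonZero : ℕ.NonZero p
          p-nonZero = ℕ.>-nonZero (ℕ.∸-monoˡ-≤ 1 (ℕ.≤-trans (s≤s (s≤s z≤n)) 3≤k))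

        -- The order on hypergraphs admits only trace orders below the number of eigenvalues, which
        -- must therefore exceed the deciding order k + 2.
        bound : ∀ {d} → d ≤ k ℕ.+ 2 → d ≤ nG ℕ.* p ℕ.^ (nG ∸ 1) ∸ 1
        bound d≤ = ℕ.≤-trans d≤ (ℕ.≤-trans (ℕ.≤-reflexive (trans (cong (_∸ 1) (sym (ℕ.+-suc k 2))) refl) ) (ℕ.∸-monoˡ-≤ 1 large))

        c-pos : 0# < ι (p ℕ.^ (nG ∸ 1))
        c-pos = fromℕ#-pos (p ℕ.^ (nG ∸ 1)) {{ℕ.m^n≢0 p (nG ∸ 1)}}

        0<β : 0# < β
        0<β = <-respˡ (R.-‿inverseʳ α) (+-monoˡ-< (- α) α<1)

        *-monoˡ : ∀ {y a b} → 0# < y → a < b → y * a < y * b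
        *-monoˡ {y} {a} {b} 0<y a<b = <-respˡ (+-identityˡ _) (<-respʳ eq (+-monoˡ-< (y * a) (*-pos 0<y 0<b-a)))
          where
          0<b-a : 0# < b - a
          0<b-a = <-respˡ (R.-‿inverseʳ a) (+-monoˡ-< (- a) a<b)
          eq : y * (b - a) + y * a ≈ y * b
          eq = R.trans (R.sym (distribˡ y _ _)) (*-congˡ (R.trans (R.+-assoc b (- a) a) (R.trans (+-congˡ (R.-‿inverseˡ a)) (+-identityʳ b))))

        +-monoʳ : ∀ z {a b} → a < b → z + a < z + b
        +-monoʳ z a<b = <-respˡ (R.+-comm _ _) (<-respʳ (R.+-comm _ _) (+-monoˡ-< z a<b))

        cG≡cH : ι (p ℕ.^ (nG ∸ 1)) ≡ ι (p ℕ.^ (nH ∸ 1))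
        cG≡cH = cong (λ n → ι (p ℕ.^ (n ∸ 1))) same-order

        Tr-zero : TrA k α G 0 ≈ TrA k α H 0
        Tr-zero = R.reflexive (cong (λ n → ι (n ℕ.* p ℕ.^ (n ∸ 1))) same-order)

        same : ∀ d d≤ {y z} → SG.edgePart d d≤ ≈ y → SH.edgePart d d≤ ≈ z → powerSum G (suc d) ≡ powerSum H (suc d) → y ≈ z →
               TrA k α G (suc d) ≈ TrA k α H (suc d)
        same d d≤ eG eH eq y≈z = R.trans (SG.Tr-statistics d d≤ eG) (R.trans
          (*-cong (R.reflexive cG≡cH) (+-cong (*-congˡ (R.reflexive (cong ι eq))) y≈z)) (R.sym (SH.Tr-statistics d d≤ eH)))

      -- Order 2 is below `k`, so hyperedges do not contribute yet. The trace of order 1 sees only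
      -- the degree sum, which is `k` times the number of hyperedges.
      precedes-by-degrees : powerSum G 2 ℕ.< powerSum H 2 → Precedes k α G H
      precedes-by-degrees lt = same-order , 2 , s≤s z≤n , bound 2≤ , equal , strict
        where
        2≤ : 2 ≤ k ℕ.+ 2
        2≤ = ℕ.m≤n+m 2 k
        1≤ : 1 ≤ k ℕ.+ 2
        1≤ = ℕ.≤-trans (s≤s z≤n) 2≤
        ⅀-power-1 : ∀ H → powerSum H 1 ≡ ℕΣ.⅀ (allFin (Hypergraph.order H)) (degree H)
        ⅀-power-1 H = ℕΣ.⅀-cong (allFin (Hypergraph.order H)) (λ v → ℕ.*-identityʳ _)
        equal : ∀ t → t ℕ.< 2 → TrA k α G t ≈ TrA k α H t
        equal 0 _ = Tr-zero
        equal 1 _ = same 0 1≤ (SG.edgePart-< 0 1≤ (ℕ.≤-trans (s≤s (s≤s z≤n)) 3≤k)) (SH.edgePart-< 0 1≤ (ℕ.≤-trans (s≤s (s≤s z≤n)) 3≤k))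
          (trans (⅀-power-1 G) (trans (⅀-degree G uniformG) (trans (cong (ℕ._* k) same-size) (sym (trans (⅀-power-1 H) (⅀-degree H uniformH)))))) R.refl
        equal (suc (suc _)) (s≤s (s≤s ()))
        -- On a single vertex any list of arcs is a closed walk; what has to be checked is that the
        -- list is not empty.
        loopCircuits>0 : 0 ℕ.< loopCircuits 2
        loopCircuits>0 = go
          where
          L = loopsOf {1} k (replicate 2 Fin.zero)
          walk : ∀ L′ → IsWalk {V = Fin 1} Fin.zero Fin.zero L′
          walk [] = []
          walk ((Fin.zero , Fin.zero) ∷ L′) = Fin.zero ∷ walk L′
          len : length L ≡ p ℕ.+ (p ℕ.+ 0)
          len = trans (length-++ (replicate p _)) (cong₂ ℕ._+_ (length-replicate p) (trans (length-++ (replicate p _)) (cong (ℕ._+ 0) (length-replicate p))))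
            where open import Data.List.Properties using (length-++; length-replicate)
          go : 0 ℕ.< Walks.circuits _≟_ L
          go with L | len
          ... | [] | eq = ⊥-elim (ℕ.<-irrefl eq (ℕ.<-≤-trans (ℕ.>-nonZero⁻¹ p) (ℕ.m≤m+n p _)))
          ... | a ∷ L′ | _ with a | walk (a ∷ L′)
          ... | Fin.zero , Fin.zero | w = Walks.circuits>0 _≟_ w
        Λ-pos : 0# < Λ 2
        Λ-pos = *-pos (1/!-pos (2 ℕ.* p)) (*-pos (pow-pos 2 0<α) (positive loopCircuits>0))
          where
          positive : ∀ {q} → 0 ℕ.< q → 0# < ι q
          positive {suc q} _ = fromℕ#-pos (suc q)
        strict : TrA k α G 2 < TrA k α H 2
        strict = <-respˡ (R.sym (SG.Tr-statistics 1 2≤ (SG.edgePart-< 1 2≤ 3≤k)))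
          (<-respʳ (R.trans (*-congʳ (R.reflexive cG≡cH)) (R.sym (SH.Tr-statistics 1 2≤ (SH.edgePart-< 1 2≤ 3≤k))))
            (*-monoˡ c-pos (+-monoˡ-< 0# (*-fromℕ-mono-< Λ-pos lt))))

      -- All power sums agree, and with them the hyperedge parts of orders `k` and k + 1, which
      -- consist of the number of hyperedges and of the second power sum. At order k + 2 `pairTotal`
      -- decides; it inherits the inequality because `spread` is twice `pairTotal` plus the third
      -- power sum.
      precedes-by-spread : Degrees12 G → Degrees12 H → spread G ℕ.< spread H → Precedes k α G H
      precedes-by-spread degG degH lt = same-order , k ℕ.+ 2 , ℕ.≤-trans (s≤s z≤n) (ℕ.m≤n+m 2 k) , bound ℕ.≤-refl , equal , strict
        where
        same-powers : ∀ d → powerSum G d ≡ powerSum H d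
        same-powers d = trans (powerSum-12 G degG d) (trans (cong₂ (λ n s → n ℕ.+ (s ∸ n) ℕ.* (2 ℕ.^ d ∸ 1)) same-order
          (trans (⅀-degree G uniformG) (trans (cong (ℕ._* k) same-size) (sym (⅀-degree H uniformH))))) (sym (powerSum-12 H degH d)))
        equal : ∀ t → t ℕ.< k ℕ.+ 2 → TrA k α G t ≈ TrA k α H t
        equal zero _ = Tr-zero
        equal (suc d) d< with ℕ.<-cmp (suc d) k
        ... | tri< d<k _ _ = same d (ℕ.<⇒≤ d<) (SG.edgePart-< d (ℕ.<⇒≤ d<) d<k) (SH.edgePart-< d (ℕ.<⇒≤ d<) d<k) (same-powers (suc d)) R.refl

        ... | tri≈ _ d≡k _ = same d (ℕ.<⇒≤ d<) (SG.edgePart-0 d (ℕ.<⇒≤ d<) eq) (SH.edgePart-0 d (ℕ.<⇒≤ d<) eq) (same-powers (suc d))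
                (*-congˡ (R.reflexive (cong ι same-size)))
          where
          eq : suc d ≡ k ℕ.+ 0
          eq = trans d≡k (sym (ℕ.+-identityʳ k))
        ... | tri> _ _ k<d = same d (ℕ.<⇒≤ d<) (SG.edgePart-1 d (ℕ.<⇒≤ d<) eq) (SH.edgePart-1 d (ℕ.<⇒≤ d<) eq) (same-powers (suc d))
                (*-congˡ (R.reflexive (cong ι (same-powers 2))))
          where
          eq : suc d ≡ k ℕ.+ 1
          eq = ℕ.≤-antisym (ℕ.s≤s⁻¹ (ℕ.≤-trans d< (ℕ.≤-reflexive (ℕ.+-suc k 1)))) (ℕ.≤-trans (ℕ.≤-reflexive (ℕ.+-comm k 1)) k<d)
        pairs< : pairTotal G ℕ.< pairTotal H
        pairs< = ℕ.*-cancelˡ-< 2 _ _ (ℕ.+-cancelˡ-< (powerSum H 3) _ _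
          (subst (ℕ._< powerSum H 3 ℕ.+ 2 ℕ.* pairTotal H) (cong (ℕ._+ 2 ℕ.* pairTotal G) (same-powers 3))
            (subst₂ ℕ._<_ (spread-split G) (spread-split H) lt)))
          where open import Relation.Binary.PropositionalEquality using (subst₂)
        C-pos : 0# < κ₁₁ (p ∸ 1) * (pow β k * (α * α))
        C-pos = *-pos (κ₁₁-pos (p ∸ 1) (ℕ.≤-trans (s≤s (s≤s z≤n)) 3≤k)) (*-pos (pow-pos k 0<β) (*-pos 0<α 0<α))
        strict′ : ∀ d (eq : d ≡ k ℕ.+ 2) → TrA k α G d < TrA k α H d
        strict′ zero eq = ⊥-elim (ℕ.1+n≢0 (sym (trans eq (ℕ.+-suc k 1))))
        strict′ (suc d) eq = <-respˡ (R.sym (SG.Tr-statistics d d≤ (SG.edgePart-2 d d≤ eq)))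
          (<-respʳ (R.trans (*-cong (R.reflexive cG≡cH) (+-cong (*-congˡ (R.reflexive (cong ι (same-powers (suc d)))))
              (+-congʳ (*-congˡ (R.reflexive (cong ι (same-powers 3))))))) (R.sym (SH.Tr-statistics d d≤ (SH.edgePart-2 d d≤ eq))))
            (*-monoˡ c-pos (+-monoʳ _ (+-monoʳ _ (*-fromℕ-mono-< C-pos pairs<)))))
          where d≤ = ℕ.≤-reflexive eq
        strict : TrA k α G (k ℕ.+ 2) < TrA k α H (k ℕ.+ 2)
        strict = strict′ (k ℕ.+ 2) refl

-- Hyperedges with a parent: counting and isomorphism.

module Structures where

  open BigOperators
  open ClosedWalks
  open SubsetLists
  open PickCounting
  open TraceComparison
  open import Data.Empty using (⊥-elim)
  open import Data.Fin as Fin using (Fin; punchIn)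
  open import Data.Fin.Properties using (_≟_; any?; punchIn-injective; punchInᵢ≢i)
  open import Data.Fin.Permutation as Perm using (Permutation; _⟨$⟩ʳ_)
  open import Data.Fin.Subset using (_∈_)
  open import Data.Fin.Subset.Properties using (_∈?_)
  open import Data.List using ([]; _∷_; map; allFin)
  open import Data.List.Properties using (length-map)
  import Data.List.Membership.Propositional as L
  open import Data.List.Membership.Propositional.Properties using (∈-allFin; ∈-map⁻)
  open import Data.List.Relation.Binary.Permutation.Propositional as ↭ using (_↭_)
  open import Data.List.Relation.Unary.All as All using (All; []; _∷_)
  open import Data.List.Relation.Unary.AllPairs using ([]; _∷_)
  import Data.List.Relation.Unary.Unique.Propositional.Properties as Unique
  open import Data.Maybe as Maybe using (Maybe; just; nothing)
  import Data.Maybe.Properties as Maybe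
  open import Data.Nat as ℕ using (ℕ; zero; suc; _+_; _*_; _∸_; _≤_; _<_; z≤n)
  import Data.Nat.Properties as ℕ
  open import Data.Nat.Tactic.RingSolver using (solve-∀)
  open import Data.Product as × using (Σ-syntax; _×_; _,_; proj₁; proj₂)
  import Data.Product.Properties as ×ₚ
  open import Data.Sum using (inj₁; inj₂)
  open import Function using (_∘_; Injective; _↔_; Inverse; mk⇔)
  open import Relation.Binary.Definitions using (DecidableEquality)
  open import Relation.Binary.PropositionalEquality as ≡ using (_≡_; _≢_; refl; sym; trans; cong; cong₂; subst)
  open import Relation.Nullary using (Dec; yes; no)
  open ℕΣ

  ⅀-∀ : ∀ {n} (y : Fin n) (f : Fin n → ℕ) → (∀ x → x ≢ y → f x ≡ 0) → ⅀ (allFin n) f ≡ f y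
  ⅀-∀ {n} y f off = ⅀-single f (Unique.allFin⁺ n) (∈-allFin y) (λ {x} _ → off x)

  ⅀-indicator : ∀ {n} (y : Fin n) → ⅀ (allFin n) (λ x → 𝟙 (y ≟ x)) ≡ 1
  ⅀-indicator y = trans (⅀-∀ y _ (λ x x≢y → 𝟙-no (y ≟ x) (x≢y ∘ sym))) (𝟙-yes (y ≟ y) refl)

  ⅀-1-allFin : ∀ n → ⅀ (allFin n) (λ _ → 1) ≡ n
  ⅀-1-allFin n = trans (⅀-1 (allFin n)) (length-allFin n)

  allFin-punchIn : ∀ {n} (j : Fin (suc n)) → allFin (suc n) ↭ j ∷ map (punchIn j) (allFin n)
  allFin-punchIn {n} j = ⊆∧length≤⇒↭
    (All.tabulate (λ x∈ j≡x → let i , _ , eq = ∈-map⁻ (punchIn j) x∈ in punchInᵢ≢i j i (sym (trans j≡x eq)))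
      ∷ Unique.map⁺ (punchIn-injective j _ _) (Unique.allFin⁺ n))
    (λ _ → ∈-allFin _)
    (ℕ.≤-reflexive (trans (length-allFin (suc n)) (cong suc (sym (trans (length-map (punchIn j) (allFin n)) (length-allFin n))))))

  ⅀-punchIn : ∀ {n} (j : Fin (suc n)) (f : Fin (suc n) → ℕ) → ⅀ (allFin (suc n)) f ≡ f j + ⅀ (allFin n) (f ∘ punchIn j)
  ⅀-punchIn {n} j f = trans (⅀-↭ f (allFin-punchIn j)) (cong (f j +_) (⅀-map f (punchIn j) (allFin n)))

  ⅀-↔ : ∀ {m n} (ρ : Fin m ↔ Fin n) (f : Fin n → ℕ) → ⅀ (allFin n) f ≡ ⅀ (allFin m) (f ∘ Inverse.to ρ)
  ⅀-↔ {m} {n} ρ f = trans (⅀-↭ f (⊆∧length≤⇒↭ (Unique.map⁺ to-injective (Unique.allFin⁺ m)) (λ _ → ∈-allFin _)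
    (Unique-⊆⇒length≤ (Unique.allFin⁺ n) (λ {y} _ → subst (L._∈ map to (allFin m)) (strictlyInverseˡ y) (∈-map⁺ to (∈-allFin (from y)))))))
    (⅀-map f to (allFin m))
    where
    open Inverse ρ
    open import Data.List.Membership.Propositional.Properties using (∈-map⁺)
    to-injective : ∀ {x y} → to x ≡ to y → x ≡ y
    to-injective {x} {y} eq = trans (sym (strictlyInverseʳ x)) (trans (cong from eq) (strictlyInverseʳ y))

  module _ {a} {A : Set a} (_≟ᴬ_ : DecidableEquality A) where

    private
      value-taken : ∀ {n} (f : Fin n → A) i → ⅀ (allFin n) (λ j → 𝟙 (f j ≟ᴬ f i)) ≢ 0
      value-taken f i z = ℕ.<-irrefl (sym z) (ℕ.≤-trans (ℕ.≤-reflexive (sym (𝟙-yes (f i ≟ᴬ f i) refl)))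
        (∈⇒≤⅀ (λ j → 𝟙 (f j ≟ᴬ f i)) (∈-allFin i)))

    -- A greedy matching: the first element is paired with some `j` of the same label, which exists
    -- because the count of that label is not zero, and `j` is then removed.
    equinumerous : ∀ n n′ (f : Fin n → A) (h : Fin n′ → A) →
      (∀ a → ⅀ (allFin n) (λ i → 𝟙 (f i ≟ᴬ a)) ≡ ⅀ (allFin n′) (λ i → 𝟙 (h i ≟ᴬ a))) →
      Σ[ φ ∈ Permutation n n′ ] ∀ i → h (φ ⟨$⟩ʳ i) ≡ f i
    equinumerous zero zero f h eq = Perm.id , λ ()
    equinumerous zero (suc n′) f h eq = ⊥-elim (value-taken h Fin.zero (sym (eq (h Fin.zero))))
    equinumerous (suc n) n′ f h eq with ⅀≢0 (λ i → 𝟙 (h i ≟ᴬ f Fin.zero)) (allFin n′) nonzero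
      where
      nonzero : ⅀ (allFin n′) (λ i → 𝟙 (h i ≟ᴬ f Fin.zero)) ≢ 0
      nonzero z = value-taken f Fin.zero (trans (eq (f Fin.zero)) z)
    equinumerous (suc n) (suc n′) f h eq | j , _ , ne with h j ≟ᴬ f Fin.zero
    ... | no _ = ⊥-elim (ne refl)
    ... | yes hj≡f0 with equinumerous n n′ (f ∘ Fin.suc) (h ∘ punchIn j) eq′
      where
      eq′ : ∀ a → ⅀ (allFin n) (λ i → 𝟙 (f (Fin.suc i) ≟ᴬ a)) ≡ ⅀ (allFin n′) (λ i → 𝟙 (h (punchIn j i) ≟ᴬ a))
      eq′ a = ℕ.+-cancelˡ-≡ (𝟙 (f Fin.zero ≟ᴬ a)) _ _ (trans (sym (⅀-punchIn Fin.zero (λ i → 𝟙 (f i ≟ᴬ a)))) (trans (eq a)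
        (trans (⅀-punchIn j (λ i → 𝟙 (h i ≟ᴬ a))) (cong (λ z → 𝟙 (z ≟ᴬ a) + ⅀ (allFin n′) (λ i → 𝟙 (h (punchIn j i) ≟ᴬ a))) hj≡f0))))
    ... | φ , hφ = Perm.insert Fin.zero j φ , λ
      { Fin.zero → hj≡f0
      ; (Fin.suc i) → trans (cong h (Perm.insert-punchIn Fin.zero j φ i)) (hφ i) }

  module _ {m n : ℕ} (h : Fin m → Fin n) where

    coincidences : ℕ
    coincidences = ⅀ (allFin m) λ e → ⅀ (allFin m) λ f → 𝟙 (h e ≟ h f)

    fibre : Fin n → ℕ
    fibre y = ⅀ (allFin m) λ e → 𝟙 (h e ≟ y)

    ⅀-fibre : ⅀ (allFin n) fibre ≡ m
    ⅀-fibre = trans (⅀-swap _ (allFin n) (allFin m)) (trans (⅀-cong (allFin m) (λ e → ⅀-indicator (h e))) (⅀-1-allFin m))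

    -- Both sides count ordered pairs with a common value, sorted by the value or by the first
    -- member.
    ⅀-fibre² : ⅀ (allFin n) (λ y → fibre y * fibre y) ≡ coincidences
    ⅀-fibre² = trans (⅀-cong (allFin n) (λ y → ⅀-* (fibre y) _ (allFin m))) (trans (⅀-swap _ (allFin n) (allFin m))
      (⅀-cong (allFin m) (λ e → trans (⅀-∀ (h e) _ (λ y y≢ → cong (_* fibre y) (𝟙-no (h e ≟ y) (y≢ ∘ sym))))
        (trans (cong (_* fibre (h e)) (𝟙-yes (h e ≟ h e) refl)) (trans (ℕ.*-identityˡ _)
          (⅀-cong (allFin m) (λ f → 𝟙-⇔ (h f ≟ h e) (h e ≟ h f) sym sym)))))))

    coincidences-injective : Injective _≡_ _≡_ h → coincidences ≡ m
    coincidences-injective inj = trans (⅀-cong (allFin m) (λ e → trans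
      (⅀-cong (allFin m) (λ f → 𝟙-⇔ (h e ≟ h f) (e ≟ f) inj (cong h))) (⅀-indicator e))) (⅀-1-allFin m)

    -- The diagonal and a pair that is not on it.
    m<coincidences : ∀ {e f} → e ≢ f → h e ≡ h f → m < coincidences
    m<coincidences {e} {f} e≢f he≡hf = begin
      suc m
        ≡⟨ ℕ.+-comm 1 m ⟩
      m + 1
        ≡⟨ cong₂ _+_ (trans (⅀-cong (allFin m) ⅀-indicator) (⅀-1-allFin m)) (⅀-indicator e) ⟨
      ⅀ (allFin m) (λ x → ⅀ (allFin m) (λ y → 𝟙 (x ≟ y))) + ⅀ (allFin m) (λ x → 𝟙 (e ≟ x))
        ≡⟨ cong (⅀ (allFin m) (λ x → ⅀ (allFin m) (λ y → 𝟙 (x ≟ y))) +_) (⅀-cong (allFin m) (λ x → trans (sym (*-⅀ (𝟙 (e ≟ x)) _ (allFin m))) (trans (cong (𝟙 (e ≟ x) *_) (⅀-indicator f)) (ℕ.*-identityʳ _)))) ⟨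
      ⅀ (allFin m) (λ x → ⅀ (allFin m) (λ y → 𝟙 (x ≟ y))) + ⅀ (allFin m) (λ x → ⅀ (allFin m) (λ y → 𝟙 (e ≟ x) * 𝟙 (f ≟ y)))
        ≡⟨ trans (⅀-cong (allFin m) (λ x → ⅀-+ _ _ (allFin m))) (⅀-+ _ _ (allFin m)) ⟨
      ⅀ (allFin m) (λ x → ⅀ (allFin m) (λ y → 𝟙 (x ≟ y) + 𝟙 (e ≟ x) * 𝟙 (f ≟ y)))
        ≤⟨ ⅀-≤ (allFin m) (λ x → ⅀-≤ (allFin m) (λ y → pointwise x y)) ⟩
      coincidences ∎
      where
      open ℕ.≤-Reasoning
      pointwise : ∀ x y → 𝟙 (x ≟ y) + 𝟙 (e ≟ x) * 𝟙 (f ≟ y) ≤ 𝟙 (h x ≟ h y)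
      pointwise x y with e ≟ x | f ≟ y
      ... | yes refl | yes refl = ℕ.≤-reflexive (trans (cong (_+ 1) (𝟙-no (e ≟ f) e≢f)) (sym (𝟙-yes (h e ≟ h f) he≡hf)))
      ... | yes _ | no _ = diagonal
        where
        diagonal : 𝟙 (x ≟ y) + 0 ≤ 𝟙 (h x ≟ h y)
        diagonal with x ≟ y
        ... | yes refl = ℕ.≤-reflexive (sym (𝟙-yes (h x ≟ h x) refl))
        ... | no _ = z≤n
      ... | no _ | _ with x ≟ y
      ... | yes refl = ℕ.≤-reflexive (sym (𝟙-yes (h x ≟ h x) refl))
      ... | no _ = z≤n

  -- In a linear unicyclic hypergraph every vertex lies in exactly one hyperedge e
  -- (its owner) other than as the distinguished vertex ext e of that hyperedge, which
  -- links e to the next hyperedge on the cycle or on the way to the cycle.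
  record Structure (H : Hypergraph) : Set where
    open Hypergraph H
    field
      ext    : Edge → Vertex
      owner  : Vertex → Edge
      ext∈   : ∀ e → ext e ∈ edge e
      owner∈ : ∀ v → v ∈ edge (owner v)
      owner≢ : ∀ v → v ≢ ext (owner v)
      unique : ∀ {v e} → v ∈ edge e → v ≢ ext e → e ≡ owner v

    parent : Edge → Edge
    parent = owner ∘ ext

    -- The two cases are exclusive by `owner≢`. Every later count of incidences splits along this
    -- sum.
    incidence : ∀ v e → 𝟙 (v ∈? edge e) ≡ 𝟙 (owner v ≟ e) + 𝟙 (ext e ≟ v)
    incidence v e with owner v ≟ e | ext e ≟ v
    ... | yes refl | yes eq = ⊥-elim (owner≢ v (sym eq))
    ... | yes refl | no _ = 𝟙-yes (v ∈? edge e) (owner∈ v)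
    ... | no _ | yes refl = 𝟙-yes (v ∈? edge e) (ext∈ e)
    ... | no ne | no ne′ = 𝟙-no (v ∈? edge e) (λ v∈ → ne (sym (unique v∈ (ne′ ∘ sym))))

    degree-fibre : ∀ v → degree H v ≡ 1 + fibre ext v
    degree-fibre v = trans (degree-⅀ H v) (trans (⅀-cong (allFin size) (incidence v))
      (trans (⅀-+ _ _ (allFin size)) (cong (_+ fibre ext v) (⅀-indicator (owner v)))))

    powerSum-2 : powerSum H 2 ≡ order + 2 * size + coincidences ext
    powerSum-2 = trans (⅀-cong (allFin order) (λ v → trans (cong (λ z → z * (z * 1)) (degree-fibre v)) (square (fibre ext v))))
      (trans (⅀-+ _ _ (allFin order)) (cong₂ _+_ (trans (⅀-+ (λ _ → 1) _ (allFin order)) (cong₂ _+_ (⅀-1-allFin order)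
        (trans (sym (*-⅀ 2 (fibre ext) (allFin order))) (cong (2 *_) (⅀-fibre ext))))) (⅀-fibre² ext)))
      where
      square : ∀ c → (1 + c) * ((1 + c) * 1) ≡ (1 + 2 * c) + c * c
      square = solve-∀

    module _ {k : ℕ} (uniform : Uniform k H) where

      private
        ⅀-edge : ∀ e → ⅀ (allFin order) (λ v → 𝟙 (v ∈? edge e)) ≡ k
        ⅀-edge e = trans (sym (trans (⅀-filter (_∈? edge e) (λ _ → 1) (allFin order)) (⅀-cong (allFin order) (λ v → ℕ.*-identityʳ _))))
          (trans (⅀-1 (els (edge e))) (trans (length-els (edge e)) (uniform e)))

      owned : ∀ e → ⅀ (allFin order) (λ v → 𝟙 (owner v ≟ e)) + 1 ≡ k
      owned e = trans (cong (⅀ (allFin order) (λ v → 𝟙 (owner v ≟ e)) +_) (sym (⅀-indicator (ext e)))) (trans (sym (⅀-+ _ _ (allFin order)))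
        (trans (⅀-cong (allFin order) (λ v → sym (incidence v e))) (⅀-edge e)))

      -- Each hyperedge owns all its vertices but one, and each vertex has one owner. Hence all
      -- members of the class have the same order.
      order≡ : order ≡ size * (k ∸ 1)
      order≡ = trans (sym (⅀-1-allFin order)) (trans (⅀-cong (allFin order) (λ v → sym (⅀-indicator (owner v))))
        (trans (⅀-swap _ (allFin order) (allFin size)) (trans (⅀-cong (allFin size) (λ e → trans (sym (ℕ.m+n∸n≡m _ 1)) (cong (_∸ 1) (owned e))))
          (trans (⅀-const (k ∸ 1) (allFin size)) (cong (_* (k ∸ 1)) (length-allFin size))))))

      module _ (ext-injective : Injective _≡_ _≡_ ext) where

        degrees12 : Degrees12 H
        degrees12 v with any? (λ e → ext e ≟ v)
        ... | yes (e , refl) = inj₂ (trans (degree-fibre v) (cong suc (trans (⅀-∀ e _ (λ f f≢e → 𝟙-no (ext f ≟ ext e) (f≢e ∘ ext-injective))) (𝟙-yes (ext e ≟ ext e) refl))))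
        ... | no none = inj₁ (trans (degree-fibre v) (cong suc (⅀-0 (allFin size) (λ e _ → 𝟙-no (ext e ≟ v) (none ∘ (e ,_))))))

        -- Each of the `k` vertices counts once for its owner, and once more for each `f` with
        -- `ext f` in `e`; such an `f` is `e` itself or a child of `e`.
        edgeDegree-parent : ∀ e → edgeDegree H e ≡ k + 1 + fibre parent e
        edgeDegree-parent e = trans (⅀-filter (_∈? edge e) (degree H) (allFin order)) (trans
          (⅀-cong (allFin order) (λ v → trans (cong (𝟙 (v ∈? edge e) *_) (degree-fibre v)) (ℕ.*-suc (𝟙 (v ∈? edge e)) (fibre ext v))))
          (trans (⅀-+ _ _ (allFin order)) (trans (cong₂ _+_ (⅀-edge e) rest) (sym (ℕ.+-assoc k 1 _)))))
          where
          rest : ⅀ (allFin order) (λ v → 𝟙 (v ∈? edge e) * fibre ext v) ≡ 1 + fibre parent e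
          rest = trans (⅀-cong (allFin order) (λ v → *-⅀ (𝟙 (v ∈? edge e)) _ (allFin size))) (trans (⅀-swap _ (allFin order) (allFin size))
            (trans (⅀-cong (allFin size) (λ f → trans (⅀-∀ (ext f) _ (λ v v≢ → trans (cong (𝟙 (v ∈? edge e) *_) (𝟙-no (ext f ≟ v) (v≢ ∘ sym))) (ℕ.*-zeroʳ (𝟙 (v ∈? edge e)))))
              (trans (cong (𝟙 (ext f ∈? edge e) *_) (𝟙-yes (ext f ≟ ext f) refl)) (trans (ℕ.*-identityʳ _) (incidence (ext f) e)))))
            (trans (⅀-+ _ _ (allFin size)) (trans (ℕ.+-comm (fibre parent e) _) (cong (_+ fibre parent e)
              (trans (⅀-cong (allFin size) (λ f → 𝟙-⇔ (ext e ≟ ext f) (e ≟ f) ext-injective (cong ext))) (⅀-indicator e)))))))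

        spread≡ : spread H ≡ size * ((k + 1) * (k + 1)) + 2 * (k + 1) * size + coincidences parent
        spread≡ = trans (⅀-cong (allFin size) (λ e → trans (cong (λ z → z * z) (edgeDegree-parent e)) (square (k + 1) (fibre parent e))))
          (trans (⅀-+ _ _ (allFin size)) (cong₂ _+_ (trans (⅀-+ _ _ (allFin size)) (cong₂ _+_
            (trans (⅀-const _ (allFin size)) (cong (_* ((k + 1) * (k + 1))) (length-allFin size)))
            (trans (sym (*-⅀ (2 * (k + 1)) (fibre parent) (allFin size))) (cong (2 * (k + 1) *_) (⅀-fibre parent))))) (⅀-fibre² parent)))
          where
          square : ∀ a c → (a + c) * (a + c) ≡ (a * a + 2 * a * c) + c * c
          square = solve-∀

  module _ {G H : Hypergraph} (S : Structure G) (T : Structure H) where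
    private
      module G = Hypergraph G
      module H = Hypergraph H
      module S = Structure S
      module T = Structure T

    module _ {k : ℕ} (uniformG : Uniform k G) (uniformH : Uniform k H)
             (S-inj : Injective _≡_ _≡_ S.ext) (T-inj : Injective _≡_ _≡_ T.ext)
             (ρ : G.Edge ↔ H.Edge) (commutes : ∀ e → T.parent (Inverse.to ρ e) ≡ Inverse.to ρ (S.parent e)) where
      open Inverse ρ

      private
        to-injective : ∀ {x y} → to x ≡ to y → x ≡ y
        to-injective {x} {y} eq = trans (sym (strictlyInverseʳ x)) (trans (cong from eq) (strictlyInverseʳ y))

        module _ {K : Hypergraph} (R : Structure K) (R-inj : Injective _≡_ _≡_ (Structure.ext R)) where
          open Hypergraph K
          open Structure R

          -- For injective `ext` a vertex is the distinguished vertex of at most one hyperedge, so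
          -- owner and child together determine the hyperedges through it.
          child : Vertex → Maybe Edge
          child v with any? (λ e → ext e ≟ v)
          ... | yes (e , _) = just e
          ... | no _ = nothing

          child-ext : ∀ {v e} → ext e ≡ v → child v ≡ just e
          child-ext {v} {e} eq with any? (λ e → ext e ≟ v)
          ... | yes (f , eq′) = cong just (R-inj (trans eq′ (sym eq)))
          ... | no none = ⊥-elim (none (e , eq))

          ext-child : ∀ {v e} → child v ≡ just e → ext e ≡ v
          ext-child {v} eq with any? (λ e → ext e ≟ v)
          ext-child refl | yes (f , eq′) = eq′

          _≟ᵐ_ : DecidableEquality (Maybe Edge)
          _≟ᵐ_ = Maybe.≡-dec _≟_

          labels : Edge → Maybe Edge → ℕ
          labels e x = ⅀ (allFin order) λ v → 𝟙 (owner v ≟ e) * 𝟙 (child v ≟ᵐ x)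

          labels-just : ∀ e f → labels e (just f) ≡ 𝟙 (parent f ≟ e)
          labels-just e f = trans (⅀-∀ (ext f) _ (λ v v≢ → trans (cong (𝟙 (owner v ≟ e) *_) (𝟙-no (child v ≟ᵐ just f) (λ eq → v≢ (sym (ext-child eq))))) (ℕ.*-zeroʳ (𝟙 (owner v ≟ e)))))
            (trans (cong (𝟙 (parent f ≟ e) *_) (𝟙-yes (child (ext f) ≟ᵐ just f) (child-ext refl))) (ℕ.*-identityʳ _))

          -- Of the k - 1 vertices owned by `e`, those with a child correspond to the children of
          -- `e`; so the number without a child depends on `k` and `parent` only.
          labels-nothing : ∀ {k} → Uniform k K → ∀ e → labels e nothing + fibre parent e + 1 ≡ k
          labels-nothing uniform e = trans (cong (_+ 1) (trans (cong (labels e nothing +_) (⅀-cong (allFin size) (λ f → sym (labels-just e f))))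
            (trans (cong (labels e nothing +_) (⅀-swap _ (allFin size) (allFin order))) (trans (sym (⅀-+ _ _ (allFin order)))
              (⅀-cong (allFin order) (λ v → trans (cong (𝟙 (owner v ≟ e) * 𝟙 (child v ≟ᵐ nothing) +_) (sym (*-⅀ (𝟙 (owner v ≟ e)) _ (allFin size))))
                (trans (sym (ℕ.*-distribˡ-+ (𝟙 (owner v ≟ e)) _ _)) (trans (cong (𝟙 (owner v ≟ e) *_) (total v)) (ℕ.*-identityʳ _)))))))))
            (owned uniform e)
            where
            total : ∀ v → 𝟙 (child v ≟ᵐ nothing) + ⅀ (allFin size) (λ f → 𝟙 (child v ≟ᵐ just f)) ≡ 1
            total v with child v
            ... | nothing = cong suc (⅀-0 (allFin size) (λ f _ → 𝟙-no (nothing ≟ᵐ just f) (λ ())))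
            ... | just e = trans (⅀-cong (allFin size) (λ f → 𝟙-⇔ (just e ≟ᵐ just f) (e ≟ f) (λ { refl → refl }) (cong just))) (⅀-indicator e)

        Label : Set
        Label = G.Edge × Maybe G.Edge

        _≟ˡ_ : DecidableEquality Label
        _≟ˡ_ = ×ₚ.≡-dec _≟_ (Maybe.≡-dec _≟_)

        labelG : G.Vertex → Label
        labelG v = S.owner v , child S S-inj v

        labelH : H.Vertex → Label
        labelH v = from (T.owner v) , Maybe.map from (child T T-inj v)

        countG : ∀ e x → ⅀ (allFin G.order) (λ v → 𝟙 (labelG v ≟ˡ (e , x))) ≡ labels S S-inj e x
        countG e x = ⅀-cong (allFin G.order) pointwise
          where
          pointwise : ∀ v → 𝟙 (labelG v ≟ˡ (e , x)) ≡ 𝟙 (S.owner v ≟ e) * 𝟙 (Maybe.≡-dec _≟_ (child S S-inj v) x)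
          pointwise v = go (S.owner v ≟ e) (Maybe.≡-dec _≟_ (child S S-inj v) x)
            where
            go : ∀ (a : Dec (S.owner v ≡ e)) (b : Dec (child S S-inj v ≡ x)) → 𝟙 (labelG v ≟ˡ (e , x)) ≡ 𝟙 a * 𝟙 b
            go (yes a) (yes b) = 𝟙-yes (labelG v ≟ˡ (e , x)) (cong₂ _,_ a b)
            go (yes _) (no b) = 𝟙-no (labelG v ≟ˡ (e , x)) (b ∘ cong proj₂)
            go (no a) _ = 𝟙-no (labelG v ≟ˡ (e , x)) (a ∘ cong proj₁)

        countH : ∀ e x → ⅀ (allFin H.order) (λ v → 𝟙 (labelH v ≟ˡ (e , x))) ≡ labels T T-inj (to e) (Maybe.map to x)
        countH e x = ⅀-cong (allFin H.order) pointwise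
          where
          pointwise : ∀ v → 𝟙 (labelH v ≟ˡ (e , x)) ≡ 𝟙 (T.owner v ≟ to e) * 𝟙 (Maybe.≡-dec _≟_ (child T T-inj v) (Maybe.map to x))
          pointwise v = go (T.owner v ≟ to e) (Maybe.≡-dec _≟_ (child T T-inj v) (Maybe.map to x))
            where
            back : ∀ x {y} → y ≡ Maybe.map to x → Maybe.map from y ≡ x
            back nothing refl = refl
            back (just f) refl = cong just (strictlyInverseʳ f)
            forth : ∀ y {x} → Maybe.map from y ≡ x → y ≡ Maybe.map to x
            forth nothing refl = refl
            forth (just f) refl = cong just (sym (strictlyInverseˡ f))
            go : ∀ (a : Dec (T.owner v ≡ to e)) (b : Dec (child T T-inj v ≡ Maybe.map to x)) → 𝟙 (labelH v ≟ˡ (e , x)) ≡ 𝟙 a * 𝟙 b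
            go (yes a) (yes b) = 𝟙-yes (labelH v ≟ˡ (e , x)) (cong₂ _,_ (trans (cong from a) (strictlyInverseʳ e)) (back x b))
            go (yes _) (no b) = 𝟙-no (labelH v ≟ˡ (e , x)) (λ eq → b (forth (child T T-inj v) (cong proj₂ eq)))
            go (no a) _ = 𝟙-no (labelH v ≟ˡ (e , x)) (λ eq → a (trans (sym (strictlyInverseˡ _)) (cong to (cong proj₁ eq))))

        parents : ∀ e f → 𝟙 (T.parent (to f) ≟ to e) ≡ 𝟙 (S.parent f ≟ e)
        parents e f = 𝟙-⇔ (T.parent (to f) ≟ to e) (S.parent f ≟ e)
          (λ eq → to-injective (trans (sym (commutes f)) eq)) (λ eq → trans (commutes f) (cong to eq))

        same-labels : ∀ e x → labels S S-inj e x ≡ labels T T-inj (to e) (Maybe.map to x)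
        same-labels e (just f) = trans (labels-just S S-inj e f) (trans (sym (parents e f)) (sym (labels-just T T-inj (to e) (to f))))
        same-labels e nothing = ℕ.+-cancelʳ-≡ (fibre S.parent e) _ _ (ℕ.+-cancelʳ-≡ 1 _ _ (trans (labels-nothing S S-inj uniformG e)
          (trans (sym (labels-nothing T T-inj uniformH (to e))) (cong (λ z → labels T T-inj (to e) nothing + z + 1)
            (trans (⅀-↔ ρ _) (⅀-cong (allFin G.size) (parents e)))))))

      -- Label counts agree, so the vertices can be matched label by label. Incidence is then
      -- preserved because a vertex lies on `e` exactly when `e` is its owner or its child.
      structures-≅ : G ≅ H
      structures-≅ with equinumerous _≟ˡ_ G.order H.order labelG labelH
        (λ (e , x) → trans (countG e x) (trans (same-labels e x) (sym (countH e x))))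
      ... | φ , same = record
        { onVertices = φ
        ; onEdges    = ρ
        ; incidence  = λ v e → mk⇔ (forward v e) (backward v e)
        }
        where
        owner-φ : ∀ v → T.owner (φ ⟨$⟩ʳ v) ≡ to (S.owner v)
        owner-φ v = trans (sym (strictlyInverseˡ _)) (cong to (cong proj₁ (same v)))
        child-φ : ∀ v → Maybe.map from (child T T-inj (φ ⟨$⟩ʳ v)) ≡ child S S-inj v
        child-φ v = cong proj₂ (same v)
        forward : ∀ v e → v ∈ G.edge e → φ ⟨$⟩ʳ v ∈ H.edge (to e)
        forward v e v∈ with v ≟ S.ext e
        ... | no v≢ = subst (λ f → φ ⟨$⟩ʳ v ∈ H.edge f) (trans (owner-φ v) (cong to (sym (S.unique v∈ v≢)))) (T.owner∈ _)
        ... | yes refl = go (child T T-inj (φ ⟨$⟩ʳ v)) refl (trans (child-φ v) (child-ext S S-inj refl))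
          where
          go : ∀ x → child T T-inj (φ ⟨$⟩ʳ v) ≡ x → Maybe.map from x ≡ just e → φ ⟨$⟩ʳ v ∈ H.edge (to e)
          go (just f) eq refl = subst (λ h → φ ⟨$⟩ʳ v ∈ H.edge h) (sym (strictlyInverseˡ f)) (subst (_∈ H.edge f) (ext-child T T-inj eq) (T.ext∈ f))
        backward : ∀ v e → φ ⟨$⟩ʳ v ∈ H.edge (to e) → v ∈ G.edge e
        backward v e φv∈ with φ ⟨$⟩ʳ v ≟ T.ext (to e)
        ... | no ne = subst (λ f → v ∈ G.edge f) (sym (to-injective (trans (T.unique φv∈ ne) (owner-φ v)))) (S.owner∈ v)
        ... | yes eq = subst (_∈ G.edge e) (ext-child S S-inj (trans (sym (child-φ v)) (trans (cong (Maybe.map from) (child-ext T T-inj (sym eq))) (cong just (strictlyInverseʳ e))))) (S.ext∈ e)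

-- Lollipops: a cycle with a path attached.

module Lollipops where

  open BigOperators
  open ClosedWalks
  open SubsetLists
  open Structures
  open import Data.Empty using (⊥-elim)
  open import Data.Fin as Fin using (Fin; toℕ; fromℕ; inject₁)
  open import Data.Fin.Properties using (_≟_; toℕ-injective; toℕ-inject₁; toℕ-fromℕ; toℕ<n; toℕ-fromℕ<)
  open import Data.Fin.Induction using (<-weakInduction; >-weakInduction)
  open import Data.Fin.Relation.Unary.Top using (view; ‵fromℕ; ‵inject₁)
  open import Data.Fin.Subset using (Subset; _∈_; ∣_∣)
  open import Data.List using ([]; _∷_; allFin)
  open import Data.List.Relation.Unary.All as All using ([]; _∷_)
  open import Data.List.Relation.Unary.AllPairs using ([]; _∷_)
  open import Data.List.Relation.Unary.Any using (here; there)
  open import Data.Nat as ℕ using (ℕ; zero; suc; _+_; _≤_; z≤n; s≤s)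
  import Data.Nat.Properties as ℕ
  open import Data.Nat.DivMod using (m<n⇒m%n≡m; n%n≡0; _%_)
  open import Data.Product as × using (∃-syntax; _×_; _,_)
  import Data.Product.Properties as ×ₚ
  open import Data.Sum using (_⊎_; inj₁; inj₂)
  open import Function using (_∘_; case_of_; Injective; _↔_; Inverse; mk↔ₛ′)
  open import Relation.Binary.PropositionalEquality as ≡ using (_≡_; _≢_; refl; sym; trans; cong; cong₂; subst)
  open import Relation.Nullary using (¬_; Dec; yes; no)
  open ℕΣ

  toℕ-next : ∀ {n} (i : Fin (suc n)) → toℕ (next i) ≡ suc (toℕ i) % suc n
  toℕ-next i = toℕ-fromℕ< _

  next-inject₁ : ∀ {n} (i : Fin n) → next (inject₁ i) ≡ Fin.suc i
  next-inject₁ {n} i = toℕ-injective (trans (toℕ-next (inject₁ i)) (trans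
    (cong (λ m → suc m % suc n) (toℕ-inject₁ i)) (m<n⇒m%n≡m (s≤s (toℕ<n i)))))

  next-fromℕ : ∀ n → next (fromℕ n) ≡ Fin.zero
  next-fromℕ n = toℕ-injective (trans (toℕ-next (fromℕ n)) (trans (cong (λ m → suc m % suc n) (toℕ-fromℕ n)) (n%n≡0 (suc n))))

  prev : ∀ {n} → Fin (suc n) → Fin (suc n)
  prev {n} Fin.zero    = fromℕ n
  prev     (Fin.suc i) = inject₁ i

  next-prev : ∀ {n} (i : Fin (suc n)) → next (prev i) ≡ i
  next-prev {n} Fin.zero = next-fromℕ n
  next-prev (Fin.suc i)  = next-inject₁ i

  prev-next : ∀ {n} (i : Fin (suc n)) → prev (next i) ≡ i
  prev-next {n} i with view i
  ... | ‵fromℕ = cong prev (next-fromℕ n)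
  ... | ‵inject₁ j = cong prev (next-inject₁ j)

  next-injective : ∀ {n} {i j : Fin (suc n)} → next i ≡ next j → i ≡ j
  next-injective {i = i} {j} eq = trans (sym (prev-next i)) (trans (cong prev eq) (prev-next j))

  next≢ : ∀ {n} → 2 ≤ suc n → (i : Fin (suc n)) → next i ≢ i
  next≢ {suc n} 2≤ i eq with view i
  ... | ‵fromℕ = case trans (sym (next-fromℕ (suc n))) eq of λ ()
  ... | ‵inject₁ j = ℕ.1+n≢n (trans (cong toℕ (trans (sym (next-inject₁ j)) eq)) (toℕ-inject₁ j))
  next≢ {zero} (s≤s ())

  next²≢ : ∀ {n} → 3 ≤ suc n → (i : Fin (suc n)) → next (next i) ≢ i
  next²≢ {suc (suc n)} _ i eq with view i
  ... | ‵fromℕ = case trans (sym (cong next (next-fromℕ (suc (suc n))))) eq of λ ()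
  ... | ‵inject₁ j with trans (sym (cong next (next-inject₁ j))) eq
  ... | eq′ with view j
  ... | ‵fromℕ = case trans (sym (next-fromℕ (suc (suc n)))) eq′ of λ ()
  ... | ‵inject₁ h = ℕ.m+1+n≢m (toℕ h) (trans (ℕ.+-comm (toℕ h) 2) (trans (cong toℕ (trans (sym (next-inject₁ (Fin.suc h))) eq′))
          (trans (toℕ-inject₁ _) (toℕ-inject₁ h))))
  next²≢ {suc zero} (s≤s (s≤s ()))
  next²≢ {zero} (s≤s ())

  -- From any position `next` climbs to the last one, wraps around to zero and climbs again, so it
  -- passes every position.
  next-closed : ∀ {n p} (P : Fin (suc n) → Set p) → (∀ {i} → P i → P (next i)) → ∀ {i} → P i → ∀ j → P j
  next-closed {n} P closed {i} pi = <-weakInduction P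
    (subst P (next-fromℕ n) (closed (>-weakInduction (λ i → P i → P (fromℕ n)) (λ p → p)
      (λ i h p → h (subst P (next-inject₁ i) (closed p))) i pi)))
    (λ i p → subst P (next-inject₁ i) (closed p))

  two-elements : ∀ {n} (S : Subset n) → (∀ {v w} → v ∈ S → w ∈ S → v ≡ w) → ∣ S ∣ ≤ 1
  two-elements S h with els S | els-unique S | length-els S | ∈-els⁻ {S = S}
  ... | []        | _ | eq | _ = subst (_≤ 1) eq z≤n
  ... | _ ∷ []    | _ | eq | _ = subst (_≤ 1) eq ℕ.≤-refl
  ... | _ ∷ _ ∷ _ | (x≢y ∷ _) ∷ _ | _ | mem = ⊥-elim (x≢y (h (mem (here refl)) (mem (there (here refl)))))

  -- The positions of the hyperedges of C_g · P_r: inj₁ is the cycle, and inj₂ is the path,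
  -- whose start is attached to position z of the cycle in stepFrom z.
  Position : ℕ → ℕ → Set
  Position g₀ r = Fin (suc g₀) ⊎ Fin r

  stepFrom : ∀ {g₀ r} → Fin (suc g₀) → Position g₀ r → Position g₀ r
  stepFrom z (inj₁ i)           = inj₁ (next i)
  stepFrom z (inj₂ Fin.zero)    = inj₁ z
  stepFrom z (inj₂ (Fin.suc s)) = inj₂ (inject₁ s)

  step : ∀ {g₀ r} → Position g₀ r → Position g₀ r
  step = stepFrom Fin.zero

  -- The numbering turns `parent` into `step`. With `ext` injective and `k` given, this determines
  -- the hypergraph up to isomorphism.
  record Lollipop {H : Hypergraph} (S : Structure H) (g₀ r : ℕ) : Set where
    open Hypergraph H
    open Structure S
    field
      positions     : Position g₀ r ↔ Edge
      ext-injective : Injective _≡_ _≡_ ext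

    open Inverse positions public using () renaming (to to at; from to position; strictlyInverseˡ to at-position; strictlyInverseʳ to position-at)

    field
      parent-at : ∀ x → parent (at x) ≡ at (step x)

    at-injective : ∀ {x y} → at x ≡ at y → x ≡ y
    at-injective {x} {y} eq = trans (sym (position-at x)) (trans (cong position eq) (position-at y))

  lollipops-≅ : ∀ {k G H g₀ r} {S : Structure G} {T : Structure H} → Uniform k G → Uniform k H →
                Lollipop S g₀ r → Lollipop T g₀ r → G ≅ H
  lollipops-≅ {S = S} {T} uG uH L M = structures-≅ S T uG uH (Lollipop.ext-injective L) (Lollipop.ext-injective M)
    (mk↔ₛ′ (M.at ∘ L.position) (L.at ∘ M.position)
      (λ e → trans (cong M.at (L.position-at _)) (M.at-position e)) (λ e → trans (cong L.at (M.position-at _)) (L.at-position e)))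
    (λ e → trans (M.parent-at (L.position e)) (cong M.at (trans (sym (L.position-at _))
      (cong L.position (trans (sym (L.parent-at (L.position e))) (cong (Structure.parent S) (L.at-position e)))))))
    where
    module L = Lollipop L
    module M = Lollipop M

  -- `step` is injective on the cycle and on the path; the only collision is at position zero of the
  -- cycle, reached from its last position and from the start of the path. The start is described by
  -- `toℕ s ≡ 0` because `Fin r` may be empty.
  step-coincidence : ∀ {g₀ r} (x y : Position g₀ r) → step x ≡ step y → x ≡ y ⊎
    (x ≡ inj₁ (fromℕ g₀) × (∃[ s ] toℕ {r} s ≡ 0 × y ≡ inj₂ s)) ⊎ (y ≡ inj₁ (fromℕ g₀) × (∃[ s ] toℕ {r} s ≡ 0 × x ≡ inj₂ s))
  step-coincidence (inj₁ i) (inj₁ j) eq = inj₁ (cong inj₁ (next-injective (inj₁-injective eq)))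
    where open import Data.Sum.Properties using (inj₁-injective)
  step-coincidence {g₀} (inj₁ i) (inj₂ Fin.zero) eq = inj₂ (inj₁ (cong inj₁ (next-injective (trans (inj₁-injective eq) (sym (next-fromℕ g₀)))) , Fin.zero , refl , refl))
    where open import Data.Sum.Properties using (inj₁-injective)
  step-coincidence (inj₁ i) (inj₂ (Fin.suc s)) ()
  step-coincidence {g₀} (inj₂ Fin.zero) (inj₁ j) eq = inj₂ (inj₂ (cong inj₁ (next-injective (trans (inj₁-injective (sym eq)) (sym (next-fromℕ g₀)))) , Fin.zero , refl , refl))
    where open import Data.Sum.Properties using (inj₁-injective)
  step-coincidence (inj₂ (Fin.suc s)) (inj₁ j) ()
  step-coincidence (inj₂ Fin.zero) (inj₂ Fin.zero) eq = inj₁ refl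
  step-coincidence (inj₂ (Fin.suc s)) (inj₂ (Fin.suc t)) eq = inj₁ (cong (inj₂ ∘ Fin.suc) (inject₁-injective (inj₂-injective eq)))
    where open import Data.Sum.Properties using (inj₂-injective)
          open import Data.Fin.Properties using (inject₁-injective)

  pair : ∀ {m} → Fin m → Fin m → Fin m → Fin m → ℕ
  pair a b x y = 𝟙 (×ₚ.≡-dec _≟_ _≟_ (a , b) (x , y))

  ⅀-pair : ∀ {m} (a b : Fin m) → ⅀ (allFin m) (λ x → ⅀ (allFin m) (pair a b x)) ≡ 1
  ⅀-pair {m} a b = trans
    (⅀-∀ a _ (λ x x≢a → ⅀-0 (allFin m) (λ y _ → 𝟙-no (×ₚ.≡-dec _≟_ _≟_ (a , b) (x , y)) (λ { refl → x≢a refl }))))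
    (trans (⅀-∀ b _ (λ y y≢b → 𝟙-no (×ₚ.≡-dec _≟_ _≟_ (a , b) (a , y)) (λ { refl → y≢b refl })))
      (𝟙-yes (×ₚ.≡-dec _≟_ _≟_ (a , b) (a , b)) refl))

  ⅀-diagonal : ∀ m → ⅀ (allFin m) (λ x → ⅀ (allFin m) (λ y → 𝟙 (x ≟ y))) ≡ m
  ⅀-diagonal m = trans (⅀-cong (allFin m) ⅀-indicator) (⅀-1-allFin m)

  module _ {m : ℕ} where

    ⅀² : (Fin m → Fin m → ℕ) → ℕ
    ⅀² f = ⅀ (allFin m) λ x → ⅀ (allFin m) (f x)

    ⅀²-+ : ∀ f g → ⅀² (λ x y → f x y + g x y) ≡ ⅀² f + ⅀² g
    ⅀²-+ f g = trans (⅀-cong (allFin m) (λ x → ⅀-+ (f x) (g x) (allFin m))) (⅀-+ _ _ (allFin m))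

    ⅀²-≤ : ∀ {f g} → (∀ x y → f x y ≤ g x y) → ⅀² f ≤ ⅀² g
    ⅀²-≤ h = ⅀-≤ (allFin m) (λ x → ⅀-≤ (allFin m) (h x))

  pair-yes : ∀ {m} (a b : Fin m) → pair a b a b ≡ 1
  pair-yes a b = 𝟙-yes (×ₚ.≡-dec _≟_ _≟_ (a , b) (a , b)) refl

  module Coincidences {H : Hypergraph} (S : Structure H) {g₀ r} (L : Lollipop S g₀ r) where
    open Hypergraph H
    open Structure S
    open Lollipop L

    cycle-coincidences : r ≡ 0 → coincidences parent ≡ size
    cycle-coincidences refl = coincidences-injective parent injective
      where
      injective : Injective _≡_ _≡_ parent
      injective {e} {f} eq with step-coincidence (position e) (position f)
        (at-injective (trans (sym (parent-at _)) (trans (cong parent (at-position e)) (trans eq (trans (sym (cong parent (at-position f))) (parent-at _))))))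
      ... | inj₁ eq′ = trans (sym (at-position e)) (trans (cong at eq′) (at-position f))
      ... | inj₂ (inj₁ (_ , () , _))
      ... | inj₂ (inj₂ (_ , () , _))

    -- Besides the diagonal there is one unordered pair of hyperedges with a common parent, which
    -- counts twice.
    coincidences≤ : ∀ {r₀} → r ≡ suc r₀ → coincidences parent ≤ size + 2
    coincidences≤ refl = ℕ.≤-trans (⅀²-≤ {f = λ e f → 𝟙 (parent e ≟ parent f)} pointwise) (ℕ.≤-reflexive
      (trans (⅀²-+ (λ e f → 𝟙 (e ≟ f)) (λ e f → pair a b e f + pair b a e f)) (cong₂ _+_ (⅀-diagonal size) (trans (⅀²-+ (pair a b) (pair b a)) (cong₂ _+_ (⅀-pair a b) (⅀-pair b a))))))
      where
      a = at (inj₁ (fromℕ g₀))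
      b = at (inj₂ Fin.zero)
      pointwise : ∀ e f → 𝟙 (parent e ≟ parent f) ≤ 𝟙 (e ≟ f) + (pair a b e f + pair b a e f)
      pointwise e f with parent e ≟ parent f
      ... | no _ = z≤n
      ... | yes eq with step-coincidence (position e) (position f)
        (at-injective (trans (sym (parent-at _)) (trans (cong parent (at-position e)) (trans eq (trans (sym (cong parent (at-position f))) (parent-at _))))))
      ... | inj₁ eq′ = ℕ.≤-trans (ℕ.≤-reflexive (sym (𝟙-yes (e ≟ f) (trans (sym (at-position e)) (trans (cong at eq′) (at-position f)))))) (ℕ.m≤m+n _ _)
      ... | inj₂ (inj₁ (p , s , s≡0 , q)) = ℕ.≤-trans (ℕ.≤-trans (ℕ.≤-reflexive (sym (trans (cong₂ (pair a b)
              (trans (sym (at-position e)) (cong at p)) (trans (sym (at-position f)) (cong at (trans q (cong inj₂ (toℕ-injective s≡0)))))) (pair-yes a b))))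
              (ℕ.m≤m+n _ (pair b a e f))) (ℕ.m≤n+m _ (𝟙 (e ≟ f)))
      ... | inj₂ (inj₂ (p , s , s≡0 , q)) = ℕ.≤-trans (ℕ.≤-trans (ℕ.≤-reflexive (sym (trans (cong₂ (pair b a)
              (trans (sym (at-position e)) (cong at (trans q (cong inj₂ (toℕ-injective s≡0))))) (trans (sym (at-position f)) (cong at p))) (pair-yes b a))))
              (ℕ.m≤n+m _ (pair a b e f))) (ℕ.m≤n+m _ (𝟙 (e ≟ f)))

  -- The diagonal and the ordered pairs (a, b), (b, a) and (c, d) are disjoint. One order of the
  -- second pair already suffices to exceed m + 2.
  three-coincidences : ∀ {m n} (h : Fin m → Fin n) {a b c d : Fin m} → a ≢ b → h a ≡ h b → c ≢ d → h c ≡ h d →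
                       ¬ (c ≡ a × d ≡ b) → ¬ (c ≡ b × d ≡ a) → m + 3 ≤ coincidences h
  three-coincidences {m} h {a} {b} {c} {d} a≢b ab c≢d cd ne₁ ne₂ = ℕ.≤-trans (ℕ.≤-reflexive (sym
    (trans (⅀²-+ (λ x y → 𝟙 (x ≟ y)) (λ x y → pair a b x y + (pair b a x y + pair c d x y))) (cong₂ _+_ (⅀-diagonal m)
      (trans (⅀²-+ (pair a b) (λ x y → pair b a x y + pair c d x y)) (cong₂ _+_ (⅀-pair a b) (trans (⅀²-+ (pair b a) (pair c d)) (cong₂ _+_ (⅀-pair b a) (⅀-pair c d)))))))))
    (⅀²-≤ {g = λ x y → 𝟙 (h x ≟ h y)} pointwise)
    where
    pointwise : ∀ x y → 𝟙 (x ≟ y) + (pair a b x y + (pair b a x y + pair c d x y)) ≤ 𝟙 (h x ≟ h y)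
    pointwise x y = go (x ≟ y) (×ₚ.≡-dec _≟_ _≟_ (a , b) (x , y)) (×ₚ.≡-dec _≟_ _≟_ (b , a) (x , y)) (×ₚ.≡-dec _≟_ _≟_ (c , d) (x , y))
      where
      one : h x ≡ h y → 1 ≤ 𝟙 (h x ≟ h y)
      one eq = ℕ.≤-reflexive (sym (𝟙-yes (h x ≟ h y) eq))
      go : (p : Dec (x ≡ y)) (q : Dec ((a , b) ≡ (x , y))) (r : Dec ((b , a) ≡ (x , y))) (s : Dec ((c , d) ≡ (x , y))) →
           𝟙 p + (𝟙 q + (𝟙 r + 𝟙 s)) ≤ 𝟙 (h x ≟ h y)
      go (yes refl) (yes refl) _ _ = ⊥-elim (a≢b refl)
      go (yes refl) (no _) (yes refl) _ = ⊥-elim (a≢b refl)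
      go (yes refl) (no _) (no _) (yes refl) = ⊥-elim (c≢d refl)
      go (yes refl) (no _) (no _) (no _) = one refl
      go (no _) (yes refl) (yes refl) _ = ⊥-elim (a≢b refl)
      go (no _) (yes refl) (no _) (yes refl) = ⊥-elim (ne₁ (refl , refl))
      go (no _) (yes refl) (no _) (no _) = one ab
      go (no _) (no _) (yes refl) (yes refl) = ⊥-elim (ne₂ (refl , refl))
      go (no _) (no _) (yes refl) (no _) = one (sym ab)
      go (no _) (no _) (no _) (yes refl) = one cd
      go (no _) (no _) (no _) (no _) = z≤n

-- Lollipops are linear, unicyclic and of the right girth.

module LollipopClass where

  open Structures
  open Lollipops
  open import Data.Empty using (⊥-elim)
  open import Data.Fin as Fin using (Fin; toℕ; inject₁)
  open import Data.Fin.Properties using (_≟_; toℕ-inject₁; toℕ<n; injective⇒≤)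
  open import Data.Fin.Induction using (<-weakInduction)
  open import Data.Fin.Subset using (_∈_; _∩_; ∣_∣)
  open import Data.Fin.Subset.Properties using (x∈p∩q⁻)
  open import Data.List using ([]; _∷_)
  open import Data.List.Relation.Unary.All as All using ([]; _∷_)
  open import Data.List.Relation.Unary.AllPairs using ([]; _∷_)
  open import Data.Nat as ℕ using (ℕ; zero; suc; _∸_; _≤_; _<_; z≤n; s≤s)
  import Data.Nat.Properties as ℕ
  open import Data.Product as × using (∃-syntax; _×_; _,_; proj₁; proj₂)
  open import Data.Sum using (_⊎_; inj₁; inj₂)
  open import Function using (_∘_; case_of_; mk⇔)
  open import Relation.Binary.Construct.Closure.ReflexiveTransitive as Star using (Star; ε; _◅_; _◅◅_)
  open import Relation.Binary.PropositionalEquality as ≡ using (_≡_; _≢_; refl; sym; trans; cong; subst)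
  open import Relation.Nullary using (yes; no)

  module Membership (k m g₀ r : ℕ) (3≤k : 3 ≤ k) (3≤g : 3 ≤ suc g₀)
                    {H : Hypergraph} (S : Structure H) (L : Lollipop S g₀ r) (uniform : Uniform k H) where
    open Hypergraph H
    open Structure S
    open Lollipop L

    private
      g = suc g₀

    -- On the cycle this is where girth at least 3 enters; along the path `step` moves strictly
    -- towards the cycle. It forbids two hyperedges that are parents of each other.
    step²≢ : ∀ (x : Position g₀ r) → step (step x) ≢ x
    step²≢ (inj₁ i) eq = next²≢ 3≤g i (inj₁-injective eq)
      where open import Data.Sum.Properties using (inj₁-injective)
    step²≢ (inj₂ Fin.zero) ()
    step²≢ (inj₂ (Fin.suc Fin.zero)) ()
    step²≢ (inj₂ (Fin.suc (Fin.suc s))) eq = ℕ.m+1+n≢m (toℕ s) (trans (ℕ.+-comm (toℕ s) 2)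
      (sym (trans (sym (trans (toℕ-inject₁ _) (toℕ-inject₁ s))) (cong toℕ (inj₂-injective eq)))))
      where open import Data.Sum.Properties using (inj₂-injective)

    parent-position : ∀ e → position (parent e) ≡ step (position e)
    parent-position e = trans (cong (position ∘ parent) (sym (at-position e))) (trans (cong position (parent-at _)) (position-at _))

    parent²≢ : ∀ e → parent (parent e) ≢ e
    parent²≢ e eq = step²≢ (position e) (trans (cong step (sym (parent-position e))) (trans (sym (parent-position _)) (cong position eq)))

    -- A vertex that is the extension of neither hyperedge would be owned by both.
    shared : ∀ {v e f} → e ≢ f → v ∈ edge e → v ∈ edge f → (v ≡ ext e × parent e ≡ f) ⊎ (v ≡ ext f × parent f ≡ e)
    shared {v} {e} {f} e≢f v∈e v∈f with v ≟ ext e | v ≟ ext f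
    ... | yes refl | yes eq = ⊥-elim (e≢f (ext-injective eq))
    ... | yes refl | no ne = inj₁ (refl , sym (unique v∈f ne))
    ... | no ne | yes refl = inj₂ (refl , sym (unique v∈e ne))
    ... | no ne | no ne′ = ⊥-elim (e≢f (trans (unique v∈e ne) (sym (unique v∈f ne′))))

    -- Two common vertices coincide if they extend the same hyperedge; otherwise the two hyperedges
    -- would be parents of each other.
    linear : Linear H
    linear {e} {f} e≢f = two-elements (edge e ∩ edge f) same
      where
      same : ∀ {v w} → v ∈ edge e ∩ edge f → w ∈ edge e ∩ edge f → v ≡ w
      same v∈ w∈ with x∈p∩q⁻ (edge e) (edge f) v∈ | x∈p∩q⁻ (edge e) (edge f) w∈
      ... | v∈e , v∈f | w∈e , w∈f with shared e≢f v∈e v∈f | shared e≢f w∈e w∈f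
      ... | inj₁ (p , _) | inj₁ (q , _) = trans p (sym q)
      ... | inj₂ (p , _) | inj₂ (q , _) = trans p (sym q)
      ... | inj₁ (_ , p) | inj₂ (_ , q) = ⊥-elim (parent²≢ e (trans (cong parent p) q))
      ... | inj₂ (_ , p) | inj₁ (_ , q) = ⊥-elim (parent²≢ e (trans (cong parent q) p))

    simple : Simple H
    simple {e} {f} eq with e ≟ f
    ... | yes e≡f = e≡f
    ... | no e≢f = ⊥-elim (ℕ.<-irrefl refl (ℕ.≤-trans (ℕ.≤-trans (s≤s (s≤s z≤n)) 3≤k) (subst (_≤ 1) (uniform e)
        (subst (λ S → ∣ S ∣ ≤ 1) (trans (cong (edge e ∩_) (sym eq)) (∩-idem (edge e))) (linear e≢f)))))
      where open import Data.Fin.Subset.Properties using (∩-idem)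

    private
      _~_ : Vertex → Vertex → Set
      _~_ = Star (Adjacent H)

      ~-sym : ∀ {u v} → u ~ v → v ~ u
      ~-sym = Star.reverse (λ (e , p , q) → e , q , p)

      to-parent : ∀ e → ext e ~ ext (parent e)
      to-parent e = (parent e , owner∈ (ext e) , ext∈ (parent e)) ◅ ε

      base : Vertex
      base = ext (at (inj₁ Fin.zero))

      cycle~base : ∀ i → ext (at (inj₁ i)) ~ base
      cycle~base = <-weakInduction (λ i → ext (at (inj₁ i)) ~ base) ε (λ i h →
        ~-sym (subst (λ e → ext (at (inj₁ (inject₁ i))) ~ ext e) (trans (parent-at _) (cong (at ∘ inj₁) (next-inject₁ i))) (to-parent _)) ◅◅ h)

      path~base : ∀ r′ (s : Fin r) → toℕ s ≡ r′ → ext (at (inj₂ s)) ~ base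
      path~base _ Fin.zero refl = subst (λ e → ext (at (inj₂ Fin.zero)) ~ ext e) (parent-at _) (to-parent _)
      path~base (suc r′) (Fin.suc s) eq = subst (λ e → ext (at (inj₂ (Fin.suc s))) ~ ext e) (parent-at _) (to-parent _)
        ◅◅ path~base r′ (inject₁ s) (trans (toℕ-inject₁ s) (ℕ.suc-injective eq))

      ext~base : ∀ x → ext (at x) ~ base
      ext~base (inj₁ i) = cycle~base i
      ext~base (inj₂ s) = path~base (toℕ s) s refl

    connected : Connected H
    connected u v = to-base u ◅◅ ~-sym (to-base v)
      where
      to-base : ∀ v → v ~ base
      to-base v = (owner v , owner∈ v , ext∈ (owner v)) ◅ subst (λ e → ext e ~ base) (at-position (owner v)) (ext~base (position (owner v)))

    cyc : Fin g → Edge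
    cyc i = at (inj₁ i)

    cyc-injective : ∀ {i j} → cyc i ≡ cyc j → i ≡ j
    cyc-injective eq = inj₁-injective (at-injective eq)
      where open import Data.Sum.Properties using (inj₁-injective)

    cycle : Cycle H g
    cycle = record
      { 2≤length        = ℕ.≤-trans (s≤s (s≤s z≤n)) 3≤g
      ; vertex          = λ i → ext (cyc (prev i))
      ; hyperedge       = cyc
      ; vertex-distinct = λ {i} {j} eq → trans (sym (next-prev i)) (trans (cong next (cyc-injective (ext-injective eq))) (next-prev j))
      ; edge-distinct   = cyc-injective
      ; source          = λ i → subst (λ e → ext (cyc (prev i)) ∈ edge e) (trans (parent-at _) (cong cyc (next-prev i))) (owner∈ _)
      ; target          = λ i → subst (λ j → ext (cyc j) ∈ edge (cyc i)) (sym (prev-next i)) (ext∈ (cyc i))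
      }

    module _ {l₀ : ℕ} (D : Cycle H (suc l₀)) where
      private
        module D = Cycle D

        hyperedge≢next : ∀ i → D.hyperedge i ≢ D.hyperedge (next i)
        hyperedge≢next i eq = next≢ D.2≤length i (sym (D.edge-distinct eq))

        vertex≢next : ∀ i → D.vertex i ≢ D.vertex (next i)
        vertex≢next i eq = next≢ D.2≤length i (sym (D.vertex-distinct eq))

        source′ : ∀ i → D.vertex i ∈ edge (D.hyperedge (prev i))
        source′ i = subst (λ j → D.vertex j ∈ edge (D.hyperedge (prev i))) (next-prev i) (D.target (prev i))

        prev≢ : ∀ i → D.hyperedge (prev i) ≢ D.hyperedge i
        prev≢ i eq = hyperedge≢next (prev i) (trans eq (cong D.hyperedge (sym (next-prev i))))

        at-source : ∀ i → (D.vertex i ≡ ext (D.hyperedge (prev i)) × parent (D.hyperedge (prev i)) ≡ D.hyperedge i) ⊎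
                          (D.vertex i ≡ ext (D.hyperedge i) × parent (D.hyperedge i) ≡ D.hyperedge (prev i))
        at-source i = shared (prev≢ i) (source′ i) (D.source i)

        at-target : ∀ i → (D.vertex (next i) ≡ ext (D.hyperedge i) × parent (D.hyperedge i) ≡ D.hyperedge (next i)) ⊎
                          (D.vertex (next i) ≡ ext (D.hyperedge (next i)) × parent (D.hyperedge (next i)) ≡ D.hyperedge i)
        at-target i = shared (hyperedge≢next i) (D.target i) (D.source (next i))

        -- The two vertices at which the cycle passes a hyperedge are distinct, so one of them is
        -- not its extension; there the neighbour on the cycle is a child.
        has-child : ∀ i → ∃[ j ] parent (D.hyperedge j) ≡ D.hyperedge i
        has-child i with at-source i | at-target i
        ... | inj₁ (_ , p) | _ = prev i , p
        ... | inj₂ _ | inj₂ (_ , p) = next i , p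
        ... | inj₂ (p , _) | inj₁ (q , _) = ⊥-elim (vertex≢next i (trans p (sym q)))

        -- Every hyperedge of the cycle has a child on the cycle, so following children
        -- from a path hyperedge would leave the end of the path.
        not-path : ∀ b (s : Fin r) → r ∸ toℕ s ≡ b → ∀ i → D.hyperedge i ≢ at (inj₂ s)
        not-path b s eq i di with has-child i
        ... | j , p with position (D.hyperedge j) in pos
        ... | inj₁ c = case at-injective (trans (trans (sym (parent-at _)) (cong parent (trans (cong at (sym pos)) (at-position _)))) (trans p di)) of λ ()
        not-path b s eq i di | j , p | inj₂ Fin.zero =
          case at-injective (trans (trans (sym (parent-at _)) (cong parent (trans (cong at (sym pos)) (at-position _)))) (trans p di)) of λ ()
        not-path b s eq i di | j , p | inj₂ (Fin.suc t) with at-injective (trans (trans (sym (parent-at _)) (cong parent (trans (cong at (sym pos)) (at-position _)))) (trans p di))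
        not-path (suc b) .(inject₁ t) eq i di | j , p | inj₂ (Fin.suc t) | refl =
          not-path b (Fin.suc t) (ℕ.suc-injective (trans (sym (ℕ.+-∸-assoc 1 (ℕ.<⇒≤ (toℕ<n t)))) (trans (cong (r ∸_) (sym (toℕ-inject₁ t))) eq))) j
            (trans (sym (at-position _)) (cong at pos))
        not-path zero .(inject₁ t) eq i di | j , p | inj₂ (Fin.suc t) | refl =
          ℕ.<-irrefl (sym eq) (ℕ.m<n⇒0<n∸m (subst (_< r) (sym (toℕ-inject₁ t)) (ℕ.<⇒≤ (toℕ<n (Fin.suc t)))))

        on-cycle : ∀ i → ∃[ c ] D.hyperedge i ≡ cyc c
        on-cycle i with position (D.hyperedge i) in pos
        ... | inj₁ c = c , trans (sym (at-position _)) (cong at pos)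
        ... | inj₂ s = ⊥-elim (not-path _ s refl i (trans (sym (at-position _)) (cong at pos)))

        parent-cyc : ∀ c → parent (cyc c) ≡ cyc (next c)
        parent-cyc c = parent-at (inj₁ c)

        child-of : ∀ i j {c} → D.hyperedge i ≡ cyc c → parent (D.hyperedge j) ≡ D.hyperedge i → D.hyperedge j ≡ cyc (prev c)
        child-of i j {c} ci eq with on-cycle j
        ... | d , dj = trans dj (cong cyc (trans (sym (prev-next d)) (cong prev
                (cyc-injective (trans (sym (parent-cyc d)) (trans (cong parent (sym dj)) (trans eq ci)))))))

        -- The alternatives in `vertices` are the two directions in which `D` may run; `successor`
        -- lets `covers` go around.
        record Ends (i : Fin (suc l₀)) : Set where
          field
            c          : Fin g
            hyperedge≡ : D.hyperedge i ≡ cyc c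
            successor  : ∃[ j ] D.hyperedge j ≡ cyc (next c)
            vertices   : (D.vertex i ≡ ext (cyc c) × D.vertex (next i) ≡ ext (cyc (prev c))) ⊎
                         (D.vertex i ≡ ext (cyc (prev c)) × D.vertex (next i) ≡ ext (cyc c))

        ends : ∀ i → Ends i
        ends i = go (on-cycle i) (at-source i) (at-target i)
          where
          go : ∃[ c ] D.hyperedge i ≡ cyc c →
               (D.vertex i ≡ ext (D.hyperedge (prev i)) × parent (D.hyperedge (prev i)) ≡ D.hyperedge i) ⊎
               (D.vertex i ≡ ext (D.hyperedge i) × parent (D.hyperedge i) ≡ D.hyperedge (prev i)) →
               (D.vertex (next i) ≡ ext (D.hyperedge i) × parent (D.hyperedge i) ≡ D.hyperedge (next i)) ⊎
               (D.vertex (next i) ≡ ext (D.hyperedge (next i)) × parent (D.hyperedge (next i)) ≡ D.hyperedge i) → Ends i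
          go (c , ci) (inj₂ (p , _)) (inj₁ (q , _)) = ⊥-elim (vertex≢next i (trans p (sym q)))
          go (c , ci) (inj₁ (p , p′)) (inj₂ (q , q′)) =
            ⊥-elim (vertex≢next i (trans p (trans (cong ext (trans (child-of i (prev i) ci p′) (sym (child-of i (next i) ci q′)))) (sym q))))
          go (c , ci) (inj₂ (p , p′)) (inj₂ (q , q′)) = record
            { c = c ; hyperedge≡ = ci
            ; successor = prev i , trans (sym p′) (trans (cong parent ci) (parent-cyc c))
            ; vertices = inj₁ (trans p (cong ext ci) , trans q (cong ext (child-of i (next i) ci q′))) }
          go (c , ci) (inj₁ (p , p′)) (inj₁ (q , q′)) = record
            { c = c ; hyperedge≡ = ci
            ; successor = next i , trans (sym q′) (trans (cong parent ci) (parent-cyc c))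
            ; vertices = inj₂ (trans p (cong ext (child-of i (prev i) ci p′)) , trans q (cong ext ci)) }

      -- With each hyperedge `D` also contains its successor, and successors close up only after the
      -- whole cycle. Both the girth and the uniqueness of the cycle rest on this.
      covers : ∀ c → ∃[ j ] D.hyperedge j ≡ cyc c
      covers = next-closed (λ c → ∃[ j ] D.hyperedge j ≡ cyc c) closed (Fin.zero , proj₂ (on-cycle Fin.zero))
        where
        closed : ∀ {c} → ∃[ j ] D.hyperedge j ≡ cyc c → ∃[ j ] D.hyperedge j ≡ cyc (next c)
        closed {c} (j , eq) = let h , p = successor in h , trans p (cong (cyc ∘ next) (cyc-injective (trans (sym hyperedge≡) eq)))
          where open Ends (ends j) hiding (c)

      private
        to-D : ∀ c v → v ≡ ext (cyc (prev c)) ⊎ v ≡ ext (cyc c) → Traverses D v (cyc c)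
        to-D c v v≡ = go (covers c)
          where
          go : ∃[ j ] D.hyperedge j ≡ cyc c → Traverses D v (cyc c)
          go (j , eq) = j , eq , place v≡ vertices
            where
            open Ends (ends j) renaming (c to c′)
            c′≡c : c′ ≡ c
            c′≡c = cyc-injective (trans (sym hyperedge≡) eq)
            place : v ≡ ext (cyc (prev c)) ⊎ v ≡ ext (cyc c) →
                    (D.vertex j ≡ ext (cyc c′) × D.vertex (next j) ≡ ext (cyc (prev c′))) ⊎
                    (D.vertex j ≡ ext (cyc (prev c′)) × D.vertex (next j) ≡ ext (cyc c′)) → D.vertex j ≡ v ⊎ D.vertex (next j) ≡ v
            place (inj₁ eq) (inj₁ (p , q)) = inj₂ (trans q (trans (cong (ext ∘ cyc ∘ prev) c′≡c) (sym eq)))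
            place (inj₂ eq) (inj₁ (p , q)) = inj₁ (trans p (trans (cong (ext ∘ cyc) c′≡c) (sym eq)))
            place (inj₁ eq) (inj₂ (p , q)) = inj₁ (trans p (trans (cong (ext ∘ cyc ∘ prev) c′≡c) (sym eq)))
            place (inj₂ eq) (inj₂ (p , q)) = inj₂ (trans q (trans (cong (ext ∘ cyc) c′≡c) (sym eq)))

        from-D : ∀ j v → D.vertex j ≡ v ⊎ D.vertex (next j) ≡ v → Traverses cycle v (D.hyperedge j)
        from-D j v v≡ = c , sym hyperedge≡ , place v≡ vertices
          where
          open Ends (ends j)
          first : ∀ {v} → v ≡ ext (cyc (prev c)) → ext (cyc (prev c)) ≡ v ⊎ ext (cyc (prev (next c))) ≡ v
          first eq = inj₁ (sym eq)
          second : ∀ {v} → v ≡ ext (cyc c) → ext (cyc (prev c)) ≡ v ⊎ ext (cyc (prev (next c))) ≡ v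
          second eq = inj₂ (trans (cong (ext ∘ cyc) (prev-next c)) (sym eq))
          place : D.vertex j ≡ v ⊎ D.vertex (next j) ≡ v →
                  (D.vertex j ≡ ext (cyc c) × D.vertex (next j) ≡ ext (cyc (prev c))) ⊎
                  (D.vertex j ≡ ext (cyc (prev c)) × D.vertex (next j) ≡ ext (cyc c)) →
                  ext (cyc (prev c)) ≡ v ⊎ ext (cyc (prev (next c))) ≡ v
          place (inj₁ eq) (inj₁ (p , q)) = second (trans (sym eq) p)
          place (inj₂ eq) (inj₁ (p , q)) = first (trans (sym eq) q)
          place (inj₁ eq) (inj₂ (p , q)) = first (trans (sym eq) p)
          place (inj₂ eq) (inj₂ (p , q)) = second (trans (sym eq) q)

      same-cycle : SameCycle cycle D
      same-cycle v e = mk⇔ forward backward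
        where
        forward : Traverses cycle v e → Traverses D v e
        forward (c , refl , inj₁ eq) = to-D c v (inj₁ (sym eq))
        forward (c , refl , inj₂ eq) = to-D c v (inj₂ (trans (sym eq) (cong (ext ∘ cyc) (prev-next c))))
        backward : Traverses D v e → Traverses cycle v e
        backward (j , refl , v≡) = from-D j v v≡

      g≤length : g ≤ suc l₀
      g≤length = injective⇒≤ {f = proj₁ ∘ covers} (λ {c} {d} eq → cyc-injective
        (trans (sym (proj₂ (covers c))) (trans (cong D.hyperedge eq) (proj₂ (covers d)))))

    private
      same : ∀ {l} (D : Cycle H l) → SameCycle cycle D × g ≤ l
      same {zero} D = case Cycle.2≤length D of λ ()
      same {suc l} D = same-cycle D , g≤length D

    linear-unicyclic : size ≡ m → LinearUnicyclic k m g H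
    linear-unicyclic size≡m = record
      { simple    = simple
      ; uniform   = uniform
      ; linear    = linear
      ; unicyclic = connected , g , cycle , proj₁ ∘ same
      ; size-m    = size≡m
      ; girth     = cycle , proj₂ ∘ same
      }

-- Loop erasure and the closing of paths to cycles.

module SimplePaths where

  open Lollipops
  open import Data.Empty using (⊥-elim)
  open import Data.Fin as Fin using (Fin; fromℕ; inject₁)
  open import Data.Fin.Properties using (_≟_; any?)
  open import Data.Fin.Relation.Unary.Top using (view; ‵fromℕ; ‵inject₁)
  open import Data.Fin.Subset using (_∈_)
  open import Data.Nat as ℕ using (ℕ; zero; suc; z≤n; s≤s)
  open import Data.Product as × using (∃-syntax; Σ-syntax; _×_; _,_; proj₁; proj₂)
  open import Data.Sum using (inj₂)
  open import Data.Vec using (Vec; []; _∷_; lookup)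
  open import Function using (Equivalence)
  open import Relation.Binary.Construct.Closure.ReflexiveTransitive as Star using (Star; ε; _◅_)
  open import Relation.Binary.PropositionalEquality using (_≡_; _≢_; refl; sym; trans; cong; subst)
  open import Relation.Nullary using (¬_; yes; no)

  module Paths (H : Hypergraph) {p} (P : Hypergraph.Edge H → Set p) where
    open Hypergraph H

    -- Walks keep to hyperedges that satisfy `P`, so a hyperedge outside `P` can close a path to a
    -- cycle without being repeated.
    Step : Vertex → Vertex → Set p
    Step u v = ∃[ e ] P e × u ∈ edge e × v ∈ edge e

    Walk : Vertex → Vertex → Set p
    Walk = Star Step

    Walk-sym : ∀ {u v} → Walk u v → Walk v u
    Walk-sym = Star.reverse λ (e , pe , u∈ , v∈) → e , pe , v∈ , u∈

    -- A walk to y that repeats neither a vertex nor a hyperedge; us are the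
    -- vertices on it other than y.
    data Path (y : Vertex) : Vertex → ∀ {l} → Vec Vertex l → Vec Edge l → Set p where
      done : Path y y [] []
      extend : ∀ {u v e l} {us : Vec Vertex l} {es : Vec Edge l} → u ∈ edge e → v ∈ edge e → P e → Path y v us es →
             u ≢ y → (∀ i → lookup us i ≢ u) → (∀ i → lookup es i ≢ e) → Path y u (u ∷ us) (e ∷ es)

    SomePath : Vertex → Vertex → Set p
    SomePath y u = ∃[ l ] Σ[ us ∈ Vec Vertex l ] Σ[ es ∈ Vec Edge l ] Path y u us es

    from-vertex : ∀ {y v l} {us : Vec Vertex l} {es : Vec Edge l} → Path y v us es → ∀ i → SomePath y (lookup us i)
    from-vertex path@(extend _ _ _ _ _ _ _) Fin.zero = _ , _ , _ , path
    from-vertex (extend _ _ _ path _ _ _) (Fin.suc i) = from-vertex path i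

    -- When a new hyperedge already occurs on the path, the path is resumed behind that occurrence.
    -- The last component says that no new vertices appear, so that `u` stays absent in `prepend`.
    from-edge : ∀ {y v l} {us : Vec Vertex l} {es : Vec Edge l} → Path y v us es → ∀ i →
      ∃[ z ] z ∈ edge (lookup es i) × (∃[ l′ ] Σ[ us′ ∈ Vec Vertex l′ ] Σ[ es′ ∈ Vec Edge l′ ] Path y z us′ es′ ×
        (∀ j → lookup es′ j ≢ lookup es i) × (∀ j → ∃[ h ] lookup us′ j ≡ lookup us h))
    from-edge (extend _ v∈ _ path _ _ e∉) Fin.zero = _ , v∈ , _ , _ , _ , path , e∉ , (λ j → Fin.suc j , refl)
    from-edge (extend _ _ _ path _ _ _) (Fin.suc i) with from-edge path i
    ... | z , z∈ , l′ , us′ , es′ , path′ , e∉ , sub = z , z∈ , l′ , us′ , es′ , path′ , e∉ , λ j → ×.map Fin.suc (λ eq → eq) (sub j)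

    -- A repeated vertex cuts the path there. A repeated hyperedge contains `u` as well, so it can
    -- be taken from `u` directly to the place where the path leaves it.
    prepend : ∀ {y u v e} → u ∈ edge e → v ∈ edge e → P e → SomePath y v → SomePath y u
    prepend {y} {u} {v} {e} u∈ v∈ pe (l , us , es , path) with u ≟ y
    ... | yes refl = _ , _ , _ , done
    ... | no u≢y with any? (λ i → lookup us i ≟ u)
    ... | yes (i , refl) = from-vertex path i
    ... | no u∉ with any? (λ i → lookup es i ≟ e)
    ... | no e∉ = _ , _ , _ , extend u∈ v∈ pe path u≢y (λ i eq → u∉ (i , eq)) (λ i eq → e∉ (i , eq))
    ... | yes (i , refl) with from-edge path i
    ... | z , z∈ , _ , us′ , _ , path′ , e∉ , sub =
      _ , _ , _ , extend u∈ z∈ pe path′ u≢y (λ j eq → u∉ (proj₁ (sub j) , trans (sym (proj₂ (sub j))) eq)) e∉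

    loop-erasure : ∀ {u y} → Walk u y → SomePath y u
    loop-erasure ε = _ , _ , _ , done
    loop-erasure ((e , pe , u∈ , v∈) ◅ walk) = prepend u∈ v∈ pe (loop-erasure walk)

    module _ {y : Vertex} where

      sources≢ : ∀ {v l} {us : Vec Vertex l} {es : Vec Edge l} → Path y v us es → ∀ i → y ≢ lookup us i
      sources≢ (extend _ _ _ _ u≢y _ _) Fin.zero eq = u≢y (sym eq)
      sources≢ (extend _ _ _ path _ _ _) (Fin.suc i) = sources≢ path i

      sources-distinct : ∀ {v l} {us : Vec Vertex l} {es : Vec Edge l} → Path y v us es → ∀ i j → lookup us i ≡ lookup us j → i ≡ j
      sources-distinct (extend _ _ _ _ _ _ _) Fin.zero Fin.zero eq = refl
      sources-distinct (extend _ _ _ _ _ u∉ _) Fin.zero (Fin.suc j) eq = ⊥-elim (u∉ j (sym eq))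
      sources-distinct (extend _ _ _ _ _ u∉ _) (Fin.suc i) Fin.zero eq = ⊥-elim (u∉ i eq)
      sources-distinct (extend _ _ _ path _ _ _) (Fin.suc i) (Fin.suc j) eq = cong Fin.suc (sources-distinct path i j eq)

      edges-distinct : ∀ {v l} {us : Vec Vertex l} {es : Vec Edge l} → Path y v us es → ∀ i j → lookup es i ≡ lookup es j → i ≡ j
      edges-distinct (extend _ _ _ _ _ _ _) Fin.zero Fin.zero eq = refl
      edges-distinct (extend _ _ _ _ _ _ e∉) Fin.zero (Fin.suc j) eq = ⊥-elim (e∉ j (sym eq))
      edges-distinct (extend _ _ _ _ _ _ e∉) (Fin.suc i) Fin.zero eq = ⊥-elim (e∉ i eq)
      edges-distinct (extend _ _ _ path _ _ _) (Fin.suc i) (Fin.suc j) eq = cong Fin.suc (edges-distinct path i j eq)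

      edges-P : ∀ {v l} {us : Vec Vertex l} {es : Vec Edge l} → Path y v us es → ∀ i → P (lookup es i)
      edges-P (extend _ _ pe _ _ _ _) Fin.zero = pe
      edges-P (extend _ _ _ path _ _ _) (Fin.suc i) = edges-P path i

      sources∈ : ∀ {v l} {us : Vec Vertex l} {es : Vec Edge l} → Path y v us es → ∀ i → lookup us i ∈ edge (lookup es i)
      sources∈ (extend u∈ _ _ _ _ _ _) Fin.zero = u∈
      sources∈ (extend _ _ _ path _ _ _) (Fin.suc i) = sources∈ path i

      first-source : ∀ {v l} {us : Vec Vertex (suc l)} {es : Vec Edge (suc l)} → Path y v us es → lookup us Fin.zero ≡ v
      first-source (extend _ _ _ _ _ _ _) = refl

      targets∈ : ∀ {v l} {us : Vec Vertex (suc l)} {es : Vec Edge (suc l)} → Path y v us es →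
                 ∀ i → lookup us (Fin.suc i) ∈ edge (lookup es (inject₁ i))
      targets∈ (extend _ v∈ _ path@(extend _ _ _ _ _ _ _) _ _ _) Fin.zero = v∈
      targets∈ (extend _ _ _ path@(extend _ _ _ _ _ _ _) _ _ _) (Fin.suc i) = targets∈ path i

      end∈ : ∀ {v l} {us : Vec Vertex (suc l)} {es : Vec Edge (suc l)} → Path y v us es → y ∈ edge (lookup es (fromℕ l))
      end∈ (extend _ v∈ _ done _ _ _) = v∈
      end∈ (extend _ _ _ path@(extend _ _ _ _ _ _ _) _ _ _) = end∈ path

      -- The cycle starts at `y`, crosses `f` to `x` and follows the path back, whence index zero
      -- for `f`. As `f` violates `P`, it does not occur on the path.
      close : ∀ {f x l} {us : Vec Vertex (suc l)} {es : Vec Edge (suc l)} → Path y x us es → ¬ P f → x ∈ edge f → y ∈ edge f →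
              Cycle H (suc (suc l))
      close {f} {x} {l} {us} {es} path ¬pf x∈ y∈ = record
        { 2≤length = s≤s (s≤s z≤n)
        ; vertex = lookup (y ∷ us)
        ; hyperedge = lookup (f ∷ es)
        ; vertex-distinct = λ {i} {j} → vertex-distinct i j
        ; edge-distinct = λ {i} {j} → edge-distinct i j
        ; source = λ { Fin.zero → y∈ ; (Fin.suc i) → sources∈ path i }
        ; target = target
        }
        where
        vertex-distinct : ∀ i j → lookup (y ∷ us) i ≡ lookup (y ∷ us) j → i ≡ j
        vertex-distinct Fin.zero Fin.zero eq = refl
        vertex-distinct Fin.zero (Fin.suc j) eq = ⊥-elim (sources≢ path j eq)
        vertex-distinct (Fin.suc i) Fin.zero eq = ⊥-elim (sources≢ path i (sym eq))
        vertex-distinct (Fin.suc i) (Fin.suc j) eq = cong Fin.suc (sources-distinct path i j eq)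
        edge-distinct : ∀ i j → lookup (f ∷ es) i ≡ lookup (f ∷ es) j → i ≡ j
        edge-distinct Fin.zero Fin.zero eq = refl
        edge-distinct Fin.zero (Fin.suc j) eq = ⊥-elim (¬pf (subst P (sym eq) (edges-P path j)))
        edge-distinct (Fin.suc i) Fin.zero eq = ⊥-elim (¬pf (subst P eq (edges-P path i)))
        edge-distinct (Fin.suc i) (Fin.suc j) eq = cong Fin.suc (edges-distinct path i j eq)
        target : ∀ i → lookup (y ∷ us) (next i) ∈ edge (lookup (f ∷ es) i)
        target i with view i
        ... | ‵fromℕ = subst (λ j → lookup (y ∷ us) j ∈ edge (lookup es (fromℕ l))) (sym (next-fromℕ (suc l))) (end∈ path)
        ... | ‵inject₁ Fin.zero = subst (λ j → lookup (y ∷ us) j ∈ edge f) (sym (next-inject₁ {suc l} Fin.zero)) (subst (_∈ edge f) (sym (first-source path)) x∈)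
        ... | ‵inject₁ (Fin.suc j) = subst (λ h → lookup (y ∷ us) h ∈ edge (lookup es (inject₁ j))) (sym (next-inject₁ (Fin.suc j))) (targets∈ path j)

  module Bypass (H : Hypergraph) {l : ℕ} (C : Cycle H l)
                (C-unique : ∀ {l′} (D : Cycle H l′) → SameCycle C D) where
    open Hypergraph H

    -- A walk around f closes up with f to a cycle, which has to be C.
    bypass : ∀ {p} {P : Edge → Set p} {f x y} → ¬ P f → x ≢ y → x ∈ edge f → y ∈ edge f → Paths.Walk H P x y →
             Traverses C x f
    bypass {P = P} {f} {x} {y} ¬pf x≢y x∈ y∈ walk with Paths.loop-erasure H P walk
    ... | zero , [] , [] , Paths.done = ⊥-elim (x≢y refl)
    ... | suc l , us , es , path = Equivalence.from (C-unique (Paths.close H P path ¬pf x∈ y∈) x f)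
            (Fin.zero , refl , inj₂ (trans (cong (lookup (y ∷ us)) (next-inject₁ {suc l} Fin.zero)) (Paths.first-source H P path)))

-- Growing a unicyclic hypergraph from its cycle.

module GrowthFromCycle where

  open Structures
  open Lollipops
  open SimplePaths
  open import Data.Empty using (⊥-elim)
  open import Data.Fin as Fin using (Fin; toℕ; fromℕ; inject₁)
  open import Data.Fin.Properties using (_≟_; any?; all?; ¬∀⟶∃¬; injective⇒≤; toℕ-inject₁)
  open import Data.Fin.Induction using (<-weakInduction; >-weakInduction)
  open import Data.Fin.Subset using (_∈_)
  open import Data.Nat as ℕ using (ℕ; zero; suc; _+_; _≤_; _<_; z≤n; s≤s)
  import Data.Nat.Properties as ℕ
  open import Data.Product as × using (∃-syntax; Σ-syntax; _×_; _,_; proj₁; proj₂)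
  open import Data.Sum as ⊎ using (_⊎_; inj₁; inj₂)
  open import Function using (_∘_; Injective)
  open import Relation.Binary.Construct.Closure.ReflexiveTransitive as Star using (Star; ε; _◅_; _◅◅_)
  open import Relation.Binary.PropositionalEquality using (_≡_; _≢_; refl; sym; trans; cong; subst)
  open import Relation.Nullary using (¬_; Dec; yes; no; _⊎-dec_)

  -- The hyperedges off the cycle, listed so that the parent of each of them is on the
  -- cycle or comes later in the list.
  record Decomposition (H : Hypergraph) (g₀ : ℕ) : Set where
    open Hypergraph H
    field
      structure : Structure H
    open Structure structure
    field
      onCycle           : Fin (suc g₀) → Edge
      onCycle-injective : Injective _≡_ _≡_ onCycle
      onCycle-parent    : ∀ i → parent (onCycle i) ≡ onCycle (next i)
      r                 : ℕ
      off               : Fin r → Edge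
      off-injective     : Injective _≡_ _≡_ off
      disjoint          : ∀ i j → onCycle i ≢ off j
      covers            : ∀ e → (∃[ i ] onCycle i ≡ e) ⊎ (∃[ j ] off j ≡ e)
      off-parent        : ∀ j → (∃[ i ] parent (off j) ≡ onCycle i) ⊎ (∃[ h ] toℕ j < toℕ h × parent (off j) ≡ off h)

  module Growth (H : Hypergraph) (connected : Connected H) (nonempty : ∀ e → ∃[ v ] v ∈ Hypergraph.edge H e)
                (g₀ : ℕ) (2≤g : 2 ≤ suc g₀) (C : Cycle H (suc g₀)) (C-unique : ∀ {l} (D : Cycle H l) → SameCycle C D) where
    open Hypergraph H
    open Cycle C
    open Bypass H C C-unique

    private
      origin : Vertex
      origin = vertex Fin.zero

      target-suc : ∀ (j : Fin g₀) → vertex (Fin.suc j) ∈ edge (hyperedge (inject₁ j))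
      target-suc j = subst (λ i → vertex i ∈ edge (hyperedge (inject₁ j))) (next-inject₁ j) (target (inject₁ j))

      target-last : origin ∈ edge (hyperedge (fromℕ g₀))
      target-last = subst (λ i → vertex i ∈ edge (hyperedge (fromℕ g₀))) (next-fromℕ g₀) (target (fromℕ g₀))

      to-origin : ∀ {p} {P : Edge → Set p} → (∀ i → P (hyperedge i)) → ∀ j → Paths.Walk H P (vertex j) origin
      to-origin all = <-weakInduction _ ε (λ j walk → (hyperedge (inject₁ j) , all _ , target-suc j , source _) ◅ walk)

      -- From a vertex of the cycle walk down, or up and across the last hyperedge,
      -- according to the side of i on which it lies.
      around : ∀ i j → Paths.Walk H (_≢ hyperedge i) (vertex j) origin
      around i j with toℕ j ℕ.≤? toℕ i
      ... | yes j≤i = <-weakInduction (λ j → toℕ j ≤ toℕ i → Paths.Walk H (_≢ hyperedge i) (vertex j) origin)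
              (λ _ → ε) (λ j walk j<i → (hyperedge (inject₁ j) ,
                (λ eq → ℕ.<-irrefl (trans (sym (toℕ-inject₁ j)) (cong toℕ (edge-distinct eq))) j<i) , target-suc j , source _)
                ◅ walk (ℕ.≤-trans (ℕ.≤-reflexive (toℕ-inject₁ j)) (ℕ.<⇒≤ j<i))) j j≤i
      ... | no j≰i = >-weakInduction (λ j → toℕ i < toℕ j → Paths.Walk H (_≢ hyperedge i) (vertex j) origin)
              (λ i<j → (hyperedge (fromℕ g₀) , (λ eq → ℕ.<-irrefl (sym (cong toℕ (edge-distinct eq))) i<j) , source _ , target-last) ◅ ε)
              (λ j walk i<j → (hyperedge (inject₁ j) , (λ eq → ℕ.<-irrefl (sym (cong toℕ (edge-distinct eq))) i<j) , source _ , target-suc j)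
                ◅ walk (ℕ.<-trans (subst (toℕ i <_) (toℕ-inject₁ j) i<j) (ℕ.n<1+n _))) j (ℕ.≰⇒> j≰i)

      traversed-end : ∀ {x i} → Traverses C x (hyperedge i) → x ≡ vertex i ⊎ x ≡ vertex (next i)
      traversed-end (j , eq , v≡) with edge-distinct eq
      ... | refl = ⊎.map sym sym v≡

      -- If `x` were not `vertex i`, then crossing `hyperedge j` and going around the cycle would
      -- bypass `hyperedge i`, which makes `x` the excluded end.
      shared-end : ∀ {x i j} → hyperedge i ≢ hyperedge j → x ∈ edge (hyperedge i) → x ∈ edge (hyperedge j) →
                   x ≢ vertex (next i) → x ≡ vertex i
      shared-end {x} {i} {j} i≢j x∈i x∈j x≢ with x ≟ vertex i
      ... | yes eq = eq
      ... | no x≢i with traversed-end (bypass {P = _≢ hyperedge i} (λ ne → ne refl) x≢i x∈i (source i)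
                          ((hyperedge j , (i≢j ∘ sym) , x∈j , source j) ◅ around i j ◅◅ Paths.Walk-sym H _ (around i i)))
      ... | inj₁ eq = eq
      ... | inj₂ eq = ⊥-elim (x≢ eq)

      In : ∀ {r} → (Fin r → Edge) → Edge → Set
      In off e = (∃[ i ] hyperedge i ≡ e) ⊎ (∃[ j ] off j ≡ e)

      in? : ∀ {r} (off : Fin r → Edge) e → Dec (In off e)
      in? off e = any? (λ i → hyperedge i ≟ e) ⊎-dec any? (λ j → off j ≟ e)

      -- The hyperedges collected so far are those of the cycle and of `off`. The values of `ext`
      -- matter on these only; `reach` supplies walks for bypasses, and `attached` records that the
      -- parent was collected before.
      record State : Set where
        field
          r             : ℕ
          off           : Fin r → Edge
          ext           : Edge → Vertex
          off-injective : Injective _≡_ _≡_ off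
          disjoint      : ∀ i j → hyperedge i ≢ off j
          ext-cycle     : ∀ i → ext (hyperedge i) ≡ vertex (next i)
          ext∈          : ∀ {e} → In off e → ext e ∈ edge e
          own-unique    : ∀ {e f x} → In off e → In off f → x ∈ edge e → x ≢ ext e → x ∈ edge f → x ≢ ext f → e ≡ f
          owned         : ∀ {e} → In off e → ∃[ f ] In off f × ext e ∈ edge f × ext e ≢ ext f
          reach         : ∀ {e x} → In off e → x ∈ edge e → Paths.Walk H (In off) x origin
          attached         : ∀ j → ∃[ f ] ((∃[ i ] hyperedge i ≡ f) ⊎ (∃[ h ] toℕ j < toℕ h × off h ≡ f)) ×
                                       ext (off j) ∈ edge f × ext (off j) ≢ ext f

      initial : State
      initial = record
        { r             = 0
        ; off           = λ ()
        ; ext           = ext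
        ; off-injective = λ { {()} }
        ; disjoint      = λ i ()
        ; ext-cycle     = ext-cycle
        ; ext∈          = λ { (inj₁ (i , refl)) → subst (_∈ edge (hyperedge i)) (sym (ext-cycle i)) (target i) }
        ; own-unique    = λ { (inj₁ (i , refl)) (inj₁ (j , refl)) → own-unique i j }
        ; owned         = λ { (inj₁ (i , refl)) → hyperedge (next i) , inj₁ (next i , refl) ,
                              subst (_∈ edge (hyperedge (next i))) (sym (ext-cycle i)) (source (next i)) ,
                              (λ eq → next≢ 2≤g (next i) (sym (vertex-distinct (trans (sym (ext-cycle i)) (trans eq (ext-cycle (next i))))))) }
        ; reach         = λ { (inj₁ (i , refl)) x∈ → (hyperedge i , inj₁ (i , refl) , x∈ , source i) ◅ to-origin (λ j → inj₁ (j , refl)) i }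
        ; attached         = λ ()
        }
        where
        ext : Edge → Vertex
        ext e with any? (λ i → hyperedge i ≟ e)
        ... | yes (i , _) = vertex (next i)
        -- A default value, replaced once the hyperedge is collected.
        ... | no _ = origin
        ext-cycle : ∀ i → ext (hyperedge i) ≡ vertex (next i)
        ext-cycle i with any? (λ j → hyperedge j ≟ hyperedge i)
        ... | yes (j , eq) = cong (vertex ∘ next) (edge-distinct eq)
        ... | no none = ⊥-elim (none (i , refl))
        own-unique : ∀ i j {x} → x ∈ edge (hyperedge i) → x ≢ ext (hyperedge i) → x ∈ edge (hyperedge j) → x ≢ ext (hyperedge j) →
                     hyperedge i ≡ hyperedge j
        own-unique i j x∈i x≢i x∈j x≢j with hyperedge i ≟ hyperedge j
        ... | yes eq = eq
        ... | no ne = cong hyperedge (vertex-distinct (trans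
                (sym (shared-end ne x∈i x∈j (λ eq → x≢i (trans eq (sym (ext-cycle i))))))
                (shared-end (ne ∘ sym) x∈j x∈i (λ eq → x≢j (trans eq (sym (ext-cycle j)))))))

      module Grow (S : State) (f : Edge) (f∉ : ¬ In (State.off S) f) (p : Vertex) (p∈f : p ∈ edge f)
                  {e₀ : Edge} (e₀∈ : In (State.off S) e₀) (p∈e₀ : p ∈ edge e₀) where
        open State S

        -- The newest hyperedge takes index zero and shifts the others, so that parents keep larger
        -- indices than their children.
        off′ : Fin (suc r) → Edge
        off′ Fin.zero    = f
        off′ (Fin.suc j) = off j

        ext′ : Edge → Vertex
        ext′ e with e ≟ f
        ... | yes _ = p
        ... | no _  = ext e

        ext′-f : ext′ f ≡ p
        ext′-f with f ≟ f
        ... | yes _ = refl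
        ... | no ne = ⊥-elim (ne refl)

        ext′-old : ∀ {e} → In off e → ext′ e ≡ ext e
        ext′-old {e} e∈ with e ≟ f
        ... | yes refl = ⊥-elim (f∉ e∈)
        ... | no _ = refl

        weaken : ∀ {e} → In off e → In off′ e
        weaken = ⊎.map (λ q → q) (×.map Fin.suc (λ q → q))

        view-In : ∀ {e} → In off′ e → e ≡ f ⊎ In off e
        view-In (inj₁ q) = inj₂ (inj₁ q)
        view-In (inj₂ (Fin.zero , eq)) = inj₁ (sym eq)
        view-In (inj₂ (Fin.suc j , eq)) = inj₂ (inj₂ (j , eq))

        -- Another vertex of f among the old hyperedges would give a bypass of f.
        only-p : ∀ {x e} → x ∈ edge f → In off e → x ∈ edge e → x ≡ p
        only-p {x} x∈f e∈ x∈e with x ≟ p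
        ... | yes eq = eq
        ... | no x≢p with bypass {P = In off} f∉ x≢p x∈f p∈f (reach e∈ x∈e ◅◅ Paths.Walk-sym H _ (reach e₀∈ p∈e₀))
        ... | i , eq , _ = ⊥-elim (f∉ (inj₁ (i , eq)))

        -- If `p` happens to be the extension of the hyperedge on which it was found, the owner of
        -- that extension serves instead.
        p-owned : ∃[ e ] In off e × p ∈ edge e × p ≢ ext e
        p-owned with p ≟ ext e₀
        ... | no ne = _ , e₀∈ , p∈e₀ , ne
        ... | yes refl = owned e₀∈

        lift-walk : ∀ {x} → Paths.Walk H (In off) x origin → Paths.Walk H (In off′) x origin
        lift-walk = Star.map (λ (e , e∈ , u∈ , v∈) → e , weaken e∈ , u∈ , v∈)

        grow : State
        grow = record
          { r             = suc r
          ; off           = off′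
          ; ext           = ext′
          ; off-injective = λ {i} {j} → injective i j
          ; disjoint      = λ { i Fin.zero eq → f∉ (inj₁ (i , eq)) ; i (Fin.suc j) → disjoint i j }
          ; ext-cycle     = λ i → trans (ext′-old (inj₁ (i , refl))) (ext-cycle i)
          ; ext∈          = λ {e} e∈ → ext′∈ (view-In e∈)
          ; own-unique    = λ e∈ g∈ → own-unique′ (view-In e∈) (view-In g∈)
          ; owned         = λ e∈ → owned′ (view-In e∈)
          ; reach         = λ e∈ → reach′ (view-In e∈)
          ; attached         = attached′
          }
          where
          injective : ∀ i j → off′ i ≡ off′ j → i ≡ j
          injective Fin.zero Fin.zero eq = refl
          injective Fin.zero (Fin.suc j) eq = ⊥-elim (f∉ (inj₂ (j , sym eq)))
          injective (Fin.suc i) Fin.zero eq = ⊥-elim (f∉ (inj₂ (i , eq)))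
          injective (Fin.suc i) (Fin.suc j) eq = cong Fin.suc (off-injective eq)
          ext′∈ : ∀ {e} → e ≡ f ⊎ In off e → ext′ e ∈ edge e
          ext′∈ (inj₁ refl) = subst (_∈ edge f) (sym ext′-f) p∈f
          ext′∈ {e} (inj₂ e∈) = subst (_∈ edge e) (sym (ext′-old e∈)) (ext∈ e∈)
          own-unique′ : ∀ {e g x} → e ≡ f ⊎ In off e → g ≡ f ⊎ In off g → x ∈ edge e → x ≢ ext′ e → x ∈ edge g → x ≢ ext′ g → e ≡ g
          own-unique′ (inj₁ refl) (inj₁ refl) _ _ _ _ = refl
          own-unique′ (inj₁ refl) (inj₂ g∈) x∈e x≢e x∈g x≢g = ⊥-elim (x≢e (trans (only-p x∈e g∈ x∈g) (sym ext′-f)))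
          own-unique′ (inj₂ e∈) (inj₁ refl) x∈e x≢e x∈g x≢g = ⊥-elim (x≢g (trans (only-p x∈g e∈ x∈e) (sym ext′-f)))
          own-unique′ (inj₂ e∈) (inj₂ g∈) x∈e x≢e x∈g x≢g =
            own-unique e∈ g∈ x∈e (λ eq → x≢e (trans eq (sym (ext′-old e∈)))) x∈g (λ eq → x≢g (trans eq (sym (ext′-old g∈))))
          owned′ : ∀ {e} → e ≡ f ⊎ In off e → ∃[ g ] In off′ g × ext′ e ∈ edge g × ext′ e ≢ ext′ g
          owned′ (inj₁ refl) = let g , g∈ , p∈ , p≢ = p-owned in
            g , weaken g∈ , subst (_∈ edge g) (sym ext′-f) p∈ , λ eq → p≢ (trans (sym ext′-f) (trans eq (ext′-old g∈)))
          owned′ (inj₂ e∈) = let g , g∈ , p∈ , p≢ = owned e∈ in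
            g , weaken g∈ , subst (_∈ edge g) (sym (ext′-old e∈)) p∈ , λ eq → p≢ (trans (sym (ext′-old e∈)) (trans eq (ext′-old g∈)))
          reach′ : ∀ {e x} → e ≡ f ⊎ In off e → x ∈ edge e → Paths.Walk H (In off′) x origin
          reach′ (inj₁ refl) x∈ = (f , inj₂ (Fin.zero , refl) , x∈ , p∈f) ◅ lift-walk (reach e₀∈ p∈e₀)
          reach′ (inj₂ e∈) x∈ = lift-walk (reach e∈ x∈)
          attached′ : ∀ j → ∃[ g ] ((∃[ i ] hyperedge i ≡ g) ⊎ (∃[ h ] toℕ j < toℕ h × off′ h ≡ g)) ×
                                ext′ (off′ j) ∈ edge g × ext′ (off′ j) ≢ ext′ g
          attached′ Fin.zero = let g , g∈ , p∈ , p≢ = p-owned in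
            g , ⊎.map (λ q → q) (λ (h , eq) → Fin.suc h , s≤s z≤n , eq) g∈ , subst (_∈ edge g) (sym ext′-f) p∈ ,
            λ eq → p≢ (trans (sym ext′-f) (trans eq (ext′-old g∈)))
          attached′ (Fin.suc j) =
            let g , g∈ , p∈ , p≢ = attached j
                g∈′ = ⊎.map (λ q → q) (λ (h , _ , eq) → h , eq) g∈
                j∈ = inj₂ (j , refl)
            in g , ⊎.map (λ q → q) (λ (h , j<h , eq) → Fin.suc h , s≤s j<h , eq) g∈ , subst (_∈ edge g) (sym (ext′-old j∈)) p∈ ,
               λ eq → p≢ (trans (sym (ext′-old j∈)) (trans eq (ext′-old g∈′)))

      -- The first step of the walk over an uncollected hyperedge starts on a collected one; without
      -- such a step, `f` itself meets a collected hyperedge at the end of the walk.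
      frontier : ∀ {r} {off : Fin r → Edge} {x y f} → (∃[ e ] In off e × x ∈ edge e) → Star (Adjacent H) x y → y ∈ edge f → ¬ In off f →
                 ∃[ h ] ∃[ p ] ∃[ e ] ¬ In off h × p ∈ edge h × In off e × p ∈ edge e
      frontier {f = f} (e , e∈ , x∈) ε y∈f f∉ = f , _ , e , f∉ , y∈f , e∈ , x∈
      frontier {off = off} (e , e∈ , x∈) ((h , u∈ , v∈) ◅ walk) y∈f f∉ with in? off h
      ... | yes h∈ = frontier (h , h∈ , v∈) walk y∈f f∉
      ... | no h∉ = h , _ , e , h∉ , u∈ , e∈ , x∈

      -- The fuel cannot run out early, as the hyperedges in `off` are distinct and so number at
      -- most `size`.
      saturate : ∀ fuel (S : State) → size ≤ State.r S + fuel → Σ[ T ∈ State ] ∀ e → In (State.off T) e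
      saturate fuel S le with all? (in? (State.off S))
      ... | yes all = S , all
      ... | no ¬all with ¬∀⟶∃¬ size (In (State.off S)) (in? (State.off S)) ¬all
      ... | f , f∉ with frontier {off = State.off S} (hyperedge Fin.zero , inj₁ (Fin.zero , refl) , source Fin.zero)
                          (connected origin (proj₁ (nonempty f))) (proj₂ (nonempty f)) f∉
      ... | h , p , e , h∉ , p∈h , e∈ , p∈e with fuel
      ... | suc fuel′ = saturate fuel′ (Grow.grow S h h∉ p p∈h e∈ p∈e) (ℕ.≤-trans le (ℕ.≤-reflexive (ℕ.+-suc _ fuel′)))
      ... | zero = ⊥-elim (ℕ.<-irrefl refl (ℕ.≤-trans (injective⇒≤ {f = State.off T} (State.off-injective T))
              (ℕ.≤-trans le (ℕ.≤-reflexive (ℕ.+-identityʳ _)))))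
        where T = Grow.grow S h h∉ p p∈h e∈ p∈e

      final : Σ[ T ∈ State ] ∀ e → In (State.off T) e
      final = saturate size initial ℕ.≤-refl

      module T = State (proj₁ final)

      inT : ∀ e → In T.off e
      inT = proj₂ final

      some-edge : ∀ v → ∃[ e ] v ∈ edge e
      some-edge v with connected v origin
      ... | ε = hyperedge Fin.zero , source Fin.zero
      ... | (e , v∈ , _) ◅ _ = e , v∈

      owner-of : ∀ v → ∃[ e ] v ∈ edge e × v ≢ T.ext e
      owner-of v with some-edge v
      ... | e , v∈ with v ≟ T.ext e
      ... | no ne = e , v∈ , ne
      ... | yes refl = let f , _ , p , q = T.owned (inT e) in f , p , q

      growth-structure : Structure H
      growth-structure = record
        { ext    = T.ext
        ; owner  = proj₁ ∘ owner-of
        ; ext∈   = λ e → T.ext∈ (inT e)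
        ; owner∈ = λ v → proj₁ (proj₂ (owner-of v))
        ; owner≢ = λ v → proj₂ (proj₂ (owner-of v))
        ; unique = λ {v} {e} v∈ v≢ → T.own-unique (inT e) (inT _) v∈ v≢ (proj₁ (proj₂ (owner-of v))) (proj₂ (proj₂ (owner-of v)))
        }

    decomposition : Decomposition H g₀
    decomposition = record
      { structure         = growth-structure
      ; onCycle           = hyperedge
      ; onCycle-injective = edge-distinct
      ; onCycle-parent    = λ i → sym (Structure.unique growth-structure
                              (subst (_∈ edge (hyperedge (next i))) (sym (T.ext-cycle i)) (source (next i)))
                              (λ eq → next≢ 2≤g (next i) (sym (vertex-distinct (trans (sym (T.ext-cycle i)) (trans eq (T.ext-cycle (next i))))))))
      ; r                 = T.r
      ; off               = T.off
      ; off-injective     = T.off-injective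
      ; disjoint          = T.disjoint
      ; covers            = inT
      ; off-parent        = off-parent
      }
      where
      off-parent : ∀ j → (∃[ i ] Structure.parent growth-structure (T.off j) ≡ hyperedge i) ⊎
                         (∃[ h ] toℕ j < toℕ h × Structure.parent growth-structure (T.off j) ≡ T.off h)
      off-parent j with T.attached j
      ... | f , place , p∈ , p≢ with Structure.unique growth-structure p∈ p≢
      ... | eq = ⊎.map (λ (i , q) → i , trans (sym eq) (sym q)) (λ (h , lt , q) → h , lt , trans (sym eq) (sym q)) place

-- Recognising lollipops by coincidences of parents.

module LollipopRecognition where

  open Structures
  open Lollipops
  open GrowthFromCycle
  open import Data.Empty using (⊥-elim)
  open import Data.Fin as Fin using (Fin; toℕ; fromℕ; inject₁; opposite)
  open import Data.Fin.Properties using (_≟_; any?; toℕ-injective; toℕ-inject₁; toℕ-fromℕ; opposite-involutive; fromℕ≢inject₁; +↔⊎; toℕ≤pred[n])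
  open import Data.Fin.Induction using (<-weakInduction; >-weakInduction)
  open import Data.Fin.Permutation using (↔⇒≡)
  open import Data.Nat as ℕ using (ℕ; zero; suc; _+_; _≤_; _<_)
  import Data.Nat.Properties as ℕ
  open import Data.Product as × using (∃-syntax; Σ-syntax; _×_; _,_; proj₁; proj₂)
  open import Data.Sum as ⊎ using (_⊎_; inj₁; inj₂; [_,_]′)
  open import Function using (_∘_; Injective; _↔_; Inverse; mk↔ₛ′)
  open import Function.Properties.Inverse using (↔-trans)
  open import Relation.Binary.PropositionalEquality using (_≡_; _≢_; refl; sym; trans; cong; subst)
  open import Relation.Nullary using (¬_; Dec; yes; no; _×-dec_; ¬?)

  -- A lollipop whose path starts at position z of the cycle.
  Attached : ∀ {H} → Structure H → (g₀ r : ℕ) → Fin (suc g₀) → Set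
  Attached {H} S g₀ r z = Σ[ positions ∈ Position g₀ r ↔ Hypergraph.Edge H ]
    ∀ x → Structure.parent S (Inverse.to positions x) ≡ Inverse.to positions (stepFrom z x)

  -- Renumbering the cycle by one step moves the attachment down by one, so that induction brings it
  -- to position zero.
  rotate : ∀ {H} {S : Structure H} {g₀ r} z → Attached S g₀ r z → Attached S g₀ r Fin.zero
  rotate {H} {S} {g₀} {r} = <-weakInduction _ (λ A → A) shift
    where
    shift : ∀ z → (Attached S g₀ r (inject₁ z) → Attached S g₀ r Fin.zero) → Attached S g₀ r (Fin.suc z) → Attached S g₀ r Fin.zero
    shift z ih (positions , parent-at) = ih (↔-trans turn positions , λ
      { (inj₁ i)           → parent-at (inj₁ (next i))
      ; (inj₂ Fin.zero)    → trans (parent-at (inj₂ Fin.zero)) (cong (Inverse.to positions ∘ inj₁) (sym (next-inject₁ z)))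
      ; (inj₂ (Fin.suc s)) → parent-at (inj₂ (Fin.suc s)) })
      where
      turn : Position g₀ r ↔ Position g₀ r
      turn = mk↔ₛ′ (⊎.map₁ next) (⊎.map₁ prev)
        (λ { (inj₁ i) → cong inj₁ (next-prev i) ; (inj₂ s) → refl }) (λ { (inj₁ i) → cong inj₁ (prev-next i) ; (inj₂ s) → refl })

  lollipop : ∀ {H} {S : Structure H} {g₀ r z} → Injective _≡_ _≡_ (Structure.ext S) → Attached S g₀ r z → Lollipop S g₀ r
  lollipop {S = S} {z = z} inj A = let positions , parent-at = rotate {S = S} z A in
    record { positions = positions ; ext-injective = inj ; parent-at = parent-at }

  opposite-inject₁ : ∀ {n} (s : Fin n) → opposite (inject₁ s) ≡ Fin.suc (opposite s)
  opposite-inject₁ Fin.zero    = refl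
  opposite-inject₁ (Fin.suc s) = cong inject₁ (opposite-inject₁ s)

  module _ {H : Hypergraph} {g₀ : ℕ} (D : Decomposition H g₀) where
    open Hypergraph H
    open Decomposition D
    open Structure structure

    private
      -- `off` has the newest hyperedge first, whereas positions on the path count away from the
      -- cycle; `opposite` reverses the order.
      enum : Position g₀ r → Edge
      enum = [ onCycle , off ∘ opposite ]′

      enum-injective : ∀ {x y} → enum x ≡ enum y → x ≡ y
      enum-injective {inj₁ i} {inj₁ j} eq = cong inj₁ (onCycle-injective eq)
      enum-injective {inj₁ i} {inj₂ s} eq = ⊥-elim (disjoint i (opposite s) eq)
      enum-injective {inj₂ s} {inj₁ i} eq = ⊥-elim (disjoint i (opposite s) (sym eq))
      enum-injective {inj₂ s} {inj₂ t} eq = cong inj₂ (trans (sym (opposite-involutive s)) (trans (cong opposite (off-injective eq)) (opposite-involutive t)))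

      locate : ∀ e → ∃[ x ] enum x ≡ e
      locate e with covers e
      ... | inj₁ (i , eq) = inj₁ i , eq
      ... | inj₂ (j , eq) = inj₂ (opposite j) , trans (cong off (opposite-involutive j)) eq

    decomposition-positions : Position g₀ r ↔ Edge
    decomposition-positions = mk↔ₛ′ enum (proj₁ ∘ locate) (proj₂ ∘ locate) (λ x → enum-injective (proj₂ (locate (enum x))))

    decomposition-size : suc g₀ + r ≡ size
    decomposition-size = ↔⇒≡ (↔-trans +↔⊎ decomposition-positions)

    private
      module Chain {r₀} (f : Fin (suc r₀) → Edge) (f-injective : Injective _≡_ _≡_ f) (apart : ∀ i j → onCycle i ≢ f j)
                   (f-parent : ∀ j → (∃[ i ] parent (f j) ≡ onCycle i) ⊎ (∃[ h ] toℕ j < toℕ h × parent (f j) ≡ f h)) where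

        -- The last hyperedge in the list has no later one to be its parent. Together with the child
        -- of `onCycle z` on the cycle it forms the unavoidable pair of siblings.
        attach : ∃[ z ] parent (f (fromℕ r₀)) ≡ onCycle z
        attach with f-parent (fromℕ r₀)
        ... | inj₁ q = q
        ... | inj₂ (h , lt , _) = ⊥-elim (ℕ.<-irrefl refl (ℕ.<-≤-trans lt (ℕ.≤-trans (toℕ≤pred[n] h) (ℕ.≤-reflexive (sym (toℕ-fromℕ r₀))))))

        z = proj₁ attach
        a = onCycle (prev z)
        b = f (fromℕ r₀)

        parent-prev : ∀ i → parent (onCycle (prev i)) ≡ onCycle i
        parent-prev i = trans (onCycle-parent (prev i)) (cong onCycle (next-prev i))

        Other : Edge → Edge → Set
        Other c d = c ≢ d × parent c ≡ parent d × ¬ (c ≡ a × d ≡ b) × ¬ (c ≡ b × d ≡ a)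

        other? : ∀ c d → Dec (Other c d)
        other? c d = ¬? (c ≟ d) ×-dec (parent c ≟ parent d) ×-dec ¬? ((c ≟ a) ×-dec (d ≟ b)) ×-dec ¬? ((c ≟ b) ×-dec (d ≟ a))

        module _ (none : ∀ c d → ¬ Other c d) where

          not-last : ∀ (j : Fin r₀) → f (inject₁ j) ≢ b
          not-last j eq = fromℕ≢inject₁ (sym (f-injective eq))

          -- Were the parent on the cycle, or later than the next path hyperedge, then it
          -- would already have another child.
          link : ∀ (j : Fin r₀) → (∀ t → suc (toℕ j) < toℕ t → ∃[ s ] suc (toℕ j) ≤ toℕ s × parent (f s) ≡ f t) →
                 parent (f (inject₁ j)) ≡ f (Fin.suc j)
          link j earlier with f-parent (inject₁ j)
          ... | inj₁ (i , eq) = ⊥-elim (none (onCycle (prev i)) (f (inject₁ j))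
                  (apart (prev i) (inject₁ j) , trans (parent-prev i) (sym eq) , not-last j ∘ proj₂ , apart (prev i) (fromℕ r₀) ∘ proj₁))
          ... | inj₂ (h , lt , eq) with h ≟ Fin.suc j
          ... | yes refl = eq
          ... | no h≢ with earlier h (ℕ.≤∧≢⇒< (subst (λ n → suc n ≤ toℕ h) (toℕ-inject₁ j) lt) (λ eq → h≢ (toℕ-injective (sym eq))))
          ... | s , le , eq′ = ⊥-elim (none (f s) (f (inject₁ j))
                  ( (λ q → ℕ.<-irrefl (sym (trans (cong toℕ (f-injective q)) (toℕ-inject₁ j))) le)
                  , trans eq′ (sym eq)
                  , apart (prev z) s ∘ sym ∘ proj₁
                  , apart (prev z) (inject₁ j) ∘ sym ∘ proj₂ ))

          -- Every entry after `j` has a child at `j` or later. A further child before `j` would be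
          -- a second coincidence, which forces each parent to be the next entry; the induction runs
          -- from the cycle outwards.
          Earlier : Fin (suc r₀) → Set
          Earlier j = ∀ t → toℕ j < toℕ t → ∃[ s ] toℕ j ≤ toℕ s × parent (f s) ≡ f t

          earlier : ∀ j → Earlier j
          earlier = >-weakInduction Earlier
            (λ t lt → ⊥-elim (ℕ.<-irrefl refl (ℕ.<-≤-trans lt (ℕ.≤-trans (toℕ≤pred[n] t) (ℕ.≤-reflexive (sym (toℕ-fromℕ r₀)))))))
            back
            where
            back : ∀ j → Earlier (Fin.suc j) → Earlier (inject₁ j)
            back j ih t lt with t ≟ Fin.suc j
            ... | yes refl = inject₁ j , ℕ.≤-refl , link j ih
            ... | no t≢ with ih t (ℕ.≤∧≢⇒< (subst (λ n → suc n ≤ toℕ t) (toℕ-inject₁ j) lt) (λ eq → t≢ (toℕ-injective (sym eq))))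
            ... | s , le , eq = s , ℕ.≤-trans (ℕ.≤-reflexive (toℕ-inject₁ j)) (ℕ.≤-trans (ℕ.n≤1+n _) le) , eq

          chain : ∀ j → parent (f (inject₁ j)) ≡ f (Fin.suc j)
          chain j = link j (earlier (Fin.suc j))

    -- In the second case parent takes equal values on another pair than the two hyperedges
    -- that meet where the path starts, so the diagonal has at least three companions.
    lollipop-or-branch : Injective _≡_ _≡_ ext → (∃[ r ] suc g₀ + r ≡ size × Lollipop structure g₀ r) ⊎ size + 3 ≤ coincidences parent
    lollipop-or-branch ext-injective = go r decomposition-positions decomposition-size off off-injective disjoint off-parent
      (λ { (inj₁ i) → refl ; (inj₂ s) → refl })
      where
      -- The length becomes a variable so that it can be split into zero and successor; in the
      -- record it is a projection.
      go : ∀ r′ → (positions : Position g₀ r′ ↔ Edge) → suc g₀ + r′ ≡ size → (f : Fin r′ → Edge) → Injective _≡_ _≡_ f →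
           (∀ i j → onCycle i ≢ f j) →
           (∀ j → (∃[ i ] parent (f j) ≡ onCycle i) ⊎ (∃[ h ] toℕ j < toℕ h × parent (f j) ≡ f h)) →
           (∀ x → Inverse.to positions x ≡ [ onCycle , f ∘ opposite ]′ x) →
           (∃[ r ] suc g₀ + r ≡ size × Lollipop structure g₀ r) ⊎ size + 3 ≤ coincidences parent
      go zero positions size≡ f f-inj apart f-parent to≡ = inj₁ (0 , size≡ , lollipop {S = structure} {z = Fin.zero} ext-injective (positions , λ
        { (inj₁ i) → trans (cong parent (to≡ (inj₁ i))) (trans (onCycle-parent i) (sym (to≡ (inj₁ (next i))))) }))
      go (suc r₀) positions size≡ f f-inj apart f-parent to≡ = decide (any? (λ c → any? (other? c)))
        where
        open Chain f f-inj apart f-parent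
        decide : Dec (∃[ c ] ∃[ d ] Other c d) → (∃[ r ] suc g₀ + r ≡ size × Lollipop structure g₀ r) ⊎ size + 3 ≤ coincidences parent
        decide (yes (c , d , c≢d , cd , ne₁ , ne₂)) =
          inj₂ (three-coincidences parent (apart (prev z) (fromℕ r₀)) (trans (parent-prev z) (sym (proj₂ attach))) c≢d cd ne₁ ne₂)
        decide (no ¬other) = inj₁ (suc r₀ , size≡ , lollipop {S = structure} ext-injective (positions , parent-at))
          where
          none : ∀ c d → ¬ Other c d
          none c d o = ¬other (c , d , o)
          parent-at : ∀ x → parent (Inverse.to positions x) ≡ Inverse.to positions (stepFrom z x)
          parent-at (inj₁ i) = trans (cong parent (to≡ (inj₁ i))) (trans (onCycle-parent i) (sym (to≡ (inj₁ (next i)))))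
          parent-at (inj₂ Fin.zero) = trans (cong parent (to≡ (inj₂ Fin.zero))) (trans (proj₂ attach) (sym (to≡ (inj₁ z))))
          parent-at (inj₂ (Fin.suc s)) = trans (cong parent (to≡ (inj₂ (Fin.suc s)))) (trans (chain none (opposite s))
            (sym (trans (to≡ (inj₂ (inject₁ s))) (cong f (opposite-inject₁ s)))))

-- Coordinates on hypergraphs built from a cycle and a path.

module CoordinateModel where

  open SubsetLists
  open Structures
  open Lollipops
  open LollipopRecognition
  open import Data.Empty using (⊥-elim)
  open import Data.Fin as Fin using (Fin; toℕ; fromℕ; inject₁; opposite; _↑ˡ_; _↑ʳ_; combine; remQuot; splitAt; punchIn)
  open import Data.Fin.Properties using (_≟_; any?; toℕ-injective; toℕ-inject₁; toℕ<n; opposite-involutive; opposite-prop; fromℕ≢inject₁; ↑ˡ-injective; ↑ʳ-injective; splitAt-↑ˡ; splitAt-↑ʳ; join-splitAt; combine-injective; combine-remQuot; punchOut-injective; punchIn-injective; punchIn-punchOut; punchInᵢ≢i; suc-injective; inject₁-injective)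
  open import Data.Fin.Relation.Unary.Top using (view; ‵fromℕ; ‵inject₁)
  open import Data.Fin.Subset using (_∈_; ∣_∣)
  open import Data.Fin.Subset.Properties using (_∈?_)
  open import Data.List using (List; []; _∷_; map; allFin)
  open import Data.List.Properties using (length-map)
  open import Data.List.Membership.Propositional.Properties using (∈-allFin; ∈-map⁺; ∈-map⁻)
  open import Data.List.Relation.Unary.All as All using (All; []; _∷_)
  open import Data.List.Relation.Unary.AllPairs using ([]; _∷_)
  open import Data.List.Relation.Unary.Any using (here; there)
  import Data.List.Relation.Unary.Unique.Propositional.Properties as Unique
  open import Data.Nat as ℕ using (ℕ; suc; _*_; _∸_; _≤_; _<_)
  import Data.Nat.Properties as ℕ
  open import Data.Product as × using (∃-syntax; _×_; _,_; proj₁; proj₂)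
  open import Data.Sum as ⊎ using (_⊎_; inj₁; inj₂; [_,_]′)
  open import Data.Sum.Properties using (inj₁-injective; inj₂-injective)
  open import Data.Vec.Properties using (lookup∘tabulate; []=⇒lookup; lookup⇒[]=)
  open import Function using (_∘_; case_of_; _↔_; Inverse)
  open import Relation.Binary.PropositionalEquality using (_≡_; _≢_; refl; sym; trans; cong; subst)
  open import Relation.Nullary using (yes; no; does; _×-dec_)
  open import Relation.Nullary.Decidable using (dec-true)

  -- A hypergraph coordinatised like C_g · P_r: the hyperedge at position x owns the
  -- vertices (x , j), and its remaining vertex is owned by the hyperedge at position
  -- stepFrom z x.
  module Coordinates {H : Hypergraph} {g₀ r q : ℕ} (2≤g : 2 ≤ suc g₀) (z : Fin (suc g₀)) (slot : Position g₀ r → Fin (suc q))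
    (link-injective : ∀ {x y} → stepFrom z x ≡ stepFrom z y → slot x ≡ slot y → x ≡ y)
    (positions : Position g₀ r ↔ Hypergraph.Edge H) (coordinates : (Position g₀ r × Fin (suc q)) ↔ Hypergraph.Vertex H)
    (link∈ : ∀ x → Inverse.to coordinates (stepFrom z x , slot x) ∈ Hypergraph.edge H (Inverse.to positions x))
    (vert∈ : ∀ x j → Inverse.to coordinates (x , j) ∈ Hypergraph.edge H (Inverse.to positions x))
    (∈-edge : ∀ x {v} → v ∈ Hypergraph.edge H (Inverse.to positions x) →
              v ≡ Inverse.to coordinates (stepFrom z x , slot x) ⊎ (∃[ j ] v ≡ Inverse.to coordinates (x , j))) where
    open Hypergraph H

    private
      at = Inverse.to positions
      vert = Inverse.to coordinates
      module P = Inverse positions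
      module V = Inverse coordinates

      vert-injective : ∀ {s t} → vert s ≡ vert t → s ≡ t
      vert-injective {s} {t} eq = trans (sym (V.strictlyInverseʳ s)) (trans (cong V.from eq) (V.strictlyInverseʳ t))

      link : Position g₀ r → Vertex
      link x = vert (stepFrom z x , slot x)

      stepFrom≢ : ∀ (x : Position g₀ r) → stepFrom z x ≢ x
      stepFrom≢ (inj₁ i) eq = next≢ 2≤g i (inj₁-injective eq)
      stepFrom≢ (inj₂ (Fin.suc s)) eq = ℕ.m≢1+m+n (toℕ s) (trans (trans (sym (toℕ-inject₁ s)) (cong toℕ (inj₂-injective eq))) (cong suc (sym (ℕ.+-identityʳ _))))

      link≢ : ∀ x j → link x ≢ vert (x , j)
      link≢ x j eq = stepFrom≢ x (cong proj₁ (vert-injective eq))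

    coordinate-structure : Structure H
    coordinate-structure = record
      { ext    = link ∘ P.from
      ; owner  = at ∘ proj₁ ∘ V.from
      ; ext∈   = λ e → subst (λ f → link (P.from e) ∈ edge f) (P.strictlyInverseˡ e) (link∈ (P.from e))
      ; owner∈ = λ v → subst (_∈ edge (at (proj₁ (V.from v)))) (V.strictlyInverseˡ v) (vert∈ _ _)
      ; owner≢ = λ v eq → link≢ _ _ (sym (trans (V.strictlyInverseˡ v) (trans eq (cong link (P.strictlyInverseʳ _)))))
      ; unique = unique
      }
      where
      unique : ∀ {v e} → v ∈ edge e → v ≢ link (P.from e) → e ≡ at (proj₁ (V.from v))
      unique {v} {e} v∈ v≢ with ∈-edge (P.from e) (subst (λ f → v ∈ edge f) (sym (P.strictlyInverseˡ e)) v∈)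
      ... | inj₁ eq = ⊥-elim (v≢ eq)
      ... | inj₂ (j , refl) = trans (sym (P.strictlyInverseˡ e)) (cong (at ∘ proj₁) (sym (V.strictlyInverseʳ _)))

    coordinate-lollipop : Lollipop coordinate-structure g₀ r
    coordinate-lollipop = lollipop {S = coordinate-structure}
      (λ {e} {f} eq → let eq′ = vert-injective eq in
        trans (sym (P.strictlyInverseˡ e)) (trans (cong at (link-injective (cong proj₁ eq′) (cong proj₂ eq′))) (P.strictlyInverseˡ f)))
      (positions , λ x → cong at (trans (cong proj₁ (V.strictlyInverseʳ _)) (cong (stepFrom z) (P.strictlyInverseʳ x))))

    coordinate-uniform : Uniform (suc (suc q)) H
    coordinate-uniform e = trans (cong (λ f → ∣ edge f ∣) (sym (P.strictlyInverseˡ e))) (trans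
      (∣∣-list {ys = link x ∷ map (λ j → vert (x , j)) (allFin (suc q))}
        (All.tabulate (λ v∈ eq → let j , _ , eq′ = ∈-map⁻ _ v∈ in link≢ x j (trans eq eq′))
          ∷ Unique.map⁺ (λ eq → cong proj₂ (vert-injective eq)) (Unique.allFin⁺ (suc q)))
        (λ { (here refl) → link∈ x ; (there v∈) → let j , _ , eq = ∈-map⁻ _ v∈ in subst (_∈ edge (at x)) (sym eq) (vert∈ x j) })
        (λ v∈ → case ∈-edge x v∈ of λ { (inj₁ eq) → here eq ; (inj₂ (j , refl)) → there (∈-map⁺ (λ j → vert (x , j)) (∈-allFin j)) }))
      (cong suc (trans (length-map (λ j → vert (x , j)) (allFin (suc q))) (length-allFin (suc q)))))
      where x = P.from e

  ∈-image⁺ : ∀ {a b} (f : Fin a → Fin b) {S x} → x ∈ S → f x ∈ image f S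
  ∈-image⁺ f {S} {x} x∈ = lookup⇒[]= (f x) _ (trans (lookup∘tabulate _ (f x))
    (dec-true (any? (λ y → (y ∈? S) ×-dec (f y ≟ f x))) (x , x∈ , refl)))

  ∈-image⁻ : ∀ {a b} (f : Fin a → Fin b) {S y} → y ∈ image f S → ∃[ x ] x ∈ S × f x ≡ y
  ∈-image⁻ f {S} {y} y∈ with any? (λ x → (x ∈? S) ×-dec (f x ≟ y)) | trans (sym (lookup∘tabulate (λ y → does (any? (λ x → (x ∈? S) ×-dec (f x ≟ y)))) y)) ([]=⇒lookup y∈)
  ... | yes p | _ = p
  ... | no _ | ()

  ↑ˡ≢↑ʳ : ∀ {a b} {i : Fin a} {j : Fin b} → i ↑ˡ b ≢ a ↑ʳ j
  ↑ˡ≢↑ʳ {a} {b} {i} {j} eq = case trans (sym (splitAt-↑ˡ a i b)) (trans (cong (splitAt a) eq) (splitAt-↑ʳ a b j)) of λ ()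

  module _ {a b : ℕ} (u : Fin a) (w : Fin (suc b)) where

    glue-base : glue u w w ≡ u ↑ˡ b
    glue-base with w ≟ w
    ... | yes _ = refl
    ... | no ne = ⊥-elim (ne refl)

    glue-punchIn : ∀ y → glue u w (punchIn w y) ≡ a ↑ʳ y
    glue-punchIn y with w ≟ punchIn w y
    ... | yes eq = ⊥-elim (punchInᵢ≢i w y (sym eq))
    ... | no ne = cong (a ↑ʳ_) (punchIn-injective w _ _ (punchIn-punchOut ne))

    glue≢ : ∀ {x c} → x ≢ w → glue u w x ≢ c ↑ˡ b
    glue≢ {x} x≢w eq with w ≟ x
    ... | yes refl = x≢w refl
    ... | no _ = ↑ˡ≢↑ʳ (sym eq)

    glue-injective : ∀ {x y} → x ≢ w → y ≢ w → glue u w x ≡ glue u w y → x ≡ y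
    glue-injective {x} {y} x≢w y≢w eq with w ≟ x | w ≟ y
    ... | yes refl | _ = ⊥-elim (x≢w refl)
    ... | no _ | yes refl = ⊥-elim (y≢w refl)
    ... | no p | no p′ = punchOut-injective p p′ (↑ʳ-injective a _ _ eq)

  -- The path read from the end w₀: pe s is the s-th edge, leading from near s to far s.
  record Orientation (r : ℕ) (w₀ : Fin (suc r)) : Set where
    field
      pe            : Fin r → Fin r
      pe-involutive : ∀ s → pe (pe s) ≡ s
      near far      : Fin r → Fin (suc r)
      ends          : ∀ s → (near s ≡ inject₁ (pe s) × far s ≡ Fin.suc (pe s)) ⊎ (near s ≡ Fin.suc (pe s) × far s ≡ inject₁ (pe s))
      far-injective : ∀ {s t} → far s ≡ far t → s ≡ t
      far≢          : ∀ s → far s ≢ w₀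
      far-covers    : ∀ o → o ≡ w₀ ⊎ (∃[ s ] far s ≡ o)
      near-zero     : ∀ s → toℕ s ≡ 0 → near s ≡ w₀
      near-suc      : ∀ s t → toℕ s ≡ suc (toℕ t) → near s ≡ far t

  forward : ∀ r → Orientation r Fin.zero
  forward r = record
    { pe = λ s → s ; pe-involutive = λ _ → refl ; near = inject₁ ; far = Fin.suc
    ; ends = λ s → inj₁ (refl , refl) ; far-injective = suc-injective ; far≢ = λ s () 
    ; far-covers = λ { Fin.zero → inj₁ refl ; (Fin.suc s) → inj₂ (s , refl) }
    ; near-zero = λ s eq → toℕ-injective (trans (toℕ-inject₁ s) eq)
    ; near-suc = λ s t eq → toℕ-injective (trans (toℕ-inject₁ s) eq)
    }

  -- The path glued at its last vertex: the edges are read in the opposite order, and each of them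
  -- in the opposite direction.
  backward : ∀ r → Orientation r (fromℕ r)
  backward r = record
    { pe = opposite ; pe-involutive = opposite-involutive ; near = Fin.suc ∘ opposite ; far = inject₁ ∘ opposite
    ; ends = λ s → inj₂ (refl , refl)
    ; far-injective = λ {s} {t} eq → trans (sym (opposite-involutive s)) (trans (cong opposite (inject₁-injective eq)) (opposite-involutive t))
    ; far≢ = λ s eq → fromℕ≢inject₁ (sym eq)
    ; far-covers = covers
    ; near-zero = λ { Fin.zero _ → refl }
    ; near-suc = λ s t eq → toℕ-injective (trans (cong suc (opposite-prop s)) (trans (trans (cong (λ m → suc (r ∸ suc m)) eq)
        (sym (ℕ.+-∸-assoc 1 (subst (_< r) eq (toℕ<n s))))) (sym (trans (toℕ-inject₁ _) (opposite-prop t)))))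
    }
    where
    covers : ∀ o → o ≡ fromℕ r ⊎ (∃[ s ] inject₁ (opposite s) ≡ o)
    covers o with view o
    ... | ‵fromℕ = inj₁ refl
    ... | ‵inject₁ s = inj₂ (opposite s , cong inject₁ (opposite-involutive s))

  module Power (k : ℕ) (G : Graph) where
    open Graph G

    old : Fin #vertices → Hypergraph.Vertex (power k G)
    old v = v ↑ˡ (#edges * (k ∸ 2))

    new : Fin #edges → Fin (k ∸ 2) → Hypergraph.Vertex (power k G)
    new e j = #vertices ↑ʳ combine e j

    old-injective : ∀ {v w} → old v ≡ old w → v ≡ w
    old-injective = ↑ˡ-injective _ _ _

    new-injective : ∀ {e f i j} → new e i ≡ new f j → e ≡ f × i ≡ j
    new-injective {e} {f} {i} {j} eq = combine-injective e i f j (↑ʳ-injective #vertices _ _ eq)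

    old≢new : ∀ {v e j} → old v ≢ new e j
    old≢new = ↑ˡ≢↑ʳ

    old-or-new : ∀ x → (∃[ v ] old v ≡ x) ⊎ (∃[ e ] ∃[ j ] new e j ≡ x)
    old-or-new x with splitAt #vertices x in eq
    ... | inj₁ v = inj₁ (v , trans (cong [ _↑ˡ _ , #vertices ↑ʳ_ ]′ (sym eq)) (join-splitAt #vertices _ x))
    ... | inj₂ y = inj₂ (proj₁ (remQuot {#edges} (k ∸ 2) y) , proj₂ (remQuot {#edges} (k ∸ 2) y) ,
            trans (cong (#vertices ↑ʳ_) (combine-remQuot {#edges} (k ∸ 2) y)) (trans (cong [ _↑ˡ _ , #vertices ↑ʳ_ ]′ (sym eq)) (join-splitAt #vertices _ x)))

    open Hypergraph (power k G)

    private
      members : Edge → List Vertex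
      members e = old (proj₁ (ends e)) ∷ old (proj₂ (ends e)) ∷ map (new e) (allFin (k ∸ 2))

    first∈ : ∀ e → old (proj₁ (ends e)) ∈ edge e
    first∈ e = ∈-setOf⁺ {xs = members e} (here refl)

    second∈ : ∀ e → old (proj₂ (ends e)) ∈ edge e
    second∈ e = ∈-setOf⁺ {xs = members e} (there (here refl))

    new∈ : ∀ e j → new e j ∈ edge e
    new∈ e j = ∈-setOf⁺ {xs = members e} (there (there (∈-map⁺ (new e) (∈-allFin j))))

    ∈-power : ∀ e {x} → x ∈ edge e → x ≡ old (proj₁ (ends e)) ⊎ x ≡ old (proj₂ (ends e)) ⊎ (∃[ j ] x ≡ new e j)
    ∈-power e x∈ with ∈-setOf⁻ {xs = members e} x∈
    ... | here eq = inj₁ eq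
    ... | there (here eq) = inj₂ (inj₁ eq)
    ... | there (there p) = let j , _ , eq = ∈-map⁻ (new e) p in inj₂ (inj₂ (j , eq))

-- The coalescence of a hypercycle and a hyperpath.

module CoalescedHypergraph where

  open BigOperators
  open Lollipops
  open CoordinateModel
  open import Data.Empty using (⊥-elim)
  open import Data.Fin as Fin using (Fin; inject₁; _↑ˡ_; _↑ʳ_; splitAt; punchIn)
  open import Data.Fin.Properties using (↑ˡ-injective; splitAt-↑ˡ; splitAt-↑ʳ; join-splitAt; inject₁-injective; toℕ-inject₁)
  open import Data.Fin.Subset using (_∈_)
  open import Data.Fin.Subset.Properties using (_∈?_)
  open import Data.List using ([]; _∷_)
  open import Data.List.Membership.Propositional.Properties using (∈-allFin; ∈-filter⁺)
  open import Data.List.Relation.Unary.All using ([]; _∷_)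
  open import Data.List.Relation.Unary.AllPairs using ([]; _∷_)
  open import Data.List.Relation.Unary.Any using (here; there)
  open import Data.Nat as ℕ using (ℕ; suc; _+_; _*_; _∸_; _≤_)
  import Data.Nat.Properties as ℕ
  open import Data.Product as × using (∃-syntax; _×_; _,_; proj₁; proj₂)
  open import Data.Sum as ⊎ using (_⊎_; inj₁; inj₂; [_,_]′)
  open import Data.Sum.Properties using (inj₁-injective; inj₂-injective)
  open import Function using (_∘_; _↔_; mk↔ₛ′)
  open import Relation.Binary.PropositionalEquality using (_≡_; _≢_; refl; sym; trans; cong; subst)

  -- A vertex of the cycle graph lies on the two edges next to it, so a vertex of degree one must be
  -- an inserted one.
  cored⇒new : ∀ k g₀ → 2 ≤ suc g₀ → (u : Hypergraph.Vertex (hypercycle k (suc g₀))) → Cored (hypercycle k (suc g₀)) u →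
              ∃[ i ] ∃[ j ] Power.new k (cycleGraph (suc g₀)) i j ≡ u
  cored⇒new k g₀ 2≤g u cored with Power.old-or-new k (cycleGraph (suc g₀)) u
  ... | inj₂ p = p
  ... | inj₁ (i , refl) = ⊥-elim (ℕ.<-irrefl refl (ℕ.≤-trans two (ℕ.≤-reflexive cored)))
    where
    open Power k (cycleGraph (suc g₀))
    open Hypergraph (hypercycle k (suc g₀))
    prev≢ : i ≢ prev i
    prev≢ eq = next≢ 2≤g (prev i) (trans (next-prev i) eq)
    two : 2 ≤ degree (hypercycle k (suc g₀)) (old i)
    two = Unique-⊆⇒length≤ {ys = i ∷ prev i ∷ []} ((prev≢ ∷ []) ∷ [] ∷ [])
      λ { (here refl) → ∈-filter⁺ (λ e → old i ∈? edge e) (∈-allFin i) (first∈ i)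
        ; (there (here refl)) → ∈-filter⁺ (λ e → old i ∈? edge e) (∈-allFin (prev i))
            (subst (λ j → old j ∈ edge (prev i)) (next-prev i) (second∈ (prev i))) }

  module Coalesced (k g₀ r : ℕ) (2≤g : 2 ≤ suc g₀) (i₀ : Fin (suc g₀)) (j₀ : Fin (k ∸ 2))
                   {w₀ : Fin (suc r)} (O : Orientation r w₀) where
    open Orientation O
    private
      q = k ∸ 2
      module C = Power k (cycleGraph (suc g₀))
      module P = Power k (pathGraph r)
      u = C.new i₀ j₀
      w = P.old w₀

    X : Hypergraph
    X = coalescence (hypercycle k (suc g₀)) u (hyperpath k r) w

    open Hypergraph X

    private
      n = Hypergraph.order (hypercycle k (suc g₀))

      left : Hypergraph.Vertex (hypercycle k (suc g₀)) → Vertex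
      left = _↑ˡ (r + r * q)

      right : Hypergraph.Vertex (hyperpath k r) → Vertex
      right = glue u w

      left-injective : ∀ {x y} → left x ≡ left y → x ≡ y
      left-injective = ↑ˡ-injective _ _ _

      far≢w : ∀ {s} → P.old (far s) ≢ w
      far≢w eq = far≢ _ (P.old-injective eq)

      new≢w : ∀ {t j} → P.new t j ≢ w
      new≢w eq = P.old≢new (sym eq)

      pe-injective : ∀ {s t} → pe s ≡ pe t → s ≡ t
      pe-injective {s} {t} eq = trans (sym (pe-involutive s)) (trans (cong pe eq) (pe-involutive t))

      -- Each position owns one old vertex and k - 2 inserted ones. An edge of the cycle owns its
      -- first end, an edge of the path the end farther from the attachment, and the glued vertex is
      -- left to the cycle.
      vert : Position g₀ r × Fin (suc q) → Vertex
      vert (inj₁ i , Fin.zero)  = left (C.old i)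
      vert (inj₁ i , Fin.suc j) = left (C.new i j)
      vert (inj₂ s , Fin.zero)  = right (P.old (far s))
      vert (inj₂ s , Fin.suc j) = right (P.new (pe s) j)

      vert-injective : ∀ x y → vert x ≡ vert y → x ≡ y
      vert-injective (inj₁ i , Fin.zero) (inj₁ j , Fin.zero) eq = cong (λ i → inj₁ i , Fin.zero) (C.old-injective (left-injective eq))
      vert-injective (inj₁ i , Fin.zero) (inj₁ j , Fin.suc b) eq = ⊥-elim (C.old≢new {i} {j} {b} (left-injective eq))
      vert-injective (inj₁ i , Fin.suc a) (inj₁ j , Fin.zero) eq = ⊥-elim (C.old≢new {j} {i} {a} (sym (left-injective eq)))
      vert-injective (inj₁ i , Fin.suc a) (inj₁ j , Fin.suc b) eq with C.new-injective {i} {j} {a} {b} (left-injective eq)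
      ... | refl , refl = refl
      vert-injective (inj₁ i , Fin.zero) (inj₂ t , Fin.zero) eq = ⊥-elim (glue≢ u w far≢w (sym eq))
      vert-injective (inj₁ i , Fin.zero) (inj₂ t , Fin.suc b) eq = ⊥-elim (glue≢ u w new≢w (sym eq))
      vert-injective (inj₁ i , Fin.suc a) (inj₂ t , Fin.zero) eq = ⊥-elim (glue≢ u w far≢w (sym eq))
      vert-injective (inj₁ i , Fin.suc a) (inj₂ t , Fin.suc b) eq = ⊥-elim (glue≢ u w new≢w (sym eq))
      vert-injective (inj₂ s , Fin.zero) (inj₁ j , Fin.zero) eq = ⊥-elim (glue≢ u w far≢w eq)
      vert-injective (inj₂ s , Fin.zero) (inj₁ j , Fin.suc b) eq = ⊥-elim (glue≢ u w far≢w eq)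
      vert-injective (inj₂ s , Fin.suc a) (inj₁ j , Fin.zero) eq = ⊥-elim (glue≢ u w new≢w eq)
      vert-injective (inj₂ s , Fin.suc a) (inj₁ j , Fin.suc b) eq = ⊥-elim (glue≢ u w new≢w eq)
      vert-injective (inj₂ s , Fin.zero) (inj₂ t , Fin.zero) eq =
        cong (λ s → inj₂ s , Fin.zero) (far-injective (P.old-injective (glue-injective u w far≢w far≢w eq)))
      vert-injective (inj₂ s , Fin.zero) (inj₂ t , Fin.suc b) eq = ⊥-elim (P.old≢new (glue-injective u w far≢w new≢w eq))
      vert-injective (inj₂ s , Fin.suc a) (inj₂ t , Fin.zero) eq = ⊥-elim (P.old≢new (sym (glue-injective u w new≢w far≢w eq)))
      vert-injective (inj₂ s , Fin.suc a) (inj₂ t , Fin.suc b) eq with P.new-injective {pe s} {pe t} {a} {b} (glue-injective u w new≢w new≢w eq)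
      ... | p , refl = cong (λ s → inj₂ s , Fin.suc a) (pe-injective p)

      from-left : ∀ c → ∃[ x ] vert x ≡ left c
      from-left c with C.old-or-new c
      ... | inj₁ (i , refl) = (inj₁ i , Fin.zero) , refl
      ... | inj₂ (i , j , refl) = (inj₁ i , Fin.suc j) , refl

      from-right : ∀ x → ∃[ y ] vert y ≡ right x
      from-right x with P.old-or-new x
      ... | inj₂ (t , j , refl) = (inj₂ (pe t) , Fin.suc j) , cong (λ t → right (P.new t j)) (pe-involutive t)
      ... | inj₁ (o , refl) with far-covers o
      ... | inj₂ (s , refl) = (inj₂ s , Fin.zero) , refl
      ... | inj₁ refl = (inj₁ i₀ , Fin.suc j₀) , sym (glue-base u w)

      vert-surjective : ∀ v → ∃[ x ] vert x ≡ v
      vert-surjective v with splitAt n v in eq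
      ... | inj₁ c = let x , p = from-left c in x , trans p (trans (cong [ left , n ↑ʳ_ ]′ (sym eq)) (join-splitAt n (r + r * q) v))
      ... | inj₂ y = let x , p = from-right (punchIn w y) in
        x , trans p (trans (glue-punchIn u w y) (trans (cong [ left , n ↑ʳ_ ]′ (sym eq)) (join-splitAt n (r + r * q) v)))

      coordinates : (Position g₀ r × Fin (suc q)) ↔ Vertex
      coordinates = mk↔ₛ′ vert (proj₁ ∘ vert-surjective) (proj₂ ∘ vert-surjective) (λ x → vert-injective _ x (proj₂ (vert-surjective (vert x))))

      at : Position g₀ r → Edge
      at (inj₁ i) = i ↑ˡ r
      at (inj₂ s) = suc g₀ ↑ʳ pe s

      positions : Position g₀ r ↔ Edge
      positions = mk↔ₛ′ at (⊎.map₂ pe ∘ splitAt (suc g₀)) at-from from-at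
        where
        at-from : ∀ e → at (⊎.map₂ pe (splitAt (suc g₀) e)) ≡ e
        at-from e with splitAt (suc g₀) e in eq
        ... | inj₁ i = trans (cong [ _↑ˡ r , suc g₀ ↑ʳ_ ]′ (sym eq)) (join-splitAt (suc g₀) r e)
        ... | inj₂ t = trans (cong (suc g₀ ↑ʳ_) (pe-involutive t)) (trans (cong [ _↑ˡ r , suc g₀ ↑ʳ_ ]′ (sym eq)) (join-splitAt (suc g₀) r e))
        from-at : ∀ x → ⊎.map₂ pe (splitAt (suc g₀) (at x)) ≡ x
        from-at (inj₁ i) = cong (⊎.map₂ pe) (splitAt-↑ˡ (suc g₀) i r)
        from-at (inj₂ s) = trans (cong (⊎.map₂ pe) (splitAt-↑ʳ (suc g₀) r (pe s))) (cong inj₂ (pe-involutive s))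

      -- Hyperedges are linked to the old vertex owned by their parent, except that the path starts
      -- at the cored vertex `u`. As `u` is not old, this slot differs from that of the cycle
      -- hyperedge with the same parent, and the extensions stay distinct.
      slot : Position g₀ r → Fin (suc q)
      slot (inj₁ i)           = Fin.zero
      slot (inj₂ Fin.zero)    = Fin.suc j₀
      slot (inj₂ (Fin.suc s)) = Fin.zero

      link-injective : ∀ {x y : Position g₀ r} → stepFrom i₀ x ≡ stepFrom i₀ y → slot x ≡ slot y → x ≡ y
      link-injective {inj₁ i} {inj₁ j} p _ = cong inj₁ (next-injective (inj₁-injective p))
      link-injective {inj₁ i} {inj₂ Fin.zero} _ ()
      link-injective {inj₁ i} {inj₂ (Fin.suc t)} ()
      link-injective {inj₂ Fin.zero} {inj₁ j} _ ()
      link-injective {inj₂ (Fin.suc s)} {inj₁ j} ()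
      link-injective {inj₂ Fin.zero} {inj₂ Fin.zero} _ _ = refl
      link-injective {inj₂ Fin.zero} {inj₂ (Fin.suc t)} ()
      link-injective {inj₂ (Fin.suc s)} {inj₂ Fin.zero} ()
      link-injective {inj₂ (Fin.suc s)} {inj₂ (Fin.suc t)} p _ = cong (inj₂ ∘ Fin.suc) (inject₁-injective (inj₂-injective p))

      edge-left : ∀ i → edge (i ↑ˡ r) ≡ image left (Hypergraph.edge (hypercycle k (suc g₀)) i)
      edge-left i = cong [ image left ∘ Hypergraph.edge (hypercycle k (suc g₀)) , image right ∘ Hypergraph.edge (hyperpath k r) ]′ (splitAt-↑ˡ (suc g₀) i r)

      edge-right : ∀ t → edge (suc g₀ ↑ʳ t) ≡ image right (Hypergraph.edge (hyperpath k r) t)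
      edge-right t = cong [ image left ∘ Hypergraph.edge (hypercycle k (suc g₀)) , image right ∘ Hypergraph.edge (hyperpath k r) ]′ (splitAt-↑ʳ (suc g₀) r t)

      left∈ : ∀ {i x} → x ∈ Hypergraph.edge (hypercycle k (suc g₀)) i → left x ∈ edge (i ↑ˡ r)
      left∈ {i} {x} x∈ = subst (left x ∈_) (sym (edge-left i)) (∈-image⁺ left x∈)

      right∈ : ∀ {t x} → x ∈ Hypergraph.edge (hyperpath k r) t → right x ∈ edge (suc g₀ ↑ʳ t)
      right∈ {t} {x} x∈ = subst (right x ∈_) (sym (edge-right t)) (∈-image⁺ right x∈)

      near∈ : ∀ s → P.old (near s) ∈ Hypergraph.edge (hyperpath k r) (pe s)
      near∈ s with ends s
      ... | inj₁ (p , _) = subst (λ o → P.old o ∈ Hypergraph.edge (hyperpath k r) (pe s)) (sym p) (P.first∈ (pe s))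
      ... | inj₂ (p , _) = subst (λ o → P.old o ∈ Hypergraph.edge (hyperpath k r) (pe s)) (sym p) (P.second∈ (pe s))

      far∈ : ∀ s → P.old (far s) ∈ Hypergraph.edge (hyperpath k r) (pe s)
      far∈ s with ends s
      ... | inj₁ (_ , p) = subst (λ o → P.old o ∈ Hypergraph.edge (hyperpath k r) (pe s)) (sym p) (P.second∈ (pe s))
      ... | inj₂ (_ , p) = subst (λ o → P.old o ∈ Hypergraph.edge (hyperpath k r) (pe s)) (sym p) (P.first∈ (pe s))

      link : Position g₀ r → Vertex
      link x = vert (stepFrom i₀ x , slot x)

      link-near : ∀ s → link (inj₂ s) ≡ right (P.old (near s))
      link-near Fin.zero    = trans (sym (glue-base u w)) (cong (right ∘ P.old) (sym (near-zero Fin.zero refl)))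
      link-near (Fin.suc s) = cong (right ∘ P.old) (sym (near-suc (Fin.suc s) (inject₁ s) (cong suc (sym (toℕ-inject₁ s)))))

      link∈ : ∀ x → link x ∈ edge (at x)
      link∈ (inj₁ i) = left∈ (C.second∈ i)
      link∈ (inj₂ s) = subst (_∈ edge (at (inj₂ s))) (sym (link-near s)) (right∈ (near∈ s))

      vert∈ : ∀ x j → vert (x , j) ∈ edge (at x)
      vert∈ (inj₁ i) Fin.zero    = left∈ (C.first∈ i)
      vert∈ (inj₁ i) (Fin.suc j) = left∈ (C.new∈ i j)
      vert∈ (inj₂ s) Fin.zero    = right∈ (far∈ s)
      vert∈ (inj₂ s) (Fin.suc j) = right∈ (P.new∈ (pe s) j)

      ∈-edge : ∀ x {v} → v ∈ edge (at x) → v ≡ link x ⊎ (∃[ j ] v ≡ vert (x , j))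
      ∈-edge (inj₁ i) {v} v∈ with ∈-image⁻ left (subst (v ∈_) (edge-left i) v∈)
      ... | x , x∈ , refl with C.∈-power i x∈
      ... | inj₁ refl = inj₂ (Fin.zero , refl)
      ... | inj₂ (inj₁ refl) = inj₁ refl
      ... | inj₂ (inj₂ (j , refl)) = inj₂ (Fin.suc j , refl)
      ∈-edge (inj₂ s) {v} v∈ with ∈-image⁻ right (subst (v ∈_) (edge-right (pe s)) v∈)
      ... | x , x∈ , refl with P.∈-power (pe s) x∈ | ends s
      ... | inj₂ (inj₂ (j , refl)) | _ = inj₂ (Fin.suc j , refl)
      ... | inj₁ refl | inj₁ (p , _) = inj₁ (trans (cong (right ∘ P.old) (sym p)) (sym (link-near s)))
      ... | inj₁ refl | inj₂ (_ , p) = inj₂ (Fin.zero , cong (right ∘ P.old) (sym p))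
      ... | inj₂ (inj₁ refl) | inj₂ (p , _) = inj₁ (trans (cong (right ∘ P.old) (sym p)) (sym (link-near s)))
      ... | inj₂ (inj₁ refl) | inj₁ (_ , p) = inj₂ (Fin.zero , cong (right ∘ P.old) (sym p))

    open Coordinates {X} 2≤g i₀ slot link-injective positions coordinates link∈ vert∈ ∈-edge public

-- Lollipops precede the rest of the class.

module LollipopFirst where

  open ContributingPicks using (three)
  open TraceComparison
  open Structures
  open Lollipops
  open LollipopClass
  open GrowthFromCycle
  open LollipopRecognition
  open CoordinateModel
  open CoalescedHypergraph
  open import Data.Empty using (⊥-elim)
  open import Data.Fin.Properties using (_≟_; any?)
  open import Data.Fin.Subset using (_∈_)
  open import Data.Nat as ℕ using (ℕ; zero; suc; _+_; _*_; _∸_; _^_; _≤_; z≤n; s≤s)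
  import Data.Nat.Properties as ℕ
  open import Data.Product as × using (∃-syntax; _×_; _,_; proj₁; proj₂)
  open import Data.Sum as ⊎ using (_⊎_; inj₁; inj₂)
  open import Function using (_∘_; Injective; mk⇔; Equivalence)
  open import Relation.Binary.PropositionalEquality using (_≡_; _≢_; refl; sym; trans; cong; cong₂; subst; subst₂)
  open import Relation.Nullary using (¬_; Dec; yes; no; _×-dec_; ¬?)

  decompose : ∀ {k m g₀ H} → 3 ≤ k → 3 ≤ suc g₀ → LinearUnicyclic k m (suc g₀) H → Decomposition H g₀
  decompose {g₀ = g₀} {H} 3≤k 3≤g class = Growth.decomposition H (proj₁ unicyclic) nonempty g₀ (ℕ.≤-trans (s≤s (s≤s z≤n)) 3≤g) (proj₁ girth) unique
    where
    open LinearUnicyclic class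
    open Hypergraph H
    nonempty : ∀ e → ∃[ v ] v ∈ edge e
    nonempty e = let v , _ , _ , v∈ , _ = three (edge e) (subst (3 ≤_) (sym (uniform e)) 3≤k) in v , v∈
    -- Unicyclicity provides a cycle of unspecified length; its uniqueness is transferred to the
    -- cycle that realises the girth, from which the hypergraph is grown.
    unique : ∀ {l} (D : Cycle H l) → SameCycle (proj₁ girth) D
    unique D v e = let same = proj₂ (proj₂ (proj₂ unicyclic)) in
      mk⇔ (Equivalence.to (same D v e) ∘ Equivalence.from (same (proj₁ girth) v e))
          (Equivalence.to (same (proj₁ girth) v e) ∘ Equivalence.from (same D v e))

  -- The order alone is large enough: with p = k - 1 at least 2, the left side p + 4 is at most 3p.
  characteristic-degree-bound : ∀ k m → 3 ≤ k → 3 ≤ m → k + 3 ≤ m * (k ∸ 1) * (k ∸ 1) ^ (m * (k ∸ 1) ∸ 1)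
  characteristic-degree-bound (suc p) m (s≤s 2≤p) 3≤m = begin
    suc p + 3            ≡⟨ ℕ.+-suc p 3 ⟨
    p + 4                ≤⟨ ℕ.+-monoʳ-≤ p (ℕ.*-mono-≤ {2} {2} ℕ.≤-refl 2≤p) ⟩
    3 * p                ≤⟨ ℕ.*-monoˡ-≤ p 3≤m ⟩
    m * p                ≡⟨ ℕ.*-identityʳ (m * p) ⟨
    m * p * 1            ≤⟨ ℕ.*-monoʳ-≤ (m * p) (ℕ.>-nonZero⁻¹ _ {{ℕ.m^n≢0 p (m * p ∸ 1) {{ℕ.>-nonZero (ℕ.<-≤-trans ℕ.z<s 2≤p)}}}}) ⟩
    m * p * p ^ (m * p ∸ 1) ∎
    where open ℕ.≤-Reasoning

  module _ {c ℓ₁ ℓ₂} (F : OrderedField c ℓ₁ ℓ₂) (k m g₀ : ℕ) (3≤k : 3 ≤ k) (3≤m : 3 ≤ m) (3≤g : 3 ≤ suc g₀)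
           (α : OrderedField.Carrier F) (0<α : OrderedField._<_ F (OrderedField.0# F) α) (α<1 : OrderedField._<_ F α (OrderedField.1# F))
           {X : Hypergraph} (S : Structure X) (L : Lollipop S g₀ (m ∸ suc g₀)) (uniformX : Uniform k X) (sizeX : Hypergraph.size X ≡ m) where

    -- A hypergraph with two equal extensions loses already at order 2. Any other is a lollipop and
    -- isomorphic to `X`, or has at least m + 3 coincidences of parents against at most m + 2 in
    -- `X`.
    lollipop-first : Tensors.IsFirst F k α (LinearUnicyclic k m (suc g₀)) X
    lollipop-first = linear-unicyclic sizeX , precedes
      where
      module X = Hypergraph X
      module S = Structure S
      open Lollipop L using () renaming (ext-injective to injX)
      open Membership k m g₀ (m ∸ suc g₀) 3≤k 3≤g S L uniformX using (linear-unicyclic) renaming (simple to simpleX; linear to linearX)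

      coincidencesX : coincidences S.parent ≤ m + 2
      coincidencesX = bound (m ∸ suc g₀) refl
        where
        bound : ∀ r → m ∸ suc g₀ ≡ r → coincidences S.parent ≤ m + 2
        bound zero r≡ = ℕ.≤-trans (ℕ.≤-reflexive (trans (Coincidences.cycle-coincidences S L r≡) sizeX)) (ℕ.m≤m+n m 2)
        bound (suc _) r≡ = ℕ.≤-trans (Coincidences.coincidences≤ S L r≡) (ℕ.≤-reflexive (cong (_+ 2) sizeX))

      precedes : ∀ H → LinearUnicyclic k m (suc g₀) H → ¬ (H ≅ X) → Tensors.Precedes F k α X H
      precedes H class ¬iso = go (any? λ e → any? λ f → ¬? (e ≟ f) ×-dec (T.ext e ≟ T.ext f))
        where
        open LinearUnicyclic class
        module H = Hypergraph H
        D = decompose 3≤k 3≤g class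
        T = Decomposition.structure D
        module T = Structure T

        same-size : X.size ≡ H.size
        same-size = trans sizeX (sym size-m)

        same-order : X.order ≡ H.order
        same-order = trans (S.order≡ uniformX) (trans (cong (_* (k ∸ 1)) same-size) (sym (T.order≡ uniform)))

        large : k + 3 ≤ X.order * (k ∸ 1) ^ (X.order ∸ 1)
        large = subst (λ n → k + 3 ≤ n * (k ∸ 1) ^ (n ∸ 1)) (sym (trans (S.order≡ uniformX) (cong (_* (k ∸ 1)) sizeX)))
          (characteristic-degree-bound k m 3≤k 3≤m)

        open Comparison F k 3≤k α

        go : Dec (∃[ e ] ∃[ f ] e ≢ f × T.ext e ≡ T.ext f) → Tensors.Precedes F k α X H
        go (yes (e , f , e≢f , eq)) = precedes-by-degrees X H simpleX uniformX linearX simple uniform linear same-order same-size large 0<α α<1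
          (subst₂ ℕ._<_ (sym S.powerSum-2) (sym T.powerSum-2) (subst₂ ℕ._<_
            (cong₂ (λ n l → n + 2 * l + coincidences S.ext) (sym same-order) (sym same-size)) refl
            (ℕ.+-monoʳ-< (H.order + 2 * H.size) (subst (ℕ._< coincidences T.ext)
              (trans (sym same-size) (sym (coincidences-injective S.ext injX))) (m<coincidences T.ext e≢f eq)))))
        go (no ¬coincide) = branch (lollipop-or-branch D injH)
          where
          injH : Injective _≡_ _≡_ T.ext
          injH {e} {f} eq with e ≟ f
          ... | yes e≡f = e≡f
          ... | no e≢f = ⊥-elim (¬coincide (e , f , e≢f , eq))
          branch : (∃[ r ] suc g₀ + r ≡ H.size × Lollipop T g₀ r) ⊎ H.size + 3 ≤ coincidences T.parent → Tensors.Precedes F k α X H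
          branch (inj₁ (r , g+r≡ , M)) = ⊥-elim (¬iso (lollipops-≅ uniform uniformX
            (subst (Lollipop T g₀) (trans (sym (ℕ.m+n∸m≡n (suc g₀) r)) (cong (_∸ suc g₀) (trans g+r≡ size-m))) M) L))
          branch (inj₂ le) = precedes-by-spread X H simpleX uniformX linearX simple uniform linear same-order same-size large 0<α α<1
            (S.degrees12 uniformX injX) (T.degrees12 uniform injH)
            (subst₂ ℕ._<_ (sym (S.spread≡ uniformX injX)) (sym (T.spread≡ uniform injH)) (subst₂ ℕ._<_
              (cong (λ l → l * ((k + 1) * (k + 1)) + 2 * (k + 1) * l + coincidences S.parent) (sym same-size)) refl
              (ℕ.+-monoʳ-< (H.size * ((k + 1) * (k + 1)) + 2 * (k + 1) * H.size)
                (ℕ.<-≤-trans (s≤s coincidencesX) (subst (_≤ coincidences T.parent) (trans (cong (_+ 3) size-m) (ℕ.+-suc m 2)) le)))))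

-- Specialisation to the coalescence, for either end of the path.

open Structures
open LollipopClass
open CoordinateModel
open CoalescedHypergraph
open LollipopFirst
open import Data.Nat using (suc; s≤s; z≤n)
import Data.Nat.Properties as ℕ
open import Data.Product using (_,_)
open import Data.Sum using (inj₁; inj₂)
open import Relation.Binary.PropositionalEquality using (_≡_; refl; subst)

theorem5p5 : ∀ {c ℓ₁ ℓ₂} (F : OrderedField c ℓ₁ ℓ₂) →
    let open OrderedField F in
    (k m g : ℕ) → 3 ≤ k → 3 ≤ m → 3 ≤ g → g ≤ m →
    (α : Carrier) → 0# < α → α < 1# →
    (u : Hypergraph.Vertex (hypercycle k g)) → Cored (hypercycle k g) u →
    (w : Hypergraph.Vertex (hyperpath k (m ∸ g))) → PathEnd k (m ∸ g) w →
    Tensors.IsFirst F k α (LinearUnicyclic k m g)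
    (coalescence (hypercycle k g) u (hyperpath k (m ∸ g)) w)
theorem5p5 F k m (suc g₀) 3≤k 3≤m 3≤g g≤m α 0<α α<1 u cored w end
  with cored⇒new k g₀ (ℕ.≤-trans (s≤s (s≤s z≤n)) 3≤g) u cored
... | i₀ , j₀ , refl = first end
  where
  r = m ∸ suc g₀
  k≡ : suc (suc (k ∸ 2)) ≡ k
  k≡ = ℕ.m+[n∸m]≡n (ℕ.≤-trans (s≤s (s≤s z≤n)) 3≤k)
  oriented : ∀ {w₀} (O : Orientation r w₀) →
    Tensors.IsFirst F k α (LinearUnicyclic k m (suc g₀)) (Coalesced.X k g₀ r (ℕ.≤-trans (s≤s (s≤s z≤n)) 3≤g) i₀ j₀ O)
  oriented O = lollipop-first F k m g₀ 3≤k 3≤m 3≤g α 0<α α<1 coordinate-structure coordinate-lollipop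
    (subst (λ k′ → Uniform k′ X) k≡ coordinate-uniform) (ℕ.m+[n∸m]≡n g≤m)
    where open Coalesced k g₀ r (ℕ.≤-trans (s≤s (s≤s z≤n)) 3≤g) i₀ j₀ O
  first : ∀ {w} → PathEnd k r w → Tensors.IsFirst F k α (LinearUnicyclic k m (suc g₀)) (coalescence (hypercycle k (suc g₀)) _ (hyperpath k r) w)
  first (inj₁ refl) = oriented (forward r)
  first (inj₂ refl) = oriented (backward r)
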